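{- Let $\lambda/\mu$ be a skew partition whose diagram coincides up to translation with that of a partition $\tilde\lambda=\tilde\lambda/\emptyset$. Then \[J_{\lambda/\mu}=c_{\mu,\lambda}\, c'_{\lambda,\mu}\, J_{\tilde\lambda}.\] In particular, $\tilde v_{\lambda/\mu,\nu}(\alpha)$ is a polynomial in $\alpha$ with nonnegative integer coefficients for all partitions $\nu$. Furthermore, \[g^\lambda_{\mu,\tilde\lambda}=c_{\mu,\lambda}\, c'_{\lambda,\mu}\, c_{\tilde\lambda}\, c'_{\tilde\lambda}.\]
   Context: Partitions and diagrams: a partition $\lambda=(\lambda_1\ge\lambda_2\ge\cdots)$ has diagram the set of boxes $(i,j)$ (row $i$, column $j$) with $1\le j\le\lambda_i$; $\lambda'$ is the transposed partition, $\ell(\lambda)$ the number of nonzero parts, $|\lambda|$ the sum of parts. $\mu\subset\lambda$ means containment of diagrams (equality allowed); a skew partition $\lambda/\mu$ is a pair $\mu\subset\lambda$. Jack functions: work in the ring of symmetric functions in $x=(x_1,x_2,\dots)$ over $\mathbb Q(\alpha)$, with the scalar product for which the power sums $p_\lambda$ are pairwise orthogonal and $\langle p_\lambda,p_\lambda\rangle=z_\lambda\alpha^{\ell(\lambda)}$, where $z_\lambda=\prod_i i^{k_i}k_i!$ and $k_i$ is the number of parts of $\lambda$ equal to $i$. The Jack symmetric functions $J_\lambda=J_\lambda(x;\alpha)$ are the unique symmetric functions that are pairwise orthogonal, of the form $J_\lambda=\sum_{\mu\le\lambda}v_{\lambda,\mu}(\alpha)m_\mu$ ($m_\mu$ the monomial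 symmetric functions, $\le$ the dominance order), and normalized by $v_{\lambda,(1^n)}=n!$ for $n=|\lambda|$. The skew Jack function $J_{\lambda/\mu}$ is defined by $\langle J_{\lambda/\mu},J_\nu\rangle=\langle J_\lambda,J_\mu J_\nu\rangle$ for all partitions $\nu$. Put $g^\lambda_{\mu,\nu}=\langle J_\lambda,J_\mu J_\nu\rangle$. Write $J_{\lambda/\mu}=\sum_\nu v_{\lambda/\mu,\nu}(\alpha)m_\nu$ and $\tilde v_{\lambda/\mu,\nu}=u_\nu^{ -1}v_{\lambda/\mu,\nu}$, where $u_\nu=\prod_{i\ge1}k_i!$ with $k_i$ the number of parts of $\nu$ equal to $i$. For $s=(i,j)\in\lambda$ the arm and leg are $a_{\lambda,s}=\lambda_i-j$ and $\ell_{\lambda,s}=\lambda'_j-i$. Put \[c_\lambda=\prod_{s\in\lambda}\bigl(a_{\lambda,s}\,\alpha+\ell_{\lambda,s}+1\bigr),\qquad c'_\lambda=\prod_{s\in\lambda}\bigl((a_{\lambda,s}+1)\alpha+\ell_{\lambda,s}\bigr),\] and for $\mu\subset\lambda$ \[c_{\mu,\lambda}=\prod_{s\in\mu}\bigl(a_{\mu,s}\,\alpha+\ell_{\lambda,s}+1\bigr),\qquad c'_{\lambda,\mu}=\prod_{s\in\mu}\bigl((a_{\lambda,s}+1)\alpha+\ell_{\mu,s}\bigr).\] Coincidence up to translation: the diagrams of $\lambda/\mu$ and $\tilde\lambda/\tilde\mu$ coincide up to translation if one is obtained from the other by a finite sequence of steps, each of which adds or removes an empty row at the top or an empty column at the left.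 Here removing an empty top row means: if $\lambda_1=\mu_1$, replace $\lambda/\mu$ by $(\lambda_2,\lambda_3,\dots)/(\mu_2,\mu_3,\dots)$; removing an empty leftmost column means: if $\lambda'_1=\mu'_1$, delete the first column from both $\lambda$ and $\mu$; adding is the inverse operation. -}

module Defs where

open import Algebra.Bundles using (CommutativeRing; RawRing; Semiring)
import Algebra.Definitions.RawSemiring as RawSemiringDefinitions
import Algebra.Morphism.RingMonomorphism as RingMonomorphism
open import Algebra.Morphism.Structures using (module RingMorphisms)
open import Algebra.Properties.CommutativeSemigroup using (interchange)
import Algebra.Properties.Ring as RingProperties
import Algebra.Solver.Ring.NaturalCoefficients.Default as Solver
open import Data.Bool.Base using (if_then_else_)
open import Data.Empty using (⊥-elim)
import Data.Integer.Base as ℤ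
open import Data.List.Base using (List; []; _∷_; _++_; concatMap; deduplicate; drop; filter; foldr; length; map; replicate; take; upTo)
open import Data.List.Membership.Propositional using (_∈_)
open import Data.List.Membership.Propositional.Properties using (∈-concat⁺′; ∈-deduplicate⁺; ∈-filter⁺; ∈-map⁺; ∈-upTo⁺)
open import Data.List.Properties using (++-assoc; ++-identityʳ; filter-++; ≡-dec)
open import Data.List.Relation.Binary.Equality.Propositional using (≋⇒≡)
open import Data.List.Relation.Binary.Permutation.Propositional using (_↭_; prep; ↭-refl; ↭-sym; ↭-trans; ↭⇒↭ₛ)
import Data.List.Relation.Binary.Permutation.Propositional.Properties as Perm
open import Data.List.Relation.Unary.All as All using (All; []; _∷_)
import Data.List.Relation.Unary.All.Properties as All
open import Data.List.Relation.Unary.AllPairs using (_∷_)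
open import Data.List.Relation.Unary.Any as Any using (here; there)
open import Data.List.Relation.Unary.Linked using (Linked; []; [-]; _∷_; linked?)
open import Data.List.Relation.Unary.Sorted.TotalOrder.Properties using (↗↭↗⇒≋)
open import Data.List.Relation.Unary.Unique.Propositional using (Unique)
import Data.List.Relation.Unary.Unique.Propositional.Properties as Unique
open import Data.List.Relation.Unary.Unique.DecPropositional.Properties using (deduplicate-!)
import Data.List.Sort.InsertionSort as InsertionSort
open import Data.List.Sort.Base using (module SortingAlgorithm)
open import Data.Nat.Base as ℕ using (ℕ; zero; suc; _∸_; _!; _≤_; _<_; _≥_; z≤n; s≤s; pred; NonZero)
open import Data.Nat.ListAction using (sum; product)
open import Data.Nat.ListAction.Properties using (product≢0; sum-++; sum-↭)
open import Data.Nat.Properties as ℕ using (_<?_)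
open import Data.Product.Base using (_×_; _,_; proj₁; proj₂; ∃-syntax)
open import Data.Rational.Base as ℚ using (ℚ; 0ℚ; 1ℚ)
open import Data.Rational.Properties as ℚ using ()
open import Data.Sum.Base using (_⊎_; inj₁; inj₂; map₁)
open import Function.Base using (_∘_; id; flip)
open import Level using (0ℓ)
open import Relation.Binary.Construct.Closure.Equivalence using (EqClosure)
open import Relation.Binary.PropositionalEquality as ≡ using (_≡_; _≢_)
import Relation.Binary.Construct.Flip.EqAndOrd as Flip
import Relation.Binary.Reasoning.Setoid as SetoidReasoning
open import Relation.Nullary using (¬_; Dec; yes; no; does)
open import Relation.Nullary.Decidable using (_×-dec_)

module Antidiagonal (R : CommutativeRing 0ℓ 0ℓ) where
  open CommutativeRing R
  open SetoidReasoning setoid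
  open Solver commutativeSemiring using (solve; _:=_; _:+_; _:*_)

  -- antidiag n F = Σ_{i + j = n} F i j
  antidiag : ℕ → (ℕ → ℕ → Carrier) → Carrier
  antidiag zero    F = F 0 0
  antidiag (suc n) F = F 0 (suc n) + antidiag n (λ i j → F (suc i) j)

  antidiag-cong : ∀ n {F G} → (∀ i j → i ℕ.+ j ≡ n → F i j ≈ G i j) → antidiag n F ≈ antidiag n G
  antidiag-cong zero    h = h 0 0 ≡.refl
  antidiag-cong (suc n) h =
    +-cong (h 0 (suc n) ≡.refl) (antidiag-cong n (λ i j eq → h (suc i) j (≡.cong suc eq)))

  antidiag-zero : ∀ n {F} → (∀ i j → i ℕ.+ j ≡ n → F i j ≈ 0#) → antidiag n F ≈ 0#
  antidiag-zero zero    h = h 0 0 ≡.refl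
  antidiag-zero (suc n) h = trans
    (+-cong (h 0 (suc n) ≡.refl) (antidiag-zero n (λ i j eq → h (suc i) j (≡.cong suc eq))))
    (+-identityˡ 0#)

  antidiag-+ : ∀ n F G → antidiag n (λ i j → F i j + G i j) ≈ antidiag n F + antidiag n G
  antidiag-+ zero    F G = refl
  antidiag-+ (suc n) F G = trans (+-congˡ (antidiag-+ n _ _))
    (solve 4 (λ a b c d → ((a :+ b) :+ (c :+ d)) := ((a :+ c) :+ (b :+ d))) refl _ _ _ _)

  antidiag-*ˡ : ∀ n a F → antidiag n (λ i j → a * F i j) ≈ a * antidiag n F
  antidiag-*ˡ zero    a F = refl
  antidiag-*ˡ (suc n) a F = trans (+-congˡ (antidiag-*ˡ n a _)) (sym (distribˡ a _ _))

  antidiag-last : ∀ n F → antidiag (suc n) F ≈ antidiag n (λ i j → F i (suc j)) + F (suc n) 0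
  antidiag-last zero    F = refl
  antidiag-last (suc n) F = trans (+-congˡ (antidiag-last n (λ i j → F (suc i) j))) (sym (+-assoc _ _ _))

  antidiag-flip : ∀ n F → antidiag n F ≈ antidiag n (flip F)
  antidiag-flip zero    F = refl
  antidiag-flip (suc n) F = begin
    F 0 (suc n) + antidiag n (λ i j → F (suc i) j)         ≈⟨ +-congˡ (antidiag-flip n _) ⟩
    F 0 (suc n) + antidiag n (λ i j → F (suc j) i)         ≈⟨ +-comm _ _ ⟩
    antidiag n (λ i j → F (suc j) i) + F 0 (suc n)         ≈⟨ antidiag-last n (flip F) ⟨
    antidiag (suc n) (flip F)                              ∎

  antidiag-swap : ∀ n m (F : ℕ → ℕ → ℕ → ℕ → Carrier) →
    antidiag n (λ i j → antidiag m (F i j)) ≈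
    antidiag m (λ k l → antidiag n (λ i j → F i j k l))
  antidiag-swap zero    m F = refl
  antidiag-swap (suc n) m F = trans
    (+-congˡ (antidiag-swap n m (λ i → F (suc i))))
    (sym (antidiag-+ m (F 0 (suc n)) (λ k l → antidiag n (λ i j → F (suc i) j k l))))

-- Polynomials are coefficient lists, constant term first, compared
-- coefficientwise (trailing zeros are irrelevant).
module Polynomials (R : CommutativeRing 0ℓ 0ℓ) where
  open CommutativeRing R
  open Antidiagonal R
  open SetoidReasoning setoid

  Seq : Set
  Seq = ℕ → Carrier

  _≋_ : Seq → Seq → Set
  a ≋ b = ∀ n → a n ≈ b n

  _⊞_ : Seq → Seq → Seq
  (a ⊞ b) n = a n + b n

  _⊠_ : Seq → Seq → Seq
  (a ⊠ b) n = antidiag n (λ i j → a i * b j)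

  neg : Seq → Seq
  neg a n = - a n

  0ₛ : Seq
  0ₛ _ = 0#

  1ₛ : Seq
  1ₛ zero    = 1#
  1ₛ (suc _) = 0#

  ⊠-cong : ∀ {a b c d} → a ≋ b → c ≋ d → (a ⊠ c) ≋ (b ⊠ d)
  ⊠-cong p q n = antidiag-cong n (λ i j _ → *-cong (p i) (q j))

  ⊠-comm : ∀ a b → (a ⊠ b) ≋ (b ⊠ a)
  ⊠-comm a b n = trans (antidiag-flip n _) (antidiag-cong n (λ _ _ _ → *-comm _ _))

  ⊠-distribˡ : ∀ a b c → (a ⊠ (b ⊞ c)) ≋ ((a ⊠ b) ⊞ (a ⊠ c))
  ⊠-distribˡ a b c n = trans (antidiag-cong n (λ _ _ _ → distribˡ _ _ _)) (antidiag-+ n _ _)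

  ⊠-distribʳ : ∀ a b c → ((b ⊞ c) ⊠ a) ≋ ((b ⊠ a) ⊞ (c ⊠ a))
  ⊠-distribʳ a b c n = trans (antidiag-cong n (λ _ _ _ → distribʳ _ _ _)) (antidiag-+ n _ _)

  ⊠-identityˡ : ∀ a → (1ₛ ⊠ a) ≋ a
  ⊠-identityˡ a zero    = *-identityˡ _
  ⊠-identityˡ a (suc n) = trans
    (+-cong (*-identityˡ _) (antidiag-zero n (λ _ _ _ → zeroˡ _))) (+-identityʳ _)

  ⊠-assoc : ∀ a b c → ((a ⊠ b) ⊠ c) ≋ (a ⊠ (b ⊠ c))
  ⊠-assoc a b c zero    = *-assoc _ _ _
  ⊠-assoc a b c (suc n) = begin
    (a 0 * b 0) * c (suc n) + antidiag n (λ i j → (a 0 * b (suc i) + (a′ ⊠ b) i) * c j)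
      ≈⟨ +-cong (*-assoc _ _ _) (⊠-distribʳ c (λ i → a 0 * b (suc i)) (a′ ⊠ b) n) ⟩
    a 0 * (b 0 * c (suc n)) + (antidiag n (λ i j → (a 0 * b (suc i)) * c j) + ((a′ ⊠ b) ⊠ c) n)
      ≈⟨ +-congˡ (+-cong (antidiag-cong n (λ _ _ _ → *-assoc _ _ _)) (⊠-assoc a′ b c n)) ⟩
    a 0 * (b 0 * c (suc n)) + (antidiag n (λ i j → a 0 * (b (suc i) * c j)) + (a′ ⊠ (b ⊠ c)) n)
      ≈⟨ +-congˡ (+-congʳ (antidiag-*ˡ n (a 0) _)) ⟩
    a 0 * (b 0 * c (suc n)) + (a 0 * antidiag n (λ i j → b (suc i) * c j) + (a′ ⊠ (b ⊠ c)) n)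
      ≈⟨ +-assoc _ _ _ ⟨
    a 0 * (b 0 * c (suc n)) + a 0 * antidiag n (λ i j → b (suc i) * c j) + (a′ ⊠ (b ⊠ c)) n
      ≈⟨ +-congʳ (distribˡ _ _ _) ⟨
    (a ⊠ (b ⊠ c)) (suc n) ∎
    where
    a′ : Seq
    a′ i = a (suc i)

  seriesRing : CommutativeRing 0ℓ 0ℓ
  seriesRing = record
    { Carrier = Seq ; _≈_ = _≋_ ; _+_ = _⊞_ ; _*_ = _⊠_ ; -_ = neg ; 0# = 0ₛ ; 1# = 1ₛ
    ; isCommutativeRing = record
      { isRing = record
        { +-isAbelianGroup = record
          { isGroup = record
            { isMonoid = record
              { isSemigroup = record
                { isMagma = record
                  { isEquivalence = record
                    { refl = λ _ → refl ; sym = λ p n → sym (p n) ; trans = λ p q n → trans (p n) (q n) }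
                  ; ∙-cong = λ p q n → +-cong (p n) (q n) }
                ; assoc = λ a b c n → +-assoc _ _ _ }
              ; identity = (λ a n → +-identityˡ _) , (λ a n → +-identityʳ _) }
            ; inverse = (λ a n → -‿inverseˡ _) , (λ a n → -‿inverseʳ _)
            ; ⁻¹-cong = λ p n → -‿cong (p n) }
          ; comm = λ a b n → +-comm _ _ }
        ; *-cong = ⊠-cong
        ; *-assoc = ⊠-assoc
        ; *-identity = ⊠-identityˡ , (λ a n → trans (⊠-comm a 1ₛ n) (⊠-identityˡ a n))
        ; distrib = ⊠-distribˡ , ⊠-distribʳ }
      ; *-comm = ⊠-comm } }

  Poly : Set
  Poly = List Carrier

  coeff : Poly → ℕ → Carrier
  coeff []      _       = 0#
  coeff (a ∷ p) zero    = a
  coeff (a ∷ p) (suc n) = coeff p n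

  infix 4 _≈ₚ_
  _≈ₚ_ : Poly → Poly → Set
  p ≈ₚ q = ∀ n → coeff p n ≈ coeff q n

  infixl 6 _+ₚ_
  _+ₚ_ : Poly → Poly → Poly
  []      +ₚ q       = q
  (a ∷ p) +ₚ []      = a ∷ p
  (a ∷ p) +ₚ (b ∷ q) = (a + b) ∷ (p +ₚ q)

  scale : Carrier → Poly → Poly
  scale a []      = []
  scale a (b ∷ q) = (a * b) ∷ scale a q

  infixl 7 _*ₚ_
  _*ₚ_ : Poly → Poly → Poly
  []      *ₚ q = []
  (a ∷ p) *ₚ q = scale a q +ₚ (0# ∷ (p *ₚ q))

  -ₚ_ : Poly → Poly
  -ₚ []      = []
  -ₚ (a ∷ p) = (- a) ∷ (-ₚ p)

  coeff-+ : ∀ p q n → coeff (p +ₚ q) n ≈ coeff p n + coeff q n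
  coeff-+ []      q       n       = sym (+-identityˡ _)
  coeff-+ (a ∷ p) []      n       = sym (+-identityʳ _)
  coeff-+ (a ∷ p) (b ∷ q) zero    = refl
  coeff-+ (a ∷ p) (b ∷ q) (suc n) = coeff-+ p q n

  coeff-scale : ∀ a q n → coeff (scale a q) n ≈ a * coeff q n
  coeff-scale a []      n       = sym (zeroʳ a)
  coeff-scale a (b ∷ q) zero    = refl
  coeff-scale a (b ∷ q) (suc n) = coeff-scale a q n

  coeff-neg : ∀ p n → coeff (-ₚ p) n ≈ - coeff p n
  coeff-neg []      n       = sym -0#≈0#
    where open RingProperties ring using (-0#≈0#)
  coeff-neg (a ∷ p) zero    = refl
  coeff-neg (a ∷ p) (suc n) = coeff-neg p n

  coeff-* : ∀ p q n → coeff (p *ₚ q) n ≈ (coeff p ⊠ coeff q) n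
  coeff-* []      q n       = sym (antidiag-zero n (λ _ _ _ → zeroˡ _))
  coeff-* (a ∷ p) q zero    =
    trans (coeff-+ (scale a q) _ 0) (trans (+-identityʳ _) (coeff-scale a q 0))
  coeff-* (a ∷ p) q (suc n) =
    trans (coeff-+ (scale a q) _ (suc n)) (+-cong (coeff-scale a q (suc n)) (coeff-* p q n))

  coeff-1 : ∀ n → coeff (1# ∷ []) n ≈ 1ₛ n
  coeff-1 zero    = refl
  coeff-1 (suc n) = refl

  rawPolyRing : RawRing 0ℓ 0ℓ
  rawPolyRing = record
    { Carrier = Poly ; _≈_ = _≈ₚ_ ; _+_ = _+ₚ_ ; _*_ = _*ₚ_ ; -_ = -ₚ_ ; 0# = [] ; 1# = 1# ∷ [] }

  open RingMorphisms rawPolyRing (CommutativeRing.rawRing seriesRing) using (IsRingMonomorphism)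

  coeff-isRingMonomorphism : IsRingMonomorphism coeff
  coeff-isRingMonomorphism = record
    { isRingHomomorphism = record
      { isSemiringHomomorphism = record
        { isNearSemiringHomomorphism = record
          { +-isMonoidHomomorphism = record
            { isMagmaHomomorphism = record
              { isRelHomomorphism = record { cong = id } ; homo = coeff-+ }
            ; ε-homo = λ _ → refl }
          ; *-homo = coeff-* }
        ; 1#-homo = coeff-1 }
      ; -‿homo = coeff-neg }
    ; injective = id }

  polyRing : CommutativeRing 0ℓ 0ℓ
  polyRing = record
    { isCommutativeRing = RingMonomorphism.isCommutativeRing coeff-isRingMonomorphism
        (CommutativeRing.isCommutativeRing seriesRing) }

  module _ (_≟0 : ∀ a → Dec (a ≈ 0#)) (integral : ∀ a b → a * b ≈ 0# → a ≈ 0# ⊎ b ≈ 0#) where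

    0∷ : ∀ {a p} → a ≈ 0# → p ≈ₚ [] → a ∷ p ≈ₚ []
    0∷ a≈0 p≈0 zero    = a≈0
    0∷ a≈0 p≈0 (suc n) = p≈0 n

    regular : ∀ p → ¬ (coeff p 0 ≈ 0#) → ∀ q → (∀ n → (coeff p ⊠ coeff q) n ≈ 0#) → q ≈ₚ []
    regular p p₀≉0 []      h = λ _ → refl
    regular p p₀≉0 (b ∷ q) h with integral (coeff p 0) b (h 0)
    ... | inj₁ p₀≈0 = ⊥-elim (p₀≉0 p₀≈0)
    ... | inj₂ b≈0  = 0∷ b≈0 (regular p p₀≉0 q (λ n → begin
      (coeff p ⊠ coeff q) n                              ≈⟨ +-identityʳ _ ⟨
      (coeff p ⊠ coeff q) n + 0#                         ≈⟨ +-congˡ (zeroʳ _) ⟨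
      (coeff p ⊠ coeff q) n + coeff p (suc n) * 0#       ≈⟨ +-congˡ (*-congˡ b≈0) ⟨
      (coeff p ⊠ coeff q) n + coeff p (suc n) * b        ≈⟨ antidiag-last n (λ i j → coeff p i * coeff (b ∷ q) j) ⟨
      (coeff p ⊠ coeff (b ∷ q)) (suc n)                  ≈⟨ h (suc n) ⟩
      0#                                                 ∎))

    series-integral : ∀ p q → (∀ n → (coeff p ⊠ coeff q) n ≈ 0#) → p ≈ₚ [] ⊎ q ≈ₚ []
    series-integral []      q h = inj₁ (λ _ → refl)
    series-integral (a ∷ p) q h with a ≟0
    ... | no a≉0  = inj₂ (regular (a ∷ p) a≉0 q h)
    ... | yes a≈0 = map₁ (0∷ a≈0) (series-integral p q (λ n → begin
      (coeff p ⊠ coeff q) n                              ≈⟨ +-identityˡ _ ⟨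
      0# + (coeff p ⊠ coeff q) n                         ≈⟨ +-congʳ (zeroˡ _) ⟨
      0# * coeff q (suc n) + (coeff p ⊠ coeff q) n       ≈⟨ +-congʳ (*-congʳ a≈0) ⟨
      (coeff (a ∷ p) ⊠ coeff q) (suc n)                  ≈⟨ h (suc n) ⟩
      0#                                                 ∎))

    polyIntegral : ∀ p q → p *ₚ q ≈ₚ [] → p ≈ₚ [] ⊎ q ≈ₚ []
    polyIntegral p q h = series-integral p q (λ n → trans (sym (coeff-* p q n)) (h n))

module Fractions (D : CommutativeRing 0ℓ 0ℓ)
  (1≉0 : ¬ (CommutativeRing._≈_ D (CommutativeRing.1# D) (CommutativeRing.0# D)))
  (integral : ∀ a b → CommutativeRing._≈_ D (CommutativeRing._*_ D a b) (CommutativeRing.0# D) →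
     CommutativeRing._≈_ D a (CommutativeRing.0# D) ⊎ CommutativeRing._≈_ D b (CommutativeRing.0# D))
  where
  open CommutativeRing D
  open SetoidReasoning setoid
  open RingProperties ring using (x∙y⁻¹≈ε⇒x≈y; -‿distribˡ-*; -‿distribʳ-*)
  open Solver commutativeSemiring using (solve; _:=_; _:+_; _:*_)

  record Fraction : Set where
    constructor fraction
    field
      num   : Carrier
      den   : Carrier
      den≉0 : ¬ (den ≈ 0#)
  open Fraction

  infix 4 _≈ᶠ_
  _≈ᶠ_ : Fraction → Fraction → Set
  x ≈ᶠ y = num x * den y ≈ num y * den x

  *≉0 : ∀ {a b} → ¬ (a ≈ 0#) → ¬ (b ≈ 0#) → ¬ (a * b ≈ 0#)
  *≉0 p q h with integral _ _ h
  ... | inj₁ a≈0 = p a≈0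
  ... | inj₂ b≈0 = q b≈0

  cancel : ∀ a {b c} → ¬ (a ≈ 0#) → a * b ≈ a * c → b ≈ c
  cancel a {b} {c} a≉0 h with integral a (b - c) (begin
      a * (b - c)         ≈⟨ distribˡ _ _ _ ⟩
      a * b + a * - c     ≈⟨ +-congˡ (-‿distribʳ-* a c) ⟨
      a * b - a * c       ≈⟨ +-congʳ h ⟩
      a * c - a * c       ≈⟨ -‿inverseʳ _ ⟩
      0#                  ∎)
  ... | inj₁ a≈0 = ⊥-elim (a≉0 a≈0)
  ... | inj₂ e   = x∙y⁻¹≈ε⇒x≈y b c e

  _+ᶠ_ : Fraction → Fraction → Fraction
  x +ᶠ y = fraction (num x * den y + num y * den x) (den x * den y) (*≉0 (den≉0 x) (den≉0 y))

  _*ᶠ_ : Fraction → Fraction → Fraction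
  x *ᶠ y = fraction (num x * num y) (den x * den y) (*≉0 (den≉0 x) (den≉0 y))

  -ᶠ_ : Fraction → Fraction
  -ᶠ x = fraction (- num x) (den x) (den≉0 x)

  fromDomain : Carrier → Fraction
  fromDomain a = fraction a 1# 1≉0

  ≈ᶠ-trans : ∀ {x y z} → x ≈ᶠ y → y ≈ᶠ z → x ≈ᶠ z
  ≈ᶠ-trans {x} {y} {z} p q = cancel (den y) (den≉0 y) (begin
    den y * (num x * den z)  ≈⟨ solve 3 (λ a b c → (a :* (b :* c)) := ((b :* a) :* c)) refl (den y) (num x) (den z) ⟩
    (num x * den y) * den z  ≈⟨ *-congʳ p ⟩
    (num y * den x) * den z  ≈⟨ solve 3 (λ a b c → ((a :* b) :* c) := ((a :* c) :* b)) refl (num y) (den x) (den z) ⟩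
    (num y * den z) * den x  ≈⟨ *-congʳ q ⟩
    (num z * den y) * den x  ≈⟨ solve 3 (λ a b c → ((a :* b) :* c) := (b :* (a :* c))) refl (num z) (den y) (den x) ⟩
    den y * (num z * den x)  ∎)

  +ᶠ-cong : ∀ {x x′ y y′} → x ≈ᶠ x′ → y ≈ᶠ y′ → (x +ᶠ y) ≈ᶠ (x′ +ᶠ y′)
  +ᶠ-cong {x} {x′} {y} {y′} p q = begin
    (num x * den y + num y * den x) * (den x′ * den y′)
      ≈⟨ solve 6 (λ a b c d b′ d′ → ((a :* d :+ c :* b) :* (b′ :* d′)) := ((a :* b′) :* (d :* d′) :+ (c :* d′) :* (b :* b′)))
           refl (num x) (den x) (num y) (den y) (den x′) (den y′) ⟩
    (num x * den x′) * (den y * den y′) + (num y * den y′) * (den x * den x′)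
      ≈⟨ +-cong (*-congʳ p) (*-congʳ q) ⟩
    (num x′ * den x) * (den y * den y′) + (num y′ * den y) * (den x * den x′)
      ≈⟨ solve 6 (λ a b c d b′ d′ → ((a :* b) :* (d :* d′) :+ (c :* d) :* (b :* b′)) := ((a :* d′ :+ c :* b′) :* (b :* d)))
           refl (num x′) (den x) (num y′) (den y) (den x′) (den y′) ⟩
    (num x′ * den y′ + num y′ * den x′) * (den x * den y) ∎

  *ᶠ-cong : ∀ {x x′ y y′} → x ≈ᶠ x′ → y ≈ᶠ y′ → (x *ᶠ y) ≈ᶠ (x′ *ᶠ y′)
  *ᶠ-cong {x} {x′} {y} {y′} p q = begin
    (num x * num y) * (den x′ * den y′)
      ≈⟨ solve 4 (λ a b c d → ((a :* b) :* (c :* d)) := ((a :* c) :* (b :* d))) refl (num x) (num y) (den x′) (den y′) ⟩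
    (num x * den x′) * (num y * den y′)
      ≈⟨ *-cong p q ⟩
    (num x′ * den x) * (num y′ * den y)
      ≈⟨ solve 4 (λ a b c d → ((a :* b) :* (c :* d)) := ((a :* c) :* (b :* d))) refl (num x′) (den x) (num y′) (den y) ⟩
    (num x′ * num y′) * (den x * den y) ∎

  -ᶠ-cong : ∀ {x y} → x ≈ᶠ y → (-ᶠ x) ≈ᶠ (-ᶠ y)
  -ᶠ-cong {x} {y} p = begin
    - num x * den y   ≈⟨ -‿distribˡ-* _ _ ⟨
    - (num x * den y) ≈⟨ -‿cong p ⟩
    - (num y * den x) ≈⟨ -‿distribˡ-* _ _ ⟩
    - num y * den x   ∎

  +ᶠ-assoc : ∀ x y z → ((x +ᶠ y) +ᶠ z) ≈ᶠ (x +ᶠ (y +ᶠ z))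
  +ᶠ-assoc (fraction a b _) (fraction c d _) (fraction e f _) = solve 6 (λ a b c d e f →
    (((a :* d :+ c :* b) :* f :+ e :* (b :* d)) :* (b :* (d :* f))) :=
    ((a :* (d :* f) :+ (c :* f :+ e :* d) :* b) :* ((b :* d) :* f))) refl a b c d e f

  +ᶠ-comm : ∀ x y → (x +ᶠ y) ≈ᶠ (y +ᶠ x)
  +ᶠ-comm (fraction a b _) (fraction c d _) = solve 4 (λ a b c d →
    ((a :* d :+ c :* b) :* (d :* b)) := ((c :* b :+ a :* d) :* (b :* d))) refl a b c d

  +ᶠ-identityˡ : ∀ x → (fromDomain 0# +ᶠ x) ≈ᶠ x
  +ᶠ-identityˡ (fraction a b _) = begin
    (0# * b + a * 1#) * b  ≈⟨ *-congʳ (+-congʳ (zeroˡ b)) ⟩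
    (0# + a * 1#) * b      ≈⟨ *-congʳ (+-identityˡ _) ⟩
    a * 1# * b             ≈⟨ *-assoc _ _ _ ⟩
    a * (1# * b)           ∎

  +ᶠ-inverseˡ : ∀ x → ((-ᶠ x) +ᶠ x) ≈ᶠ fromDomain 0#
  +ᶠ-inverseˡ (fraction a b _) = begin
    (- a * b + a * b) * 1#   ≈⟨ *-identityʳ _ ⟩
    - a * b + a * b          ≈⟨ distribʳ _ _ _ ⟨
    (- a + a) * b            ≈⟨ *-congʳ (-‿inverseˡ a) ⟩
    0# * b                   ≈⟨ zeroˡ _ ⟩
    0#                       ≈⟨ zeroˡ _ ⟨
    0# * (b * b)             ∎

  *ᶠ-assoc : ∀ x y z → ((x *ᶠ y) *ᶠ z) ≈ᶠ (x *ᶠ (y *ᶠ z))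
  *ᶠ-assoc (fraction a b _) (fraction c d _) (fraction e f _) = solve 6 (λ a b c d e f →
    (((a :* c) :* e) :* (b :* (d :* f))) := ((a :* (c :* e)) :* ((b :* d) :* f))) refl a b c d e f

  *ᶠ-comm : ∀ x y → (x *ᶠ y) ≈ᶠ (y *ᶠ x)
  *ᶠ-comm (fraction a b _) (fraction c d _) = solve 4 (λ a b c d →
    ((a :* c) :* (d :* b)) := ((c :* a) :* (b :* d))) refl a b c d

  *ᶠ-identityˡ : ∀ x → (fromDomain 1# *ᶠ x) ≈ᶠ x
  *ᶠ-identityˡ (fraction a b _) = begin
    1# * a * b    ≈⟨ *-congʳ (*-comm _ _) ⟩
    a * 1# * b    ≈⟨ *-assoc _ _ _ ⟩
    a * (1# * b)  ∎

  *ᶠ-distribˡ : ∀ x y z → (x *ᶠ (y +ᶠ z)) ≈ᶠ ((x *ᶠ y) +ᶠ (x *ᶠ z))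
  *ᶠ-distribˡ (fraction a b _) (fraction c d _) (fraction e f _) = solve 6 (λ a b c d e f →
    ((a :* (c :* f :+ e :* d)) :* ((b :* d) :* (b :* f))) :=
    (((a :* c) :* (b :* f) :+ (a :* e) :* (b :* d)) :* (b :* (d :* f)))) refl a b c d e f

  *ᶠ-distribʳ : ∀ x y z → ((y +ᶠ z) *ᶠ x) ≈ᶠ ((y *ᶠ x) +ᶠ (z *ᶠ x))
  *ᶠ-distribʳ (fraction a b _) (fraction c d _) (fraction e f _) = solve 6 (λ a b c d e f →
    (((c :* f :+ e :* d) :* a) :* ((d :* b) :* (f :* b))) :=
    (((c :* a) :* (f :* b) :+ (e :* a) :* (d :* b)) :* ((d :* f) :* b))) refl a b c d e f

  fractionField : CommutativeRing 0ℓ 0ℓ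
  fractionField = record
    { Carrier = Fraction ; _≈_ = _≈ᶠ_ ; _+_ = _+ᶠ_ ; _*_ = _*ᶠ_ ; -_ = -ᶠ_
    ; 0# = fromDomain 0# ; 1# = fromDomain 1#
    ; isCommutativeRing = record
      { isRing = record
        { +-isAbelianGroup = record
          { isGroup = record
            { isMonoid = record
              { isSemigroup = record
                { isMagma = record
                  { isEquivalence = record
                    { refl = refl ; sym = sym ; trans = λ {x} {y} {z} → ≈ᶠ-trans {x} {y} {z} }
                  ; ∙-cong = λ {x} {x′} {y} {y′} → +ᶠ-cong {x} {x′} {y} {y′} }
                ; assoc = +ᶠ-assoc }
              ; identity = +ᶠ-identityˡ , λ x →
                  ≈ᶠ-trans {x +ᶠ fromDomain 0#} {fromDomain 0# +ᶠ x} {x} (+ᶠ-comm x (fromDomain 0#)) (+ᶠ-identityˡ x) }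
            ; inverse = +ᶠ-inverseˡ , λ x →
                ≈ᶠ-trans {x +ᶠ (-ᶠ x)} {(-ᶠ x) +ᶠ x} {fromDomain 0#} (+ᶠ-comm x (-ᶠ x)) (+ᶠ-inverseˡ x)
            ; ⁻¹-cong = λ {x} {y} → -ᶠ-cong {x} {y} }
          ; comm = +ᶠ-comm }
        ; *-cong = λ {x} {x′} {y} {y′} → *ᶠ-cong {x} {x′} {y} {y′}
        ; *-assoc = *ᶠ-assoc
        ; *-identity = *ᶠ-identityˡ , λ x →
            ≈ᶠ-trans {x *ᶠ fromDomain 1#} {fromDomain 1# *ᶠ x} {x} (*ᶠ-comm x (fromDomain 1#)) (*ᶠ-identityˡ x)
        ; distrib = *ᶠ-distribˡ , *ᶠ-distribʳ }
      ; *-comm = *ᶠ-comm } }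

ℚ-integral : ∀ a b → a ℚ.* b ≡ 0ℚ → a ≡ 0ℚ ⊎ b ≡ 0ℚ
ℚ-integral a b ab≡0 with a ℚ.≟ 0ℚ
... | yes a≡0 = inj₁ a≡0
... | no  a≢0 = inj₂ (begin
  b                     ≡⟨ ℚ.*-identityˡ b ⟨
  1ℚ ℚ.* b              ≡⟨ ≡.cong (ℚ._* b) (ℚ.*-inverseˡ a) ⟨
  (ℚ.1/ a) ℚ.* a ℚ.* b  ≡⟨ ℚ.*-assoc (ℚ.1/ a) a b ⟩
  (ℚ.1/ a) ℚ.* (a ℚ.* b) ≡⟨ ≡.cong ((ℚ.1/ a) ℚ.*_) ab≡0 ⟩
  (ℚ.1/ a) ℚ.* 0ℚ       ≡⟨ ℚ.*-zeroʳ (ℚ.1/ a) ⟩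
  0ℚ                    ∎)
  where
  open ≡.≡-Reasoning
  instance
    a-nonZero : ℚ.NonZero a
    a-nonZero = ℚ.≢-nonZero a≢0

open Polynomials ℚ.+-*-commutativeRing public
  using (Poly; _≈ₚ_; polyRing; polyIntegral)

1≉0 : ¬ ((1ℚ ∷ []) ≈ₚ [])
1≉0 h with h 0
... | ()

open Fractions polyRing 1≉0 (polyIntegral (ℚ._≟ 0ℚ) ℚ-integral) public
  using (Fraction; fraction; fractionField) renaming (fromDomain to fromPoly)

ℚ⟨α⟩ : CommutativeRing 0ℓ 0ℓ
ℚ⟨α⟩ = fractionField

fromℚ : ℚ → Fraction
fromℚ q = fromPoly (q ∷ [])

ℕ⇒ℚ : ℕ → ℚ
ℕ⇒ℚ n = (ℤ.+ n) ℚ./ 1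

fromℕ : ℕ → Fraction
fromℕ n = fromℚ (ℕ⇒ℚ n)

α : Fraction
α = fromPoly (0ℚ ∷ 1ℚ ∷ [])

-- Partitions.  Rows, columns and boxes are indexed from 0, so that
-- row θ i, col θ j and the box (i , j) stand for θ_{i+1}, θ′_{j+1} and
-- (i+1 , j+1) in the usual convention (θ replaces λ, a reserved word).

IsPartition : List ℕ → Set
IsPartition ns = Linked _≥_ ns × All (0 <_) ns

record Partition : Set where
  constructor mkPartition
  field
    parts       : List ℕ
    isPartition : IsPartition parts
open Partition public

∅ : Partition
∅ = mkPartition [] ([] , [])

1^_ : ℕ → Partition
1^ n = mkPartition (replicate n 1) (decreasing n , All.replicate⁺ n ℕ.≤-refl)
  where
  decreasing : ∀ n → Linked _≥_ (replicate n 1)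
  decreasing 0             = []
  decreasing 1             = [-]
  decreasing (suc (suc n)) = ℕ.≤-refl ∷ decreasing (suc n)

ℓ : Partition → ℕ
ℓ θ = length (parts θ)

∣_∣ : Partition → ℕ
∣ θ ∣ = sum (parts θ)

row : Partition → ℕ → ℕ
row θ = go (parts θ)
  where
  go : List ℕ → ℕ → ℕ
  go []       _       = 0
  go (n ∷ _)  zero    = n
  go (_ ∷ ns) (suc i) = go ns i

col : Partition → ℕ → ℕ
col θ j = length (filter (j <?_) (parts θ))

Box : Set
Box = ℕ × ℕ

_∈ᴰ_ : Box → Partition → Set
(i , j) ∈ᴰ θ = j < row θ i

boxes : Partition → List Box
boxes θ = concatMap (λ i → map (i ,_) (upTo (row θ i))) (upTo (ℓ θ))

arm leg : Partition → Box → ℕ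
arm θ (i , j) = row θ i ∸ suc j
leg θ (i , j) = col θ j ∸ suc i

multiplicity : Partition → ℕ → ℕ
multiplicity θ i = length (filter (i ℕ.≟_) (parts θ))

-- The multiplicity of every i > ∣ θ ∣ is 0, so the products below
-- may stop at ∣ θ ∣.
z : Partition → ℕ
z θ = product (map (λ i → i ℕ.^ multiplicity θ i ℕ.* multiplicity θ i !) (map suc (upTo ∣ θ ∣)))

u : Partition → ℕ
u θ = product (map (λ i → multiplicity θ i !) (map suc (upTo ∣ θ ∣)))

u-nonZero : ∀ θ → NonZero (u θ)
u-nonZero θ = product≢0 (All.map⁺ (All.universal (λ i → multiplicity θ i ℕ.!≢0) (map suc (upTo ∣ θ ∣))))

_⊴_ : Partition → Partition → Set
μ ⊴ θ = ∣ μ ∣ ≡ ∣ θ ∣ × (∀ k → sum (take k (parts μ)) ≤ sum (take k (parts θ)))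

_⊂_ : Partition → Partition → Set
μ ⊂ θ = ∀ s → s ∈ᴰ μ → s ∈ᴰ θ

record SkewPartition : Set where
  constructor skew
  field
    outer     : Partition
    inner     : Partition
    contained : inner ⊂ outer
open SkewPartition public

_/∅ : Partition → SkewPartition
θ /∅ = skew θ ∅ λ _ ()

removeRow removeColumn : List ℕ → List ℕ
removeRow    = drop 1
removeColumn = filter (0 <?_) ∘ map pred

data Removal (s t : SkewPartition) : Set where
  topRow : row (outer s) 0 ≡ row (inner s) 0 →
    parts (outer t) ≡ removeRow (parts (outer s)) →
    parts (inner t) ≡ removeRow (parts (inner s)) → Removal s t
  leftColumn : col (outer s) 0 ≡ col (inner s) 0 →
    parts (outer t) ≡ removeColumn (parts (outer s)) →
    parts (inner t) ≡ removeColumn (parts (inner s)) → Removal s t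

CoincideUpToTranslation : SkewPartition → SkewPartition → Set
CoincideUpToTranslation = EqClosure Removal

-- Symmetric functions in x₁, x₂, … over a commutative ring: symmetric
-- formal power series of bounded degree, given by their coefficients.
-- The list e₁ ∷ … ∷ eₙ ∷ [] stands for the monomial x₁^e₁ ⋯ xₙ^eₙ.

Exponent : Set
Exponent = List ℕ

open InsertionSort (Flip.decTotalOrder ℕ.≤-decTotalOrder) using (sort; insertionSort)
open SortingAlgorithm insertionSort using (sort-↭; sort-↗)

nonzero : Exponent → List ℕ
nonzero = filter (0 <?_)

-- The nonzero exponents, in decreasing order
shape : Exponent → List ℕ
shape e = sort (nonzero e)

shape-isPartition : ∀ e → IsPartition (shape e)
shape-isPartition e = sort-↗ (nonzero e) ,
  Perm.All-resp-↭ (↭-sym (sort-↭ (nonzero e))) (All.all-filter (0 <?_) e)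

shape-↭ : ∀ {e e′} → e ↭ e′ → shape e ≡ shape e′
shape-↭ {e} {e′} p = ≋⇒≡ (↗↭↗⇒≋ (Flip.totalOrder ℕ.≤-totalOrder) (sort-↗ (nonzero e)) (sort-↗ (nonzero e′))
  (↭⇒↭ₛ (↭-trans (sort-↭ (nonzero e)) (↭-trans (Perm.filter-↭ (0 <?_) p) (↭-sym (sort-↭ (nonzero e′)))))))

shape-pad : ∀ e → shape (e ++ 0 ∷ []) ≡ shape e
shape-pad e = ≡.cong sort (≡.trans (filter-++ (0 <?_) e (0 ∷ [])) (++-identityʳ _))

↭-shape : ∀ e → ∃[ k ] e ↭ shape e ++ replicate k 0
↭-shape e = proj₁ (go e) , ↭-trans (proj₂ (go e)) (Perm.++⁺ʳ (replicate (proj₁ (go e)) 0) (↭-sym (sort-↭ (nonzero e))))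
  where
  go : ∀ e → ∃[ k ] e ↭ nonzero e ++ replicate k 0
  go []          = 0 , ↭-refl
  go (zero ∷ e)  = let (k , p) = go e in
    suc k , ↭-trans (prep 0 p) (↭-sym (Perm.shift 0 (nonzero e) (replicate k 0)))
  go (suc n ∷ e) = let (k , p) = go e in k , prep (suc n) p

sum-replicate-0 : ∀ k → sum (replicate k 0) ≡ 0
sum-replicate-0 zero    = ≡.refl
sum-replicate-0 (suc k) = sum-replicate-0 k

sum-shape : ∀ e → sum (shape e) ≡ sum e
sum-shape e = let (k , p) = ↭-shape e in ≡.sym (≡.trans (sum-↭ p)
  (≡.trans (sum-++ (shape e) (replicate k 0)) (≡.trans (≡.cong (sum (shape e) ℕ.+_) (sum-replicate-0 k)) (ℕ.+-identityʳ _))))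

_≟ˡ_ : (ms ns : List ℕ) → Dec (ms ≡ ns)
_≟ˡ_ = ≡-dec ℕ._≟_

words : ℕ → ℕ → List (List ℕ)
words b zero    = [] ∷ []
words b (suc k) = [] ∷ concatMap (λ n → map (n ∷_) (words b k)) (upTo (suc b))

∈-words : ∀ {b} k {ns} → length ns ≤ k → All (_≤ b) ns → ns ∈ words b k
∈-words zero    {[]}     _         _        = here ≡.refl
∈-words (suc k) {[]}     _         _        = here ≡.refl
∈-words (suc k) {n ∷ ns} (s≤s len) (p ∷ ps) = there
  (∈-concat⁺′ (∈-map⁺ (n ∷_) (∈-words k len ps)) (∈-map⁺ (λ n → map (n ∷_) (words _ k)) (∈-upTo⁺ (s≤s p))))

isPartition? : ∀ ns → Dec (IsPartition ns)
isPartition? ns = linked? ℕ._≥?_ ns ×-dec All.all? (0 <?_) ns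

partitionLists : ℕ → List (List ℕ)
partitionLists d = filter isPartition? (deduplicate _≟ˡ_ (words d d))

partitionLists-all : ∀ d → All IsPartition (partitionLists d)
partitionLists-all d = All.all-filter isPartition? (deduplicate _≟ˡ_ (words d d))

length≤sum : ∀ {ns} → All (0 <_) ns → length ns ≤ sum ns
length≤sum []       = z≤n
length≤sum (p ∷ ps) = ℕ.+-mono-≤ p (length≤sum ps)

parts≤sum : ∀ ns → All (_≤ sum ns) ns
parts≤sum []       = []
parts≤sum (n ∷ ns) = ℕ.m≤m+n n _ ∷ All.map (λ p → ℕ.≤-trans p (ℕ.m≤n+m _ n)) (parts≤sum ns)

∈-partitionLists : ∀ d {ns} → IsPartition ns → sum ns ≤ d → ns ∈ partitionLists d
∈-partitionLists d {ns} isP@(_ , pos) le = ∈-filter⁺ isPartition? (∈-deduplicate⁺ _≟ˡ_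
  (∈-words d (ℕ.≤-trans (length≤sum pos) le) (All.map (λ p → ℕ.≤-trans p le) (parts≤sum ns)))) isP

-- All partitions with at most d parts, each at most d
partitionsInSquare : ℕ → List Partition
partitionsInSquare d = All.reduce (λ {ns} → mkPartition ns) (partitionLists-all d)

module SymmetricFunctions (K : CommutativeRing 0ℓ 0ℓ) where
  open CommutativeRing K
  open Antidiagonal K

  record SymFun : Set where
    field
      coeff     : Exponent → Carrier
      symmetric : ∀ {e e′} → e ↭ e′ → coeff e ≈ coeff e′
      padding   : ∀ e → coeff (e ++ 0 ∷ []) ≈ coeff e
      degree    : ℕ
      bounded   : ∀ e → degree < sum e → coeff e ≈ 0#
  open SymFun public

  infix 4 _≈ₛ_
  _≈ₛ_ : SymFun → SymFun → Set
  f ≈ₛ g = ∀ e → coeff f e ≈ coeff g e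

  0ₛ : SymFun
  0ₛ = record { coeff = λ _ → 0# ; symmetric = λ _ → refl ; padding = λ _ → refl ; degree = 0 ; bounded = λ _ _ → refl }

  infixl 6 _+ₛ_
  _+ₛ_ : SymFun → SymFun → SymFun
  f +ₛ g = record
    { coeff     = λ e → coeff f e + coeff g e
    ; symmetric = λ p → +-cong (symmetric f p) (symmetric g p)
    ; padding   = λ e → +-cong (padding f e) (padding g e)
    ; degree    = degree f ℕ.⊔ degree g
    ; bounded   = λ e h → trans
        (+-cong (bounded f e (ℕ.≤-<-trans (ℕ.m≤m⊔n _ _) h))
                (bounded g e (ℕ.≤-<-trans (ℕ.m≤n⊔m (degree f) _) h)))
        (+-identityˡ 0#)
    }

  infixr 7 _•_
  _•_ : Carrier → SymFun → SymFun
  a • f = record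
    { coeff     = λ e → a * coeff f e
    ; symmetric = λ p → *-congˡ (symmetric f p)
    ; padding   = λ e → *-congˡ (padding f e)
    ; degree    = degree f
    ; bounded   = λ e h → trans (*-congˡ (bounded f e h)) (zeroʳ a)
    }

  -- The coefficient at e of the product of two power series: the sum of
  -- f a * g b over all a, b of the same length as e with a + b = e.
  convolve : (Exponent → Carrier) → (Exponent → Carrier) → Exponent → Carrier
  convolve f g []      = f [] * g []
  convolve f g (n ∷ e) = antidiag n (λ i j → convolve (f ∘ (i ∷_)) (g ∘ (j ∷_)) e)

  convolve-cong : ∀ {f f′ g g′} → (∀ e → f e ≈ f′ e) → (∀ e → g e ≈ g′ e) →
    ∀ e → convolve f g e ≈ convolve f′ g′ e
  convolve-cong p q []      = *-cong (p []) (q [])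
  convolve-cong p q (n ∷ e) = antidiag-cong n (λ i j _ → convolve-cong (λ e → p (i ∷ e)) (λ e → q (j ∷ e)) e)

  convolve-↭ : ∀ {f g} → (∀ {e e′} → e ↭ e′ → f e ≈ f e′) → (∀ {e e′} → e ↭ e′ → g e ≈ g e′) →
    ∀ {e e′} → e ↭ e′ → convolve f g e ≈ convolve f g e′
  convolve-↭ sf sg _↭_.refl = refl
  convolve-↭ sf sg (prep n p) = antidiag-cong n (λ i j _ →
    convolve-↭ (λ q → sf (prep i q)) (λ q → sg (prep j q)) p)
  convolve-↭ sf sg (_↭_.swap {ys = e′} m n p) = trans
    (antidiag-cong m (λ i j _ → antidiag-cong n (λ k l _ → trans
      (convolve-↭ (λ q → sf (prep i (prep k q))) (λ q → sg (prep j (prep l q))) p)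
      (convolve-cong (λ e → sf (_↭_.swap {xs = e} i k ↭-refl)) (λ e → sg (_↭_.swap {xs = e} j l ↭-refl)) e′))))
    (antidiag-swap m n _)
  convolve-↭ sf sg (_↭_.trans p q) = trans (convolve-↭ sf sg p) (convolve-↭ sf sg q)

  convolve-pad : ∀ {f g} → (∀ e → f (e ++ 0 ∷ []) ≈ f e) → (∀ e → g (e ++ 0 ∷ []) ≈ g e) →
    ∀ e → convolve f g (e ++ 0 ∷ []) ≈ convolve f g e
  convolve-pad pf pg []      = *-cong (pf []) (pg [])
  convolve-pad pf pg (n ∷ e) = antidiag-cong n (λ i j _ →
    convolve-pad (λ e → pf (i ∷ e)) (λ e → pg (j ∷ e)) e)

  convolve-zero : ∀ {f g} e → (∀ a b → sum a ℕ.+ sum b ≡ sum e → f a * g b ≈ 0#) → convolve f g e ≈ 0#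
  convolve-zero []      h = h [] [] ≡.refl
  convolve-zero (n ∷ e) h = antidiag-zero n (λ i j i+j≡n → convolve-zero e (λ a b eq →
    h (i ∷ a) (j ∷ b) (≡.trans (interchange ℕ.+-commutativeSemigroup i (sum a) j (sum b)) (≡.cong₂ ℕ._+_ i+j≡n eq))))

  infixl 7 _·_
  _·_ : SymFun → SymFun → SymFun
  f · g = record
    { coeff     = convolve (coeff f) (coeff g)
    ; symmetric = convolve-↭ (symmetric f) (symmetric g)
    ; padding   = convolve-pad (padding f) (padding g)
    ; degree    = degree f ℕ.+ degree g
    ; bounded   = λ e h → convolve-zero e (λ a b eq → vanish a b (ℕ.≤-trans h (ℕ.≤-reflexive (≡.sym eq))))
    }
    where
    vanish : ∀ a b → degree f ℕ.+ degree g < sum a ℕ.+ sum b → coeff f a * coeff g b ≈ 0#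
    vanish a b h with degree f <? sum a | degree g <? sum b
    ... | yes p | _     = trans (*-congʳ (bounded f a p)) (zeroˡ _)
    ... | no _  | yes q = trans (*-congˡ (bounded g b q)) (zeroʳ _)
    ... | no p  | no q  = ⊥-elim (ℕ.<⇒≱ h (ℕ.+-mono-≤ (ℕ.≮⇒≥ p) (ℕ.≮⇒≥ q)))

  δ : List ℕ → List ℕ → Carrier
  δ ms ns = if does (ms ≟ˡ ns) then 1# else 0#

  δ-≢ : ∀ ms ns → ms ≢ ns → δ ms ns ≈ 0#
  δ-≢ ms ns ms≢ns with ms ≟ˡ ns
  ... | yes ms≡ns = ⊥-elim (ms≢ns ms≡ns)
  ... | no  _     = refl

  δ-refl : ∀ ms → δ ms ms ≈ 1#
  δ-refl ms with ms ≟ˡ ms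
  ... | yes _     = refl
  ... | no  ms≢ms = ⊥-elim (ms≢ms ≡.refl)

  -- The sum of all monomials whose nonzero exponents, in decreasing
  -- order, are ns
  orbitSum : List ℕ → SymFun
  orbitSum ns = record
    { coeff     = λ e → δ (shape e) ns
    ; symmetric = λ p → reflexive (≡.cong (λ ms → δ ms ns) (shape-↭ p))
    ; padding   = λ e → reflexive (≡.cong (λ ms → δ ms ns) (shape-pad e))
    ; degree    = sum ns
    ; bounded   = λ e h → δ-≢ (shape e) ns λ eq → ℕ.<⇒≢ h (≡.trans (≡.cong sum {ns} {shape e} (≡.sym eq)) (sum-shape e))
    }

  1ₛ : SymFun
  1ₛ = orbitSum []

  monomial : Partition → SymFun
  monomial μ = orbitSum (parts μ)

  -- Σᵢ xᵢ^r, for r ≥ 1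
  powerSum : ℕ → SymFun
  powerSum r = orbitSum (r ∷ [])

  powerSums : Partition → SymFun
  powerSums θ = foldr (λ r f → powerSum r · f) 1ₛ (parts θ)

  -- The coefficient of monomial ν in the expansion of f in the monomial
  -- basis, by monomial-expansion below
  mcoeff : SymFun → Partition → Carrier
  mcoeff f ν = coeff f (parts ν)

  ∑ : List SymFun → SymFun
  ∑ = foldr _+ₛ_ 0ₛ

  private
    module _ (f : SymFun) (e : Exponent) where

      expansion : ∀ {nss} → All IsPartition nss → SymFun
      expansion = ∑ ∘ map (λ ν → mcoeff f ν • monomial ν) ∘ All.reduce (λ {ns} → mkPartition ns)

      absent : ∀ {nss} (ps : All IsPartition nss) → All (shape e ≢_) nss → coeff (expansion ps) e ≈ 0#
      absent []       []       = refl
      absent (p ∷ ps) (q ∷ qs) = trans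
        (+-cong (trans (*-congˡ (δ-≢ (shape e) _ q)) (zeroʳ _)) (absent ps qs)) (+-identityˡ 0#)

      present : ∀ {nss} (ps : All IsPartition nss) → Unique nss → shape e ∈ nss →
        coeff (expansion ps) e ≈ coeff f (shape e)
      present (p ∷ ps) (q ∷ _)    (here ≡.refl) = trans
        (+-cong (trans (*-congˡ (δ-refl (shape e))) (*-identityʳ _)) (absent ps q)) (+-identityʳ _)
      present (p ∷ ps) (q ∷ uniq) (there e∈)    = trans
        (+-cong (trans (*-congˡ (δ-≢ (shape e) _ λ eq → All.lookup q e∈ (≡.sym eq))) (zeroʳ _)) (present ps uniq e∈))
        (+-identityˡ _)

    coeff-shape : ∀ f e → coeff f e ≈ coeff f (shape e)
    coeff-shape f e = let (k , p) = ↭-shape e in trans (symmetric f p) (pads k (shape e))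
      where
      pads : ∀ k e → coeff f (e ++ replicate k 0) ≈ coeff f e
      pads zero    e = reflexive (≡.cong (coeff f) (++-identityʳ e))
      pads (suc k) e = trans
        (reflexive (≡.cong (coeff f) (≡.sym (++-assoc e (0 ∷ []) (replicate k 0)))))
        (trans (pads k (e ++ 0 ∷ [])) (padding f e))

  monomial-expansion : ∀ f → f ≈ₛ ∑ (map (λ ν → mcoeff f ν • monomial ν) (partitionsInSquare (degree f)))
  monomial-expansion f e with Any.any? (shape e ≟ˡ_) (partitionLists (degree f))
  ... | yes e∈ = trans (coeff-shape f e) (sym (present f e (partitionLists-all (degree f))
          (Unique.filter⁺ isPartition? (deduplicate-! _≟ˡ_ (words (degree f) (degree f)))) e∈))
  ... | no e∉  = trans
          (bounded f e (ℕ.≰⇒> λ le → e∉ (∈-partitionLists _ (shape-isPartition e)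
            (ℕ.≤-trans (ℕ.≤-reflexive (sum-shape e)) le))))
          (sym (absent f e (partitionLists-all (degree f)) (All.¬Any⇒All¬ _ e∉)))

open CommutativeRing ℚ⟨α⟩ public
  using (0#; 1#) renaming (_≈_ to _≈ᴷ_; _+_ to _+ᴷ_; _*_ to _*ᴷ_)
open RawSemiringDefinitions (Semiring.rawSemiring (CommutativeRing.semiring ℚ⟨α⟩)) public
  using () renaming (_^_ to _^ᴷ_)
open SymmetricFunctions ℚ⟨α⟩ public

-- The power sums form a basis over ℚ(α), so at most one form satisfies
-- these conditions.
record IsJackScalarProduct (⟨_,_⟩ : SymFun → SymFun → Fraction) : Set where
  field
    cong        : ∀ {f f′ g g′} → f ≈ₛ f′ → g ≈ₛ g′ → ⟨ f , g ⟩ ≈ᴷ ⟨ f′ , g′ ⟩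
    commutative : ∀ f g → ⟨ f , g ⟩ ≈ᴷ ⟨ g , f ⟩
    additive    : ∀ f g h → ⟨ f +ₛ g , h ⟩ ≈ᴷ (⟨ f , h ⟩ +ᴷ ⟨ g , h ⟩)
    homogeneous : ∀ a f g → ⟨ a • f , g ⟩ ≈ᴷ (a *ᴷ ⟨ f , g ⟩)
    orthogonal  : ∀ θ μ → parts θ ≢ parts μ → ⟨ powerSums θ , powerSums μ ⟩ ≈ᴷ 0#
    norm        : ∀ θ → ⟨ powerSums θ , powerSums θ ⟩ ≈ᴷ (fromℕ (z θ) *ᴷ (α ^ᴷ ℓ θ))

-- The Jack functions are the unique family satisfying these conditions.
record IsJack (⟨_,_⟩ : SymFun → SymFun → Fraction) (J : Partition → SymFun) : Set where
  field
    orthogonal : ∀ θ μ → parts θ ≢ parts μ → ⟨ J θ , J μ ⟩ ≈ᴷ 0#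
    triangular : ∀ θ μ → ¬ (μ ⊴ θ) → mcoeff (J θ) μ ≈ᴷ 0#
    normalized : ∀ θ → mcoeff (J θ) (1^ ∣ θ ∣) ≈ᴷ fromℕ (∣ θ ∣ !)

module _ (⟨_,_⟩ : SymFun → SymFun → Fraction) (J : Partition → SymFun) where

  g : Partition → Partition → Partition → Fraction
  g θ μ ν = ⟨ J θ , J μ · J ν ⟩

  IsSkewJack : SkewPartition → SymFun → Set
  IsSkewJack s f = ∀ ν → ⟨ f , J ν ⟩ ≈ᴷ ⟨ J (outer s) , J (inner s) · J ν ⟩

ṽ : SymFun → Partition → Fraction
ṽ f ν = fromℚ (ℚ._/_ (ℤ.+ 1) (u ν) {{u-nonZero ν}}) *ᴷ mcoeff f ν

HasNonnegativeIntegerCoefficients : Fraction → Set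
HasNonnegativeIntegerCoefficients x = ∃[ cs ] x ≈ᴷ fromPoly (map ℕ⇒ℚ cs)

∏[_] : List Box → (Box → Fraction) → Fraction
∏[ bs ] F = foldr (λ s x → F s *ᴷ x) 1# bs

c c′ : Partition → Fraction
c  θ = ∏[ boxes θ ] λ s → (fromℕ (arm θ s) *ᴷ α) +ᴷ fromℕ (leg θ s ℕ.+ 1)
c′ θ = ∏[ boxes θ ] λ s → (fromℕ (arm θ s ℕ.+ 1) *ᴷ α) +ᴷ fromℕ (leg θ s)

-- c₂ μ θ is c_{μ,θ} and c₂′ θ μ is c′_{θ,μ}; both are products over μ.
c₂ c₂′ : Partition → Partition → Fraction
c₂  μ θ = ∏[ boxes μ ] λ s → (fromℕ (arm μ s) *ᴷ α) +ᴷ fromℕ (leg θ s ℕ.+ 1)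
c₂′ θ μ = ∏[ boxes μ ] λ s → (fromℕ (arm θ s ℕ.+ 1) *ᴷ α) +ᴷ fromℕ (leg μ s)

{-# OPTIONS --safe #-}

-- A recursion of Knop and Sahi over the columns of θ produces explicit
-- functions F_θ whose coefficients are visibly u_ν times polynomials in
-- α with nonnegative integer coefficients.  They are eigenfunctions of a
-- self-adjoint operator, the Laplace-Beltrami operator, built from
-- operators of Cherednik type; together with triangularity and with the
-- anisotropy of the form over the ordered field ℚ(α) this gives
-- F_θ = J_θ.
--
-- In ℓ(θ) variables J_θ is a multiple of e_ℓ(θ) J_θ̄, where θ̄ is θ
-- without its first column, and the coefficient of x^θ₁ in J_θ is a
-- multiple of J_θ̂, where θ̂ is θ without its first row.  Multiplication
-- by e_m and by the one-row function g_a being adjoint to these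
-- operations, removing a common first column or row from λ and μ
-- changes ⟨J_λ, J_μ f⟩ by an explicit factor, independent of f, that
-- involves norms of Jack functions.  Evaluating ⟨J_θ, g_a e_(m-1) J_κ⟩
-- in two ways, where a is the first row and m the first column of θ and
-- κ is θ without both, gives a recursion for the norms, solved by
-- c_θ c′_θ, and the factors become those by which c_{μ,λ} c′_{λ,μ}
-- changes.

module Submission where

open import Defs using (module Antidiagonal; module SymmetricFunctions; IsPartition; shape; shape-isPartition; shape-↭; ↭-shape; sum-shape; parts; isPartition; _≟ˡ_; shape-pad; removeColumn; parts≤sum)
open import Algebra.Bundles using (CommutativeRing; Semiring)
import Algebra.Definitions.RawSemiring as RawSemiringDefinitions
import Algebra.Properties.Ring as RingProperties
import Algebra.Solver.Ring.NaturalCoefficients.Default as Solver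
open import Data.Empty using (⊥-elim; ⊥)
import Data.Integer.Base as ℤ
import Data.Integer.Properties as ℤ
open import Data.List.Base using (List; []; _∷_; _++_; map; length; replicate; filter; take; drop; upTo; foldr; applyUpTo; concatMap)
open import Data.List.Membership.Propositional using (_∈_; _∉_; find)
open import Data.List.Membership.Propositional.Properties using (∈-++⁻; ∈-∃++; ∈-++⁺ˡ; ∈-++⁺ʳ; ∈-upTo⁺)
open import Data.List.Properties using (++-identityʳ; ++-assoc; map-++; length-++; length-map; length-replicate; take++drop≡id; length-take; length-drop; filter-accept; filter-reject; ∷-injective; length-upTo; filter-++; upTo-∷ʳ; filter-all)
open import Data.List.Relation.Binary.Equality.Propositional using (≋⇒≡)
open import Data.List.Relation.Binary.Permutation.Propositional using (_↭_; prep; ↭-refl; ↭-sym; ↭-trans; ↭⇒↭ₛ; ↭-reflexive)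
import Data.List.Relation.Binary.Permutation.Propositional.Properties as Perm
import Data.List.Relation.Binary.Permutation.Setoid.Properties as PermS
open import Data.List.Relation.Unary.All as All using (All; []; _∷_)
import Data.List.Relation.Unary.All.Properties as All
open import Data.List.Relation.Unary.AllPairs using ([]; _∷_)
open import Data.List.Relation.Unary.Any as Any using (Any; here; there)
open import Data.List.Relation.Unary.Linked using (Linked; []; [-]; _∷_)
open import Data.List.Relation.Unary.Sorted.TotalOrder.Properties using (↗↭↗⇒≋)
open import Data.List.Relation.Unary.Unique.Propositional using (Unique)
import Data.List.Relation.Unary.Unique.Propositional.Properties as Unique
open import Data.Nat.Base as ℕ using (ℕ; zero; suc; _<_; _≤_; s≤s; z≤n; pred; _∸_; _≥_; _!; _⊓_; NonZero)
open import Data.Nat.Induction using (<-rec)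
open import Data.Nat.ListAction using (sum; product)
open import Data.Nat.ListAction.Properties using (sum-++; sum-↭; product-++)
import Data.Nat.Properties as ℕ
open import Data.List.Membership.DecPropositional ℕ._≟_ using (_∈?_)
open import Data.Nat.Tactic.RingSolver using (solve-∀)
open import Data.Product.Base using (_×_; _,_; proj₁; proj₂; ∃-syntax)
open import Data.Rational.Base as ℚ using (ℚ; 0ℚ; 1ℚ; toℚᵘ)
import Data.Rational.Properties as ℚ
open import Data.Rational.Unnormalised.Base as ℚᵘ using (mkℚᵘ; _≃_; *≡*)
import Data.Rational.Unnormalised.Properties as ℚᵘ
open import Data.Sum.Base using (inj₁; inj₂; _⊎_)
open import Data.Unit.Base using (⊤; tt)
open import Function.Base using (_∘_)
open import Level using (0ℓ)
open import Relation.Binary.Construct.Closure.ReflexiveTransitive using (ε; _◅_)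
open import Relation.Binary.Construct.Closure.Symmetric using (SymClosure; fwd; bwd)
import Relation.Binary.Construct.Flip.EqAndOrd as Flip
open import Relation.Binary.Definitions using (tri<; tri≈; tri>)
open import Relation.Binary.PropositionalEquality as ≡ using (_≡_; _≢_)
import Relation.Binary.Reasoning.Setoid as SetoidReasoning
open import Relation.Nullary using (¬_; Dec; yes; no)

-- Equations that hold in only `m` variables enter scalar products because a function vanishing in
-- `m` variables is a combination of Jack functions with more than `m` rows, hence orthogonal to
-- those with at most `m` rows. Rows are handled dually: the adjoint of a multiplication never
-- creates exponents above those of its argument, so a bound on the first row survives it. The
-- eigenvalues do not separate all partitions, for instance (4,1,1) and (3,3), but they separate
-- partitions comparable in dominance order, which is all that the triangular comparison with `J`
-- needs; orthogonality of the remaining pairs is then read off from `J`. In `N` variables the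
-- operator has a term that is `N` times the degree. Its cancellation leaves an operator on
-- symmetric functions, written in the power sums and their derivations, whose self-adjointness is
-- visible. The function `f` in ⟨J_λ, J_μ f⟩ stays arbitrary since neither removal changes it; a
-- sequence of removals and insertions thus only multiplies the pairing by constants.

-- Finite sums and sums over picks of an entry

module FiniteSums (K : CommutativeRing 0ℓ 0ℓ) where

  open CommutativeRing K
  open Solver commutativeSemiring using (solve; _:=_; _:+_; _:*_; con)

  ⟦_⟧ : ℕ → Carrier
  ⟦ zero ⟧  = 0#
  ⟦ suc n ⟧ = 1# + ⟦ n ⟧

  ⟦⟧-+ : ∀ m n → ⟦ m ℕ.+ n ⟧ ≈ ⟦ m ⟧ + ⟦ n ⟧
  ⟦⟧-+ zero    n = sym (+-identityˡ _)
  ⟦⟧-+ (suc m) n = trans (+-congˡ (⟦⟧-+ m n)) (sym (+-assoc _ _ _))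

  ⟦⟧-* : ∀ m n → ⟦ m ℕ.* n ⟧ ≈ ⟦ m ⟧ * ⟦ n ⟧
  ⟦⟧-* zero    n = sym (zeroˡ _)
  ⟦⟧-* (suc m) n = trans (⟦⟧-+ n (m ℕ.* n)) (trans (+-congˡ (⟦⟧-* m n))
    (solve 2 (λ a b → b :+ a :* b := (con 1 :+ a) :* b) refl ⟦ m ⟧ ⟦ n ⟧))

  ⟦1⟧ : ⟦ 1 ⟧ ≈ 1#
  ⟦1⟧ = +-identityʳ 1#

  sumOf : ∀ {A : Set} → List A → (A → Carrier) → Carrier
  sumOf []       f = 0#
  sumOf (x ∷ xs) f = f x + sumOf xs f

  module _ {A : Set} where

    sumOf-cong∈ : ∀ (xs : List A) {f g} → (∀ {x} → x ∈ xs → f x ≈ g x) → sumOf xs f ≈ sumOf xs g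
    sumOf-cong∈ []       h = refl
    sumOf-cong∈ (x ∷ xs) h = +-cong (h (here ≡.refl)) (sumOf-cong∈ xs (h ∘ there))

    sumOf-cong : ∀ (xs : List A) {f g} → (∀ x → f x ≈ g x) → sumOf xs f ≈ sumOf xs g
    sumOf-cong xs h = sumOf-cong∈ xs (λ {x} _ → h x)

    sumOf-zero : ∀ (xs : List A) {f} → (∀ {x} → x ∈ xs → f x ≈ 0#) → sumOf xs f ≈ 0#
    sumOf-zero []       h = refl
    sumOf-zero (x ∷ xs) h = trans (+-cong (h (here ≡.refl)) (sumOf-zero xs (h ∘ there))) (+-identityˡ 0#)

    sumOf-+ : ∀ (xs : List A) f g → sumOf xs (λ x → f x + g x) ≈ sumOf xs f + sumOf xs g
    sumOf-+ []       f g = sym (+-identityˡ 0#)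
    sumOf-+ (x ∷ xs) f g = trans (+-congˡ (sumOf-+ xs f g))
      (solve 4 (λ a b c d → ((a :+ b) :+ (c :+ d)) := ((a :+ c) :+ (b :+ d))) refl _ _ _ _)

    sumOf-*ˡ : ∀ (xs : List A) a f → sumOf xs (λ x → a * f x) ≈ a * sumOf xs f
    sumOf-*ˡ []       a f = sym (zeroʳ a)
    sumOf-*ˡ (x ∷ xs) a f = trans (+-congˡ (sumOf-*ˡ xs a f)) (sym (distribˡ a _ _))

    sumOf-*ʳ : ∀ (xs : List A) a f → sumOf xs (λ x → f x * a) ≈ sumOf xs f * a
    sumOf-*ʳ xs a f = trans (sumOf-cong xs (λ _ → *-comm _ _)) (trans (sumOf-*ˡ xs a f) (*-comm _ _))

    sumOf-const : ∀ (xs : List A) a → sumOf xs (λ _ → a) ≈ ⟦ length xs ⟧ * a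
    sumOf-const []       a = sym (zeroˡ a)
    sumOf-const (x ∷ xs) a = trans (+-congˡ (sumOf-const xs a))
      (solve 2 (λ n a → a :+ n :* a := (con 1 :+ n) :* a) refl _ a)

    sumOf-++ : ∀ (xs ys : List A) f → sumOf (xs ++ ys) f ≈ sumOf xs f + sumOf ys f
    sumOf-++ []       ys f = sym (+-identityˡ _)
    sumOf-++ (x ∷ xs) ys f = trans (+-congˡ (sumOf-++ xs ys f)) (sym (+-assoc _ _ _))

    sumOf-↭ : ∀ {xs ys : List A} f → xs ↭ ys → sumOf xs f ≈ sumOf ys f
    sumOf-↭ f _↭_.refl         = refl
    sumOf-↭ f (prep x p)       = +-congˡ (sumOf-↭ f p)
    sumOf-↭ f (_↭_.swap x y p) = trans (+-congˡ (+-congˡ (sumOf-↭ f p)))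
      (solve 3 (λ a b c → a :+ (b :+ c) := b :+ (a :+ c)) refl _ _ _)
    sumOf-↭ f (_↭_.trans p q)  = trans (sumOf-↭ f p) (sumOf-↭ f q)

    sumOf-map : ∀ {B : Set} (h : B → A) xs f → sumOf (map h xs) f ≡ sumOf xs (f ∘ h)
    sumOf-map h []       f = ≡.refl
    sumOf-map h (x ∷ xs) f = ≡.cong (f (h x) +_) (sumOf-map h xs f)

    -- Entries are picked by position, so equal entries count separately, and the remaining ones
    -- stay available. Multiplication by a power sum and the symmetric part of `raiseFirst` both
    -- have this shape.
    sumPicks : List A → (A → List A → Carrier) → Carrier
    sumPicks []       G = 0#
    sumPicks (x ∷ xs) G = G x xs + sumPicks xs (λ y ys → G y (x ∷ ys))

    sumPicks-cong : ∀ (xs : List A) {G H} → (∀ y ys → y ∷ ys ↭ xs → G y ys ≈ H y ys) → sumPicks xs G ≈ sumPicks xs H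
    sumPicks-cong []       h = refl
    sumPicks-cong (x ∷ xs) h = +-cong (h x xs ↭-refl)
      (sumPicks-cong xs (λ y ys p → h y (x ∷ ys) (↭-trans (_↭_.swap y x ↭-refl) (prep x p))))

    sumPicks-zero : ∀ (xs : List A) {G} → (∀ y ys → y ∷ ys ↭ xs → G y ys ≈ 0#) → sumPicks xs G ≈ 0#
    sumPicks-zero []       h = refl
    sumPicks-zero (x ∷ xs) h = trans (+-cong (h x xs ↭-refl)
      (sumPicks-zero xs (λ y ys p → h y (x ∷ ys) (↭-trans (_↭_.swap y x ↭-refl) (prep x p))))) (+-identityˡ 0#)

    sumPicks-sumOf : ∀ (xs : List A) g → sumPicks xs (λ y _ → g y) ≈ sumOf xs g
    sumPicks-sumOf []       g = refl
    sumPicks-sumOf (x ∷ xs) g = +-congˡ (sumPicks-sumOf xs g)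

    sumPicks-+ : ∀ (xs : List A) G H → sumPicks xs (λ y ys → G y ys + H y ys) ≈ sumPicks xs G + sumPicks xs H
    sumPicks-+ []       G H = sym (+-identityˡ 0#)
    sumPicks-+ (x ∷ xs) G H = trans (+-congˡ (sumPicks-+ xs _ _))
      (solve 4 (λ a b c d → ((a :+ b) :+ (c :+ d)) := ((a :+ c) :+ (b :+ d))) refl _ _ _ _)

    sumPicks-*ˡ : ∀ (xs : List A) a G → sumPicks xs (λ y ys → a * G y ys) ≈ a * sumPicks xs G
    sumPicks-*ˡ []       a G = sym (zeroʳ a)
    sumPicks-*ˡ (x ∷ xs) a G = trans (+-congˡ (sumPicks-*ˡ xs a _)) (sym (distribˡ a _ _))

    sumPicks-↭ : ∀ {xs ys : List A} G → (∀ y {zs zs′} → zs ↭ zs′ → G y zs ≈ G y zs′) →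
      xs ↭ ys → sumPicks xs G ≈ sumPicks ys G
    sumPicks-↭ G h _↭_.refl   = refl
    sumPicks-↭ G h (prep x p) = +-cong (h x p) (sumPicks-↭ _ (λ y q → h y (prep x q)) p)
    sumPicks-↭ G h (_↭_.swap {xs} {ys} x y p) = trans
      (+-cong (h x (prep y p)) (+-cong (h y (prep x p)) (trans
        (sumPicks-↭ _ (λ z q → h z (prep x (prep y q))) p)
        (sumPicks-cong ys (λ z zs _ → h z (_↭_.swap x y ↭-refl))))))
      (solve 3 (λ a b c → a :+ (b :+ c) := b :+ (a :+ c)) refl _ _ _)
    sumPicks-↭ G h (_↭_.trans p q) = trans (sumPicks-↭ G h p) (sumPicks-↭ G h q)

    sumPicks-swap : ∀ (xs : List A) (G : A → A → List A → Carrier) →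
      sumPicks xs (λ x ys → sumPicks ys (λ y zs → G x y zs)) ≈
      sumPicks xs (λ x ys → sumPicks ys (λ y zs → G y x zs))
    sumPicks-swap []       G = refl
    sumPicks-swap (x ∷ xs) G = trans
      (+-congˡ (trans (sumPicks-+ xs _ _) (+-congˡ (sumPicks-swap xs (λ y z zs → G y z (x ∷ zs))))))
      (trans (solve 3 (λ a b c → a :+ (b :+ c) := b :+ (a :+ c)) refl _ _ _)
      (+-congˡ (sym (sumPicks-+ xs _ _))))

  sumPicks-map : ∀ {A B : Set} (h : B → A) xs G →
    sumPicks (map h xs) G ≡ sumPicks xs (λ y ys → G (h y) (map h ys))
  sumPicks-map h []       G = ≡.refl
  sumPicks-map h (x ∷ xs) G = ≡.cong (G (h x) (map h xs) +_) (sumPicks-map h xs (λ y ys → G y (h x ∷ ys)))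

  sumOf-swap : ∀ {A B : Set} (xs : List A) (ys : List B) (f : A → B → Carrier) →
    sumOf xs (λ x → sumOf ys (f x)) ≈ sumOf ys (λ y → sumOf xs (λ x → f x y))
  sumOf-swap []       ys f = sym (sumOf-zero ys (λ _ → refl))
  sumOf-swap (x ∷ xs) ys f = trans (+-congˡ (sumOf-swap xs ys f)) (sym (sumOf-+ ys _ _))

-- Algebra of the product; multiplication by power sums

module Convolution (K : CommutativeRing 0ℓ 0ℓ) where

  open CommutativeRing K
  open Antidiagonal K
  open SymmetricFunctions K
  open FiniteSums K

  Fun : Set
  Fun = List ℕ → Carrier

  antidiag-assoc : ∀ n (F : ℕ → ℕ → ℕ → Carrier) →
    antidiag n (λ i j → antidiag i (λ k l → F k l j)) ≈ antidiag n (λ k m → antidiag m (λ l j → F k l j))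
  antidiag-assoc zero    F = refl
  antidiag-assoc (suc n) F = trans (+-congˡ (antidiag-+ n _ _)) (trans (sym (+-assoc _ _ _))
    (+-congˡ (antidiag-assoc n (λ k l j → F (suc k) l j))))

  convolve-comm : ∀ (f g : Fun) e → convolve f g e ≈ convolve g f e
  convolve-comm f g []      = *-comm _ _
  convolve-comm f g (n ∷ e) = trans (antidiag-flip n _) (antidiag-cong n (λ i j _ → convolve-comm _ _ e))

  convolve-+ˡ : ∀ (f f′ g : Fun) e → convolve (λ a → f a + f′ a) g e ≈ convolve f g e + convolve f′ g e
  convolve-+ˡ f f′ g []      = distribʳ _ _ _
  convolve-+ˡ f f′ g (n ∷ e) = trans (antidiag-cong n (λ i j _ → convolve-+ˡ _ _ _ e)) (antidiag-+ n _ _)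

  convolve-*ˡ : ∀ a (f g : Fun) e → convolve (λ e′ → a * f e′) g e ≈ a * convolve f g e
  convolve-*ˡ a f g []      = *-assoc _ _ _
  convolve-*ˡ a f g (n ∷ e) = trans (antidiag-cong n (λ i j _ → convolve-*ˡ a _ _ e)) (antidiag-*ˡ n a _)

  convolve-antidiagˡ : ∀ n (F : ℕ → ℕ → Fun) g e →
    convolve (λ a → antidiag n (λ i j → F i j a)) g e ≈ antidiag n (λ i j → convolve (F i j) g e)
  convolve-antidiagˡ zero    F g e = refl
  convolve-antidiagˡ (suc n) F g e = trans (convolve-+ˡ _ _ g e) (+-congˡ (convolve-antidiagˡ n _ g e))

  convolve-zeroˡ : ∀ {f : Fun} g e → (∀ a → length a ≡ length e → f a ≈ 0#) → convolve f g e ≈ 0#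
  convolve-zeroˡ g []      h = trans (*-congʳ (h [] ≡.refl)) (zeroˡ _)
  convolve-zeroˡ g (n ∷ e) h = antidiag-zero n (λ i j _ → convolve-zeroˡ _ e (λ a eq → h (i ∷ a) (≡.cong suc eq)))

  convolve-congˡ : ∀ {f f′ : Fun} g e → (∀ a → length a ≡ length e → f a ≈ f′ a) → convolve f g e ≈ convolve f′ g e
  convolve-congˡ g []      h = *-congʳ (h [] ≡.refl)
  convolve-congˡ g (n ∷ e) h = antidiag-cong n (λ i j _ → convolve-congˡ _ e (λ a eq → h (i ∷ a) (≡.cong suc eq)))

  convolve-assoc : ∀ (f g h : Fun) e → convolve (convolve f g) h e ≈ convolve f (convolve g h) e
  convolve-assoc f g h []      = *-assoc _ _ _
  convolve-assoc f g h (n ∷ e) = trans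
    (antidiag-cong n (λ i j _ → convolve-antidiagˡ i _ _ e))
    (trans (antidiag-assoc n _)
    (antidiag-cong n (λ k m _ → trans
      (antidiag-cong m (λ l j _ → trans (convolve-assoc _ _ _ e) (convolve-comm _ _ e)))
      (sym (trans (convolve-comm _ _ e) (convolve-antidiagˡ m _ _ e))))))

  one : Fun
  one = coeff 1ₛ

  one-suc : ∀ i a → one (suc i ∷ a) ≈ 0#
  one-suc i a = δ-≢ (shape (suc i ∷ a)) [] (λ eq → ℕ.1+n≢0 (≡.trans (≡.sym (sum-shape (suc i ∷ a))) (≡.cong sum {shape (suc i ∷ a)} {[]} eq)))

  convolve-identityˡ : ∀ (f : Fun) e → convolve one f e ≈ f e
  convolve-identityˡ f []            = *-identityˡ _
  convolve-identityˡ f (zero  ∷ e)   = convolve-identityˡ (f ∘ (0 ∷_)) e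
  convolve-identityˡ f (suc n ∷ e)   = trans
    (+-cong (convolve-identityˡ (f ∘ (suc n ∷_)) e)
      (antidiag-zero n (λ i j _ → trans (convolve-congˡ _ e (λ a _ → one-suc i a)) (convolve-zeroˡ _ e (λ _ _ → refl)))))
    (+-identityʳ _)

  ·-comm : ∀ f g → f · g ≈ₛ g · f
  ·-comm f g = convolve-comm (coeff f) (coeff g)

  ·-assoc : ∀ f g h → (f · g) · h ≈ₛ f · (g · h)
  ·-assoc f g h = convolve-assoc (coeff f) (coeff g) (coeff h)

  ·-cong : ∀ {f f′ g g′} → f ≈ₛ f′ → g ≈ₛ g′ → f · g ≈ₛ f′ · g′
  ·-cong p q = convolve-cong p q

  ·-distribʳ : ∀ f g h → (f +ₛ g) · h ≈ₛ f · h +ₛ g · h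
  ·-distribʳ f g h = convolve-+ˡ (coeff f) (coeff g) (coeff h)

  ·-•ˡ : ∀ a f g → (a • f) · g ≈ₛ a • (f · g)
  ·-•ˡ a f g = convolve-*ˡ a (coeff f) (coeff g)

  ·-identityˡ : ∀ f → 1ₛ · f ≈ₛ f
  ·-identityˡ f = convolve-identityˡ (coeff f)

  ·-distribˡ : ∀ f g h → f · (g +ₛ h) ≈ₛ f · g +ₛ f · h
  ·-distribˡ f g h e = trans (·-comm f (g +ₛ h) e) (trans (·-distribʳ g h f e) (+-cong (·-comm g f e) (·-comm h f e)))

  ·-•ʳ : ∀ a f g → f · (a • g) ≈ₛ a • (f · g)
  ·-•ʳ a f g e = trans (·-comm f (a • g) e) (trans (·-•ˡ a g f e) (*-congˡ (·-comm g f e)))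

  -- The coefficients of a polynomial in one variable after multiplication by the `r`-th power of
  -- that variable.
  low : ℕ → ℕ → (ℕ → Carrier) → Carrier
  low zero    n       F = F n
  low (suc r) zero    F = 0#
  low (suc r) (suc n) F = low r n F

  low-cong : ∀ r n {F G} → (∀ k → F k ≈ G k) → low r n F ≈ low r n G
  low-cong zero    n       h = h n
  low-cong (suc r) zero    h = refl
  low-cong (suc r) (suc n) h = low-cong r n h

  antidiag-pick : ∀ r n {G : ℕ → ℕ → Carrier} {F} → (∀ j → G r j ≈ F j) → (∀ i j → i ≢ r → G i j ≈ 0#) →
    antidiag n G ≈ low r n F
  antidiag-pick zero    zero    p q = p 0
  antidiag-pick zero    (suc n) p q = trans (+-cong (p (suc n)) (antidiag-zero n (λ i j _ → q (suc i) j λ ()))) (+-identityʳ _)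
  antidiag-pick (suc r) zero    p q = q 0 0 λ ()
  antidiag-pick (suc r) (suc n) p q = trans (+-cong (q 0 (suc n) λ ())
    (antidiag-pick r n p (λ i j i≢r → q (suc i) j (i≢r ∘ ℕ.suc-injective)))) (+-identityˡ _)

  shape-partition : ∀ {ns} → IsPartition ns → shape ns ≡ ns
  shape-partition {ns} isP@(sorted , pos) =
    ≋⇒≡ (↗↭↗⇒≋ (Flip.totalOrder ℕ.≤-totalOrder) (proj₁ (shape-isPartition ns)) sorted
      (↭⇒↭ₛ (↭-sym (drop-zeros pos (proj₂ (shape-isPartition ns)) (proj₂ (↭-shape ns))))))
    where
    drop-zeros : ∀ {xs ys k} → All (0 <_) xs → All (0 <_) ys → xs ↭ ys ++ replicate k 0 → xs ↭ ys
    drop-zeros {ys = ys} {zero}  _   _ p = ↭-trans p (↭-reflexive (++-identityʳ ys))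
      where open import Data.List.Properties using (++-identityʳ)
    drop-zeros {ys = ys} {suc k} pos _ p with All.lookup pos (Perm.∈-resp-↭ (↭-sym p) (∈-++⁺ʳ ys (here ≡.refl)))
      where open import Data.List.Membership.Propositional.Properties using (∈-++⁺ʳ)
    ... | ()

  shape-pads : ∀ {ns} → IsPartition ns → ∀ {e k} → e ↭ ns ++ replicate k 0 → shape e ≡ ns
  shape-pads {ns} isP {k = k} p = ≡.trans (shape-↭ p) (≡.trans (go k ns) (shape-partition isP))
    where
    go : ∀ k ns → shape (ns ++ replicate k 0) ≡ shape ns
    go zero    ns = ≡.cong shape (++-identityʳ ns)
    go (suc k) ns = ≡.trans (≡.cong shape (≡.sym (++-assoc ns (0 ∷ []) (replicate k 0))))
      (≡.trans (go k (ns ++ 0 ∷ [])) (shape-pad ns))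

  ∈-replicate-0 : ∀ k {x} → x ∈ replicate k 0 → x ≡ 0
  ∈-replicate-0 (suc k) (here eq) = eq
  ∈-replicate-0 (suc k) (there p) = ∈-replicate-0 k p

  δ-≡ : ∀ {ms ns} → ms ≡ ns → δ ms ns ≈ 1#
  δ-≡ {ms} ≡.refl = δ-refl ms

  powerSum-hit : ∀ r a → coeff (powerSum (suc r)) (suc r ∷ a) ≈ one a
  powerSum-hit r a = go (shape a ≟ˡ [])
    where
    go : Dec (shape a ≡ []) → coeff (powerSum (suc r)) (suc r ∷ a) ≈ one a
    go (yes eq) = trans (δ-≡ (shape-pads {suc r ∷ []} ([-] , (s≤s z≤n ∷ [])) {k = proj₁ (↭-shape a)}
      (prep (suc r) (≡.subst (λ s → a ↭ s ++ replicate (proj₁ (↭-shape a)) 0) eq (proj₂ (↭-shape a))))))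
      (sym (δ-≡ eq))
    go (no neq) = trans (δ-≢ (shape (suc r ∷ a)) (suc r ∷ []) miss) (sym (δ-≢ (shape a) [] neq))
      where
      miss : shape (suc r ∷ a) ≢ suc r ∷ []
      miss eq′ = neq (shape-pads {[]} ([] , []) {k = proj₁ (↭-shape (suc r ∷ a))}
        (Perm.drop-∷ (≡.subst (λ s → suc r ∷ a ↭ s ++ replicate (proj₁ (↭-shape (suc r ∷ a))) 0) eq′ (proj₂ (↭-shape (suc r ∷ a))))))

  powerSum-miss : ∀ r i a → i ≢ r → coeff (powerSum (suc r)) (suc i ∷ a) ≈ 0#
  powerSum-miss r i a i≢r = δ-≢ (shape (suc i ∷ a)) (suc r ∷ []) λ eq →
    contra {proj₁ (↭-shape (suc i ∷ a))} (Perm.∈-resp-↭ (≡.subst (λ s → suc i ∷ a ↭ s ++ replicate (proj₁ (↭-shape (suc i ∷ a))) 0) eq (proj₂ (↭-shape (suc i ∷ a)))) (here ≡.refl))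
    where
    contra : ∀ {k} → ¬ (suc i ∈ suc r ∷ replicate k 0)
    contra (here eq) = i≢r (ℕ.suc-injective eq)
    contra {k} (there p) with ∈-replicate-0 k p
    ... | ()

  -- The variable occurring in the power sum is either the first one, which gives the `low` term, or
  -- one of the others.
  powerSum-∷ : ∀ r (f : Fun) n e → convolve (coeff (powerSum (suc r))) f (n ∷ e) ≈
    low (suc r) n (λ k → f (k ∷ e)) + convolve (coeff (powerSum (suc r))) (f ∘ (n ∷_)) e
  powerSum-∷ r f zero    e = sym (+-identityˡ _)
  powerSum-∷ r f (suc n) e = trans (+-comm _ _) (+-congʳ (antidiag-pick r n
    (λ j → trans (convolve-congˡ _ e (λ a _ → powerSum-hit r a)) (convolve-identityˡ _ e))
    (λ i j i≢r → convolve-zeroˡ _ e (λ a _ → powerSum-miss r i a i≢r))))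

  powerSum-[] : ∀ r (f : Fun) → convolve (coeff (powerSum (suc r))) f [] ≈ 0#
  powerSum-[] r f = trans (*-congʳ (δ-≢ [] (suc r ∷ []) λ ())) (zeroˡ _)

-- Operators on polynomials and divided differences

module ExponentFunctions (K : CommutativeRing 0ℓ 0ℓ) (α : CommutativeRing.Carrier K) where

  open CommutativeRing K
  open Solver commutativeSemiring using (solve; _:=_; _:+_; _:*_; con)
  open RingProperties ring using (+-cancelˡ; +-cancelʳ)
  open Antidiagonal K
  open FiniteSums K
  open Convolution K using (low; low-cong)

  Exp : Set
  Exp = ℕ → ℕ

  infix 4 _≗ᵉ_
  _≗ᵉ_ : Exp → Exp → Set
  η ≗ᵉ ζ = ∀ k → η k ≡ ζ k

  upd : Exp → ℕ → ℕ → Exp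
  upd η i v k with k ℕ.≟ i
  ... | yes _ = v
  ... | no _  = η k

  upd-same : ∀ η i v → upd η i v i ≡ v
  upd-same η i v with i ℕ.≟ i
  ... | yes _ = ≡.refl
  ... | no ne = ⊥-elim (ne ≡.refl)

  upd-other : ∀ η {i} v {k} → k ≢ i → upd η i v k ≡ η k
  upd-other η {i} v {k} k≢i with k ℕ.≟ i
  ... | yes eq = ⊥-elim (k≢i eq)
  ... | no _   = ≡.refl

  upd-cong : ∀ {η ζ} → η ≗ᵉ ζ → ∀ i v → upd η i v ≗ᵉ upd ζ i v
  upd-cong h i v k with k ℕ.≟ i
  ... | yes _ = ≡.refl
  ... | no _  = h k

  upd-upd : ∀ η i v w → upd (upd η i v) i w ≗ᵉ upd η i w
  upd-upd η i v w k with k ℕ.≟ i in eq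
  ... | yes _ = ≡.refl
  ... | no _  rewrite eq = ≡.refl

  upd-comm : ∀ η {i j} v w → i ≢ j → upd (upd η i v) j w ≗ᵉ upd (upd η j w) i v
  upd-comm η {i} {j} v w i≢j k = go (k ℕ.≟ i) (k ℕ.≟ j)
    where
    go : Dec (k ≡ i) → Dec (k ≡ j) → upd (upd η i v) j w k ≡ upd (upd η j w) i v k
    go (yes ≡.refl) _ = ≡.trans (upd-other (upd η i v) w i≢j) (≡.trans (upd-same η i v) (≡.sym (upd-same (upd η j w) i v)))
    go (no p) (yes ≡.refl) = ≡.trans (upd-same (upd η i v) j w) (≡.sym (≡.trans (upd-other (upd η j w) v p) (upd-same η j w)))
    go (no p) (no q) = ≡.trans (upd-other (upd η i v) w q) (≡.trans (upd-other η v p)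
      (≡.sym (≡.trans (upd-other (upd η j w) v p) (upd-other η w q))))

  upd-id : ∀ η i → upd η i (η i) ≗ᵉ η
  upd-id η i k with k ℕ.≟ i
  ... | yes ≡.refl = ≡.refl
  ... | no _       = ≡.refl

  τ : ℕ → ℕ → ℕ → ℕ
  τ i j k with k ℕ.≟ i
  ... | yes _ = j
  ... | no _ with k ℕ.≟ j
  ...   | yes _ = i
  ...   | no _  = k

  τ-l : ∀ i j → τ i j i ≡ j
  τ-l i j with i ℕ.≟ i
  ... | yes _ = ≡.refl
  ... | no ne = ⊥-elim (ne ≡.refl)

  τ-r : ∀ i j → τ i j j ≡ i
  τ-r i j with j ℕ.≟ i
  ... | yes eq = eq
  ... | no _ with j ℕ.≟ j
  ...   | yes _ = ≡.refl
  ...   | no ne = ⊥-elim (ne ≡.refl)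

  τ-fix : ∀ {i j k} → k ≢ i → k ≢ j → τ i j k ≡ k
  τ-fix {i} {j} {k} p q with k ℕ.≟ i
  ... | yes eq = ⊥-elim (p eq)
  ... | no _ with k ℕ.≟ j
  ...   | yes eq = ⊥-elim (q eq)
  ...   | no _  = ≡.refl

  τ-invol : ∀ i j k → τ i j (τ i j k) ≡ k
  τ-invol i j k with k ℕ.≟ i
  ... | yes ≡.refl = τ-r k j
  ... | no ne with k ℕ.≟ j
  ...   | yes ≡.refl = τ-l i k
  ...   | no ne′     = τ-fix ne ne′

  τ-inj : ∀ i j {k l} → τ i j k ≡ τ i j l → k ≡ l
  τ-inj i j {k} {l} eq = ≡.trans (≡.sym (τ-invol i j k)) (≡.trans (≡.cong (τ i j) eq) (τ-invol i j l))

  τ-comm : ∀ i j k → τ i j k ≡ τ j i k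
  τ-comm i j k = go (k ℕ.≟ i) (k ℕ.≟ j)
    where
    go : Dec (k ≡ i) → Dec (k ≡ j) → τ i j k ≡ τ j i k
    go (yes ≡.refl) _            = ≡.trans (τ-l i j) (≡.sym (τ-r j i))
    go (no p)       (yes ≡.refl) = ≡.trans (τ-r i j) (≡.sym (τ-l j i))
    go (no p)       (no q)       = ≡.trans (τ-fix p q) (≡.sym (τ-fix q p))

  τ-conj : ∀ a b c d x → τ a b (τ c d x) ≡ τ (τ a b c) (τ a b d) (τ a b x)
  τ-conj a b c d x = go (x ℕ.≟ c) (x ℕ.≟ d)
    where
    go : Dec (x ≡ c) → Dec (x ≡ d) → τ a b (τ c d x) ≡ τ (τ a b c) (τ a b d) (τ a b x)
    go (yes ≡.refl) _ = ≡.trans (≡.cong (τ a b) (τ-l x d)) (≡.sym (τ-l (τ a b x) _))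
    go (no _) (yes ≡.refl) = ≡.trans (≡.cong (τ a b) (τ-r c x)) (≡.sym (τ-r _ (τ a b x)))
    go (no p) (no q) = ≡.trans (≡.cong (τ a b) (τ-fix p q)) (≡.sym (τ-fix (p ∘ τ-inj a b) (q ∘ τ-inj a b)))

  upd-τ : ∀ a b η i v → upd (η ∘ τ a b) i v ≗ᵉ upd η (τ a b i) v ∘ τ a b
  upd-τ a b η i v k = go (k ℕ.≟ i)
    where
    go : Dec (k ≡ i) → upd (η ∘ τ a b) i v k ≡ upd η (τ a b i) v (τ a b k)
    go (yes ≡.refl) = ≡.trans (upd-same (η ∘ τ a b) i v) (≡.sym (upd-same η (τ a b i) v))
    go (no p) = ≡.trans (upd-other (η ∘ τ a b) v p) (≡.sym (upd-other η v (p ∘ τ-inj a b)))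

  upd-swap : ∀ η {i j} p q → i ≢ j → upd (upd η i p) j q ∘ τ i j ≗ᵉ upd (upd η i q) j p
  upd-swap η {i} {j} p q i≢j k = go (k ℕ.≟ i) (k ℕ.≟ j)
    where
    go : Dec (k ≡ i) → Dec (k ≡ j) → upd (upd η i p) j q (τ i j k) ≡ upd (upd η i q) j p k
    go (yes ≡.refl) _ = ≡.trans (≡.cong (upd (upd η i p) j q) (τ-l i j)) (≡.trans (upd-same (upd η i p) j q)
      (≡.sym (≡.trans (upd-other (upd η i q) p i≢j) (upd-same η i q))))
    go (no n) (yes ≡.refl) = ≡.trans (≡.cong (upd (upd η i p) j q) (τ-r i j))
      (≡.trans (upd-other (upd η i p) q i≢j) (≡.trans (upd-same η i p) (≡.sym (upd-same (upd η i q) j p))))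
    go (no n) (no m) = ≡.trans (≡.cong (upd (upd η i p) j q) (τ-fix n m))
      (≡.trans (upd-other (upd η i p) q m) (≡.trans (upd-other η p n)
      (≡.sym (≡.trans (upd-other (upd η i q) p m) (upd-other η q n)))))

  -- Polynomials in variables indexed by ℕ, given by their coefficients.
  record Fn : Set where
    field
      app : Exp → Carrier
      ext : ∀ {η ζ} → η ≗ᵉ ζ → app η ≈ app ζ
  open Fn public

  infix 4 _≋_
  _≋_ : Fn → Fn → Set
  f ≋ g = ∀ η → app f η ≈ app g η

  infixl 6 _⊕_
  _⊕_ : Fn → Fn → Fn
  f ⊕ g = record { app = λ η → app f η + app g η ; ext = λ h → +-cong (ext f h) (ext g h) }

  infixr 7 _⊙_
  _⊙_ : Carrier → Fn → Fn
  a ⊙ f = record { app = λ η → a * app f η ; ext = λ h → *-congˡ (ext f h) }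

  ⨁ : ∀ {A : Set} → List A → (A → Fn) → Fn
  ⨁ xs F = record { app = λ η → sumOf xs (λ x → app (F x) η) ; ext = λ h → sumOf-cong xs (λ x → ext (F x) h) }

  s : ℕ → ℕ → Fn → Fn
  s i j f = record { app = λ η → app f (η ∘ τ i j) ; ext = λ h → ext f (h ∘ τ i j) }

  -- X i multiplies by the variable i.
  X : ℕ → Fn → Fn
  X i f = record { app = λ η → low 1 (η i) (λ p → app f (upd η i p)) ; ext = λ {η} {ζ} h →
    trans (reflexive (≡.cong (λ n → low 1 n (λ p → app f (upd η i p))) (h i))) (low-cong 1 (ζ i) (λ p → ext f (upd-cong h i p))) }

  -- T i is the Euler operator of the variable i.
  T : ℕ → Fn → Fn
  T i f = record { app = λ η → ⟦ η i ⟧ * app f η ; ext = λ h → *-cong (reflexive (≡.cong ⟦_⟧ (h i))) (ext f h) }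

  -- The coefficients of y / (x - y) times h(x, y) - h(y, x).
  divDiff : (ℕ → ℕ → Carrier) → ℕ → ℕ → Carrier
  divDiff h p zero    = 0#
  divDiff h p (suc q) = divDiff h (suc p) q + (h (suc p) q - h q (suc p))

  divDiff-cong : ∀ {h h′} → (∀ p q → h p q ≈ h′ p q) → ∀ p q → divDiff h p q ≈ divDiff h′ p q
  divDiff-cong e p zero    = refl
  divDiff-cong e p (suc q) = +-cong (divDiff-cong e (suc p) q) (+-cong (e _ _) (-‿cong (e _ _)))

  private
    -- The recursion with its subtraction cleared. The identities below then follow by additive
    -- cancellation from identities of commutative semirings.
    divDiff-step : ∀ h p q → divDiff h p (suc q) + h q (suc p) ≈ divDiff h (suc p) q + h (suc p) q
    divDiff-step h p q = trans (+-assoc _ _ _) (+-congˡ (trans (+-assoc _ _ _)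
      (trans (+-congˡ (-‿inverseˡ _)) (+-identityʳ _))))

  divDiff-+ : ∀ h h′ p q → divDiff (λ p q → h p q + h′ p q) p q ≈ divDiff h p q + divDiff h′ p q
  divDiff-+ h h′ p zero    = sym (+-identityˡ 0#)
  divDiff-+ h h′ p (suc q) = +-cancelʳ _ _ _ (trans (divDiff-step _ p q) (trans (+-congʳ (divDiff-+ h h′ (suc p) q))
    (trans (solve 4 (λ a b c d → (a :+ b) :+ (c :+ d) := (a :+ c) :+ (b :+ d)) refl _ _ _ _)
    (trans (+-cong (sym (divDiff-step h p q)) (sym (divDiff-step h′ p q)))
    (solve 4 (λ a b c d → (a :+ b) :+ (c :+ d) := (a :+ c) :+ (b :+ d)) refl _ _ _ _)))))

  divDiff-* : ∀ a h p q → divDiff (λ p q → a * h p q) p q ≈ a * divDiff h p q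
  divDiff-* a h p zero    = sym (zeroʳ a)
  divDiff-* a h p (suc q) = +-cancelʳ _ _ _ (trans (divDiff-step _ p q) (trans (+-congʳ (divDiff-* a h (suc p) q))
    (trans (sym (distribˡ _ _ _)) (trans (*-congˡ (sym (divDiff-step h p q))) (distribˡ _ _ _)))))

  divDiff-sym : ∀ h → (∀ p q → h p q ≈ h q p) → ∀ p q → divDiff h p q ≈ 0#
  divDiff-sym h e p zero    = refl
  divDiff-sym h e p (suc q) = trans (+-cong (divDiff-sym h e (suc p) q)
    (trans (+-congʳ (e _ _)) (-‿inverseʳ _))) (+-identityˡ 0#)

  divDiff-zero : ∀ {h} → (∀ p q → h p q ≈ 0#) → ∀ p q → divDiff h p q ≈ 0#
  divDiff-zero e p q = trans (divDiff-cong e p q) (divDiff-sym (λ _ _ → 0#) (λ _ _ → refl) p q)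

  -- Writing `h'` for `h` with its variables exchanged: `y h - x h'` is `y (h - h')` minus
  -- `(x - y) h'`, and the factor `y / (x - y)` turns the last product into `y h'`. `divDiff-Xˡ`
  -- comes in the same way from `x h - y h'`.
  divDiff-Xʳ : ∀ h p q → divDiff (λ p q → low 1 q (h p)) p q + low 1 q (λ q′ → h q′ p) ≈ low 1 q (divDiff h p)
  divDiff-Xʳ h p zero          = +-identityˡ 0#
  divDiff-Xʳ h p (suc zero)    = trans (divDiff-step (λ p q → low 1 q (h p)) p 0) (+-identityˡ 0#)
  divDiff-Xʳ h p (suc (suc q)) = +-cancelʳ (h q (suc p)) _ _ (trans (+-congʳ (divDiff-step (λ p q → low 1 q (h p)) p (suc q)))
    (trans (solve 3 (λ a b c → (a :+ b) :+ c := (a :+ c) :+ b) refl _ _ _)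
    (trans (+-congʳ (divDiff-Xʳ h (suc p) (suc q))) (sym (divDiff-step h p q)))))

  -- The recursion unrolled until the second exponent is 0, where the quotient vanishes.
  divDiff-antidiag : ∀ h p q →
    divDiff h p (suc q) + antidiag q (λ i j → h j (suc p ℕ.+ i)) ≈ antidiag q (λ i j → h (suc p ℕ.+ i) j)
  divDiff-antidiag h p zero    = trans (+-congˡ (reflexive (≡.cong (h 0) (ℕ.+-identityʳ (suc p)))))
    (trans (divDiff-step h p 0) (trans (+-identityˡ _) (reflexive (≡.cong (λ k → h k 0) (≡.sym (ℕ.+-identityʳ (suc p)))))))
  divDiff-antidiag h p (suc q) = trans (sym (+-assoc _ _ _)) (trans
    (+-cong (trans (+-congˡ (reflexive (≡.cong (h (suc q)) (ℕ.+-identityʳ (suc p))))) (divDiff-step h p (suc q)))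
      (antidiag-cong q (λ i j _ → reflexive (≡.cong (h j) (ℕ.+-suc (suc p) i)))))
    (trans (solve 3 (λ a b c → (a :+ b) :+ c := b :+ (a :+ c)) refl _ _ _)
    (+-cong (reflexive (≡.cong (λ k → h k (suc q)) (≡.sym (ℕ.+-identityʳ (suc p)))))
      (trans (divDiff-antidiag h (suc p) q)
        (antidiag-cong q (λ i j _ → reflexive (≡.cong (λ k → h k j) (≡.sym (ℕ.+-suc (suc p) i)))))))))

  -- For `x = 0` the factor `y / (x - y)` equals -1.
  divDiff-0ˡ : ∀ h q → divDiff h 0 q + h 0 q ≈ h q 0
  divDiff-0ˡ h zero    = +-identityˡ _
  divDiff-0ˡ h (suc q) = +-cancelˡ (antidiag q (λ i j → h i (suc j))) _ _ (trans
    (solve 3 (λ a b c → a :+ (b :+ c) := c :+ (b :+ a)) refl _ _ _)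
    (trans (+-congˡ (trans (+-congˡ (antidiag-flip q _)) (divDiff-antidiag h 0 q)))
    (antidiag-last q h)))

  divDiff-Xˡ : ∀ h p q → divDiff (λ p q → low 1 p (λ p′ → h p′ q)) p q ≈
    low 1 p (λ p′ → divDiff h p′ q) + low 1 q (λ q′ → h q′ p)
  divDiff-Xˡ h p q = go p q
    where
    h′ : ℕ → ℕ → Carrier
    h′ p q = low 1 p (λ p′ → h p′ q)
    go : ∀ p q → divDiff h′ p q ≈ low 1 p (λ p′ → divDiff h p′ q) + low 1 q (λ q′ → h q′ p)
    go zero    zero    = sym (+-identityˡ 0#)
    go zero    (suc q) = trans (sym (+-identityʳ _)) (trans (divDiff-0ˡ h′ (suc q)) (sym (+-identityˡ _)))
    go (suc p) zero    = sym (+-identityˡ 0#)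
    go (suc p) (suc q) = +-cancelʳ (h′ q (suc (suc p))) _ _ (trans (divDiff-step h′ (suc p) q)
      (trans (+-congʳ (go (suc (suc p)) q))
      (trans (solve 3 (λ a b c → (a :+ b) :+ c := (a :+ c) :+ b) refl _ _ _)
      (+-congʳ (sym (divDiff-step h p q))))))

  section : Fn → ℕ → ℕ → Exp → ℕ → ℕ → Carrier
  section f i j η p q = app f (upd (upd η i p) j q)

  -- N i j is x_j / (x_i - x_j) times 1 - s i j.
  N : ℕ → ℕ → Fn → Fn
  N i j f = record
    { app = λ η → divDiff (section f i j η) (η i) (η j)
    ; ext = λ {η} {ζ} h → trans (divDiff-cong (λ p q → ext f (upd-cong (upd-cong h i p) j q)) (η i) (η j))
        (reflexive (≡.cong₂ (divDiff (section f i j ζ)) (h i) (h j))) }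

  module _ {i j : ℕ} (i≢j : i ≢ j) (η : Exp) where

    private
      at-i : ∀ p q → upd (upd η i p) j q i ≡ p
      at-i p q = ≡.trans (upd-other (upd η i p) q i≢j) (upd-same η i p)
      at-j : ∀ p q → upd (upd η i p) j q j ≡ q
      at-j p q = upd-same (upd η i p) j q

    section-≈ : ∀ f → app f η ≈ section f i j η (η i) (η j)
    section-≈ f = ext f (λ k → ≡.sym (≡.trans (upd-comm η (η i) (η j) i≢j k)
      (≡.trans (upd-cong (upd-id η j) i (η i) k) (upd-id η i k))))

    section-Xʳ : ∀ f p q → section (X j f) i j η p q ≈ low 1 q (section f i j η p)
    section-Xʳ f p q = trans (reflexive (≡.cong (λ n → low 1 n (λ r → app f (upd (upd (upd η i p) j q) j r))) (at-j p q)))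
      (low-cong 1 q (λ q′ → ext f (upd-upd (upd η i p) j q q′)))

    section-Xˡ : ∀ f p q → section (X i f) i j η p q ≈ low 1 p (λ p′ → section f i j η p′ q)
    section-Xˡ f p q = trans (reflexive (≡.cong (λ n → low 1 n (λ r → app f (upd (upd (upd η i p) j q) i r))) (at-i p q)))
      (low-cong 1 p (λ p′ → ext f (λ k → ≡.trans (upd-cong (upd-comm η p q i≢j) i p′ k)
        (≡.trans (upd-upd (upd η j q) i p p′ k) (≡.sym (upd-comm η p′ q i≢j k))))))

    section-s : ∀ f p q → section (s i j f) i j η p q ≈ section f i j η q p
    section-s f p q = ext f (upd-swap η p q i≢j)

    private
      re-upd : ∀ p q p′ q′ → upd (upd (upd (upd η i p) j q) i p′) j q′ ≗ᵉ upd (upd η i p′) j q′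
      re-upd p q p′ q′ k = ≡.trans (upd-cong (λ k → ≡.trans (upd-cong (upd-comm η p q i≢j) i p′ k)
          (≡.trans (upd-upd (upd η j q) i p p′ k) (≡.sym (upd-comm η p′ q i≢j k)))) j q′ k)
        (upd-upd (upd η i p′) j q q′ k)

    section-N : ∀ f p q → section (N i j f) i j η p q ≈ divDiff (section f i j η) p q
    section-N f p q = trans (reflexive (≡.cong₂ (divDiff _) (at-i p q) (at-j p q)))
      (divDiff-cong (λ p′ q′ → ext f (re-upd p q p′ q′)) p q)

    N-Xʳ : ∀ f → app (N i j (X j f)) η + app (X j (s i j f)) η ≈ app (X j (N i j f)) η
    N-Xʳ f = trans (+-cong (divDiff-cong (section-Xʳ f) (η i) (η j))
        (trans (section-≈ (X j (s i j f))) (trans (section-Xʳ (s i j f) (η i) (η j)) (low-cong 1 (η j) (section-s f (η i))))))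
      (trans (divDiff-Xʳ (section f i j η) (η i) (η j))
      (sym (trans (section-≈ (X j (N i j f))) (trans (section-Xʳ (N i j f) (η i) (η j)) (low-cong 1 (η j) (section-N f (η i)))))))

    N-Xˡ : ∀ f → app (N i j (X i f)) η ≈ app (X i (N i j f)) η + app (X j (s i j f)) η
    N-Xˡ f = trans (divDiff-cong (section-Xˡ f) (η i) (η j))
      (trans (divDiff-Xˡ (section f i j η) (η i) (η j))
      (sym (+-cong
        (trans (section-≈ (X i (N i j f))) (trans (section-Xˡ (N i j f) (η i) (η j)) (low-cong 1 (η i) (λ p → section-N f p (η j)))))
        (trans (section-≈ (X j (s i j f))) (trans (section-Xʳ (s i j f) (η i) (η j)) (low-cong 1 (η j) (section-s f (η i))))))))

    N-0ˡ : ∀ f → η i ≡ 0 → app (N i j f) η + app f η ≈ app (s i j f) η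
    N-0ˡ f ηi≡0 = trans (+-cong (reflexive (≡.cong (λ p → divDiff h p (η j)) ηi≡0))
        (trans (section-≈ f) (reflexive (≡.cong (λ p → h p (η j)) ηi≡0))))
      (trans (divDiff-0ˡ h (η j)) (sym (trans (section-≈ (s i j f)) (trans (section-s f (η i) (η j))
        (reflexive (≡.cong (h (η j)) ηi≡0))))))
      where
      h : ℕ → ℕ → Carrier
      h = section f i j η

    N-sym : ∀ f → (∀ ζ → app (s i j f) ζ ≈ app f ζ) → app (N i j f) η ≈ 0#
    N-sym f h = divDiff-sym _ (λ p q → trans (sym (h _)) (section-s f p q)) (η i) (η j)

  N-0ʳ : ∀ i j f η → η j ≡ 0 → app (N i j f) η ≈ 0#
  N-0ʳ i j f η eq = reflexive (≡.cong (divDiff (section f i j η) (η i)) eq)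

  N-cong : ∀ i j {f g} → f ≋ g → N i j f ≋ N i j g
  N-cong i j h η = divDiff-cong (λ p q → h _) (η i) (η j)

  N-+ : ∀ i j f g → N i j (f ⊕ g) ≋ N i j f ⊕ N i j g
  N-+ i j f g η = divDiff-+ _ _ (η i) (η j)

  N-* : ∀ i j a f → N i j (a ⊙ f) ≋ a ⊙ N i j f
  N-* i j a f η = divDiff-* a _ (η i) (η j)

  N-X : ∀ {i j k} → i ≢ j → k ≢ i → k ≢ j → ∀ f → N i j (X k f) ≋ X k (N i j f)
  N-X {i} {j} {k} i≢j k≢i k≢j f η = trans
    (divDiff-cong (λ p q → reflexive (≡.cong (λ n → low 1 n (λ r → app f (upd (upd (upd η i p) j q) k r)))
      (≡.trans (upd-other (upd η i p) q k≢j) (upd-other η p k≢i)))) (η i) (η j)) (go (η k))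
    where
    go : ∀ n → divDiff (λ p q → low 1 n (λ r → app f (upd (upd (upd η i p) j q) k r))) (η i) (η j) ≈
      low 1 n (λ r → app (N i j f) (upd η k r))
    go zero    = divDiff-zero (λ _ _ → refl) (η i) (η j)
    go (suc r) = trans (divDiff-cong (λ p q → ext f (λ x → ≡.trans (upd-comm (upd η i p) q r (k≢j ∘ ≡.sym) x)
        (upd-cong (upd-comm η p r (k≢i ∘ ≡.sym)) j q x))) (η i) (η j))
      (reflexive (≡.cong₂ (divDiff _) (≡.sym (upd-other η r (k≢i ∘ ≡.sym))) (≡.sym (upd-other η r (k≢j ∘ ≡.sym)))))

  s-N : ∀ a b i j f → s a b (N i j f) ≋ N (τ a b i) (τ a b j) (s a b f)
  s-N a b i j f η = divDiff-cong (λ p q → ext f (λ k → ≡.trans (upd-cong (upd-τ a b η i p) j q k)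
    (upd-τ a b (upd η (τ a b i) p) j q k))) (η (τ a b i)) (η (τ a b j))

  s-X : ∀ a b i f → s a b (X i f) ≋ X (τ a b i) (s a b f)
  s-X a b i f η = low-cong 1 (η (τ a b i)) (λ p → ext f (upd-τ a b η i p))

  s-s : ∀ a b c d f → s a b (s c d f) ≋ s (τ a b c) (τ a b d) (s a b f)
  s-s a b c d f η = ext f (λ k → ≡.cong η (τ-conj a b c d k))

  s-comm : ∀ a b f → s a b f ≋ s b a f
  s-comm a b f η = ext f (λ k → ≡.cong η (τ-comm a b k))

  X-cong : ∀ i {f g} → f ≋ g → X i f ≋ X i g
  X-cong i h η = low-cong 1 (η i) (λ p → h _)

  low-+ : ∀ n F G → low 1 n (λ p → F p + G p) ≈ low 1 n F + low 1 n G
  low-+ zero    F G = sym (+-identityˡ 0#)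
  low-+ (suc n) F G = refl

  low-* : ∀ n a F → low 1 n (λ p → a * F p) ≈ a * low 1 n F
  low-* zero    a F = sym (zeroʳ a)
  low-* (suc n) a F = refl

  low-sum : ∀ {A : Set} n (xs : List A) (F : A → ℕ → Carrier) → low 1 n (λ p → sumOf xs (λ x → F x p)) ≈ sumOf xs (λ x → low 1 n (F x))
  low-sum zero    xs F = sym (sumOf-zero xs (λ _ → refl))
  low-sum (suc n) xs F = refl

  T-Xˡ : ∀ i f → T i (X i f) ≋ X i (T i f) ⊕ X i f
  T-Xˡ i f η = go (η i)
    where
    go : ∀ n → ⟦ n ⟧ * low 1 n (λ p → app f (upd η i p)) ≈
      low 1 n (λ p → ⟦ upd η i p i ⟧ * app f (upd η i p)) + low 1 n (λ p → app f (upd η i p))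
    go zero    = trans (zeroˡ _) (sym (+-identityˡ 0#))
    go (suc n) = trans (solve 2 (λ a b → (con 1 :+ a) :* b := a :* b :+ b) refl ⟦ n ⟧ _)
      (+-congʳ (*-congʳ (reflexive (≡.cong ⟦_⟧ (≡.sym (upd-same η i n))))))

  T-Xʳ : ∀ {i k} → i ≢ k → ∀ f → T i (X k f) ≋ X k (T i f)
  T-Xʳ {i} {k} i≢k f η = trans (sym (low-* (η k) ⟦ η i ⟧ _))
    (low-cong 1 (η k) (λ p → *-congʳ (reflexive (≡.cong ⟦_⟧ (≡.sym (upd-other η p i≢k))))))

-- Operators of Cherednik type and their raising

module Cherednik (K : CommutativeRing 0ℓ 0ℓ) (α : CommutativeRing.Carrier K) where

  open CommutativeRing K
  open Solver commutativeSemiring using (solve; _:=_; _:+_; _:*_; con)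
  open RingProperties ring using (+-cancelʳ)
  open FiniteSums K
  open Convolution K using (low)
  open ExponentFunctions K α

  Unique-↭ : ∀ {xs ys : List ℕ} → xs ↭ ys → Unique xs → Unique ys
  Unique-↭ p = PermS.Unique-resp-↭ (≡.setoid ℕ) (↭⇒↭ₛ p)

  ∈⇒↭ : ∀ {x : ℕ} {xs} → x ∈ xs → ∃[ ys ] xs ↭ x ∷ ys
  ∈⇒↭ x∈xs with ∈-∃++ x∈xs
  ... | ys , zs , ≡.refl = ys ++ zs , Perm.shift _ ys zs

  Unique-head : ∀ {x : ℕ} {xs} → Unique (x ∷ xs) → x ∉ xs
  Unique-head (ne ∷ _) x∈xs = All.lookup ne x∈xs ≡.refl

  Unique-tail : ∀ {x : ℕ} {xs} → Unique (x ∷ xs) → Unique xs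
  Unique-tail (_ ∷ u) = u

  ∉⇒≢ : ∀ {x y : ℕ} {xs} → x ∉ xs → y ∈ xs → y ≢ x
  ∉⇒≢ x∉ y∈ ≡.refl = x∉ y∈

  map-τ-fix : ∀ a b xs → a ∉ xs → b ∉ xs → map (τ a b) xs ≡ xs
  map-τ-fix a b []       p q = ≡.refl
  map-τ-fix a b (x ∷ xs) p q = ≡.cong₂ _∷_ (τ-fix (λ e → p (here (≡.sym e))) (λ e → q (here (≡.sym e)))) (map-τ-fix a b xs (p ∘ there) (q ∘ there))

  map-τ-↭ : ∀ {a b xs} → Unique xs → a ∈ xs → b ∈ xs → a ≢ b → map (τ a b) xs ↭ xs
  map-τ-↭ {a} {b} u a∈ b∈ a≢b with ∈⇒↭ a∈
  ... | ys , p with ∈⇒↭ (other (Perm.∈-resp-↭ p b∈))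
    where
    other : b ∈ a ∷ ys → b ∈ ys
    other (here e)  = ⊥-elim (a≢b (≡.sym e))
    other (there q) = q
  ... | zs , q with Unique-↭ (↭-trans p (prep a q)) u
  ... | u′ = ↭-trans (Perm.map⁺ (τ a b) (↭-trans p (prep a q)))
    (↭-trans (↭-reflexive (≡.cong₂ _∷_ (τ-l a b) (≡.cong₂ _∷_ (τ-r a b)
        (map-τ-fix a b zs (Unique-head u′ ∘ there) (Unique-head (Unique-tail u′))))))
    (↭-trans (_↭_.swap b a ↭-refl) (↭-sym (↭-trans p (prep a q)))))

  0ꟳ : Fn
  0ꟳ = record { app = λ _ → 0# ; ext = λ _ → refl }

  -- Extended by 0 to equal indices: the sum in `𝒴` then runs over all of `A` and is permuted as a
  -- whole by transpositions.
  N° : ℕ → ℕ → Fn → Fn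
  N° i j f with i ℕ.≟ j
  ... | yes _ = 0ꟳ
  ... | no _  = N i j f

  N°-same : ∀ i f → N° i i f ≋ 0ꟳ
  N°-same i f η with i ℕ.≟ i
  ... | yes _ = refl
  ... | no ne = ⊥-elim (ne ≡.refl)

  N°-other : ∀ {i j} → i ≢ j → ∀ f → N° i j f ≋ N i j f
  N°-other {i} {j} i≢j f η with i ℕ.≟ j
  ... | yes eq = ⊥-elim (i≢j eq)
  ... | no _   = refl

  N°-cong : ∀ i j {f g} → f ≋ g → N° i j f ≋ N° i j g
  N°-cong i j {f} {g} h η with i ℕ.≟ j
  ... | yes _ = refl
  ... | no _  = N-cong i j {f} {g} h η

  N°-+ : ∀ i j f g → N° i j (f ⊕ g) ≋ N° i j f ⊕ N° i j g
  N°-+ i j f g η with i ℕ.≟ j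
  ... | yes _ = sym (+-identityˡ 0#)
  ... | no _  = N-+ i j f g η

  N°-* : ∀ i j a f → N° i j (a ⊙ f) ≋ a ⊙ N° i j f
  N°-* i j a f η with i ℕ.≟ j
  ... | yes _ = sym (zeroʳ a)
  ... | no _  = N-* i j a f η

  s-N° : ∀ a b i j f → s a b (N° i j f) ≋ N° (τ a b i) (τ a b j) (s a b f)
  s-N° a b i j f η = go (i ℕ.≟ j)
    where
    go : Dec (i ≡ j) → app (s a b (N° i j f)) η ≈ app (N° (τ a b i) (τ a b j) (s a b f)) η
    go (yes ≡.refl) = trans (N°-same i f (η ∘ τ a b)) (sym (N°-same (τ a b i) (s a b f) η))
    go (no i≢j) = trans (N°-other i≢j f (η ∘ τ a b)) (trans (s-N a b i j f η) (sym (N°-other (i≢j ∘ τ-inj a b) (s a b f) η)))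

  N°-X : ∀ {i j k} → k ≢ i → k ≢ j → ∀ f → N° i j (X k f) ≋ X k (N° i j f)
  N°-X {i} {j} {k} k≢i k≢j f η with i ℕ.≟ j
  ... | yes _  = sym (low-zero (η k))
    where
    low-zero : ∀ n → low 1 n (λ _ → 0#) ≈ 0#
    low-zero zero    = refl
    low-zero (suc n) = refl
  ... | no i≢j = N-X i≢j k≢i k≢j f η

  -- The Dunkl-Cherednik type operator of the variable k, for the
  -- variables in the list A.
  𝒴 : List ℕ → ℕ → Fn → Fn
  𝒴 A k f = α ⊙ T k f ⊕ ⨁ A (λ j → N° k j f)

  𝒴-cong : ∀ A k {f g} → f ≋ g → 𝒴 A k f ≋ 𝒴 A k g
  𝒴-cong A k {f} {g} h η = +-cong (*-congˡ (*-congˡ (h η))) (sumOf-cong A (λ j → N°-cong k j {f} {g} h η))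

  𝒴-↭ : ∀ {A B} → A ↭ B → ∀ k f → 𝒴 A k f ≋ 𝒴 B k f
  𝒴-↭ p k f η = +-congˡ (sumOf-↭ _ p)

  𝒴-+ : ∀ A k f g → 𝒴 A k (f ⊕ g) ≋ 𝒴 A k f ⊕ 𝒴 A k g
  𝒴-+ A k f g η = trans (+-cong (trans (*-congˡ (distribˡ _ _ _)) (distribˡ _ _ _))
      (trans (sumOf-cong A (λ j → N°-+ k j f g η)) (sumOf-+ A _ _)))
    (solve 4 (λ a b c d → ((a :+ b) :+ (c :+ d)) := ((a :+ c) :+ (b :+ d))) refl _ _ _ _)

  𝒴-* : ∀ A k a f → 𝒴 A k (a ⊙ f) ≋ a ⊙ 𝒴 A k f
  𝒴-* A k a f η = trans (+-cong (solve 4 (λ x n a f → x :* (n :* (a :* f)) := a :* (x :* (n :* f))) refl α ⟦ η k ⟧ a (app f η))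
      (trans (sumOf-cong A (λ j → N°-* k j a f η)) (sumOf-*ˡ A a _)))
    (sym (distribˡ _ _ _))

  𝒴-0 : ∀ A k → 𝒴 A k 0ꟳ ≋ 0ꟳ
  𝒴-0 A k η = trans (𝒴-cong A k {0ꟳ} {0# ⊙ 0ꟳ} (λ _ → sym (zeroˡ _)) η) (trans (𝒴-* A k 0# 0ꟳ η) (zeroˡ _))

  𝒴-⨁ : ∀ {B : Set} A k (xs : List B) F → 𝒴 A k (⨁ xs F) ≋ ⨁ xs (λ x → 𝒴 A k (F x))
  𝒴-⨁ A k []       F η = 𝒴-0 A k η
  𝒴-⨁ A k (x ∷ xs) F η = trans (𝒴-+ A k (F x) (⨁ xs F) η) (+-congˡ (𝒴-⨁ A k xs F η))

  -- All divided differences in `𝒴` have the same form, without regard to an order of the variables,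
  -- so permuting the variables permutes the operators. The order enters only on the right-hand
  -- sides of `Eigen`.
  𝒴-s : ∀ {A} a b → map (τ a b) A ↭ A → ∀ k f → s a b (𝒴 A k f) ≋ 𝒴 A (τ a b k) (s a b f)
  𝒴-s {A} a b p k f η = +-congˡ (trans (sumOf-cong A (λ j → s-N° a b k j f η))
    (trans (reflexive (≡.sym (sumOf-map (τ a b) A (λ j → app (N° (τ a b k) j (s a b f)) η)))) (sumOf-↭ _ p)))

  X-+ : ∀ i f g → X i (f ⊕ g) ≋ X i f ⊕ X i g
  X-+ i f g η = low-+ (η i) _ _

  X-* : ∀ i a f → X i (a ⊙ f) ≋ a ⊙ X i f
  X-* i a f η = low-* (η i) a _

  X-⨁ : ∀ {B : Set} i (xs : List B) F → X i (⨁ xs F) ≋ ⨁ xs (λ x → X i (F x))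
  X-⨁ i xs F η = low-sum (η i) xs _

  X-index : ∀ {i j} → i ≡ j → ∀ f → X i f ≋ X j f
  X-index ≡.refl f η = refl

  𝒴-Xˡ : ∀ {i B} → i ∉ B → ∀ f → 𝒴 (i ∷ B) i (X i f) ≋ X i (𝒴 (i ∷ B) i f) ⊕ (α ⊙ X i f ⊕ ⨁ B (λ j → s i j (X i f)))
  𝒴-Xˡ {i} {B} i∉B f η = trans (+-cong
      (*-congˡ (T-Xˡ i f η))
      (+-cong (N°-same i (X i f) η) (trans (sumOf-cong∈ B exch) (sumOf-+ B _ _))))
    (trans (solve 5 (λ a t x n m → a :* (t :+ x) :+ (con 0 :+ (n :+ m)) := (a :* t :+ n) :+ (a :* x :+ m)) refl α _ _ _ _)
    (+-congʳ (sym (trans (X-+ i (α ⊙ T i f) (⨁ (i ∷ B) (λ j → N° i j f)) η)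
      (+-cong (X-* i α (T i f) η) (trans (X-⨁ i (i ∷ B) (λ j → N° i j f) η)
        (trans (+-congʳ (trans (X-cong i {N° i i f} {0ꟳ} (N°-same i f) η) (X0 (η i)))) (+-identityˡ _))))))))
    where
    X0 : ∀ n → low 1 n (λ _ → 0#) ≈ 0#
    X0 zero    = refl
    X0 (suc n) = refl
    exch : ∀ {j} → j ∈ B → app (N° i j (X i f)) η ≈ app (X i (N° i j f)) η + app (s i j (X i f)) η
    exch {j} j∈B = trans (N°-other i≢j (X i f) η) (trans (N-Xˡ i≢j η f)
      (+-cong (X-cong i {N i j f} {N° i j f} (λ ζ → sym (N°-other i≢j f ζ)) η)
        (sym (trans (s-X i j i f η) (X-index (τ-l i j) (s i j f) η)))))
      where
      i≢j : i ≢ j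
      i≢j eq = i∉B (≡.subst (_∈ B) (≡.sym eq) j∈B)

  𝒴-Xʳ : ∀ {i k B} → i ∉ B → k ≢ i → ∀ f → 𝒴 (i ∷ B) k (X i f) ⊕ X i (s i k f) ≋ X i (𝒴 (i ∷ B) k f)
  𝒴-Xʳ {i} {k} {B} i∉B k≢i f η = trans
    (trans (+-congʳ (+-cong (*-congˡ (T-Xʳ k≢i f η)) (+-cong (N°-other k≢i (X i f) η) (sumOf-cong∈ B (λ j∈B → N°-X (k≢i ∘ ≡.sym) (λ e → i∉B (≡.subst (_∈ B) (≡.sym e) j∈B)) f η)))))
      (solve 4 (λ t n m x → (t :+ (n :+ m)) :+ x := t :+ ((n :+ x) :+ m)) refl _ _ _ _))
    (sym (trans (X-+ i (α ⊙ T k f) (⨁ (i ∷ B) (λ j → N° k j f)) η)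
      (+-cong (X-* i α (T k f) η) (trans (X-⨁ i (i ∷ B) (λ j → N° k j f) η)
        (+-congʳ (trans (X-cong i {N° k i f} {N k i f} (N°-other k≢i f) η) (sym (trans (+-congˡ (X-cong i {s i k f} {s k i f} (s-comm i k f) η)) (N-Xʳ k≢i η f)))))))))

  -- With the transpositions moved to the left, each equation says that `f` is an eigenfunction of a
  -- Cherednik operator: `𝒴 A j` minus the transpositions of `j` with the variables behind it in the
  -- list.
  Eigen : List ℕ → Fn → List ℕ → List Carrier → Set
  Eigen A f []      []       = ⊤
  Eigen A f []      (_ ∷ _)  = ⊥
  Eigen A f (_ ∷ _) []       = ⊥
  Eigen A f (j ∷ B) (θ ∷ θs) = (𝒴 A j f ≋ θ ⊙ f ⊕ ⨁ B (λ t → s t j f)) × Eigen A f B θs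

  -- The equation that `k` would satisfy at the head of `k ∷ L`, with eigenvalue minus the length of
  -- `L`. In the application `f` is symmetric in `Y`, so it can be demanded of all `k` in `Y` at
  -- once, and turning one of them into an ordered variable costs nothing.
  Zeros : List ℕ → Fn → List ℕ → List ℕ → Set
  Zeros A f L Y = ∀ {k} → k ∈ Y → 𝒴 A k f ⊕ ⟦ length L ⟧ ⊙ f ≋ ⨁ L (λ j → s j k f)

  raise : Carrier → ℕ → List ℕ → Fn → Fn
  raise d i Y f = d ⊙ X i f ⊕ ⨁ Y (λ k → s i k (X i f))

  -- Both kinds of equations are preserved when the first variable i of
  -- the order is raised and moved behind the other ones; the value of d
  -- is forced by the equation at i.
  module Raise {i : ℕ} {L Y : List ℕ} (unique : Unique (i ∷ L ++ Y)) (f : Fn) (θ : Carrier)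
    (eqᵢ : 𝒴 (i ∷ L ++ Y) i f ≋ θ ⊙ f)
    (zeros : ∀ {k} → k ∈ Y → 𝒴 (i ∷ L ++ Y) k f ⊕ ⟦ suc (length L) ⟧ ⊙ f ≋ ⨁ (i ∷ L) (λ j → s j k f))
    where

    private
      A : List ℕ
      A = i ∷ L ++ Y
      M d : Carrier
      M = ⟦ suc (length L) ⟧
      d = θ + α + M
      g R : Fn
      g = X i f
      R = raise d i Y f
      i∉ : i ∉ L ++ Y
      i∉ = Unique-head unique
      L≢i : ∀ {j} → j ∈ L → j ≢ i
      L≢i j∈L = ∉⇒≢ i∉ (∈-++⁺ˡ j∈L)
      Y≢i : ∀ {k} → k ∈ Y → k ≢ i
      Y≢i k∈Y = ∉⇒≢ i∉ (∈-++⁺ʳ L k∈Y)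
      L≢Y : ∀ {L Y : List ℕ} {j k} → Unique (L ++ Y) → j ∈ L → k ∈ Y → j ≢ k
      L≢Y {x ∷ L} (ne ∷ u) (here ≡.refl) k∈Y = All.lookup ne (∈-++⁺ʳ L k∈Y)
      L≢Y (ne ∷ u) (there j∈L) k∈Y = L≢Y u j∈L k∈Y
      j≢k : ∀ {j k} → j ∈ L → k ∈ Y → j ≢ k
      j≢k = L≢Y (Unique-tail unique)
      τᵢ : ∀ {k} → k ∈ Y → map (τ i k) A ↭ A
      τᵢ k∈Y = map-τ-↭ unique (here ≡.refl) (there (∈-++⁺ʳ L k∈Y)) (Y≢i k∈Y ∘ ≡.sym)
      S : Exp → Carrier
      S η = sumOf Y (λ k → app (s i k g) η)

      gᵢ : ∀ η → app (𝒴 A i g) η ≈ (θ + α) * app g η + (sumOf L (λ j → app (s j i g) η) + S η)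
      gᵢ η = trans (𝒴-Xˡ i∉ f η) (trans (+-cong (trans (X-cong i {𝒴 A i f} {θ ⊙ f} eqᵢ η) (X-* i θ f η)) (+-congˡ (sumOf-++ L Y _)))
        (trans (solve 5 (λ t a x l y → t :* x :+ (a :* x :+ (l :+ y)) := (t :+ a) :* x :+ (l :+ y)) refl θ α _ _ _)
        (+-congˡ (+-congʳ (sumOf-cong L (λ j → s-comm i j g η))))))

      -- The exchange relation of `X i` with `𝒴 A k` produces `X i (s i k f)`, which cancels against
      -- the term `j = i` of `zeros`.
      gₖ : ∀ {k} → k ∈ Y → ∀ η → app (𝒴 A k g) η + M * app g η ≈ sumOf L (λ j → app (s j k g) η)
      gₖ {k} k∈Y η = +-cancelʳ (app (X i (s i k f)) η) _ _ (trans
        (solve 3 (λ a b c → (a :+ b) :+ c := (a :+ c) :+ b) refl _ _ _)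
        (trans (+-congʳ (𝒴-Xʳ i∉ (Y≢i k∈Y) f η))
        (trans (+-congˡ (sym (X-* i M f η)))
        (trans (sym (X-+ i (𝒴 A k f) (M ⊙ f) η))
        (trans (X-cong i {𝒴 A k f ⊕ M ⊙ f} {⨁ (i ∷ L) (λ j → s j k f)} (zeros k∈Y) η)
        (trans (X-⨁ i (i ∷ L) (λ j → s j k f) η)
        (trans (+-comm _ _) (+-congʳ (sumOf-cong∈ L (λ {j} j∈L →
          sym (trans (s-X j k i f η) (X-index (τ-fix (L≢i j∈L ∘ ≡.sym) (Y≢i k∈Y ∘ ≡.sym)) (s j k f) η)))))))))))) 

      -- The same exchange relation removes the transposition with `i` from the equation at `j`: the
      -- raised `i` is no longer behind `j`.
      gⱼ : ∀ {j} → j ∈ L → ∀ {B ϑ} → (∀ {t} → t ∈ B → t ∈ L) →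
        𝒴 A j f ≋ ϑ ⊙ f ⊕ ⨁ (B ++ i ∷ []) (λ t → s t j f) → 𝒴 A j g ≋ ϑ ⊙ g ⊕ ⨁ B (λ t → s t j g)
      gⱼ {j} j∈L {B} {ϑ} B⊂L eq η = +-cancelʳ (app (X i (s i j f)) η) _ _ (trans (𝒴-Xʳ i∉ (L≢i j∈L) f η)
        (trans (X-cong i {𝒴 A j f} {ϑ ⊙ f ⊕ ⨁ (B ++ i ∷ []) (λ t → s t j f)} eq η) (trans (X-+ i (ϑ ⊙ f) (⨁ (B ++ i ∷ []) (λ t → s t j f)) η) (trans (+-cong (X-* i ϑ f η)
          (trans (X-⨁ i (B ++ i ∷ []) (λ t → s t j f) η) (trans (sumOf-++ B (i ∷ []) _)
          (+-cong (sumOf-cong∈ B (λ {t} t∈B → sym (trans (s-X t j i f η)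
              (X-index (τ-fix (L≢i (B⊂L t∈B) ∘ ≡.sym) (L≢i j∈L ∘ ≡.sym)) (s t j f) η)))) (+-identityʳ _)))))
        (sym (+-assoc _ _ _))))))

      𝒴R : ∀ k η → app (𝒴 A k R) η ≈ d * app (𝒴 A k g) η + sumOf Y (λ l → app (𝒴 A k (s i l g)) η)
      𝒴R k η = trans (𝒴-+ A k (d ⊙ g) _ η) (+-cong (𝒴-* A k d g η) (𝒴-⨁ A k Y _ η))

      𝒴-s′ : ∀ {k} → k ∈ Y → ∀ l {l′} → τ i k l ≡ l′ → ∀ η → app (𝒴 A l′ (s i k g)) η ≈ app (s i k (𝒴 A l g)) η
      𝒴-s′ k∈Y l ≡.refl η = sym (𝒴-s i _ (τᵢ k∈Y) l g η)

      s-s′ : ∀ a b c d {c′ d′} → τ a b c ≡ c′ → τ a b d ≡ d′ → ∀ h η → app (s a b (s c d h)) η ≈ app (s c′ d′ (s a b h)) η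
      s-s′ a b c d ≡.refl ≡.refl h η = s-s a b c d h η

    raised-i : 𝒴 A i R ≋ (θ + α) ⊙ R ⊕ ⨁ L (λ j → s j i R)
    raised-i η = trans (𝒴R i η) (trans (+-congʳ (*-congˡ (gᵢ η)))
      -- Here `t` is `θ + α`, and `d` is `t + M`. The summand `M` leaves `M S` over, with which `gₖ`
      -- evaluates the sum `P` over `Y`.
      (trans (solve 6 (λ t M G l S P → (t :+ M) :* (t :* G :+ (l :+ S)) :+ P :=
          (t :* ((t :+ M) :* G :+ S) :+ (t :+ M) :* l) :+ (P :+ M :* S)) refl (θ + α) M _ _ _ _)
      (trans (+-congˡ (trans (+-congˡ (sym (sumOf-*ˡ Y M _))) (trans (sym (sumOf-+ Y _ _))
        (trans (sumOf-cong∈ Y (λ {k} k∈Y → trans (+-congʳ (𝒴-s′ k∈Y k (τ-r i k) η)) (gₖ k∈Y (η ∘ τ i k))))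
        (trans (sumOf-swap Y L _) (sumOf-cong∈ L (λ {j} j∈L → sumOf-cong∈ Y (λ {k} k∈Y →
          s-s′ i k j k (τ-fix (L≢i j∈L) (j≢k j∈L k∈Y)) (τ-r i k) g η))))))))
      (trans (+-assoc _ _ _) (+-congˡ (trans (+-congʳ (sym (sumOf-*ˡ L d _))) (sym (sumOf-+ L _ _))))))))

    raised-j : ∀ {j} → j ∈ L → ∀ {B ϑ} → (∀ {t} → t ∈ B → t ∈ L) →
      𝒴 A j f ≋ ϑ ⊙ f ⊕ ⨁ (B ++ i ∷ []) (λ t → s t j f) → 𝒴 A j R ≋ ϑ ⊙ R ⊕ ⨁ B (λ t → s t j R)
    raised-j {j} j∈L {B} {ϑ} B⊂L eq η = trans (𝒴R j η) (trans (+-cong (*-congˡ (gⱼ j∈L B⊂L eq η))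
        (trans (sumOf-cong∈ Y (λ {k} k∈Y → trans (𝒴-s′ k∈Y j (τ-fix (L≢i j∈L) (j≢k j∈L k∈Y)) η) (trans (gⱼ j∈L B⊂L eq (η ∘ τ i k))
          (+-congˡ (sumOf-cong∈ B (λ {t} t∈B → s-s′ i k t j (τ-fix (L≢i (B⊂L t∈B)) (j≢k (B⊂L t∈B) k∈Y)) (τ-fix (L≢i j∈L) (j≢k j∈L k∈Y)) g η))))))
        (trans (sumOf-+ Y _ _) (+-cong (sumOf-*ˡ Y ϑ _) (sumOf-swap Y B _)))))
      (trans (solve 6 (λ d e G l S P → d :* (e :* G :+ l) :+ (e :* S :+ P) := e :* (d :* G :+ S) :+ (d :* l :+ P)) refl d ϑ _ _ _ _)
      (+-congˡ (trans (+-congʳ (sym (sumOf-*ˡ B d _))) (sym (sumOf-+ B _ _))))))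

    -- Among the summands of `R` indexed by `Y`, the one at `k` is evaluated by `gᵢ` and gives the
    -- term `j = i` of the result; the others are evaluated by `gₖ`.
    raised-zeros : Unique Y → ∀ {k} → k ∈ Y → 𝒴 A k R ⊕ M ⊙ R ≋ ⨁ (i ∷ L) (λ j → s j k R)
    raised-zeros uY {k} k∈Y η with ∈⇒↭ k∈Y
    ... | Y′ , p = trans (+-congʳ (𝒴R k η)) (trans
        (solve 6 (λ d y u M G S → (d :* y :+ u) :+ M :* (d :* G :+ S) := d :* (y :+ M :* G) :+ (u :+ M :* S)) refl d _ _ M _ _)
        (trans (+-cong (*-congˡ (gₖ k∈Y η)) (trans (+-congˡ (sym (sumOf-*ˡ Y M _))) (trans (sym (sumOf-+ Y _ _)) (trans (sumOf-↭ _ p)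
          (+-cong (trans (+-congʳ (trans (𝒴-s′ k∈Y i (τ-l i k) η) (gᵢ (η ∘ τ i k))))
              (solve 5 (λ t M G l S → (t :* G :+ (l :+ S)) :+ M :* G := ((t :+ M) :* G :+ S) :+ l) refl (θ + α) M _ _ _))
            (sumOf-cong∈ Y′ (λ {l} l∈ → trans (+-congʳ (𝒴-s′ (Y′⊂Y l∈) k (τ-fix (Y≢i k∈Y) (k≢l l∈)) η)) (gₖ k∈Y (η ∘ τ i l)))))))))
        (trans (solve 4 (λ D Rk l q → D :+ ((Rk :+ l) :+ q) := Rk :+ (D :+ (l :+ q))) refl _ _ _ _)
        (+-congˡ (trans (+-cong (sym (sumOf-*ˡ L d _)) (trans (+-congˡ (sumOf-swap Y′ L _)) (sym (sumOf-+ L _ _))))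
          (trans (sym (sumOf-+ L _ _)) (sumOf-cong∈ L (λ {j} j∈L → +-congˡ (sym (trans (sumOf-↭ _ p)
            (+-cong (s-jk-ik j∈L) (sumOf-cong∈ Y′ (λ {l} l∈ → s-disjoint j∈L l∈)))))))))))))
      where
      uk : Unique (k ∷ Y′)
      uk = Unique-↭ p uY
      Y′⊂Y : ∀ {l} → l ∈ Y′ → l ∈ Y
      Y′⊂Y l∈ = Perm.∈-resp-↭ (↭-sym p) (there l∈)
      k≢l : ∀ {l} → l ∈ Y′ → k ≢ l
      k≢l l∈ eq = Unique-head uk (≡.subst (_∈ Y′) (≡.sym eq) l∈)
      s-jk-ik : ∀ {j} → j ∈ L → app (s j k (s i k g)) η ≈ app (s i k (s j i g)) η
      s-jk-ik {j} j∈L = sym (trans (s-s′ i k j i (τ-fix (L≢i j∈L) (j≢k j∈L k∈Y)) (τ-l i k) g η) refl)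
      s-disjoint : ∀ {j l} → j ∈ L → l ∈ Y′ → app (s j k (s i l g)) η ≈ app (s i l (s j k g)) η
      s-disjoint {j} {l} j∈L l∈ = sym (s-s′ i l j k (τ-fix (L≢i j∈L) (j≢k j∈L (Y′⊂Y l∈))) (τ-fix (Y≢i k∈Y) (k≢l l∈)) g η)

-- The Knop-Sahi recursion and its eigenvalue equations

module KnopSahi (K : CommutativeRing 0ℓ 0ℓ) (α : CommutativeRing.Carrier K) where

  open CommutativeRing K
  open Solver commutativeSemiring using (solve; _:=_; _:+_; _:*_; con)
  open RingProperties ring using (+-cancelʳ)
  open SymmetricFunctions K using (δ-≢; 1ₛ; symmetric)
  open FiniteSums K
  open Convolution K using (low; low-cong; one)
  open ExponentFunctions K α
  open Cherednik K α

  -- f a e is the coefficient of x^a y^e of a polynomial in ordered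
  -- variables x and further variables y in which it is symmetric.  The
  -- first variable of the order comes last in the list a.
  St : Set
  St = List ℕ → List ℕ → Carrier

  SymSt : St → Set
  SymSt f = ∀ a {e e′} → e ↭ e′ → f a e ≈ f a e′

  base : St
  base []      e = one e
  base (_ ∷ _) e = 0#

  -- The first of the symmetric variables becomes the head of the ordered ones. The value at `[]` is
  -- a default: a function built with `m` ordered variables is meant for lists of length `m`.
  adjoin : St → St
  adjoin f []      e = 0#
  adjoin f (z ∷ a) e = f a (z ∷ e)

  -- The operator `raise` on coefficients. The variable moves from the end of the list, where it is
  -- the next in order, to the head; its exchange with a variable of `Y` becomes a pick from `e`.
  raiseFirst : Carrier → St → St
  raiseFirst d f []      e = 0#
  raiseFirst d f (b ∷ a) e = d * low 1 b (λ p → f (a ++ p ∷ []) e) +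
    sumPicks e (λ v e′ → low 1 v (λ p → f (a ++ p ∷ []) (b ∷ e′)))

  adjoins : ℕ → St → St
  adjoins zero    f = f
  adjoins (suc k) f = adjoins k (adjoin f)

  raiseAll : List Carrier → St → St
  raiseAll []       f = f
  raiseAll (d ∷ ds) f = raiseAll ds (raiseFirst d f)

  -- The factors `d` of the successive raisings: the raised eigenvalue `x α - r` of row `r` plus the
  -- number of all rows, which leaves the number of rows from this one on.
  weights : List ℕ → List Carrier
  weights []       = []
  weights (x ∷ xs) = (⟦ x ⟧ * α + ⟦ suc (length xs) ⟧) ∷ weights xs

  -- The Knop-Sahi recursion, one column of the partition at a time; the
  -- first argument bounds the number of columns.
  knopSahi : ℕ → List ℕ → St
  knopSahi zero    θ = base
  knopSahi (suc n) θ = raiseAll (weights θ) (adjoins (length θ ∸ length (removeColumn θ)) (knopSahi n (removeColumn θ)))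

  base-sym : SymSt base
  base-sym []      p = symmetric 1ₛ p
  base-sym (_ ∷ _) p = refl

  adjoin-sym : ∀ {f} → SymSt f → SymSt (adjoin f)
  adjoin-sym h []      p = refl
  adjoin-sym h (z ∷ a) p = h a (prep z p)

  raiseFirst-sym : ∀ d {f} → SymSt f → SymSt (raiseFirst d f)
  raiseFirst-sym d h []      p = refl
  raiseFirst-sym d h (b ∷ a) p = +-cong (*-congˡ (low-cong 1 b (λ q → h _ p)))
    (sumPicks-↭ _ (λ v q → low-cong 1 v (λ r → h _ (prep b q))) p)

  map-agree : ∀ {A B : Set} {η ζ : A → B} xs → (∀ {x} → x ∈ xs → η x ≡ ζ x) → map η xs ≡ map ζ xs
  map-agree []       h = ≡.refl
  map-agree (x ∷ xs) h = ≡.cong₂ _∷_ (h (here ≡.refl)) (map-agree xs (h ∘ there))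

  lift : St → List ℕ → List ℕ → Fn
  lift f L Y = record { app = λ η → f (map η L) (map η Y)
    ; ext = λ h → reflexive (≡.cong₂ f (map-agree L (λ {x} _ → h x)) (map-agree Y (λ {x} _ → h x))) }

  map-∘τ : ∀ (η : Exp) {a b} (xs : List ℕ) → a ∉ xs → b ∉ xs → map (η ∘ τ a b) xs ≡ map η xs
  map-∘τ η xs p q = map-agree xs (λ x∈ → ≡.cong η (τ-fix (∉⇒≢ p x∈) (∉⇒≢ q x∈)))

  map-upd : ∀ (η : Exp) {i} v (xs : List ℕ) → i ∉ xs → map (upd η i v) xs ≡ map η xs
  map-upd η v xs p = map-agree xs (λ x∈ → upd-other η v (∉⇒≢ p x∈))

  map-compose : ∀ {A B C : Set} (g : B → C) (h : A → B) xs → map (g ∘ h) xs ≡ map g (map h xs)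
  map-compose g h []       = ≡.refl
  map-compose g h (x ∷ xs) = ≡.cong (g (h x) ∷_) (map-compose g h xs)

  lift-sym : ∀ {f} → SymSt f → ∀ {L Y a b} → a ∉ L → b ∉ L → Unique Y → a ∈ Y → b ∈ Y → a ≢ b →
    s a b (lift f L Y) ≋ lift f L Y
  lift-sym {f} h {L} {Y} {a} {b} a∉ b∉ u a∈ b∈ a≢b η = trans (reflexive (≡.cong₂ f (map-∘τ η L a∉ b∉) (map-compose η (τ a b) Y)))
    (h _ (Perm.map⁺ η (map-τ-↭ u a∈ b∈ a≢b)))

  Disjoint : List ℕ → List ℕ → Set
  Disjoint L Y = ∀ {j k} → j ∈ L → k ∈ Y → j ≢ k

  Unique-disjoint : ∀ L {Y} → Unique (L ++ Y) → Disjoint L Y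
  Unique-disjoint (x ∷ L) (ne ∷ u) (here ≡.refl) k∈Y = All.lookup ne (∈-++⁺ʳ L k∈Y)
  Unique-disjoint (x ∷ L) (ne ∷ u) (there j∈L)   k∈Y = Unique-disjoint L u j∈L k∈Y

  Unique-right : ∀ L {Y : List ℕ} → Unique (L ++ Y) → Unique Y
  Unique-right []      u       = u
  Unique-right (x ∷ L) (_ ∷ u) = Unique-right L u

  lift-raiseFirst : ∀ d {f i L Y} → SymSt f → Unique (i ∷ L ++ Y) →
    lift (raiseFirst d f) (i ∷ L) Y ≋ raise d i Y (lift f (L ++ i ∷ []) Y)
  lift-raiseFirst d {f} {i} {L} {Y} h u η = +-cong
    (*-congˡ (low-cong 1 (η i) (λ p → reflexive (≡.cong₂ f
      (≡.sym (≡.trans (map-++ (upd η i p) L (i ∷ [])) (≡.cong₂ _++_ (map-upd η p L i∉L) (≡.cong (_∷ []) (upd-same η i p)))))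
      (≡.sym (map-upd η p Y i∉Y))))))
    (trans (reflexive (sumPicks-map η Y _)) (trans (sumPicks-cong Y pick) (sumPicks-sumOf Y _)))
    where
    i∉L : i ∉ L
    i∉L = Unique-head u ∘ ∈-++⁺ˡ
    i∉Y : i ∉ Y
    i∉Y = Unique-head u ∘ ∈-++⁺ʳ L
    pick : ∀ k Y′ → k ∷ Y′ ↭ Y →
      low 1 (η k) (λ p → f (map η L ++ p ∷ []) (η i ∷ map η Y′)) ≈ app (s i k (X i (lift f (L ++ i ∷ []) Y))) η
    pick k Y′ p = trans (reflexive (≡.cong (λ n → low 1 n (λ p → f (map η L ++ p ∷ []) (η i ∷ map η Y′))) (≡.cong η (≡.sym (τ-l i k)))))
      (low-cong 1 (η (τ i k i)) (λ r → trans (reflexive (≡.cong₂ f (≡.sym (at-L r)) (≡.sym (at-Y r)))) (h _ (Perm.map⁺ _ p))))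
      where
      k∈Y : k ∈ Y
      k∈Y = Perm.∈-resp-↭ p (here ≡.refl)
      k∉L : k ∉ L
      k∉L k∈L = Unique-disjoint L (Unique-tail u) k∈L k∈Y ≡.refl
      uk : Unique (k ∷ Y′)
      uk = Unique-↭ (↭-sym p) (Unique-right L (Unique-tail u))
      i∉Y′ : i ∉ Y′
      i∉Y′ i∈ = i∉Y (Perm.∈-resp-↭ p (there i∈))
      at-L : ∀ r → map (upd (η ∘ τ i k) i r) (L ++ i ∷ []) ≡ map η L ++ r ∷ []
      at-L r = ≡.trans (map-++ (upd (η ∘ τ i k) i r) L (i ∷ []))
        (≡.cong₂ _++_ (≡.trans (map-upd (η ∘ τ i k) r L i∉L) (map-∘τ η L i∉L k∉L)) (≡.cong (_∷ []) (upd-same (η ∘ τ i k) i r)))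
      at-Y : ∀ r → map (upd (η ∘ τ i k) i r) (k ∷ Y′) ≡ η i ∷ map η Y′
      at-Y r = ≡.cong₂ _∷_ (≡.trans (upd-other (η ∘ τ i k) r (λ e → i∉Y (≡.subst (_∈ Y) e k∈Y))) (≡.cong η (τ-r i k)))
        (≡.trans (map-upd (η ∘ τ i k) r Y′ i∉Y′) (map-∘τ η Y′ i∉Y′ (Unique-head uk)))

  Eigen-cong : ∀ {A B f g} → A ↭ B → f ≋ g → ∀ L θs → Eigen A f L θs → Eigen B g L θs
  Eigen-cong p h []      []       _        = tt
  Eigen-cong {A} {B} {f} {g} p h (j ∷ L) (θ ∷ θs) (eq , es) =
    (λ η → trans (sym (trans (𝒴-↭ p j f η) (𝒴-cong B j {f} {g} h η))) (trans (eq η)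
      (+-cong (*-congˡ (h η)) (sumOf-cong L (λ t → h _))))) , Eigen-cong p h L θs es

  Zeros-cong : ∀ {A B f g L} Y → A ↭ B → f ≋ g → Zeros A f L Y → Zeros B g L Y
  Zeros-cong {A} {B} {f} {g} {L} Y p h z {k} k∈ η = trans (+-cong (sym (trans (𝒴-↭ p k f η) (𝒴-cong B k {f} {g} h η))) (*-congˡ (sym (h η))))
    (trans (z k∈ η) (sumOf-cong L (λ t → h _)))

  record Good (L : List ℕ) (θs : List Carrier) (Y : List ℕ) (f : St) : Set where
    field
      sym-e  : SymSt f
      unique : Unique (L ++ Y)
      eigen  : Eigen (L ++ Y) (lift f L Y) L θs
      zeros  : Zeros (L ++ Y) (lift f L Y) L Y
  open Good

  private
    last-eq : ∀ {A f i θ} θs L → Eigen A f (L ++ i ∷ []) (θs ++ θ ∷ []) → 𝒴 A i f ≋ θ ⊙ f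
    last-eq []           []      (eq , _)  η = trans (eq η) (+-identityʳ _)
    last-eq (ϑ ∷ [])     []      (eq , ())
    last-eq (ϑ ∷ _ ∷ _)  []      (eq , ())
    last-eq []           (j ∷ []) (eq , ())
    last-eq []           (j ∷ _ ∷ _) (eq , ())
    last-eq (ϑ ∷ θs)     (j ∷ L) (eq , es) = last-eq θs L es

  raiseFirst-good : ∀ {L θs i θ Y f} → Good (L ++ i ∷ []) (θs ++ θ ∷ []) Y f →
    ∀ {d θ′} → θ′ ≈ θ + α → d ≈ θ′ + ⟦ suc (length L) ⟧ → Good (i ∷ L) (θ′ ∷ θs) Y (raiseFirst d f)
  raiseFirst-good {L} {θs} {i} {θ} {Y} {f} G {d} {θ′} θ′≈ d≈ = record
    { sym-e  = raiseFirst-sym d (sym-e G)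
    ; unique = uA
    ; eigen  = Eigen-cong {new} {new} {raise d′ i Y F} {lift (raiseFirst d f) (i ∷ L) Y} ↭-refl R≋ (i ∷ L) (θ′ ∷ θs)
        ((λ η → trans (raised-i η) (+-congʳ (*-congʳ (sym θ′≈)))) , others L θs (λ x → x) old-eigen)
    ; zeros  = Zeros-cong {new} {new} {raise d′ i Y F} {lift (raiseFirst d f) (i ∷ L) Y} {i ∷ L} Y ↭-refl R≋ (raised-zeros (Unique-right L (Unique-tail uA)))
    }
    where
    old new : List ℕ
    old = (L ++ i ∷ []) ++ Y
    new = i ∷ L ++ Y
    F : Fn
    F = lift f (L ++ i ∷ []) Y
    perm : old ↭ new
    perm = ↭-trans (↭-reflexive (++-assoc L (i ∷ []) Y)) (Perm.shift i L Y)
    uA : Unique new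
    uA = Unique-↭ perm (unique G)
    old-eigen : Eigen new F (L ++ i ∷ []) (θs ++ θ ∷ [])
    old-eigen = Eigen-cong perm (λ _ → refl) (L ++ i ∷ []) (θs ++ θ ∷ []) (eigen G)
    len : length (L ++ i ∷ []) ≡ suc (length L)
    len = ≡.trans (length-++ L) (ℕ.+-comm (length L) 1)
    old-zeros : ∀ {k} → k ∈ Y → 𝒴 new k F ⊕ ⟦ suc (length L) ⟧ ⊙ F ≋ ⨁ (i ∷ L) (λ j → s j k F)
    old-zeros {k} k∈ η = trans (+-cong (sym (𝒴-↭ perm k F η)) (*-congʳ (reflexive (≡.cong ⟦_⟧ (≡.sym len)))))
      (trans (zeros G k∈ η) (sumOf-↭ _ (↭-sym (Perm.∷↭∷ʳ i L))))
    open Raise {i} {L} {Y} uA F θ (last-eq θs L old-eigen) old-zeros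
    d′ : Carrier
    d′ = θ + α + ⟦ suc (length L) ⟧
    R≋ : raise d′ i Y F ≋ lift (raiseFirst d f) (i ∷ L) Y
    R≋ η = sym (trans (lift-raiseFirst d (sym-e G) uA η) (+-congʳ (*-congʳ (trans d≈ (+-congʳ θ′≈)))))
    others : ∀ B ϑs → (∀ {t} → t ∈ B → t ∈ L) → Eigen new F (B ++ i ∷ []) (ϑs ++ θ ∷ []) → Eigen new (raise d′ i Y F) B ϑs
    others []      []           sub es = tt
    others []      (ϑ ∷ [])     sub (_ , ())
    others []      (ϑ ∷ _ ∷ _)  sub (_ , ())
    others (j ∷ [])    []       sub (_ , ())
    others (j ∷ _ ∷ _) []       sub (_ , ())
    others (j ∷ B) (ϑ ∷ ϑs)     sub (eq , es) = raised-j (sub (here ≡.refl)) (sub ∘ there) eq , others B ϑs (sub ∘ there) es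

  -- The equation in `zeros` at `y` is already the eigenvalue equation of `y`. For the other
  -- variables the new summand `s y k` acts trivially, by symmetry, and matches the increase of
  -- `length L`.
  adjoin-good : ∀ {L θs y Y f} → Good L θs (y ∷ Y) f → ∀ {θ} → θ + ⟦ length L ⟧ ≈ 0# → Good (y ∷ L) (θ ∷ θs) Y (adjoin f)
  adjoin-good {L} {θs} {y} {Y} {f} G {θ} θ≈ = record
    { sym-e  = adjoin-sym (sym-e G)
    ; unique = uA
    ; eigen  = Eigen-cong {y ∷ L ++ Y} {y ∷ L ++ Y} {F} {lift (adjoin f) (y ∷ L) Y} ↭-refl (λ _ → refl) (y ∷ L) (θ ∷ θs) ((λ η → +-cancelʳ (⟦ length L ⟧ * app F η) _ _ (trans (trans (+-congʳ (sym (𝒴-↭ perm y F η))) (zeros G (here ≡.refl) η))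
        (sym (trans (solve 4 (λ t m x s → (t :* x :+ s) :+ m :* x := (t :+ m) :* x :+ s) refl θ _ _ _)
          (trans (+-congʳ (trans (*-congʳ θ≈) (zeroˡ _))) (+-identityˡ _))))))
        , Eigen-cong perm (λ _ → refl) L θs (eigen G))
    ; zeros  = Zeros-cong {y ∷ L ++ Y} {y ∷ L ++ Y} {F} {lift (adjoin f) (y ∷ L) Y} {y ∷ L} Y ↭-refl (λ _ → refl) (λ {k} k∈ η → trans (+-congˡ (solve 2 (λ m x → (con 1 :+ m) :* x := m :* x :+ x) refl ⟦ length L ⟧ (app F η)))
        (trans (sym (+-assoc _ _ _)) (trans (+-cong
          (trans (+-congʳ (sym (𝒴-↭ perm k F η))) (zeros G (there k∈) η))
          (sym (lift-sym (sym-e G) {L} {y ∷ Y} {y} {k} (λ q → dis q (here ≡.refl) ≡.refl) (λ q → dis q (there k∈) ≡.refl) uY (here ≡.refl) (there k∈)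
             (λ e → Unique-head uY (≡.subst (_∈ Y) (≡.sym e) k∈)) η)))
          (+-comm _ _))))
    }
    where
    F : Fn
    F = lift f L (y ∷ Y)
    perm : L ++ y ∷ Y ↭ y ∷ L ++ Y
    perm = Perm.shift y L Y
    uA : Unique (y ∷ L ++ Y)
    uA = Unique-↭ perm (unique G)
    uY : Unique (y ∷ Y)
    uY = Unique-right L (unique G)
    dis : Disjoint L (y ∷ Y)
    dis = Unique-disjoint L (unique G)

  one-nonzero : ∀ {k} (η : Exp) (Y : List ℕ) → k ∈ Y → ⟦ η k ⟧ * one (map η Y) ≈ 0#
  one-nonzero {k} η Y k∈ = go (η k ℕ.≟ 0)
    where
    mem : ∀ Y → k ∈ Y → η k ℕ.≤ sum (map η Y)
    mem (x ∷ Y) (here ≡.refl) = ℕ.m≤m+n _ _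
    mem (x ∷ Y) (there q)     = ℕ.≤-trans (mem Y q) (ℕ.m≤n+m _ (η x))
    go : Dec (η k ≡ 0) → ⟦ η k ⟧ * one (map η Y) ≈ 0#
    go (yes eq) = trans (*-congʳ (reflexive (≡.cong ⟦_⟧ eq))) (zeroˡ _)
    go (no ne)  = trans (*-congˡ (δ-≢ (shape (map η Y)) [] (λ eq → ne (ℕ.n≤0⇒n≡0 (ℕ.≤-trans (mem Y k∈)
      (ℕ.≤-reflexive (≡.trans (≡.sym (sum-shape (map η Y))) (≡.cong sum {shape (map η Y)} {[]} eq)))))))) (zeroʳ _)

  base-good : ∀ {Y} → Unique Y → Good [] [] Y base
  base-good {Y} u = record
    { sym-e = base-sym ; unique = u ; eigen = tt
    ; zeros = λ {k} k∈ η → trans (+-cong (+-cong (trans (*-congˡ (one-nonzero η Y k∈)) (zeroʳ _))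
        (sumOf-zero Y (λ {j} j∈ → trivial k∈ j∈ η))) (zeroˡ _)) (trans (+-identityʳ _) (+-identityʳ _)) }
    where
    trivial : ∀ {k j} → k ∈ Y → j ∈ Y → ∀ η → app (N° k j (lift base [] Y)) η ≈ 0#
    trivial {k} {j} k∈ j∈ η = go (k ℕ.≟ j)
      where
      go : Dec (k ≡ j) → app (N° k j (lift base [] Y)) η ≈ 0#
      go (yes ≡.refl) = N°-same k (lift base [] Y) η
      go (no k≢j) = trans (N°-other k≢j (lift base [] Y) η) (N-sym k≢j η (lift base [] Y)
        (lift-sym base-sym {[]} {Y} (λ ()) (λ ()) u k∈ j∈ k≢j))

  rev : ∀ {A : Set} → List A → List A
  rev []       = []
  rev (x ∷ xs) = rev xs ++ x ∷ []

  eigenvalues : ℕ → List ℕ → List Carrier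
  eigenvalues r []       = []
  eigenvalues r (x ∷ xs) = (⟦ x ⟧ * α - ⟦ r ⟧) ∷ eigenvalues (suc r) xs

  onto : ∀ {A : Set} → List A → List A → List A
  onto A []       = A
  onto A (x ∷ xs) = onto (x ∷ A) xs

  onto-rev : ∀ {A : Set} (xs A : List A) → onto A xs ≡ rev xs ++ A
  onto-rev []       A = ≡.refl
  onto-rev (x ∷ xs) A = ≡.trans (onto-rev xs (x ∷ A)) (≡.sym (++-assoc (rev xs) (x ∷ []) A))

  length-rev : ∀ {A : Set} (xs : List A) → length (rev xs) ≡ length xs
  length-rev []       = ≡.refl
  length-rev (x ∷ xs) = ≡.trans (length-++ (rev xs)) (≡.trans (ℕ.+-comm _ 1) (≡.cong suc (length-rev xs)))

  length-eigenvalues : ∀ r xs → length (eigenvalues r xs) ≡ length xs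
  length-eigenvalues r []       = ≡.refl
  length-eigenvalues r (x ∷ xs) = ≡.cong suc (length-eigenvalues (suc r) xs)

  -- Invariant of the raisings: `A` holds the variables raised so far, `r` in number, and the next
  -- one to raise stands at the end, which is why `Cs` appears reversed.
  raiseAll-good : ∀ ps (Cs : List ℕ) {A θA r Y f} → length Cs ≡ length ps → r ≡ length A →
    Good (A ++ rev Cs) (θA ++ rev (eigenvalues r ps)) Y f →
    Good (onto A Cs) (onto θA (eigenvalues r (map suc ps))) Y (raiseAll (weights (map suc ps)) f)
  raiseAll-good []       []       {A} {θA} {Y = Y} {f} _ _ G =
    ≡.subst₂ (λ L t → Good L t Y f) (++-identityʳ A) (++-identityʳ θA) G
  raiseAll-good (p ∷ ps) (c ∷ Cs) {A} {θA} {r} {Y} {f} len r≡ G =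
    raiseAll-good ps Cs {c ∷ A} {(⟦ suc p ⟧ * α - ⟦ r ⟧) ∷ θA} (ℕ.suc-injective len) (≡.cong suc r≡)
      (raiseFirst-good (≡.subst₂ (λ L t → Good L t Y f) (≡.sym (++-assoc A (rev Cs) (c ∷ [])))
          (≡.sym (++-assoc θA (rev (eigenvalues (suc r) ps)) _)) G)
        (solve 4 (λ o p a m → (o :+ p) :* a :+ m := (p :* a :+ m) :+ o :* a) refl 1# ⟦ p ⟧ α (- ⟦ r ⟧) ⟨trans⟩ (+-congˡ (*-identityˡ α)))
        (weight))
    where
    infixl 4 _⟨trans⟩_
    _⟨trans⟩_ : ∀ {x y z} → x ≈ y → y ≈ z → x ≈ z
    _⟨trans⟩_ = trans
    total : suc (length (A ++ rev Cs)) ≡ r ℕ.+ suc (length (map suc ps))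
    total = ≡.trans (≡.cong suc (≡.trans (length-++ A) (≡.cong₂ ℕ._+_ (≡.sym r≡)
        (≡.trans (length-rev Cs) (≡.trans (ℕ.suc-injective len) (≡.sym (length-map suc ps)))))))
      (≡.sym (ℕ.+-suc r (length (map suc ps))))
    weight : ⟦ suc p ⟧ * α + ⟦ suc (length (map suc ps)) ⟧ ≈ (⟦ suc p ⟧ * α - ⟦ r ⟧) + ⟦ suc (length (A ++ rev Cs)) ⟧
    weight = sym (trans (+-congˡ (trans (reflexive (≡.cong ⟦_⟧ total)) (⟦⟧-+ r _)))
      (trans (solve 4 (λ x n r m → (x :+ n) :+ (r :+ m) := x :+ ((n :+ r) :+ m)) refl _ (- ⟦ r ⟧) ⟦ r ⟧ _)
      (+-congˡ (trans (+-congʳ (-‿inverseˡ _)) (+-identityˡ _)))))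

  adjoins-good : ∀ (ys : List ℕ) {L θs Y f} → Good L θs (ys ++ Y) f →
    Good (onto L ys) (onto θs (eigenvalues (length L) (replicate (length ys) 0))) Y (adjoins (length ys) f)
  adjoins-good []       G = G
  adjoins-good (y ∷ ys) {L} {θs} G = adjoins-good ys {y ∷ L} (adjoin-good G
    (trans (+-congʳ (trans (+-congʳ (zeroˡ α)) (+-identityˡ _))) (-‿inverseˡ _)))

-- Symmetry, stability and the squarefree coefficient

module KnopSahiSymmetry (K : CommutativeRing 0ℓ 0ℓ) (α : CommutativeRing.Carrier K) where

  open CommutativeRing K
  open Solver commutativeSemiring using (solve; _:=_; _:+_; _:*_; con)
  open FiniteSums K
  open Convolution K using (low; low-cong)
  open ExponentFunctions K α
  open Cherednik K α
  open KnopSahi K α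

  private
    zeros-tail : ∀ {ys} → Linked _≥_ (0 ∷ ys) → ys ≡ replicate (length ys) 0 × filter (0 ℕ.<?_) ys ≡ []
    zeros-tail [-]       = ≡.refl , ≡.refl
    zeros-tail (z≤n ∷ l) = let (p , q) = zeros-tail l in ≡.cong (0 ∷_) p , q

    filter-split : ∀ {ys} → Linked _≥_ ys →
      ys ≡ filter (0 ℕ.<?_) ys ++ replicate (length ys ∸ length (filter (0 ℕ.<?_) ys)) 0
    filter-split []                  = ≡.refl
    filter-split {zero ∷ ys} l       = let (p , q) = zeros-tail l in
      ≡.trans (≡.cong (0 ∷_) p) (≡.cong (λ zs → zs ++ replicate (suc (length ys) ∸ length zs) 0) (≡.sym q))
    filter-split {suc y ∷ []} l      = ≡.refl
    filter-split {suc y ∷ _ ∷ _} (_ ∷ l) = ≡.cong (suc y ∷_) (filter-split l)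

    filter-linked : ∀ {ys} → Linked _≥_ ys → Linked _≥_ (filter (0 ℕ.<?_) ys)
    filter-linked []                    = []
    filter-linked {zero ∷ ys} l         = ≡.subst (Linked _≥_) (≡.sym (proj₂ (zeros-tail l))) []
    filter-linked {suc y ∷ []} l        = [-]
    filter-linked {suc y ∷ zero ∷ ys} (_ ∷ l)      = ≡.subst (Linked _≥_) (≡.cong (suc y ∷_) (≡.sym (proj₂ (zeros-tail l)))) [-]
    filter-linked {suc y ∷ suc z ∷ ys} (p ∷ l) = p ∷ filter-linked l

    pred-linked : ∀ {xs} → Linked _≥_ xs → Linked _≥_ (map pred xs)
    pred-linked []      = []
    pred-linked [-]     = [-]
    pred-linked (p ∷ l) = ℕ.pred-mono-≤ p ∷ pred-linked l

  pred-split : ∀ {xs} → Linked _≥_ xs → map pred xs ≡ removeColumn xs ++ replicate (length xs ∸ length (removeColumn xs)) 0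
  pred-split {xs} l = ≡.trans (filter-split (pred-linked l))
    (≡.cong (λ n → removeColumn xs ++ replicate (n ∸ length (removeColumn xs)) 0) (length-map pred xs))

  removeColumn-isPartition : ∀ {xs} → IsPartition xs → IsPartition (removeColumn xs)
  removeColumn-isPartition {xs} (l , _) = filter-linked (pred-linked l) , All.all-filter (0 ℕ.<?_) (map pred xs)

  removeColumn-≤ : ∀ {n xs} → All (_≤ suc n) xs → All (_≤ n) (removeColumn xs)
  removeColumn-≤ ps = All.filter⁺ (0 ℕ.<?_) (All.map⁺ (All.map ℕ.pred-mono-≤ ps))

  suc-pred : ∀ {xs} → All (0 <_) xs → map suc (map pred xs) ≡ xs
  suc-pred []                      = ≡.refl
  suc-pred {suc x ∷ xs} (_ ∷ ps)   = ≡.cong (suc x ∷_) (suc-pred ps)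

  length-removeColumn : ∀ xs → length (removeColumn xs) ≤ length xs
  length-removeColumn xs = ℕ.≤-trans (length-filter (0 ℕ.<?_) (map pred xs)) (ℕ.≤-reflexive (length-map pred xs))
    where open import Data.List.Properties using (length-filter)

  isPartition-≤0 : ∀ {xs} → IsPartition xs → All (_≤ 0) xs → xs ≡ []
  isPartition-≤0 {[]}     _ _ = ≡.refl
  isPartition-≤0 {x ∷ xs} (_ , p ∷ _) (q ∷ _) = ⊥-elim (ℕ.<⇒≱ p q)

  rev-++ : ∀ {A : Set} (xs ys : List A) → rev (xs ++ ys) ≡ rev ys ++ rev xs
  rev-++ []       ys = ≡.sym (++-identityʳ (rev ys))
  rev-++ (x ∷ xs) ys = ≡.trans (≡.cong (_++ x ∷ []) (rev-++ xs ys)) (++-assoc (rev ys) (rev xs) (x ∷ []))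

  rev-↭ : ∀ {A : Set} (xs : List A) → rev xs ↭ xs
  rev-↭ []       = ↭-refl
  rev-↭ (x ∷ xs) = ↭-trans (↭-sym (Perm.∷↭∷ʳ x (rev xs))) (prep x (rev-↭ xs))

  eigenvalues-++ : ∀ r xs ys → eigenvalues r (xs ++ ys) ≡ eigenvalues r xs ++ eigenvalues (r ℕ.+ length xs) ys
  eigenvalues-++ r []       ys = ≡.cong (λ k → eigenvalues k ys) (≡.sym (ℕ.+-identityʳ r))
  eigenvalues-++ r (x ∷ xs) ys = ≡.cong (_ ∷_) (≡.trans (eigenvalues-++ (suc r) xs ys)
    (≡.cong (λ k → eigenvalues (suc r) xs ++ eigenvalues k ys) (≡.sym (ℕ.+-suc r (length xs)))))

  -- An adjoined variable gets the eigenvalue minus the number of its predecessors, which is that of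
  -- a part 0 in the next row. So the adjunctions supply exactly the rows of `θ` that disappear with
  -- its first column.
  adjoined-good : ∀ {n θ} → IsPartition θ → All (_≤ suc n) θ →
    (∀ L Y → length L ≡ length (removeColumn θ) → Unique (rev L ++ Y) →
      Good (rev L) (rev (eigenvalues 0 (removeColumn θ))) Y (knopSahi n (removeColumn θ))) →
    ∀ L Y → length L ≡ length θ → Unique (rev L ++ Y) →
    Good (rev L) (rev (eigenvalues 0 (map pred θ))) Y
      (adjoins (length θ ∸ length (removeColumn θ)) (knopSahi n (removeColumn θ)))
  adjoined-good {n} {θ} isP@(link , pos) bnd ih L Y len u =
    ≡.subst₂ (λ M t → Good M t Y (adjoins k (knopSahi n θ̄))) eqL eqθ
      (≡.subst (λ j → Good (onto (rev L₁) L₂) (onto (rev (eigenvalues 0 θ̄)) (eigenvalues (length (rev L₁)) (replicate j 0))) Y (adjoins j (knopSahi n θ̄))) lenL₂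
        (adjoins-good L₂ (ih L₁ (L₂ ++ Y) lenL₁ u′)))
    where
    θ̄ : List ℕ
    θ̄ = removeColumn θ
    k : ℕ
    k = length θ ∸ length θ̄
    L₁ L₂ : List ℕ
    L₁ = take (length θ̄) L
    L₂ = drop (length θ̄) L
    split : L₁ ++ L₂ ≡ L
    split = take++drop≡id (length θ̄) L
    lenL₁ : length L₁ ≡ length θ̄
    lenL₁ = ≡.trans (length-take (length θ̄) L) (≡.trans (≡.cong (length θ̄ ℕ.⊓_) len) (ℕ.m≤n⇒m⊓n≡m (length-removeColumn θ)))
    lenL₂ : length L₂ ≡ k
    lenL₂ = ≡.trans (length-drop (length θ̄) L) (≡.cong (_∸ length θ̄) len)
    u′ : Unique (rev L₁ ++ L₂ ++ Y)
    u′ = Unique-↭ (↭-trans (Perm.++⁺ʳ Y (rev-↭ L)) (↭-trans (↭-reflexive (≡.trans (≡.cong (_++ Y) (≡.sym split)) (++-assoc L₁ L₂ Y)))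
      (Perm.++⁺ʳ (L₂ ++ Y) (↭-sym (rev-↭ L₁))))) u
    eqL : onto (rev L₁) L₂ ≡ rev L
    eqL = ≡.trans (onto-rev L₂ (rev L₁)) (≡.trans (≡.sym (rev-++ L₁ L₂)) (≡.cong rev split))
    eqθ : onto (rev (eigenvalues 0 θ̄)) (eigenvalues (length (rev L₁)) (replicate k 0)) ≡ rev (eigenvalues 0 (map pred θ))
    eqθ = ≡.trans (onto-rev (eigenvalues (length (rev L₁)) (replicate k 0)) (rev (eigenvalues 0 θ̄)))
      (≡.trans (≡.sym (rev-++ (eigenvalues 0 θ̄) _)) (≡.cong rev (≡.trans
        (≡.cong (λ j → eigenvalues 0 θ̄ ++ eigenvalues j (replicate k 0)) (≡.trans (length-rev L₁) lenL₁))
        (≡.trans (≡.sym (eigenvalues-++ 0 θ̄ (replicate k 0))) (≡.cong (eigenvalues 0) (≡.sym (pred-split link)))))))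

  knopSahi-good : ∀ n {θ} → IsPartition θ → All (_≤ n) θ → ∀ L Y → length L ≡ length θ → Unique (rev L ++ Y) →
    Good (rev L) (rev (eigenvalues 0 θ)) Y (knopSahi n θ)
  knopSahi-good zero {θ} isP bnd L Y len u with isPartition-≤0 isP bnd
  knopSahi-good zero {θ} isP bnd [] Y len u | ≡.refl = base-good u
  knopSahi-good (suc n) {θ} isP@(link , pos) bnd L Y len u =
    ≡.subst₂ (λ M ts → Good M (rev (eigenvalues 0 ts)) Y (raiseAll (weights ts) f)) eqL (suc-pred pos)
      (≡.subst (λ t → Good (onto [] L) t Y (raiseAll (weights (map suc (map pred θ))) f))
        (≡.trans (onto-rev (eigenvalues 0 (map suc (map pred θ))) []) (++-identityʳ _))
        (raiseAll-good (map pred θ) L {[]} {[]} (≡.trans len (≡.sym (length-map pred θ))) ≡.refl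
          (adjoined-good isP bnd (knopSahi-good n (removeColumn-isPartition isP) (removeColumn-≤ bnd)) L Y len u)))
    where
    f : St
    f = adjoins (length θ ∸ length (removeColumn θ)) (knopSahi n (removeColumn θ))
    eqL : onto [] L ≡ rev L
    eqL = ≡.trans (onto-rev L []) (++-identityʳ (rev L))

  adjoins-sym : ∀ k {f} → SymSt f → SymSt (adjoins k f)
  adjoins-sym zero    h = h
  adjoins-sym (suc k) h = adjoins-sym k (adjoin-sym h)

  raiseAll-sym : ∀ ds {f} → SymSt f → SymSt (raiseAll ds f)
  raiseAll-sym []       h = h
  raiseAll-sym (d ∷ ds) h = raiseAll-sym ds (raiseFirst-sym d h)

  knopSahi-sym : ∀ n θ → SymSt (knopSahi n θ)
  knopSahi-sym zero    θ = base-sym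
  knopSahi-sym (suc n) θ = raiseAll-sym (weights θ) (adjoins-sym (length θ ∸ length (removeColumn θ)) (knopSahi-sym n (removeColumn θ)))

  PadSt : St → Set
  PadSt f = ∀ a e → f a (0 ∷ e) ≈ f a e

  adjoin-pad : ∀ {f} → SymSt f → PadSt f → PadSt (adjoin f)
  adjoin-pad h p []      e = refl
  adjoin-pad h p (z ∷ a) e = trans (h a (_↭_.swap z 0 ↭-refl)) (p a (z ∷ e))

  raiseFirst-pad : ∀ d {f} → SymSt f → PadSt f → PadSt (raiseFirst d f)
  raiseFirst-pad d h p []      e = refl
  raiseFirst-pad d h p (b ∷ a) e = +-cong (*-congˡ (low-cong 1 b (λ q → p _ e)))
    (trans (+-identityˡ _) (sumPicks-cong e (λ v e′ _ → low-cong 1 v (λ q → trans (h _ (_↭_.swap b 0 ↭-refl)) (p _ (b ∷ e′))))))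

  adjoins-pad : ∀ k {f} → SymSt f → PadSt f → PadSt (adjoins k f)
  adjoins-pad zero    h p = p
  adjoins-pad (suc k) h p = adjoins-pad k (adjoin-sym h) (adjoin-pad h p)

  raiseAll-pad : ∀ ds {f} → SymSt f → PadSt f → PadSt (raiseAll ds f)
  raiseAll-pad []       h p = p
  raiseAll-pad (d ∷ ds) h p = raiseAll-pad ds (raiseFirst-sym d h) (raiseFirst-pad d h p)

  base-pad : PadSt base
  base-pad []      e = refl
  base-pad (_ ∷ _) e = refl

  knopSahi-pad : ∀ n θ → PadSt (knopSahi n θ)
  knopSahi-pad zero    θ = base-pad
  knopSahi-pad (suc n) θ = raiseAll-pad (weights θ) (adjoins-sym k (knopSahi-sym n (removeColumn θ)))
      (adjoins-pad k (knopSahi-sym n (removeColumn θ)) (knopSahi-pad n (removeColumn θ)))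
    where
    k : ℕ
    k = length θ ∸ length (removeColumn θ)

  replicate-∷ʳ : ∀ n (x : ℕ) → replicate n x ++ x ∷ [] ≡ replicate (suc n) x
  replicate-∷ʳ zero    x = ≡.refl
  replicate-∷ʳ (suc n) x = ≡.cong (x ∷_) (replicate-∷ʳ n x)

  pad-zeros : ∀ {f} → PadSt f → ∀ k a e → f a (replicate k 0 ++ e) ≈ f a e
  pad-zeros p zero    a e = refl
  pad-zeros p (suc k) a e = trans (p a (replicate k 0 ++ e)) (pad-zeros p k a e)

  adjoins-zeros : ∀ {f} k m e → adjoins k f (replicate (k ℕ.+ m) 0) e ≈ f (replicate m 0) (replicate k 0 ++ e)
  adjoins-zeros {f} zero    m e = refl
  adjoins-zeros {f} (suc k) m e = trans (reflexive (≡.cong (λ j → adjoins k (adjoin f) (replicate j 0) e) (≡.sym (ℕ.+-suc k m))))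
    (adjoins-zeros {adjoin f} k (suc m) e)

  Ones : ℕ → ℕ → St → Set
  Ones m n f = f (replicate m 0) (replicate n 1) ≈ ⟦ n ! ⟧

  sumPicks-replicate : ∀ {A : Set} n (x : A) G → sumPicks (replicate (suc n) x) G ≈ ⟦ suc n ⟧ * G x (replicate n x)
  sumPicks-replicate zero    x G = trans (+-identityʳ _) (sym (trans (*-congʳ ⟦1⟧) (*-identityˡ _)))
  sumPicks-replicate (suc n) x G = trans (+-congˡ (sumPicks-replicate n x (λ y ys → G y (x ∷ ys))))
    (solve 2 (λ n g → g :+ n :* g := (con 1 :+ n) :* g) refl ⟦ suc n ⟧ _)

  -- With exponent 0 at the raised variable the term with `d` vanishes, and the `suc n` picks of an
  -- exponent 1 give equal values; this produces the factorial.
  raiseFirst-ones : ∀ d {m n f} → PadSt f → Ones (suc m) n f → Ones (suc m) (suc n) (raiseFirst d f)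
  raiseFirst-ones d {m} {n} {f} p h = trans (+-cong (zeroʳ d) (sumPicks-replicate n 1 (λ v e′ → low 1 v (λ q → f (replicate m 0 ++ q ∷ []) (0 ∷ e′))))) (trans (+-identityˡ _)
    (trans (*-congˡ (trans (p _ _) (trans (reflexive (≡.cong (λ a → f a (replicate n 1)) (replicate-∷ʳ m 0))) h)))
    (sym (⟦⟧-* (suc n) (n !)))))

  raiseAll-ones : ∀ ds {m n f} → length ds ≤ m → SymSt f → PadSt f → Ones m n f → Ones m (length ds ℕ.+ n) (raiseAll ds f)
  raiseAll-ones []       le h p o = o
  raiseAll-ones (d ∷ ds) {suc m} {n} {f} le h p o =
    ≡.subst (λ j → Ones (suc m) j (raiseAll ds (raiseFirst d f))) (ℕ.+-suc (length ds) n)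
    (raiseAll-ones ds (ℕ.≤-trans (ℕ.n≤1+n _) le) (raiseFirst-sym d h) (raiseFirst-pad d h p) (raiseFirst-ones d p o))

  length-weights : ∀ θ → length (weights θ) ≡ length θ
  length-weights []       = ≡.refl
  length-weights (x ∷ xs) = ≡.cong suc (length-weights xs)

  sum-++-zeros : ∀ xs k → sum (xs ++ replicate k 0) ≡ sum xs
  sum-++-zeros []       zero    = ≡.refl
  sum-++-zeros []       (suc k) = sum-++-zeros [] k
  sum-++-zeros (x ∷ xs) k       = ≡.cong (x ℕ.+_) (sum-++-zeros xs k)

  sum-map-suc : ∀ xs → sum (map suc xs) ≡ length xs ℕ.+ sum xs
  sum-map-suc []       = ≡.refl
  sum-map-suc (x ∷ xs) = ≡.cong suc (≡.trans (≡.cong (x ℕ.+_) (sum-map-suc xs))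
    (≡.trans (≡.sym (ℕ.+-assoc x (length xs) (sum xs))) (≡.trans (≡.cong (ℕ._+ sum xs) (ℕ.+-comm x (length xs))) (ℕ.+-assoc (length xs) x (sum xs)))))

  sum-removeColumn : ∀ {θ} → IsPartition θ → length θ ℕ.+ sum (removeColumn θ) ≡ sum θ
  sum-removeColumn {θ} (link , pos) = ≡.sym (≡.trans (≡.cong sum (≡.sym (suc-pred pos)))
    (≡.trans (sum-map-suc (map pred θ)) (≡.cong₂ ℕ._+_ (length-map pred θ)
      (≡.trans (≡.cong sum (pred-split link)) (sum-++-zeros (removeColumn θ) _)))))

  knopSahi-ones : ∀ n {θ} → IsPartition θ → All (_≤ n) θ → Ones (length θ) (sum θ) (knopSahi n θ)
  knopSahi-ones zero isP bnd with isPartition-≤0 isP bnd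
  ... | ≡.refl = sym ⟦1⟧
  knopSahi-ones (suc n) {θ} isP bnd =
    ≡.subst (λ j → Ones (length θ) j (knopSahi (suc n) θ)) (≡.trans (≡.cong (ℕ._+ sum θ̄) (length-weights θ)) (sum-removeColumn isP))
    (raiseAll-ones (weights θ) (ℕ.≤-reflexive (length-weights θ)) (adjoins-sym k (knopSahi-sym n θ̄)) (adjoins-pad k (knopSahi-sym n θ̄) (knopSahi-pad n θ̄))
      (≡.subst (λ m → Ones m (sum θ̄) (adjoins k (knopSahi n θ̄))) (ℕ.m∸n+n≡m (length-removeColumn θ))
        (trans (adjoins-zeros {knopSahi n θ̄} k (length θ̄) _) (trans (pad-zeros (knopSahi-pad n θ̄) k _ _)
          (knopSahi-ones n (removeColumn-isPartition isP) (removeColumn-≤ bnd))))))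
    where
    θ̄ : List ℕ
    θ̄ = removeColumn θ
    k : ℕ
    k = length θ ∸ length θ̄

-- Dominance and integrality of the coefficients

module KnopSahiSupport (K : CommutativeRing 0ℓ 0ℓ) (α : CommutativeRing.Carrier K) where

  open CommutativeRing K
  open Solver commutativeSemiring using (solve; _:=_; _:+_; _:*_; con)
  open SymmetricFunctions K using (δ-≢)
  open FiniteSums K
  open Convolution K using (low; low-cong; one)
  open ExponentFunctions K α
  open Cherednik K α
  open KnopSahi K α
  open KnopSahiSymmetry K α

  prefix : ℕ → List ℕ → ℕ
  prefix k μ = sum (take k μ)

  -- The list l, in any order and with any number of zeros, is dominated by μ.
  Dom : List ℕ → List ℕ → Set
  Dom l μ = sum l ≡ sum μ × (∀ xs ys → xs ++ ys ↭ l → sum xs ≤ prefix (length xs) μ)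

  Dom-↭ : ∀ {l l′ μ} → l ↭ l′ → Dom l μ → Dom l′ μ
  Dom-↭ p (eq , h) = ≡.trans (≡.sym (sum-↭ p)) eq , λ xs ys q → h xs ys (↭-trans q (↭-sym p))

  DomSt : ℕ → List ℕ → St → Set
  DomSt m μ f = ∀ a e → length a ≡ m → ¬ Dom (a ++ e) μ → f a e ≈ 0#

  -- After s of the m raisings of one column the raised exponents and
  -- those of the symmetric variables form N, the others form U.
  Partial : ℕ → List ℕ → List ℕ → List ℕ → Set
  Partial s μ N U = sum N ℕ.+ sum U ≡ sum μ ℕ.+ s ×
    (∀ xs xs′ us us′ → xs ++ xs′ ↭ N → us ++ us′ ↭ U → sum xs ℕ.+ sum us ≤ prefix (length xs ℕ.+ length us) μ ℕ.+ (s ⊓ length xs))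

  PartialSt : ℕ → ℕ → List ℕ → St → Set
  PartialSt m s μ f = ∀ A U e → length (A ++ U) ≡ m → length A ≡ s → ¬ Partial s μ (A ++ e) U → f (A ++ U) e ≈ 0#

  Partial-↭ : ∀ {s μ N N′ U U′} → N ↭ N′ → U ↭ U′ → Partial s μ N U → Partial s μ N′ U′
  Partial-↭ p q (eq , h) = ≡.trans (≡.cong₂ ℕ._+_ (≡.sym (sum-↭ p)) (≡.sym (sum-↭ q))) eq ,
    λ xs xs′ us us′ r t → h xs xs′ us us′ (↭-trans r (↭-sym p)) (↭-trans t (↭-sym q))

  -- A raising takes an exponent `p` of `U` to `suc p` in `N`. For a choice containing it, the sum
  -- and the minimum both grow by one; for any other choice the bound is only relaxed.
  Partial-raise : ∀ {s μ N p U} → Partial s μ N (p ∷ U) → Partial (suc s) μ (suc p ∷ N) U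
  Partial-raise {s} {μ} {N} {p} {U} (eq , h) = total , bound
    where
    total : suc p ℕ.+ sum N ℕ.+ sum U ≡ sum μ ℕ.+ suc s
    total = ≡.trans (≡.cong suc (≡.trans (≡.cong (ℕ._+ sum U) (ℕ.+-comm p (sum N))) (≡.trans (ℕ.+-assoc (sum N) p (sum U)) eq)))
      (≡.sym (ℕ.+-suc (sum μ) s))
    bound : ∀ xs xs′ us us′ → xs ++ xs′ ↭ suc p ∷ N → us ++ us′ ↭ U →
      sum xs ℕ.+ sum us ≤ prefix (length xs ℕ.+ length us) μ ℕ.+ (suc s ⊓ length xs)
    bound xs xs′ us us′ q r with ∈-++⁻ xs (Perm.∈-resp-↭ (↭-sym q) (here ≡.refl))
    ... | inj₁ p∈xs with ∈⇒↭ p∈xs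
    ...   | xs₀ , t = ℕ.≤-trans (ℕ.≤-reflexive (≡.trans (≡.cong (ℕ._+ sum us) (sum-↭ t)) (≡.cong suc
              (≡.trans (≡.cong (ℕ._+ sum us) (ℕ.+-comm p (sum xs₀))) (ℕ.+-assoc (sum xs₀) p (sum us))))))
            (ℕ.≤-trans (s≤s (h xs₀ xs′ (p ∷ us) us′ (Perm.drop-∷ (↭-trans (↭-sym (Perm.++⁺ʳ xs′ t)) q)) (prep p r)))
            (ℕ.≤-reflexive (≡.trans (≡.sym (ℕ.+-suc (prefix (length xs₀ ℕ.+ suc (length us)) μ) (s ⊓ length xs₀)))
              (≡.cong₂ (λ a b → prefix a μ ℕ.+ (suc s ⊓ b)) (≡.trans (ℕ.+-suc (length xs₀) (length us)) (≡.cong (ℕ._+ length us) (≡.sym (Perm.↭-length t))))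
                (≡.sym (Perm.↭-length t))))))
    bound xs xs′ us us′ q r | inj₂ p∈xs′ with ∈⇒↭ p∈xs′
    ...   | xs₀ , t = ℕ.≤-trans (h xs xs₀ us (us′ ++ p ∷ [])
              (Perm.drop-∷ (↭-trans (↭-sym (↭-trans (Perm.++⁺ˡ xs t) (Perm.shift (suc p) xs xs₀))) q))
              (↭-trans (↭-reflexive (≡.sym (++-assoc us us′ (p ∷ [])))) (↭-trans (↭-sym (Perm.∷↭∷ʳ p (us ++ us′))) (prep p r))))
            (ℕ.+-monoʳ-≤ (prefix (length xs ℕ.+ length us) μ) (ℕ.⊓-monoˡ-≤ (length xs) (ℕ.n≤1+n s)))

  low-zero : ∀ n {F} → (∀ p → n ≡ suc p → F p ≈ 0#) → low 1 n F ≈ 0#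
  low-zero zero    h = refl
  low-zero (suc n) h = h n ≡.refl

  -- Each term of `raiseFirst` undoes one raising: either `b` or an entry of `e` exchanged with it
  -- is lowered and returned to the unraised exponents.
  raiseFirst-partial : ∀ d {m s μ f} → PartialSt m s μ f → PartialSt m (suc s) μ (raiseFirst d f)
  raiseFirst-partial d {f = f} h []      U e len ()
  raiseFirst-partial d {s = s} {μ} {f} h (b ∷ A) U e len lenA ¬P = trans (+-cong
      (trans (*-congˡ (low-zero b (λ p b≡ → val e p (λ old → ¬P (Partial-↭ (↭-reflexive (≡.cong (λ x → x ∷ A ++ e) (≡.sym b≡))) ↭-refl (Partial-raise old))))))
        (zeroʳ d))
      (sumPicks-zero e (λ v e′ q → low-zero v (λ p v≡ → val (b ∷ e′) p (λ old → ¬P (Partial-↭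
        (↭-trans (↭-reflexive (≡.cong (λ x → x ∷ A ++ b ∷ e′) (≡.sym v≡))) (↭-trans (prep v (Perm.shift b A e′))
          (↭-trans (_↭_.swap v b ↭-refl) (prep b (↭-trans (↭-sym (Perm.shift v A e′)) (Perm.++⁺ˡ A q))))))
        ↭-refl (Partial-raise old)))))))
    (+-identityˡ 0#)
    where
    val : ∀ e′ p → ¬ Partial s μ (A ++ e′) (p ∷ U) → f ((A ++ U) ++ p ∷ []) e′ ≈ 0#
    val e′ p n = trans (reflexive (≡.cong (λ a → f a e′) (++-assoc A U (p ∷ []))))
      (h A (U ++ p ∷ []) e′ (≡.trans (≡.cong length (≡.sym (++-assoc A U (p ∷ [])))) (≡.trans (length-++ (A ++ U)) (≡.trans (ℕ.+-comm _ 1) len)))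
        (ℕ.suc-injective lenA) (λ old → n (Partial-↭ ↭-refl (↭-sym (Perm.∷↭∷ʳ p U)) old)))

  raiseAll-partial : ∀ ds {m s μ f} → PartialSt m s μ f → PartialSt m (length ds ℕ.+ s) μ (raiseAll ds f)
  raiseAll-partial []       h = h
  raiseAll-partial (d ∷ ds) {m} {s} {μ} {f} h = ≡.subst (λ j → PartialSt m j μ (raiseAll ds (raiseFirst d f))) (ℕ.+-suc (length ds) s)
    (raiseAll-partial ds (raiseFirst-partial d h))

  adjoins-dom : ∀ k {m μ f} → DomSt m μ f → DomSt (k ℕ.+ m) μ (adjoins k f)
  adjoins-dom zero    h = h
  adjoins-dom (suc k) {m} {μ} {f} h = ≡.subst (λ j → DomSt j μ (adjoins k (adjoin f))) (ℕ.+-suc k m) (adjoins-dom k adjoined)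
    where
    adjoined : DomSt (suc m) μ (adjoin f)
    adjoined (z ∷ a) e len ¬D = h a (z ∷ e) (ℕ.suc-injective len) (λ d → ¬D (Dom-↭ (Perm.shift z a e) d))

  private
    dom⇒partial : ∀ {μ e U} → Dom (U ++ e) μ → Partial 0 μ e U
    dom⇒partial {μ} {e} {U} (eq , h) = ≡.trans (ℕ.+-comm (sum e) (sum U)) (≡.trans (≡.sym (sum-++ U e)) (≡.trans eq (≡.sym (ℕ.+-identityʳ _)))) ,
      λ xs xs′ us us′ p q → ℕ.≤-trans (ℕ.≤-reflexive (≡.trans (ℕ.+-comm (sum xs) (sum us)) (≡.sym (sum-++ us xs))))
        (ℕ.≤-trans (h (us ++ xs) (us′ ++ xs′) (↭-trans (interleave us xs us′ xs′) (Perm.++⁺ q p)))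
        (ℕ.≤-trans (ℕ.≤-reflexive (≡.cong (λ k → prefix k μ) (≡.trans (length-++ us) (ℕ.+-comm (length us) (length xs))))) (ℕ.m≤m+n _ _)))
      where
      interleave : ∀ as bs cs ds → (as ++ bs) ++ cs ++ ds ↭ (as ++ cs) ++ bs ++ ds
      interleave as bs cs ds = ↭-trans (↭-reflexive (++-assoc as bs (cs ++ ds))) (↭-trans (Perm.++⁺ˡ as (Perm.shifts bs cs))
        (↭-reflexive (≡.sym (++-assoc as cs (bs ++ ds)))))

    prefix-suc : ∀ k xs → prefix k (map suc xs) ≡ prefix k xs ℕ.+ (length xs ⊓ k)
    prefix-suc zero    xs       = ≡.sym (≡.trans (ℕ.+-comm 0 _) (≡.trans (ℕ.+-identityʳ _) (ℕ.⊓-zeroʳ (length xs))))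
    prefix-suc (suc k) []       = ≡.refl
    prefix-suc (suc k) (x ∷ xs) = ≡.trans (≡.cong (λ t → suc (x ℕ.+ t)) (prefix-suc k xs))
      (≡.trans (≡.cong suc (≡.sym (ℕ.+-assoc x _ _))) (≡.sym (ℕ.+-suc (x ℕ.+ prefix k xs) _)))

    prefix-zeros : ∀ k xs j → prefix k (xs ++ replicate j 0) ≡ prefix k xs
    prefix-zeros zero    xs       j       = ≡.refl
    prefix-zeros (suc k) []       zero    = ≡.refl
    prefix-zeros (suc k) []       (suc j) = ≡.trans (prefix-zeros k [] j) (prefix-[] k)
      where
      prefix-[] : ∀ k → prefix k [] ≡ 0
      prefix-[] zero    = ≡.refl
      prefix-[] (suc k) = ≡.refl
    prefix-zeros (suc k) (x ∷ xs) j       = ≡.cong (x ℕ.+_) (prefix-zeros k xs j)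

  -- The second summand counts the boxes of the first column in the first `k` rows; the minimum in
  -- `Partial` is chosen so as to become it once all rows are raised.
  prefix-removeColumn : ∀ {θ} → IsPartition θ → ∀ k → prefix k θ ≡ prefix k (removeColumn θ) ℕ.+ (length θ ⊓ k)
  prefix-removeColumn {θ} (link , pos) k = ≡.trans (≡.cong (prefix k) (≡.sym (suc-pred pos)))
    (≡.trans (prefix-suc k (map pred θ)) (≡.cong₂ ℕ._+_ (≡.trans (≡.cong (prefix k) (pred-split link)) (prefix-zeros k (removeColumn θ) _))
      (≡.cong (_⊓ k) (length-map pred θ))))

  base-dom : DomSt 0 [] base
  base-dom [] e len ¬D = δ-≢ (shape e) [] λ eq → ¬D (zero-sum (≡.trans (≡.sym (sum-shape e)) (≡.cong sum {shape e} {[]} eq)))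
    where
    zero-sum : sum e ≡ 0 → Dom e []
    zero-sum eq = eq , λ xs ys p → ℕ.≤-trans (ℕ.≤-trans (ℕ.m≤m+n (sum xs) (sum ys)) (ℕ.≤-reflexive (≡.trans (≡.sym (sum-++ xs ys)) (≡.trans (sum-↭ p) eq)))) z≤n

  knopSahi-dom : ∀ n {θ} → IsPartition θ → All (_≤ n) θ → DomSt (length θ) θ (knopSahi n θ)
  knopSahi-dom zero isP bnd with isPartition-≤0 isP bnd
  ... | ≡.refl = base-dom
  knopSahi-dom (suc n) {θ} isP bnd a e len ¬D =
    trans (reflexive (≡.cong (λ l → knopSahi (suc n) θ l e) (≡.sym (++-identityʳ a))))
    (raiseAll-partial (weights θ) start a [] e (≡.trans (≡.cong length (++-identityʳ a)) len)
      (≡.trans len (≡.trans (≡.sym (length-weights θ)) (≡.sym (ℕ.+-identityʳ _))))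
      (λ par → ¬D (finish par)))
    where
    θ̄ : List ℕ
    θ̄ = removeColumn θ
    k : ℕ
    k = length θ ∸ length θ̄
    start : PartialSt (length θ) 0 θ̄ (adjoins k (knopSahi n θ̄))
    start []      U e lenU _ nope = ≡.subst (λ m → DomSt m θ̄ (adjoins k (knopSahi n θ̄))) (ℕ.m∸n+n≡m (length-removeColumn θ))
      (adjoins-dom k (knopSahi-dom n (removeColumn-isPartition isP) (removeColumn-≤ bnd))) U e lenU (λ d → nope (dom⇒partial d))
    m≡ : length (weights θ) ℕ.+ 0 ≡ length θ
    m≡ = ≡.trans (ℕ.+-identityʳ _) (length-weights θ)
    finish : Partial (length (weights θ) ℕ.+ 0) θ̄ (a ++ e) [] → Dom (a ++ e) θ
    finish (eq , h) = ≡.trans (≡.sym (ℕ.+-identityʳ _)) (≡.trans eq (≡.trans (ℕ.+-comm (sum θ̄) _)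
        (≡.trans (≡.cong (ℕ._+ sum θ̄) m≡) (sum-removeColumn isP)))) ,
      λ xs ys p → ℕ.≤-trans (ℕ.≤-reflexive (≡.sym (ℕ.+-identityʳ (sum xs)))) (ℕ.≤-trans (h xs ys [] [] p ↭-refl)
        (ℕ.≤-reflexive (≡.trans (≡.cong₂ (λ i j → prefix i θ̄ ℕ.+ (j ⊓ length xs)) (ℕ.+-identityʳ (length xs)) m≡)
          (≡.sym (prefix-removeColumn isP (length xs))))))

  -- The closure of the natural numbers and `α` under sum and product, that is, the polynomials in
  -- `α` with coefficients in ℕ; the absence of subtraction makes positivity automatic.
  data Pol : Carrier → Set where
    nat   : ∀ n → Pol ⟦ n ⟧
    alpha : Pol α
    plus  : ∀ {x y} → Pol x → Pol y → Pol (x + y)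
    times : ∀ {x y} → Pol x → Pol y → Pol (x * y)
    resp  : ∀ {x y} → x ≈ y → Pol x → Pol y

  count : ℕ → List ℕ → ℕ
  count x e = length (filter (x ℕ.≟_) e)

  count-same : ∀ x e → count x (x ∷ e) ≡ suc (count x e)
  count-same x e = ≡.cong length (filter-accept (x ℕ.≟_) {xs = e} ≡.refl)

  count-other : ∀ {x y} e → x ≢ y → count x (y ∷ e) ≡ count x e
  count-other e ne = ≡.cong length (filter-reject (_ ℕ.≟_) {xs = e} ne)

  count-↭ : ∀ x {e e′} → e ↭ e′ → count x e ≡ count x e′
  count-↭ x p = Perm.↭-length (Perm.filter-↭ (x ℕ.≟_) p)

  -- Zeros are not counted, so that `stab` does not depend on the number of variables and equals `u`
  -- on partitions.
  gain : ℕ → List ℕ → ℕ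
  gain zero    e = 1
  gain (suc x) e = suc (count (suc x) e)

  -- The order of the stabilizer: the product of the factorials of the
  -- multiplicities of the nonzero entries.
  stab : List ℕ → ℕ
  stab []      = 1
  stab (x ∷ e) = gain x e ℕ.* stab e

  gain-↭ : ∀ x {e e′} → e ↭ e′ → gain x e ≡ gain x e′
  gain-↭ zero    p = ≡.refl
  gain-↭ (suc x) p = ≡.cong suc (count-↭ (suc x) p)

  gain-other : ∀ {x y} e → x ≢ y → gain x (y ∷ e) ≡ gain x e
  gain-other {zero}  e ne = ≡.refl
  gain-other {suc x} e ne = ≡.cong suc (count-other e ne)

  stab-↭ : ∀ {e e′} → e ↭ e′ → stab e ≡ stab e′
  stab-↭ _↭_.refl   = ≡.refl
  stab-↭ (prep x p) = ≡.cong₂ ℕ._*_ (gain-↭ x p) (stab-↭ p)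
  stab-↭ (_↭_.swap {xs} {ys} x y p) = go (x ℕ.≟ y)
    where
    go : Dec (x ≡ y) → stab (x ∷ y ∷ xs) ≡ stab (y ∷ x ∷ ys)
    go (yes ≡.refl) = ≡.cong₂ ℕ._*_ (gain-↭ x (prep x p)) (≡.cong₂ ℕ._*_ (gain-↭ x p) (stab-↭ p))
    go (no ne) = ≡.trans (≡.cong₂ ℕ._*_ (≡.trans (gain-other xs ne) (gain-↭ x p))
        (≡.cong₂ ℕ._*_ (≡.trans (gain-↭ y p) (≡.sym (gain-other ys (ne ∘ ≡.sym)))) (stab-↭ p)))
      (≡.trans (≡.sym (ℕ.*-assoc (gain x ys) (gain y (x ∷ ys)) (stab ys))) (≡.trans (≡.cong (ℕ._* stab ys) (ℕ.*-comm (gain x ys) (gain y (x ∷ ys)))) (ℕ.*-assoc (gain y (x ∷ ys)) (gain x ys) (stab ys))))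
  stab-↭ (_↭_.trans p q) = ≡.trans (stab-↭ p) (stab-↭ q)

  record PolMult (n : ℕ) (x : Carrier) : Set where
    constructor polMult
    field
      quotient : Carrier
      isPol    : Pol quotient
      equation : x ≈ ⟦ n ⟧ * quotient

  PolMult-0 : ∀ n → PolMult n 0#
  PolMult-0 n = polMult 0# (nat 0) (sym (zeroʳ _))

  PolMult-+ : ∀ {n x y} → PolMult n x → PolMult n y → PolMult n (x + y)
  PolMult-+ (polMult p Pp ep) (polMult q Pq eq) = polMult (p + q) (plus Pp Pq) (trans (+-cong ep eq) (sym (distribˡ _ _ _)))

  PolMult-* : ∀ {n d x} → Pol d → PolMult n x → PolMult n (d * x)
  PolMult-* Pd (polMult p Pp ep) = polMult _ (times Pd Pp) (trans (*-congˡ ep) (solve 3 (λ d n p → d :* (n :* p) := n :* (d :* p)) refl _ _ _))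

  PolMult-resp : ∀ {n x y} → x ≈ y → PolMult n x → PolMult n y
  PolMult-resp e (polMult p Pp ep) = polMult p Pp (trans (sym e) ep)

  PolMult-≡ : ∀ {n m x} → n ≡ m → PolMult n x → PolMult m x
  PolMult-≡ ≡.refl p = p

  PolMult-factor : ∀ {n} m {x} → PolMult (m ℕ.* n) x → PolMult n x
  PolMult-factor {n} m (polMult p Pp ep) = polMult _ (times (nat m) Pp) (trans ep (trans (*-congʳ (⟦⟧-* m n))
    (solve 3 (λ m n p → (m :* n) :* p := n :* (m :* p)) refl _ _ _)))

  PolMult-nat : ∀ {n} m {x} → PolMult n x → PolMult (m ℕ.* n) (⟦ m ⟧ * x)
  PolMult-nat {n} m (polMult p Pp ep) = polMult p Pp (trans (*-congˡ ep) (trans (sym (*-assoc _ _ _)) (*-congʳ (sym (⟦⟧-* m n)))))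

  PolMult-sum : ∀ {A : Set} {n} (xs : List A) {F} → (∀ x → PolMult n (F x)) → PolMult n (sumOf xs F)
  PolMult-sum []       h = PolMult-0 _
  PolMult-sum (x ∷ xs) h = PolMult-+ (h x) (PolMult-sum xs h)

  private
    pickOne : ℕ → (ℕ → Carrier) → ℕ → Carrier
    pickOne x φ v with v ℕ.≟ x
    ... | yes _ = φ v
    ... | no _  = 0#

    pickOne-other : ∀ {x φ v} → v ≢ x → pickOne x φ v ≈ 0#
    pickOne-other {x} {φ} {v} ne with v ℕ.≟ x
    ... | yes e = ⊥-elim (ne e)
    ... | no _  = refl

    pickOne-same : ∀ x φ → pickOne x φ x ≈ φ x
    pickOne-same x φ with x ℕ.≟ x
    ... | yes _ = refl
    ... | no ne = ⊥-elim (ne ≡.refl)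

    sum-pickOne : ∀ {x φ vs} → Unique vs → x ∈ vs → sumOf vs (pickOne x φ) ≈ φ x
    sum-pickOne {x} {φ} {v ∷ vs} (ne ∷ u) (here ≡.refl) = trans (+-cong (pickOne-same x φ)
      (sumOf-zero vs (λ {w} w∈ → pickOne-other (λ e → All.lookup ne w∈ (≡.sym e))))) (+-identityʳ _)
    sum-pickOne {x} {φ} {v ∷ vs} (ne ∷ u) (there p) = trans (+-cong (pickOne-other (All.lookup ne p)) (sum-pickOne u p)) (+-identityˡ _)

    count-pickOne : ∀ x e φ v → ⟦ count v (x ∷ e) ⟧ * φ v ≈ pickOne x φ v + ⟦ count v e ⟧ * φ v
    count-pickOne x e φ v with v ℕ.≟ x
    ... | yes ≡.refl = trans (*-congʳ (reflexive (≡.cong ⟦_⟧ (count-same v e)))) (solve 2 (λ n f → (con 1 :+ n) :* f := f :+ n :* f) refl _ _)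
    ... | no ne      = trans (*-congʳ (reflexive (≡.cong ⟦_⟧ (count-other e ne)))) (sym (+-identityˡ _))

  sumOf-byValue : ∀ {vs} → Unique vs → ∀ e φ → All (_∈ vs) e → sumOf e φ ≈ sumOf vs (λ v → ⟦ count v e ⟧ * φ v)
  sumOf-byValue {vs} u []      φ []       = sym (sumOf-zero vs (λ _ → zeroˡ _))
  sumOf-byValue {vs} u (x ∷ e) φ (p ∷ ps) = trans (+-cong (sym (sum-pickOne u p)) (sumOf-byValue u e φ ps))
    (trans (sym (sumOf-+ vs _ _)) (sumOf-cong vs (λ v → sym (count-pickOne x e φ v))))

  remove : ℕ → List ℕ → List ℕ
  remove v []      = []
  remove v (x ∷ e) with v ℕ.≟ x
  ... | yes _ = e
  ... | no _  = x ∷ remove v e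

  remove-↭ : ∀ {v e} → v ∈ e → e ↭ v ∷ remove v e
  remove-↭ {v} {x ∷ e} v∈ with v ℕ.≟ x
  ... | yes ≡.refl = ↭-refl
  ... | no ne with v∈
  ...   | here eq  = ⊥-elim (ne eq)
  ...   | there v∈e = ↭-trans (prep x (remove-↭ v∈e)) (_↭_.swap x v ↭-refl)

  count-∈ : ∀ {v} e → v ∉ e → count v e ≡ 0
  count-∈ []          _  = ≡.refl
  count-∈ {v} (x ∷ e) ∉e = ≡.trans (count-other e (λ eq → ∉e (here eq))) (count-∈ e (∉e ∘ there))

  -- Equal entries give equal terms, so the value `v` contributes with its multiplicity in `e`,
  -- which is the quotient of the stabilizer orders before and after the removal of `v`. The value 0
  -- has no such factor and must contribute nothing.
  sumPicks-pol : ∀ e G → (∀ e′ → G 0 e′ ≈ 0#) → (∀ v {e e′} → e ↭ e′ → G v e ≈ G v e′) →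
    (∀ v e′ → PolMult (stab e′) (G v e′)) → PolMult (stab e) (sumPicks e G)
  sumPicks-pol e G G0 G↭ Gpol = PolMult-resp
    (sym (trans (sumPicks-cong e (λ v e′ p → G↭ v (Perm.drop-∷ (↭-trans p (remove-↭ (Perm.∈-resp-↭ p (here ≡.refl)))))))
      (trans (sumPicks-sumOf e (λ v → G v (remove v e)))
        (sumOf-byValue (Unique.upTo⁺ (suc (sum e))) e (λ v → G v (remove v e)) (All.map (∈-upTo⁺ ∘ s≤s) (parts≤sum e))))))
    (PolMult-sum (upTo (suc (sum e))) term)
    where
    term : ∀ v → PolMult (stab e) (⟦ count v e ⟧ * G v (remove v e))
    term zero    = PolMult-resp (sym (trans (*-congˡ (G0 _)) (zeroʳ _))) (PolMult-0 _)
    term (suc v) with suc v ∈? e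
    ... | no ∉e  = PolMult-resp (sym (trans (*-congʳ (reflexive (≡.cong ⟦_⟧ (count-∈ e ∉e)))) (zeroˡ _))) (PolMult-0 _)
    ... | yes ∈e = PolMult-≡ (≡.trans (≡.cong (ℕ._* stab (remove (suc v) e)) (≡.trans (count-↭ (suc v) (remove-↭ ∈e)) (count-same (suc v) _)))
        (≡.sym (stab-↭ (remove-↭ ∈e)))) (PolMult-nat (count (suc v) e) (Gpol (suc v) (remove (suc v) e)))

  PolSt : St → Set
  PolSt f = ∀ a e → PolMult (stab e) (f a e)

  low-pol : ∀ {n} b {F} → (∀ p → PolMult n (F p)) → PolMult n (low 1 b F)
  low-pol zero    h = PolMult-0 _
  low-pol (suc b) h = h b

  adjoin-pol : ∀ {f} → PolSt f → PolSt (adjoin f)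
  adjoin-pol h []      e = PolMult-0 _
  adjoin-pol h (z ∷ a) e = PolMult-factor (gain z e) (h a (z ∷ e))

  raiseFirst-pol : ∀ {d f} → Pol d → SymSt f → PolSt f → PolSt (raiseFirst d f)
  raiseFirst-pol Pd hs h []      e = PolMult-0 _
  raiseFirst-pol Pd hs h (b ∷ a) e = PolMult-+ (PolMult-* Pd (low-pol b (λ p → h _ e)))
    (sumPicks-pol e _ (λ e′ → refl) (λ v p → low-cong 1 v (λ q → hs _ (prep b p)))
      (λ v e′ → low-pol v (λ p → PolMult-factor (gain b e′) (h _ (b ∷ e′)))))

  adjoins-pol : ∀ k {f} → PolSt f → PolSt (adjoins k f)
  adjoins-pol zero    h = h
  adjoins-pol (suc k) h = adjoins-pol k (adjoin-pol h)

  raiseAll-pol : ∀ {ds f} → All Pol ds → SymSt f → PolSt f → PolSt (raiseAll ds f)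
  raiseAll-pol []       hs h = h
  raiseAll-pol (p ∷ ps) hs h = raiseAll-pol ps (raiseFirst-sym _ hs) (raiseFirst-pol p hs h)

  weights-pol : ∀ θ → All Pol (weights θ)
  weights-pol []       = []
  weights-pol (x ∷ xs) = plus (times (nat x) alpha) (nat (suc (length xs))) ∷ weights-pol xs

  base-pol : PolSt base
  base-pol (_ ∷ _) e = PolMult-0 _
  base-pol []      e with sum e ℕ.≟ 0
  ... | yes eq = polMult (one e) (resp (sym (one-zero {e} eq)) (resp ⟦1⟧ (nat 1))) (sym (trans (*-congʳ (trans (reflexive (≡.cong ⟦_⟧ (stab-zero e eq))) ⟦1⟧)) (*-identityˡ _)))
    where
    stab-zero : ∀ e → sum e ≡ 0 → stab e ≡ 1
    stab-zero []         eq = ≡.refl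
    stab-zero (zero ∷ e) eq = ≡.trans (ℕ.+-identityʳ _) (stab-zero e eq)
    one-zero : ∀ {e} → sum e ≡ 0 → one e ≈ 1#
    one-zero {[]}       eq = refl
    one-zero {zero ∷ e} eq = one-zero {e} eq
  ... | no ne  = PolMult-resp (sym (δ-≢ (shape e) [] (λ eq → ne (≡.trans (≡.sym (sum-shape e)) (≡.cong sum {shape e} {[]} eq))))) (PolMult-0 _)

  knopSahi-pol : ∀ n θ → PolSt (knopSahi n θ)
  knopSahi-pol zero    θ = base-pol
  knopSahi-pol (suc n) θ = raiseAll-pol (weights-pol θ) (adjoins-sym k (knopSahi-sym n θ̄)) (adjoins-pol k (knopSahi-pol n θ̄))
    where
    θ̄ : List ℕ
    θ̄ = removeColumn θ
    k : ℕ
    k = length θ ∸ length θ̄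

-- Values where the ordered exponents vanish

module KnopSahiValues (K : CommutativeRing 0ℓ 0ℓ) (α : CommutativeRing.Carrier K) where

  open CommutativeRing K
  open Solver commutativeSemiring using (solve; _:=_; _:+_; _:*_)
  open RingProperties ring using (+-cancelˡ)
  open FiniteSums K
  open Convolution K using (low; low-cong)
  open ExponentFunctions K α
  open Cherednik K α
  open KnopSahi K α
  open KnopSahiSymmetry K α
  open Good

  assign : List ℕ → List ℕ → Exp
  assign []       vs       = λ _ → 0
  assign (k ∷ ks) []       = λ _ → 0
  assign (k ∷ ks) (v ∷ vs) = upd (assign ks vs) k v

  map-assign : ∀ ks vs → Unique ks → length ks ≡ length vs → map (assign ks vs) ks ≡ vs
  map-assign []       []       u len = ≡.refl
  map-assign (k ∷ ks) (v ∷ vs) u len = ≡.cong₂ _∷_ (upd-same (assign ks vs) k v)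
    (≡.trans (map-upd (assign ks vs) v ks (Unique-head u)) (map-assign ks vs (Unique-tail u) (ℕ.suc-injective len)))

  ++-injective : ∀ {A : Set} (xs xs′ : List A) {ys ys′} → length xs ≡ length xs′ → xs ++ ys ≡ xs′ ++ ys′ → xs ≡ xs′ × ys ≡ ys′
  ++-injective []       []         len eq = ≡.refl , eq
  ++-injective (x ∷ xs) (x′ ∷ xs′) len eq with ∷-injective eq
  ... | ≡.refl , eq′ with ++-injective xs xs′ (ℕ.suc-injective len) eq′
  ... | ≡.refl , p = ≡.refl , p

  map-zero : ∀ (η : Exp) xs → map η xs ≡ replicate (length xs) 0 → ∀ {x} → x ∈ xs → η x ≡ 0
  map-zero η (x ∷ xs) eq (here ≡.refl) = proj₁ (∷-injective eq)
  map-zero η (x ∷ xs) eq (there p)     = map-zero η xs (proj₂ (∷-injective eq)) p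

  zero-map : ∀ (η : Exp) xs → (∀ {x} → x ∈ xs → η x ≡ 0) → map η xs ≡ replicate (length xs) 0
  zero-map η []       h = ≡.refl
  zero-map η (x ∷ xs) h = ≡.cong₂ _∷_ (h (here ≡.refl)) (zero-map η xs (h ∘ there))

  τ-equal : ∀ (η : Exp) {i j} → η i ≡ η j → η ∘ τ i j ≗ᵉ η
  τ-equal η {i} {j} eq k = go (k ℕ.≟ i) (k ℕ.≟ j)
    where
    go : Dec (k ≡ i) → Dec (k ≡ j) → η (τ i j k) ≡ η k
    go (yes ≡.refl) _            = ≡.trans (≡.cong η (τ-l i j)) (≡.sym eq)
    go (no _)       (yes ≡.refl) = ≡.trans (≡.cong η (τ-r i j)) eq
    go (no p)       (no q)       = ≡.cong η (τ-fix p q)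

  eigen-at : ∀ {A f i θ C tC} B tB → length B ≡ length tB → Eigen A f (B ++ i ∷ C) (tB ++ θ ∷ tC) →
    𝒴 A i f ≋ θ ⊙ f ⊕ ⨁ C (λ t → s t i f)
  eigen-at []      []       len (eq , _)  = eq
  eigen-at (b ∷ B) (t ∷ tB) len (_ , es) = eigen-at B tB (ℕ.suc-injective len) es

  -- At exponent 0 the Euler operator of `i` vanishes and `N i x` becomes `s i x` minus the
  -- identity. In the equation at `i` the transpositions with `C` then cancel, those with `B` act
  -- trivially as these exponents are 0 too, and those with `Y` remain.
  moves : ∀ B {i C Y f} tB {θ tC} → Good (B ++ i ∷ C) (tB ++ θ ∷ tC) Y f → length B ≡ length tB →
    ∀ η → η i ≡ 0 → (∀ {x} → x ∈ B → η x ≡ 0) →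
    sumOf Y (λ k → app (s i k (lift f (B ++ i ∷ C) Y)) η) ≈ (θ + ⟦ length C ℕ.+ length Y ⟧) * app (lift f (B ++ i ∷ C) Y) η
  moves B {i} {C} {Y} {f} tB {θ} {tC} G len η ηi≡0 ηB≡0 =
    +-cancelˡ (⟦ length B ⟧ * Fη) _ _ (+-cancelˡ (sumOf C (λ t → app (s t i F) η)) _ _ (trans (sym total) (sym rhs)))
    where
    A A′ : List ℕ
    A = (B ++ i ∷ C) ++ Y
    A′ = B ++ C ++ Y
    F : Fn
    F = lift f (B ++ i ∷ C) Y
    Fη : Carrier
    Fη = app F η
    perm : A ↭ i ∷ A′
    perm = ↭-trans (↭-reflexive (++-assoc B (i ∷ C) Y)) (Perm.shift i B (C ++ Y))
    i∉ : i ∉ A′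
    i∉ = Unique-head (Unique-↭ perm (unique G))
    step : ∀ {x} → x ∈ A′ → app (N° i x F) η + Fη ≈ app (s i x F) η
    step {x} x∈ = trans (+-congʳ (N°-other i≢x F η)) (N-0ˡ i≢x η F ηi≡0)
      where
      i≢x : i ≢ x
      i≢x e = i∉ (≡.subst (_∈ A′) (≡.sym e) x∈)
    left : app (𝒴 A i F) η + ⟦ length A′ ⟧ * Fη ≈ sumOf A′ (λ x → app (s i x F) η)
    left = trans (+-congʳ (trans (+-cong (trans (*-congˡ (trans (*-congʳ (reflexive (≡.cong ⟦_⟧ ηi≡0))) (zeroˡ _))) (zeroʳ α))
        (trans (sumOf-↭ _ perm) (trans (+-congʳ (N°-same i F η)) (+-identityˡ _)))) (+-identityˡ _)))
      (trans (+-congˡ (sym (sumOf-const A′ Fη))) (trans (sym (sumOf-+ A′ _ _)) (sumOf-cong∈ A′ step)))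
    total : app (𝒴 A i F) η + ⟦ length A′ ⟧ * Fη ≈
      sumOf C (λ t → app (s t i F) η) + (⟦ length B ⟧ * Fη + sumOf Y (λ k → app (s i k F) η))
    total = trans left (trans (sumOf-++ B (C ++ Y) _) (trans (+-cong
        (trans (sumOf-cong∈ B (λ {x} x∈ → ext F (τ-equal η (≡.trans ηi≡0 (≡.sym (ηB≡0 x∈)))))) (sumOf-const B Fη))
        (trans (sumOf-++ C Y _) (+-congʳ (sumOf-cong C (λ t → s-comm i t F η)))))
      (solve 3 (λ a b c → a :+ (b :+ c) := b :+ (a :+ c)) refl _ _ _)))
    rhs : sumOf C (λ t → app (s t i F) η) + (⟦ length B ⟧ * Fη + (θ + ⟦ length C ℕ.+ length Y ⟧) * Fη) ≈
      app (𝒴 A i F) η + ⟦ length A′ ⟧ * Fη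
    rhs = sym (trans (+-cong (eigen-at B tB len (eigen G) η)
        (*-congʳ (trans (reflexive (≡.cong ⟦_⟧ (≡.trans (length-++ B) (≡.cong (length B ℕ.+_) (length-++ C))))) (⟦⟧-+ (length B) _))))
      (solve 5 (λ t x c b n → (t :* x :+ c) :+ (b :+ n) :* x := c :+ (b :* x :+ (t :+ n) :* x)) refl θ Fη _ _ _))

  moves-list : ∀ B {i C Y f} tB {θ tC} → Good (B ++ i ∷ C) (tB ++ θ ∷ tC) Y f → length B ≡ length tB →
    ∀ a e → length C ≡ length a → length Y ≡ length e →
    sumPicks e (λ v e′ → f (replicate (length B) 0 ++ v ∷ a) (0 ∷ e′)) ≈
    (θ + ⟦ length C ℕ.+ length Y ⟧) * f (replicate (length B) 0 ++ 0 ∷ a) e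
  moves-list B {i} {C} {Y} {f} tB {θ} {tC} G len a e lenC lenY =
    trans (reflexive (≡.cong (λ l → sumPicks l (λ v e′ → f (zs ++ v ∷ a) (0 ∷ e′))) (≡.sym ηY)))
    (trans (reflexive (sumPicks-map η Y _))
    (trans (sumPicks-cong Y pick) (trans (sumPicks-sumOf Y _)
    (trans (moves B tB G len η ηi (map-zero η B ηB)) (*-congˡ (reflexive (≡.cong₂ f ηL ηY)))))))
    where
    zs : List ℕ
    zs = replicate (length B) 0
    L : List ℕ
    L = B ++ i ∷ C
    η : Exp
    η = assign (L ++ Y) ((zs ++ 0 ∷ a) ++ e)
    lenL : length L ≡ length (zs ++ 0 ∷ a)
    lenL = ≡.trans (length-++ B) (≡.sym (≡.trans (length-++ zs) (≡.cong₂ ℕ._+_ (length-replicate (length B)) (≡.cong suc (≡.sym lenC)))))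
    both : map η L ≡ zs ++ 0 ∷ a × map η Y ≡ e
    both = ++-injective (map η L) (zs ++ 0 ∷ a) (≡.trans (length-map η L) lenL)
      (≡.trans (≡.sym (map-++ η L Y)) (map-assign (L ++ Y) ((zs ++ 0 ∷ a) ++ e) (unique G)
        (≡.trans (length-++ L) (≡.trans (≡.cong₂ ℕ._+_ lenL lenY) (≡.sym (length-++ (zs ++ 0 ∷ a)))))))
    ηL : map η L ≡ zs ++ 0 ∷ a
    ηL = proj₁ both
    ηY : map η Y ≡ e
    ηY = proj₂ both
    inner : map η B ≡ zs × map η (i ∷ C) ≡ 0 ∷ a
    inner = ++-injective (map η B) zs (≡.trans (length-map η B) (≡.sym (length-replicate (length B)))) (≡.trans (≡.sym (map-++ η B (i ∷ C))) ηL)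
    ηB : map η B ≡ zs
    ηB = proj₁ inner
    ηi : η i ≡ 0
    ηi = proj₁ (∷-injective (proj₂ inner))
    ηC : map η C ≡ a
    ηC = proj₂ (∷-injective (proj₂ inner))
    uL : Unique (i ∷ B ++ C ++ Y)
    uL = Unique-↭ (↭-trans (↭-reflexive (++-assoc B (i ∷ C) Y)) (Perm.shift i B (C ++ Y))) (unique G)
    pick : ∀ k Y′ → k ∷ Y′ ↭ Y → f (zs ++ η k ∷ a) (0 ∷ map η Y′) ≈ app (s i k (lift f L Y)) η
    pick k Y′ p = trans (reflexive (≡.cong₂ f (≡.sym at-L) (≡.sym at-Y))) (sym-e G _ (Perm.map⁺ (η ∘ τ i k) p))
      where
      k∈Y : k ∈ Y
      k∈Y = Perm.∈-resp-↭ p (here ≡.refl)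
      i∉B : i ∉ B
      i∉B = Unique-head uL ∘ ∈-++⁺ˡ
      i∉C : i ∉ C
      i∉C = Unique-head uL ∘ ∈-++⁺ʳ B ∘ ∈-++⁺ˡ
      i∉Y : i ∉ Y
      i∉Y = Unique-head uL ∘ ∈-++⁺ʳ B ∘ ∈-++⁺ʳ C
      k∉B : k ∉ B
      k∉B q = Unique-disjoint L (unique G) (∈-++⁺ˡ q) k∈Y ≡.refl
      k∉C : k ∉ C
      k∉C q = Unique-disjoint L (unique G) (∈-++⁺ʳ B (there q)) k∈Y ≡.refl
      k∉Y′ : k ∉ Y′
      k∉Y′ = Unique-head (Unique-↭ (↭-sym p) (Unique-right L (unique G)))
      at-L : map (η ∘ τ i k) L ≡ zs ++ η k ∷ a
      at-L = ≡.trans (map-++ (η ∘ τ i k) B (i ∷ C)) (≡.cong₂ _++_ (≡.trans (map-∘τ η B i∉B k∉B) ηB)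
        (≡.cong₂ _∷_ (≡.cong η (τ-l i k)) (≡.trans (map-∘τ η C i∉C k∉C) ηC)))
      at-Y : map (η ∘ τ i k) (k ∷ Y′) ≡ 0 ∷ map η Y′
      at-Y = ≡.cong₂ _∷_ (≡.trans (≡.cong η (τ-r i k)) ηi) (map-∘τ η Y′ (λ q → i∉Y (Perm.∈-resp-↭ p (there q))) k∉Y′)

  sumPicks-++ : ∀ {A : Set} (xs ys : List A) G →
    sumPicks (xs ++ ys) G ≈ sumPicks xs (λ x xs′ → G x (xs′ ++ ys)) + sumPicks ys (λ y ys′ → G y (xs ++ ys′))
  sumPicks-++ []       ys G = sym (+-identityˡ _)
  sumPicks-++ (x ∷ xs) ys G = trans (+-congˡ (sumPicks-++ xs ys (λ y zs → G y (x ∷ zs)))) (sym (+-assoc _ _ _))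

  -- For `w` of length `n` this sums over all its rearrangements, equal entries counted separately.
  permSum : ℕ → (List ℕ → Carrier) → List ℕ → Carrier
  permSum zero    φ w = φ []
  permSum (suc n) φ w = sumPicks w (λ p w′ → permSum n (φ ∘ (p ∷_)) w′)

  permSum-cong : ∀ n {φ ψ} w → (∀ l → φ l ≈ ψ l) → permSum n φ w ≈ permSum n ψ w
  permSum-cong zero    w h = h []
  permSum-cong (suc n) w h = sumPicks-cong w (λ p w′ _ → permSum-cong n w′ (h ∘ (p ∷_)))

  permSum-last : ∀ n φ w → permSum (suc n) φ w ≈ sumPicks w (λ p w′ → permSum n (λ l → φ (l ++ p ∷ [])) w′)
  permSum-last zero    φ w = refl
  permSum-last (suc n) φ w = trans (sumPicks-cong w (λ p w′ _ → permSum-last n (φ ∘ (p ∷_)) w′))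
    (sumPicks-swap w (λ p q w″ → permSum n (λ l → φ (p ∷ l ++ q ∷ [])) w″))

  fill : ℕ → St → St
  fill zero    f a e = f a e
  fill (suc n) f a e = sumPicks e (λ v e′ → low 1 v (λ p → fill n f (a ++ p ∷ []) (0 ∷ e′)))

  -- At exponent 0 the term with `d` drops out, so raising amounts to lowering one symmetric
  -- exponent and handing it to an ordered variable.
  fill-raiseFirst : ∀ n d f a e → fill n (raiseFirst d f) (0 ∷ a) e ≈ fill (suc n) f a e
  fill-raiseFirst zero    d f a e = trans (+-congʳ (zeroʳ d)) (+-identityˡ _)
  fill-raiseFirst (suc n) d f a e = sumPicks-cong e (λ v e′ _ → low-cong 1 v (λ p → fill-raiseFirst n d f (a ++ p ∷ []) (0 ∷ e′)))

  raiseAll-zeros : ∀ ds f a e → raiseAll ds f (replicate (length ds) 0 ++ a) e ≈ fill (length ds) f a e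
  raiseAll-zeros []       f a e = refl
  raiseAll-zeros (d ∷ ds) f a e = trans (reflexive (≡.cong (λ l → raiseAll ds (raiseFirst d f) l e) (shift (length ds))))
    (trans (raiseAll-zeros ds (raiseFirst d f) (0 ∷ a) e) (fill-raiseFirst (length ds) d f a e))
    where
    shift : ∀ n → 0 ∷ replicate n 0 ++ a ≡ replicate n 0 ++ 0 ∷ a
    shift zero    = ≡.refl
    shift (suc n) = ≡.cong (0 ∷_) (shift n)

  sumPicks-zeros : ∀ c {G : ℕ → List ℕ → Carrier} → (∀ e → G 0 e ≈ 0#) → sumPicks (replicate c 0) G ≈ 0#
  sumPicks-zeros zero    h = refl
  sumPicks-zeros (suc c) h = trans (+-cong (h _) (sumPicks-zeros c (h ∘ (0 ∷_)))) (+-identityˡ 0#)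

  fill-step : ∀ n f a c w → fill (suc n) f a (replicate c 0 ++ map suc w) ≈
    sumPicks w (λ p w′ → fill n f (a ++ p ∷ []) (replicate (suc c) 0 ++ map suc w′))
  fill-step n f a c w = trans (sumPicks-++ (replicate c 0) (map suc w) _)
    (trans (+-cong (sumPicks-zeros c (λ _ → refl)) (reflexive (sumPicks-map suc w _))) (+-identityˡ _))

  private
    picked : ∀ {p : ℕ} {w′ w n} → p ∷ w′ ↭ w → length w ≡ suc n → length w′ ≡ n
    picked p len = ℕ.suc-injective (≡.trans (Perm.↭-length p) len)

  fill-permSum : ∀ n f a c w → length w ≡ n →
    fill n f a (replicate c 0 ++ map suc w) ≈ permSum n (λ l → f (a ++ l) (replicate (n ℕ.+ c) 0)) w
  fill-permSum zero    f a c []      len = reflexive (≡.cong₂ f (≡.sym (++-identityʳ a)) (++-identityʳ (replicate c 0)))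
  fill-permSum (suc n) f a c w       len = trans (fill-step n f a c w) (sumPicks-cong w (λ p w′ q →
    trans (fill-permSum n f (a ++ p ∷ []) (suc c) w′ (picked q len)) (permSum-cong n w′ (λ l →
      reflexive (≡.cong₂ (λ x k → f x (replicate k 0)) (++-assoc a (p ∷ []) l) (ℕ.+-suc n c))))))

  -- Every raising uses up a nonzero symmetric exponent.
  fill-few : ∀ n f a c w → length w < n → fill n f a (replicate c 0 ++ map suc w) ≈ 0#
  fill-few (suc n) f a c w (s≤s lt) = trans (fill-step n f a c w) (sumPicks-zero w (λ p w′ q →
    fill-few n f (a ++ p ∷ []) (suc c) w′ (ℕ.≤-trans (ℕ.≤-reflexive (Perm.↭-length q)) lt)))

  zeros-sucs : ∀ e → ∃[ c ] ∃[ w ] e ↭ replicate c 0 ++ map suc w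
  zeros-sucs []          = 0 , [] , ↭-refl
  zeros-sucs (zero ∷ e)  = let (c , w , p) = zeros-sucs e in suc c , w , prep 0 p
  zeros-sucs (suc x ∷ e) = let (c , w , p) = zeros-sucs e in
    c , x ∷ w , ↭-trans (prep (suc x) p) (↭-sym (Perm.shift (suc x) (replicate c 0) (map suc w)))

  factors : ℕ → List Carrier → Carrier
  factors m []       = 1#
  factors m (θ ∷ ts) = (θ + ⟦ m ⟧) * factors m ts

  -- The first variable of the order is filled first, so that the
  -- variables before it contribute equally to both sides of its equation.
  permSum-factors : ∀ ls {C ts tC Y f} m → Good (rev ls ++ C) (rev ts ++ tC) Y f → length ls ≡ length ts →
    length Y ≡ m → length ls ℕ.+ length C ≡ m → ∀ w a → length w ≡ length ls → length C ≡ length a →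
    permSum (length ls) (λ l → f (l ++ a) (replicate m 0)) w ≈
    factors m ts * f (replicate (length ls) 0 ++ a) (replicate (length C) 0 ++ w)
  permSum-factors [] {C} {[]} {tC} {Y} {f} m G len lenY total [] a lenw lenC =
    trans (reflexive (≡.cong (f a) (≡.trans (≡.cong (λ k → replicate k 0) (≡.sym total)) (≡.sym (++-identityʳ _))))) (sym (*-identityˡ _))
  permSum-factors (l ∷ ls) {C} {θ ∷ ts} {tC} {Y} {f} m G len lenY total w a lenw lenC =
    trans (permSum-last (length ls) (λ x → f (x ++ a) (replicate m 0)) w)
    (trans (sumPicks-cong w (λ p w′ q → trans (permSum-cong (length ls) w′ (λ x → reflexive (≡.cong (λ y → f y (replicate m 0)) (++-assoc x (p ∷ []) a))))
      (permSum-factors ls {l ∷ C} {ts} {θ ∷ tC} m G′ (ℕ.suc-injective len) lenY (≡.trans (ℕ.+-suc (length ls) (length C)) total)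
        w′ (p ∷ a) (picked q lenw) (≡.cong suc lenC))))
    (trans (sumPicks-*ˡ w (factors m ts) _)
    (trans (*-congˡ slot) (solve 3 (λ p t x → p :* (t :* x) := (t :* p) :* x) refl _ _ _))))
    where
    b c : ℕ
    b = length ls
    c = length C
    zs : List ℕ
    zs = replicate b 0
    G′ : Good (rev ls ++ l ∷ C) (rev ts ++ θ ∷ tC) Y f
    G′ = ≡.subst₂ (λ L t → Good L t Y f) (++-assoc (rev ls) (l ∷ []) C) (++-assoc (rev ts) (θ ∷ []) tC) G
    val : Carrier
    val = f (zs ++ 0 ∷ a) (replicate c 0 ++ w)
    lenB : length (rev ls) ≡ length (rev ts)
    lenB = ≡.trans (length-rev ls) (≡.trans (ℕ.suc-injective len) (≡.sym (length-rev ts)))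
    zs≡ : replicate (length (rev ls)) 0 ≡ zs
    zs≡ = ≡.cong (λ k → replicate k 0) (length-rev ls)
    all : sumPicks (replicate c 0 ++ w) (λ v e′ → f (zs ++ v ∷ a) (0 ∷ e′)) ≈ (θ + ⟦ c ℕ.+ m ⟧) * val
    all = trans (reflexive (≡.cong (λ z → sumPicks (replicate c 0 ++ w) (λ v e′ → f (z ++ v ∷ a) (0 ∷ e′))) (≡.sym zs≡)))
      (trans (moves-list (rev ls) (rev ts) G′ lenB a (replicate c 0 ++ w) lenC
        (≡.trans lenY (≡.trans (≡.sym total) (≡.sym (≡.trans (length-++ (replicate c 0)) (≡.trans (≡.cong₂ ℕ._+_ (length-replicate c) lenw) (ℕ.+-comm c (suc b))))))))
      (*-cong (+-congˡ (reflexive (≡.cong (λ k → ⟦ c ℕ.+ k ⟧) lenY))) (reflexive (≡.cong (λ z → f (z ++ 0 ∷ a) (replicate c 0 ++ w)) zs≡))))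
    zero-part : ∀ c → sumPicks (replicate c 0) (λ v z → f (zs ++ v ∷ a) (0 ∷ z ++ w)) ≈ ⟦ c ⟧ * f (zs ++ 0 ∷ a) (replicate c 0 ++ w)
    zero-part zero    = sym (zeroˡ _)
    zero-part (suc c) = sumPicks-replicate c 0 (λ v z → f (zs ++ v ∷ a) (0 ∷ z ++ w))
    -- Each of the `c` zeros contributes `val` to `all`. Discarding them turns `θ + (c + m)` into
    -- `θ + m`, a summand `m` that is the same for every variable.
    slot : sumPicks w (λ p w′ → f (zs ++ p ∷ a) (0 ∷ replicate c 0 ++ w′)) ≈ (θ + ⟦ m ⟧) * f (0 ∷ zs ++ a) (replicate c 0 ++ w)
    slot = trans (+-cancelˡ (⟦ c ⟧ * val) _ _ (trans (+-congʳ (sym (zero-part c))) (trans (sym (sumPicks-++ (replicate c 0) w _))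
        (trans all (trans (*-congʳ (+-congˡ (⟦⟧-+ c m))) (solve 4 (λ t c m v → (t :+ (c :+ m)) :* v := c :* v :+ (t :+ m) :* v) refl θ ⟦ c ⟧ ⟦ m ⟧ val))))))
      (*-congˡ (reflexive (≡.cong (λ z → f z (replicate c 0 ++ w)) (≡.trans (≡.sym (++-assoc zs (0 ∷ []) a)) (≡.cong (_++ a) (replicate-∷ʳ b 0))))))

-- The explicit functions and their second-order equation

module JackFunctions (K : CommutativeRing 0ℓ 0ℓ) (α : CommutativeRing.Carrier K) where

  open CommutativeRing K
  open Solver commutativeSemiring using (solve; _:=_; _:+_; _:*_)
  open SymmetricFunctions K
  open FiniteSums K
  open ExponentFunctions K α
  open Cherednik K α
  open KnopSahi K α
  open KnopSahiSymmetry K α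
  open KnopSahiSupport K α
  open KnopSahiValues K α
  open Good

  first : List ℕ → ℕ
  first []      = 0
  first (x ∷ _) = x

  ≤-first : ∀ {θ} → Linked _≥_ θ → All (_≤ first θ) θ
  ≤-first []      = []
  ≤-first [-]     = ℕ.≤-refl ∷ []
  ≤-first (p ∷ l) = ℕ.≤-refl ∷ All.map (λ q → ℕ.≤-trans q p) (≤-first l)

  first-removeColumn : ∀ {θ} → IsPartition θ → first (removeColumn θ) ≡ pred (first θ)
  first-removeColumn {θ} (link , pos) = ≡.trans (≡.sym (first-++ (removeColumn θ) (length θ ∸ length (removeColumn θ))))
    (≡.trans (≡.cong first (≡.sym (pred-split link))) (first-pred θ))
    where
    first-zeros : ∀ j → first (replicate j 0) ≡ 0
    first-zeros zero    = ≡.refl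
    first-zeros (suc j) = ≡.refl
    first-++ : ∀ xs j → first (xs ++ replicate j 0) ≡ first xs
    first-++ []       j = first-zeros j
    first-++ (x ∷ xs) j = ≡.refl
    first-pred : ∀ xs → first (map pred xs) ≡ pred (first xs)
    first-pred []       = ≡.refl
    first-pred (x ∷ xs) = ≡.refl

  module _ {θ : List ℕ} (isP : IsPartition θ) where
    private
      n m : ℕ
      n = first θ
      m = length θ
      ks : List ℕ → Carrier
      ks = knopSahi n θ (replicate m 0)

    knopSahi-supp : ∀ e → ¬ Dom e θ → ks e ≈ 0#
    knopSahi-supp e ¬D = knopSahi-dom n isP (≤-first (proj₁ isP)) (replicate m 0) e (length-replicate m)
      (λ d → ¬D (drop-zeros m d))
      where
      drop-zeros : ∀ m → Dom (replicate m 0 ++ e) θ → Dom e θ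
      drop-zeros zero    d        = d
      drop-zeros (suc m) (eq , h) = drop-zeros m (eq , λ xs ys p → h xs (ys ++ 0 ∷ [])
        (↭-trans (↭-reflexive (≡.sym (++-assoc xs ys (0 ∷ [])))) (↭-trans (↭-sym (Perm.∷↭∷ʳ 0 (xs ++ ys))) (prep 0 p))))

    -- The ordered variables are set to 0, which leaves a function that is symmetric and stable
    -- under adding variables.
    jackF : SymFun
    jackF = record
      { coeff     = ks
      ; symmetric = knopSahi-sym n θ (replicate m 0)
      ; padding   = λ e → trans (knopSahi-sym n θ (replicate m 0) (↭-sym (Perm.∷↭∷ʳ 0 e))) (knopSahi-pad n θ (replicate m 0) e)
      ; degree    = sum θ
      ; bounded   = λ e lt → knopSahi-supp e (λ (eq , _) → ℕ.<⇒≢ lt (≡.sym eq)) }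

    jackF-ones : coeff jackF (replicate (sum θ) 1) ≈ ⟦ sum θ ! ⟧
    jackF-ones = knopSahi-ones n isP (≤-first (proj₁ isP))

    jackF-pol : ∀ e → PolMult (stab e) (coeff jackF e)
    jackF-pol e = knopSahi-pol n θ (replicate m 0) e

  -- The part of `c_θ` that comes from the first column.
  colFactor : List ℕ → Carrier
  colFactor []       = 1#
  colFactor (x ∷ xs) = (⟦ pred x ⟧ * α + ⟦ suc (length xs) ⟧) * colFactor xs

  indices : ∀ m N → ∃[ L ] ∃[ Y ] length L ≡ m × length Y ≡ N × Unique (rev L ++ Y)
  indices m N = take m U , drop m U ,
    ≡.trans (length-take m U) (≡.trans (≡.cong (m ℕ.⊓_) (length-upTo (m ℕ.+ N))) (ℕ.m≤n⇒m⊓n≡m (ℕ.m≤m+n m N))) ,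
    ≡.trans (length-drop m U) (≡.trans (≡.cong (_∸ m) (length-upTo (m ℕ.+ N))) (ℕ.m+n∸m≡n m N)) ,
    Unique-↭ (↭-trans (↭-reflexive (≡.sym (take++drop≡id m U))) (Perm.++⁺ʳ (drop m U) (↭-sym (rev-↭ (take m U))))) (Unique.upTo⁺ (m ℕ.+ N))
    where
    U : List ℕ
    U = upTo (m ℕ.+ N)

  private
    factors-colFactor : ∀ r m θ → r ℕ.+ length θ ≡ m → factors m (eigenvalues r (map pred θ)) ≈ colFactor θ
    factors-colFactor r m []       eq = refl
    factors-colFactor r m (x ∷ xs) eq = *-cong
      (trans (+-congˡ (trans (reflexive (≡.cong ⟦_⟧ (≡.sym eq))) (⟦⟧-+ r _)))
        (trans (solve 4 (λ a b c d → (a :+ b) :+ (c :+ d) := a :+ ((b :+ c) :+ d)) refl _ (- ⟦ r ⟧) ⟦ r ⟧ _)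
        (+-congˡ (trans (+-congʳ (-‿inverseˡ _)) (+-identityˡ _)))))
      (factors-colFactor (suc r) m xs (≡.trans (≡.sym (ℕ.+-suc r (length xs))) eq))

    module Column {n θ} (isP : IsPartition θ) (bnd : All (_≤ suc n) θ) where
      θ̄ : List ℕ
      θ̄ = removeColumn θ
      m k : ℕ
      m = length θ
      k = m ∸ length θ̄
      f : St
      f = adjoins k (knopSahi n θ̄)

      knopSahi-fill : ∀ e → knopSahi (suc n) θ (replicate m 0) e ≈ fill m f [] e
      knopSahi-fill e = trans (reflexive (≡.cong (λ a → raiseAll (weights θ) f a e)
          (≡.trans (≡.cong (λ j → replicate j 0) (≡.sym (length-weights θ))) (≡.sym (++-identityʳ _)))))
        (trans (raiseAll-zeros (weights θ) f [] e) (reflexive (≡.cong (λ j → fill j f [] e) (length-weights θ))))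

      -- The raisings distribute the entries of `w` over the ordered variables in all ways, and
      -- `permSum-factors` takes them back to the symmetric variables at the price of `colFactor θ`.
      -- It is applied with as many symmetric as ordered variables.
      knopSahi-column : ∀ w → length w ≡ m → knopSahi (suc n) θ (replicate m 0) (map suc w) ≈
        colFactor θ * knopSahi n θ̄ (replicate (length θ̄) 0) w
      knopSahi-column w len with indices m m
      ... | L , Y , lenL , lenY , u = trans (knopSahi-fill (map suc w)) (trans (fill-permSum m f [] 0 w len)
        (trans (permSum-cong m w (λ l → reflexive (≡.cong₂ (λ x j → f x (replicate j 0)) (≡.sym (++-identityʳ l)) (ℕ.+-identityʳ m))))
        (trans (reflexive (≡.cong (λ j → permSum j (λ l → f (l ++ []) (replicate m 0)) w) (≡.sym lenL)))
        (trans (permSum-factors L {[]} {eigenvalues 0 (map pred θ)} {[]} m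
          (≡.subst₂ (λ M t → Good M t Y f) (≡.sym (++-identityʳ (rev L))) (≡.sym (++-identityʳ (rev (eigenvalues 0 (map pred θ)))))
            (adjoined-good isP bnd (knopSahi-good n (removeColumn-isPartition isP) (removeColumn-≤ bnd)) L Y lenL u))
          (≡.trans lenL (≡.sym (≡.trans (length-eigenvalues 0 (map pred θ)) (length-map pred θ)))) lenY
          (≡.trans (ℕ.+-identityʳ _) lenL) w [] (≡.trans len (≡.sym lenL)) ≡.refl)
        (*-cong (factors-colFactor 0 m θ ≡.refl) (trans (reflexive (≡.cong (λ a → f a w)
            (≡.trans (++-identityʳ _) (≡.cong (λ j → replicate j 0) (≡.trans lenL (≡.sym (ℕ.m∸n+n≡m (length-removeColumn θ))))))))
          (trans (adjoins-zeros {knopSahi n θ̄} k (length θ̄) w) (pad-zeros (knopSahi-pad n θ̄) k _ w))))))))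

      knopSahi-few : ∀ c w → length w < m → knopSahi (suc n) θ (replicate m 0) (replicate c 0 ++ map suc w) ≈ 0#
      knopSahi-few c w lt = trans (knopSahi-fill _) (fill-few m f [] c w lt)

  jackF-column : ∀ {θ} (isP : IsPartition θ) w → length w ≡ length θ →
    coeff (jackF isP) (map suc w) ≈ colFactor θ * coeff (jackF (removeColumn-isPartition isP)) w
  jackF-column {[]} isP [] len = sym (*-identityˡ _)
  jackF-column {zero ∷ θ} (_ , () ∷ _)
  jackF-column {suc x ∷ θ} isP w len = trans (Column.knopSahi-column isP (≤-first (proj₁ isP)) w len)
    (*-congˡ (reflexive (≡.cong (λ j → knopSahi j (removeColumn (suc x ∷ θ)) (replicate (length (removeColumn (suc x ∷ θ))) 0) w)
      (≡.sym (first-removeColumn isP)))))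

  jackF-few : ∀ {θ} (isP : IsPartition θ) c w → length w < length θ → coeff (jackF isP) (replicate c 0 ++ map suc w) ≈ 0#
  jackF-few {zero ∷ θ} (_ , () ∷ _)
  jackF-few {suc x ∷ θ} isP c w lt = Column.knopSahi-few isP (≤-first (proj₁ isP)) c w lt

  DFn : List ℕ → Fn → Fn
  DFn Y g = ⨁ Y (λ k → 𝒴 Y k (T k g))

  evens : ℕ → List Carrier → Carrier
  evens o []       = 0#
  evens o (θ ∷ ts) = (θ + ⟦ length ts ℕ.+ o ⟧) + evens o ts

  -- The eigenvalue in the form in which `moved-sum` produces it: a variable contributes `θ` times
  -- its own `reach` and, through the transpositions in its equation, the `reach` of each variable
  -- behind it.
  quad : ℕ → List Carrier → Carrier
  quad o []       = 0#
  quad o (θ ∷ ts) = (θ * (θ + ⟦ length ts ℕ.+ o ⟧) + evens o ts) + quad o ts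

  module Eigenfunction {L Y : List ℕ} {θs : List Carrier} {f : St} (G : Good L θs Y f) (lenθ : length L ≡ length θs) where

    m : ℕ
    m = length L

    h : Fn
    h = record { app = λ η → f (replicate m 0) (map η Y) ; ext = λ e → reflexive (≡.cong (f _) (map-agree Y (λ {x} _ → e x))) }

    private
      A : List ℕ
      A = L ++ Y
      F : Fn
      F = lift f L Y

      Z : Exp → Set
      Z η = ∀ {x} → x ∈ L → η x ≡ 0

      dis : Disjoint L Y
      dis = Unique-disjoint L (unique G)
      uY : Unique Y
      uY = Unique-right L (unique G)

      F≈h : ∀ {η} → Z η → app F η ≈ app h η
      F≈h {η} z = reflexive (≡.cong (λ a → f a (map η Y)) (zero-map η L z))

      h-sym : ∀ {k l} → k ∈ Y → l ∈ Y → k ≢ l → s k l h ≋ h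
      h-sym {k} {l} k∈ l∈ ne η = trans (reflexive (≡.cong (f _) (map-compose η (τ k l) Y))) (sym-e G _ (Perm.map⁺ η (map-τ-↭ uY k∈ l∈ ne)))

      N-h : ∀ {k l} → k ∈ Y → l ∈ Y → N° k l h ≋ 0ꟳ
      N-h {k} {l} k∈ l∈ η = go (k ℕ.≟ l)
        where
        go : Dec (k ≡ l) → app (N° k l h) η ≈ 0#
        go (yes ≡.refl) = N°-same k h η
        go (no ne)      = trans (N°-other ne h η) (N-sym ne η h (h-sym k∈ l∈ ne))

      Z-upd : ∀ {η} → Z η → ∀ {k} v → k ∈ Y → Z (upd η k v)
      Z-upd {η} z v k∈ x∈ = ≡.trans (upd-other η v (λ e → dis x∈ k∈ e)) (z x∈)

      N-cong₀ : ∀ {f g} → (∀ {ζ} → Z ζ → app f ζ ≈ app g ζ) → ∀ {k l} → k ∈ Y → l ∈ Y → ∀ {η} → Z η → app (N° k l f) η ≈ app (N° k l g) η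
      N-cong₀ {f} {g} e {k} {l} k∈ l∈ {η} z = go (k ℕ.≟ l)
        where
        go : Dec (k ≡ l) → app (N° k l f) η ≈ app (N° k l g) η
        go (yes ≡.refl) = trans (N°-same k f η) (sym (N°-same k g η))
        go (no ne)      = trans (N°-other ne f η) (trans (divDiff-cong (λ p q → e (Z-upd (Z-upd z p k∈) q l∈)) (η k) (η l)) (sym (N°-other ne g η)))

      -- The operators of variables in `Y` do not touch the exponents on `L`, so an equation valid
      -- where those vanish may be used under them.
      𝒴-cong₀ : ∀ {f g} → (∀ {ζ} → Z ζ → app f ζ ≈ app g ζ) → ∀ {k} → k ∈ Y → ∀ {η} → Z η → app (𝒴 Y k f) η ≈ app (𝒴 Y k g) η
      𝒴-cong₀ {f} {g} e k∈ z = +-cong (*-congˡ (*-congˡ (e z))) (sumOf-cong∈ Y (λ l∈ → N-cong₀ {f} {g} e k∈ l∈ z))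

      -- Where the exponents on `L` vanish, the divided differences of `𝒴 A k` with `L` vanish as
      -- well, and those within `Y` vanish by symmetry. Only the Euler operator is left of `𝒴` in
      -- `Zeros`.
      T-h : ∀ {k} → k ∈ Y → ∀ {ζ} → Z ζ → app (α ⊙ T k h ⊕ ⟦ m ⟧ ⊙ h) ζ ≈ app (⨁ L (λ j → s j k F)) ζ
      T-h {k} k∈ {ζ} z = trans (+-cong (sym (trans (+-cong (*-congˡ (*-congˡ (F≈h z)))
          (trans (sumOf-++ L Y _) (trans (+-cong
              (sumOf-zero L (λ {j} j∈ → trans (N°-other (λ e → dis j∈ k∈ (≡.sym e)) F ζ) (N-0ʳ k j F ζ (z j∈))))
              (sumOf-zero Y (λ {j} j∈ → trans (N-cong₀ {F} {h} F≈h k∈ j∈ z) (N-h k∈ j∈ ζ)))) (+-identityˡ 0#)))) (+-identityʳ _)))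
          (*-congˡ (sym (F≈h z)))) (zeros G k∈ ζ)

      -- Exchanging `j` and `k` carries `𝒴` from a symmetric to an ordered variable, where the
      -- eigenvalue equation is available; the divided differences without a counterpart vanish at
      -- exponent 0.
      move : ∀ {j k} → j ∈ L → k ∈ Y → ∀ {η} → Z η → app (𝒴 Y k (s j k F)) η ≈ app (𝒴 A j F) (η ∘ τ j k)
      move {j} {k} j∈ k∈ {η} z = +-cong (*-congˡ (*-congʳ (reflexive (≡.cong (⟦_⟧ ∘ η) (≡.sym (τ-l j k))))))
        (sym (trans (sumOf-++ L Y _) (trans (+-cong (sumOf-zero L inL) (sumOf-cong∈ Y inY)) (+-identityˡ _))))
        where
        j≢k : j ≢ k
        j≢k = dis j∈ k∈
        inL : ∀ {x} → x ∈ L → app (N° j x F) (η ∘ τ j k) ≈ 0#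
        inL {x} x∈ = go (j ℕ.≟ x)
          where
          go : Dec (j ≡ x) → app (N° j x F) (η ∘ τ j k) ≈ 0#
          go (yes ≡.refl) = N°-same j F (η ∘ τ j k)
          go (no ne)      = trans (N°-other ne F (η ∘ τ j k)) (N-0ʳ j x F (η ∘ τ j k)
            (≡.trans (≡.cong η (τ-fix (ne ∘ ≡.sym) (dis x∈ k∈))) (z x∈)))
        inY : ∀ {x} → x ∈ Y → app (N° j x F) (η ∘ τ j k) ≈ app (N° k x (s j k F)) η
        inY {x} x∈ = go (k ℕ.≟ x)
          where
          idx : ∀ {x′} → τ j k x ≡ x′ → app (N° (τ j k j) (τ j k x) (s j k F)) η ≈ app (N° k x′ (s j k F)) η
          idx ≡.refl = reflexive (≡.cong (λ i → app (N° i (τ j k x) (s j k F)) η) (τ-l j k))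
          go : Dec (k ≡ x) → app (N° j x F) (η ∘ τ j k) ≈ app (N° k x (s j k F)) η
          go (yes ≡.refl) = trans (N°-other j≢k F (η ∘ τ j k)) (trans (N-0ʳ j k F (η ∘ τ j k) (≡.trans (≡.cong η (τ-r j k)) (z j∈)))
            (sym (N°-same k (s j k F) η)))
          go (no ne)      = trans (s-N° j k j x F η) (idx (τ-fix (λ e → dis j∈ x∈ (≡.sym e)) (ne ∘ ≡.sym)))

      -- As `η` vanishes at `t` and `j`, moving the exponent of `k` to `j` and then to `t` has the
      -- same effect as moving it to `t` directly.
      hop : ∀ {j t k} → j ∈ L → t ∈ L → k ∈ Y → ∀ {η} → Z η → (η ∘ τ j k) ∘ τ t j ≗ᵉ η ∘ τ t k
      hop {j} {t} {k} j∈ t∈ k∈ {η} z x = go (x ℕ.≟ t) (x ℕ.≟ j) (x ℕ.≟ k)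
        where
        t≢k : t ≢ k
        t≢k = dis t∈ k∈
        j≢k : j ≢ k
        j≢k = dis j∈ k∈
        go : Dec (x ≡ t) → Dec (x ≡ j) → Dec (x ≡ k) → η (τ j k (τ t j x)) ≡ η (τ t k x)
        go (yes ≡.refl) _ _ = ≡.cong η (≡.trans (≡.cong (τ j k) (τ-l x j)) (≡.trans (τ-l j k) (≡.sym (τ-l x k))))
        go (no p) (yes ≡.refl) _ = ≡.trans (≡.cong (η ∘ τ x k) (τ-r t x)) (≡.trans (≡.cong η (τ-fix (p ∘ ≡.sym) t≢k))
          (≡.trans (z t∈) (≡.sym (≡.trans (≡.cong η (τ-fix p j≢k)) (z j∈)))))
        go (no p) (no q) (yes ≡.refl) = ≡.trans (≡.cong (η ∘ τ j x) (τ-fix p q)) (≡.trans (≡.cong η (τ-r j x))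
          (≡.trans (z j∈) (≡.sym (≡.trans (≡.cong η (τ-r t x)) (z t∈)))))
        go (no p) (no q) (no r) = ≡.cong η (≡.trans (≡.cong (τ j k) (τ-fix p q)) (≡.trans (τ-fix q r) (≡.sym (τ-fix p r))))

      module _ {η : Exp} (z : Z η) where

        reach : ℕ → Carrier
        reach j = sumOf Y (λ k → app (s j k F) η)

        reach-at : ∀ B {j} C tB {θ} tC → L ≡ B ++ j ∷ C → θs ≡ tB ++ θ ∷ tC → length B ≡ length tB →
          reach j ≈ (θ + ⟦ length C ℕ.+ length Y ⟧) * app h η
        reach-at B {j} C tB {θ} tC ≡.refl ≡.refl len = trans (moves B tB G len η (z (∈-++⁺ʳ B (here ≡.refl))) (z ∘ ∈-++⁺ˡ)) (*-congˡ (F≈h z))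

        reach-sum : ∀ B C tB tC → L ≡ B ++ C → θs ≡ tB ++ tC → length B ≡ length tB → length C ≡ length tC →
          sumOf C reach ≈ evens (length Y) tC * app h η
        reach-sum B []      tB []       p q len lenC = sym (zeroˡ _)
        reach-sum B (j ∷ C) tB (θ ∷ tC) p q len lenC = trans
          (+-cong (trans (reach-at B C tB tC p q len) (*-congʳ (+-congˡ (reflexive (≡.cong (λ l → ⟦ l ℕ.+ length Y ⟧) (ℕ.suc-injective lenC))))))
            (reach-sum (B ++ j ∷ []) C (tB ++ θ ∷ []) tC (≡.trans p (≡.sym (++-assoc B (j ∷ []) C))) (≡.trans q (≡.sym (++-assoc tB (θ ∷ []) tC)))
              (≡.trans (length-++ B) (≡.trans (≡.cong (ℕ._+ 1) len) (≡.sym (length-++ tB)))) (ℕ.suc-injective lenC)))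
          (sym (distribʳ _ _ _))

        moved-sum : ∀ B C tB tC → L ≡ B ++ C → θs ≡ tB ++ tC → length B ≡ length tB → length C ≡ length tC →
          sumOf C (λ j → sumOf Y (λ k → app (𝒴 A j F) (η ∘ τ j k))) ≈ quad (length Y) tC * app h η
        moved-sum B []      tB []       p q len lenC = sym (zeroˡ _)
        moved-sum B (j ∷ C) tB (θ ∷ tC) p q len lenC = trans
          (+-cong
            (trans (sumOf-cong∈ Y (λ {k} k∈ → trans (at-j (η ∘ τ j k)) (+-congˡ (sumOf-cong∈ C (λ {t} t∈ → ext F (hop j∈L (C⊂L t∈) k∈ z))))))
            (trans (sumOf-+ Y _ _) (trans (+-cong (sumOf-*ˡ Y θ _) (sumOf-swap Y C _))
            (trans (+-cong (*-congˡ (trans (reach-at B C tB tC p q len) (*-congʳ (+-congˡ (reflexive (≡.cong (λ l → ⟦ l ℕ.+ length Y ⟧) (ℕ.suc-injective lenC)))))))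
                (reach-sum (B ++ j ∷ []) C (tB ++ θ ∷ []) tC p′ q′ len′ (ℕ.suc-injective lenC)))
              (solve 4 (λ t c x e → t :* (c :* x) :+ e :* x := (t :* c :+ e) :* x) refl θ _ _ _)))))
            (moved-sum (B ++ j ∷ []) C (tB ++ θ ∷ []) tC p′ q′ len′ (ℕ.suc-injective lenC)))
          (sym (distribʳ _ _ _))
          where
          p′ : L ≡ (B ++ j ∷ []) ++ C
          p′ = ≡.trans p (≡.sym (++-assoc B (j ∷ []) C))
          q′ : θs ≡ (tB ++ θ ∷ []) ++ tC
          q′ = ≡.trans q (≡.sym (++-assoc tB (θ ∷ []) tC))
          len′ : length (B ++ j ∷ []) ≡ length (tB ++ θ ∷ [])
          len′ = ≡.trans (length-++ B) (≡.trans (≡.cong (ℕ._+ 1) len) (≡.sym (length-++ tB)))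
          C⊂L : ∀ {t} → t ∈ C → t ∈ L
          C⊂L t∈ = ≡.subst (_ ∈_) (≡.sym p) (∈-++⁺ʳ B (there t∈))
          j∈L : j ∈ L
          j∈L = ≡.subst (j ∈_) (≡.sym p) (∈-++⁺ʳ B (here ≡.refl))
          at-j : 𝒴 A j F ≋ θ ⊙ F ⊕ ⨁ C (λ t → s t j F)
          at-j = eigen-at B tB len (≡.subst₂ (Eigen A F) p q (eigen G))

    -- The equations of the ordered variables are used twice. `T-h` expresses `T k h` through the
    -- functions `s j k F`; applying `𝒴 Y k` once more and moving it to `j` gives the equation at
    -- `j`, and `moves` evaluates the transpositions left over.
    eigenfunction : ∀ {η} → (∀ {x} → x ∈ L → η x ≡ 0) →
      α * app (DFn Y h) η + ⟦ m ⟧ * (α * (sumOf Y (λ k → ⟦ η k ⟧) * app h η)) ≈ quad (length Y) θs * app h η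
    eigenfunction {η} z = trans (+-cong (sym (sumOf-*ˡ Y α _))
        (trans (*-congˡ (*-congˡ (sym (sumOf-*ʳ Y (app h η) _)))) (trans (*-congˡ (sym (sumOf-*ˡ Y α _))) (sym (sumOf-*ˡ Y ⟦ m ⟧ _)))))
      (trans (sym (sumOf-+ Y _ _))
      (trans (sumOf-cong∈ Y (λ {k} k∈ → trans (+-cong (sym (𝒴-* Y k α (T k h) η)) (*-congˡ (sym (trans (+-congˡ (sumOf-zero Y (λ l∈ → N-h k∈ l∈ η))) (+-identityʳ _)))))
        (trans (+-congˡ (sym (𝒴-* Y k ⟦ m ⟧ h η))) (trans (sym (𝒴-+ Y k (α ⊙ T k h) (⟦ m ⟧ ⊙ h) η))
        (trans (𝒴-cong₀ {α ⊙ T k h ⊕ ⟦ m ⟧ ⊙ h} {⨁ L (λ j → s j k F)} (T-h k∈) k∈ z) (trans (𝒴-⨁ Y k L (λ j → s j k F) η)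
        (sumOf-cong∈ L (λ j∈ → move j∈ k∈ z))))))))
      (trans (sumOf-swap Y L _) (moved-sum z [] L [] θs ≡.refl ≡.refl ≡.refl lenθ))))

-- The eigenvalue attached to a partition

module JackEigenvalues (K : CommutativeRing 0ℓ 0ℓ) (α : CommutativeRing.Carrier K) where

  open CommutativeRing K
  open Solver commutativeSemiring using (solve; _:=_; _:+_; _:*_; con)
  open RingProperties ring using (+-cancelʳ)
  open SymmetricFunctions K
  open FiniteSums K
  open ExponentFunctions K α
  open Cherednik K α
  open KnopSahi K α
  open KnopSahiSymmetry K α
  open KnopSahiSupport K α
  open KnopSahiValues K α
  open JackFunctions K α

  evens-∷ʳ : ∀ o ts θ → evens o (ts ++ θ ∷ []) ≈ evens (suc o) ts + (θ + ⟦ o ⟧)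
  evens-∷ʳ o []       θ = +-comm _ _
  evens-∷ʳ o (t ∷ ts) θ = trans (+-cong (+-congˡ (reflexive (≡.cong ⟦_⟧ (shift ts)))) (evens-∷ʳ o ts θ)) (sym (+-assoc _ _ _))
    where
    shift : ∀ (ts : List Carrier) → length (ts ++ θ ∷ []) ℕ.+ o ≡ length ts ℕ.+ suc o
    shift ts = ≡.trans (≡.cong (ℕ._+ o) (≡.trans (length-++ ts) (ℕ.+-comm (length ts) 1))) (≡.sym (ℕ.+-suc (length ts) o))

  quad-∷ʳ : ∀ o ts θ → quad o (ts ++ θ ∷ []) ≈ quad (suc o) ts + (⟦ length ts ⟧ + θ) * (θ + ⟦ o ⟧)
  quad-∷ʳ o []       θ = solve 2 (λ t x → (t :* x :+ con 0) :+ con 0 := con 0 :+ (con 0 :+ t) :* x) refl θ _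
  quad-∷ʳ o (t ∷ ts) θ = trans (+-cong (+-cong (*-congˡ (+-congˡ (reflexive (≡.cong ⟦_⟧ shift)))) (evens-∷ʳ o ts θ)) (quad-∷ʳ o ts θ))
    (solve 6 (λ a e x q n t → (a :+ (e :+ x)) :+ (q :+ (n :+ t) :* x) := ((a :+ e) :+ q) :+ ((con 1 :+ n) :+ t) :* x) refl _ _ (θ + ⟦ o ⟧) _ _ θ)
    where
    shift : length (ts ++ θ ∷ []) ℕ.+ o ≡ length ts ℕ.+ suc o
    shift = ≡.trans (≡.cong (ℕ._+ o) (≡.trans (length-++ ts) (ℕ.+-comm (length ts) 1))) (≡.sym (ℕ.+-suc (length ts) o))

  squares : List ℕ → ℕ
  squares []       = 0
  squares (x ∷ xs) = x ℕ.* x ℕ.+ squares xs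

  -- For `r = 0` the sum of `(2 i - 1) θ_i` over the rows, numbered from 1; it enters the eigenvalue
  -- with a minus sign, next to `α` times the sum of squares.
  odds : ℕ → List ℕ → ℕ
  odds r []       = 0
  odds r (x ∷ xs) = (r ℕ.+ suc r) ℕ.* x ℕ.+ odds (suc r) xs

  private
    ups downs : ℕ → List ℕ → ℕ
    ups r []         = 0
    ups r (x ∷ xs)   = r ℕ.+ ups (suc r) xs
    downs r []       = 0
    downs r (x ∷ xs) = length xs ℕ.+ downs r xs

    ups-downs : ∀ r xs → ups r xs ≡ r ℕ.* length xs ℕ.+ downs r xs
    ups-downs r []       = ≡.sym (≡.trans (ℕ.+-identityʳ _) (ℕ.*-zeroʳ r))
    ups-downs r (x ∷ xs) = ≡.trans (≡.cong (r ℕ.+_) (≡.trans (ups-downs (suc r) xs) (≡.cong (suc r ℕ.* length xs ℕ.+_) (downs-const xs))))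
      (arith r (length xs) (downs r xs))
      where
      downs-const : ∀ xs → downs (suc r) xs ≡ downs r xs
      downs-const []       = ≡.refl
      downs-const (x ∷ xs) = ≡.cong (length xs ℕ.+_) (downs-const xs)
      arith : ∀ r l d → r ℕ.+ (suc r ℕ.* l ℕ.+ d) ≡ r ℕ.* suc l ℕ.+ (l ℕ.+ d)
      arith = solve-∀

    -- The first row comes last in `rev`, so the induction removes it by `quad-∷ʳ`. Negative terms
    -- are kept on the left; `ups` and `downs` sum the row numbers from either end and agree for
    -- `r = 0`.
    quad-eigenvalues : ∀ r N xs → quad (r ℕ.+ N) (rev (eigenvalues r xs)) + (α * ⟦ odds r xs ⟧ + ⟦ N ⟧ * ⟦ ups r xs ⟧) ≈
      α * (α * ⟦ squares xs ⟧ + (⟦ N ⟧ * ⟦ sum xs ⟧ + ⟦ r ℕ.+ length xs ⟧ * ⟦ sum xs ⟧)) + ⟦ N ⟧ * ⟦ downs r xs ⟧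
    quad-eigenvalues r N []       = solve 3 (λ a n l → con 0 :+ (a :* con 0 :+ n :* con 0) := a :* (a :* con 0 :+ (n :* con 0 :+ l :* con 0)) :+ n :* con 0) refl α ⟦ N ⟧ ⟦ r ℕ.+ 0 ⟧
    quad-eigenvalues r N (x ∷ xs) = trans
      (+-cong (trans (quad-∷ʳ (r ℕ.+ N) (rev (eigenvalues (suc r) xs)) (xα - ⟦ r ⟧))
          (+-congˡ (*-cong (+-congʳ (reflexive (≡.cong ⟦_⟧ (≡.trans (length-rev (eigenvalues (suc r) xs)) (length-eigenvalues (suc r) xs))))) value)))
        (+-cong (*-congˡ (trans (⟦⟧-+ ((r ℕ.+ suc r) ℕ.* x) (odds (suc r) xs)) (+-congʳ (trans (⟦⟧-* (r ℕ.+ suc r) x) (*-congʳ (⟦⟧-+ r (suc r)))))))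
          (*-congˡ (⟦⟧-+ r (ups (suc r) xs)))))
      (trans (solve 11 (λ q n nr r x a N o u k1 dummy →
          (q :+ (n :+ (x :* a :+ nr)) :* (x :* a :+ N)) :+ (a :* ((r :+ (con 1 :+ r)) :* x :+ o) :+ N :* (r :+ u)) :=
          (q :+ (a :* o :+ N :* u)) :+ ((nr :+ r) :* (x :* a :+ N) :+ (a :* (a :* (x :* x) :+ (N :* x :+ ((con 1 :+ r) :+ n) :* x)) :+ N :* n)))
          refl _ ⟦ length xs ⟧ (- ⟦ r ⟧) ⟦ r ⟧ ⟦ x ⟧ α ⟦ N ⟧ ⟦ odds (suc r) xs ⟧ ⟦ ups (suc r) xs ⟧ 0# 0#)
      (trans (+-cong (quad-eigenvalues (suc r) N xs) (trans (+-congʳ (trans (*-congʳ (-‿inverseˡ ⟦ r ⟧)) (zeroˡ _))) (+-identityˡ _)))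
      (trans (+-congˡ (+-congʳ (*-congˡ (+-congˡ (+-congˡ (*-congʳ (sym (⟦⟧-+ (suc r) (length xs)))))))))
      (trans (solve 9 (λ a sq N s l x n d dummy →
          (a :* (a :* sq :+ (N :* s :+ l :* s)) :+ N :* d) :+ (a :* (a :* (x :* x) :+ (N :* x :+ l :* x)) :+ N :* n) :=
          a :* (a :* (x :* x :+ sq) :+ (N :* (x :+ s) :+ l :* (x :+ s))) :+ N :* (n :+ d))
          refl α ⟦ squares xs ⟧ ⟦ N ⟧ ⟦ sum xs ⟧ ⟦ suc r ℕ.+ length xs ⟧ ⟦ x ⟧ ⟦ length xs ⟧ ⟦ downs (suc r) xs ⟧ 0#)
      (+-cong (*-congˡ (+-cong (*-congˡ (trans (+-congʳ (sym (⟦⟧-* x x))) (sym (⟦⟧-+ (x ℕ.* x) (squares xs)))))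
          (+-cong (*-congˡ (sym (⟦⟧-+ x (sum xs)))) (*-cong (reflexive (≡.cong ⟦_⟧ (≡.sym (ℕ.+-suc r (length xs))))) (sym (⟦⟧-+ x (sum xs)))))))
        (*-congˡ (sym (trans (⟦⟧-+ (length xs) (downs r xs)) (+-congˡ (reflexive (≡.cong ⟦_⟧ (downs-const xs)))))))))))) 
      where
      xα : Carrier
      xα = ⟦ x ⟧ * α
      downs-const : ∀ xs → downs r xs ≡ downs (suc r) xs
      downs-const []       = ≡.refl
      downs-const (x ∷ xs) = ≡.cong (length xs ℕ.+_) (downs-const xs)
      value : (xα - ⟦ r ⟧) + ⟦ r ℕ.+ N ⟧ ≈ xα + ⟦ N ⟧
      value = trans (+-congˡ (⟦⟧-+ r N)) (trans (solve 4 (λ a b c d → (a :+ b) :+ (c :+ d) := a :+ ((b :+ c) :+ d)) refl xα (- ⟦ r ⟧) ⟦ r ⟧ ⟦ N ⟧)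
        (+-congˡ (trans (+-congʳ (-‿inverseˡ _)) (+-identityˡ _))))

  eigenvalue-sum : ∀ N xs → quad N (rev (eigenvalues 0 xs)) + α * ⟦ odds 0 xs ⟧ ≈
    α * (α * ⟦ squares xs ⟧ + (⟦ N ⟧ * ⟦ sum xs ⟧ + ⟦ length xs ⟧ * ⟦ sum xs ⟧))
  eigenvalue-sum N xs = +-cancelʳ (⟦ N ⟧ * ⟦ downs 0 xs ⟧) _ _ (trans (trans (+-congˡ (*-congˡ (reflexive (≡.cong ⟦_⟧ (≡.sym (ups-downs 0 xs))))))
    (+-assoc _ _ _)) (quad-eigenvalues 0 N xs))

  hat : SymFun → List ℕ → Fn
  hat f Y = record { app = λ η → coeff f (map η Y) ; ext = λ h → reflexive (≡.cong (coeff f) (map-agree Y (λ {x} _ → h x))) }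

  assign-∉ : ∀ ks vs {x} → x ∉ ks → assign ks vs x ≡ 0
  assign-∉ []       vs       p = ≡.refl
  assign-∉ (k ∷ ks) []       p = ≡.refl
  assign-∉ (k ∷ ks) (v ∷ vs) p = ≡.trans (upd-other (assign ks vs) v (λ e → p (here e))) (assign-∉ ks vs (p ∘ there))

  sumOf-nat : ∀ (η : Exp) Y → sumOf Y (λ k → ⟦ η k ⟧) ≈ ⟦ sum (map η Y) ⟧
  sumOf-nat η []      = refl
  sumOf-nat η (y ∷ Y) = trans (+-congˡ (sumOf-nat η Y)) (sym (⟦⟧-+ (η y) _))

  -- The number of ordered variables enters both sides of `eigenfunction` only as a multiple of the
  -- degree, and cancels, as does a factor `α`. The number of symmetric variables survives as
  -- `length e` times the degree.
  jackF-eigen : (∀ {x y} → α * x ≈ α * y → x ≈ y) → ∀ {θ} (isP : IsPartition θ) e →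
    ∃[ Y ] ∃[ η ] Unique Y × map η Y ≡ e ×
      app (DFn Y (hat (jackF isP) Y)) η + ⟦ odds 0 θ ⟧ * coeff (jackF isP) e ≈
      (α * ⟦ squares θ ⟧ + ⟦ length e ⟧ * ⟦ sum θ ⟧) * coeff (jackF isP) e
  jackF-eigen cancel {θ} isP e with indices (length θ) (length e)
  ... | L , Y , lenL , lenY , u = Y , η , uY , ηY , cancel (+-cancelʳ (⟦ length θ ⟧ * (α * (⟦ sum θ ⟧ * he))) _ _
      (trans (solve 5 (λ a D o h r → a :* (D :+ o :* h) :+ r := (a :* D :+ r) :+ (a :* o) :* h) refl α _ ⟦ odds 0 θ ⟧ he _)
      (trans (+-congʳ (trans (+-congˡ (*-cong (reflexive (≡.cong ⟦_⟧ (≡.trans (≡.sym lenL) (≡.sym (length-rev L))))) degree-he))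
          (trans (+-congʳ (*-congˡ D≈)) (trans (eigenfunction zero-on-L) (*-cong (reflexive (≡.cong (λ N → quad N (rev (eigenvalues 0 θ))) lenY)) h≈)))))
      (trans (sym (distribʳ _ _ _)) (trans (*-congʳ (eigenvalue-sum (length e) θ))
      (solve 6 (λ a q n s l h → (a :* (a :* q :+ (n :* s :+ l :* s))) :* h := a :* ((a :* q :+ n :* s) :* h) :+ l :* (a :* (s :* h)))
        refl α ⟦ squares θ ⟧ ⟦ length e ⟧ ⟦ sum θ ⟧ ⟦ length θ ⟧ he))))))
    where
    open Eigenfunction (knopSahi-good (first θ) isP (≤-first (proj₁ isP)) L Y lenL u)
      (≡.trans (length-rev L) (≡.trans lenL (≡.sym (≡.trans (length-rev (eigenvalues 0 θ)) (length-eigenvalues 0 θ)))))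
    uY : Unique Y
    uY = Unique-right (rev L) u
    η : Exp
    η = assign Y e
    ηY : map η Y ≡ e
    ηY = map-assign Y e uY lenY
    he : Carrier
    he = coeff (jackF isP) e
    zero-on-L : ∀ {x} → x ∈ rev L → η x ≡ 0
    zero-on-L x∈ = assign-∉ Y e (λ x∈Y → Unique-disjoint (rev L) u x∈ x∈Y ≡.refl)
    hat≋ : hat (jackF isP) Y ≋ h
    hat≋ ζ = reflexive (≡.cong (λ j → knopSahi (first θ) θ (replicate j 0) (map ζ Y)) (≡.trans (≡.sym lenL) (≡.sym (length-rev L))))
    D≈ : app (DFn Y (hat (jackF isP) Y)) η ≈ app (DFn Y h) η
    D≈ = sumOf-cong Y (λ k → 𝒴-cong Y k {T k (hat (jackF isP) Y)} {T k h} (λ ζ → *-congˡ (hat≋ ζ)) η)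
    h≈ : app h η ≈ he
    h≈ = trans (sym (hat≋ η)) (reflexive (≡.cong (coeff (jackF isP)) ηY))
    degree-he : α * (⟦ sum θ ⟧ * he) ≈ α * (sumOf Y (λ k → ⟦ η k ⟧) * app h η)
    degree-he = *-congˡ (trans (go (sum e ℕ.≟ sum θ)) (*-cong (sym (trans (sumOf-nat η Y) (reflexive (≡.cong (⟦_⟧ ∘ sum) ηY)))) (sym h≈)))
      where
      go : Dec (sum e ≡ sum θ) → ⟦ sum θ ⟧ * he ≈ ⟦ sum e ⟧ * he
      go (yes eq) = *-congʳ (reflexive (≡.cong ⟦_⟧ (≡.sym eq)))
      go (no ne)  = trans (*-congˡ he≈0) (trans (zeroʳ _) (sym (trans (*-congˡ he≈0) (zeroʳ _))))
        where
        he≈0 : he ≈ 0#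
        he≈0 = knopSahi-supp isP e (λ d → ne (proj₁ d))

-- Derivations with respect to the power sums

module PowerSumDerivations (K : CommutativeRing 0ℓ 0ℓ) (α : CommutativeRing.Carrier K) where

  open CommutativeRing K
  open Solver commutativeSemiring using (solve; _:=_; _:+_; _:*_; con)
  open RingProperties ring using (+-cancelˡ; -0#≈0#)
  open Antidiagonal K
  open SymmetricFunctions K
  open FiniteSums K
  open Convolution K
  open ExponentFunctions K α
  open Cherednik K α
  open KnopSahi K α
  open KnopSahiValues K α
  open JackFunctions K α
  open JackEigenvalues K α

  record Nice (f : Fun) : Set where
    field
      sym-nice : ∀ {e e′} → e ↭ e′ → f e ≈ f e′
      pad-nice : ∀ e → f (0 ∷ e) ≈ f e
  open Nice

  coeff-nice : ∀ f → Nice (coeff f)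
  coeff-nice f = record { sym-nice = symmetric f ; pad-nice = λ e → trans (symmetric f (Perm.∷↭∷ʳ 0 e)) (padding f e) }

  -- pSeq solves Σ_{r + k = n} E_k (pSeq r B) = B n, where E_k takes the
  -- coefficient of x^k of an adjoined variable x.
  pSeq : ℕ → (ℕ → Fun) → Fun
  pSeq zero    B = B 0
  pSeq (suc r) B = pSeq r (λ k e → B (suc k) e - B 0 (suc k ∷ e))

  private
    next : (ℕ → Fun) → ℕ → Fun
    next B k e = B (suc k) e - B 0 (suc k ∷ e)

    next-nice : ∀ {B} → (∀ k → Nice (B k)) → ∀ k → Nice (next B k)
    next-nice nB k = record
      { sym-nice = λ p → +-cong (sym-nice (nB (suc k)) p) (-‿cong (sym-nice (nB 0) (prep (suc k) p)))
      ; pad-nice = λ e → +-cong (pad-nice (nB (suc k)) e) (-‿cong (trans (sym-nice (nB 0) (_↭_.swap (suc k) 0 ↭-refl)) (pad-nice (nB 0) _))) }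

  pSeq-nice : ∀ r {B} → (∀ k → Nice (B k)) → Nice (pSeq r B)
  pSeq-nice zero    nB = nB 0
  pSeq-nice (suc r) nB = pSeq-nice r (next-nice nB)

  pSeq-newton : ∀ n {B} → (∀ k → Nice (B k)) → ∀ e → antidiag n (λ r k → pSeq r B (k ∷ e)) ≈ B n e
  pSeq-newton zero    nB e = pad-nice (nB 0) e
  pSeq-newton (suc n) {B} nB e = trans (+-congˡ (pSeq-newton n (next-nice nB) e))
    (trans (solve 3 (λ a b c → a :+ (b :+ c) := b :+ (c :+ a)) refl _ _ _) (trans (+-congˡ (-‿inverseˡ _)) (+-identityʳ _)))

  -- On stable functions the coefficient at exponent 0 is the function itself, so the equations are
  -- triangular in `r`.
  pSeq-unique : ∀ r {Q B : ℕ → Fun} → (∀ k → Nice (Q k)) → (∀ n e → antidiag n (λ r k → Q r (k ∷ e)) ≈ B n e) → ∀ e → Q r e ≈ pSeq r B e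
  pSeq-unique zero    nQ h e = trans (sym (pad-nice (nQ 0) e)) (h 0 e)
  pSeq-unique (suc r) {Q} {B} nQ h e = pSeq-unique r {Q ∘ suc} {next B} (nQ ∘ suc) (λ n e → +-cancelˡ (Q 0 (suc n ∷ e)) _ _
    (trans (h (suc n) e) (sym (trans (+-congʳ (trans (sym (pad-nice (nQ 0) _)) (h 0 (suc n ∷ e))))
      (trans (solve 3 (λ a b c → a :+ (b :+ c) := b :+ (c :+ a)) refl _ _ _) (trans (+-congˡ (-‿inverseˡ _)) (+-identityʳ _))))))) e

  pSeq-cong : ∀ r {B C : ℕ → Fun} → (∀ k e → B k e ≈ C k e) → ∀ e → pSeq r B e ≈ pSeq r C e
  pSeq-cong zero    h e = h 0 e
  pSeq-cong (suc r) h e = pSeq-cong r (λ k e → +-cong (h (suc k) e) (-‿cong (h 0 _))) e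

  pSeq-vanish : ∀ r {B : ℕ → Fun} {D o} → (∀ k e → D < o ℕ.+ (k ℕ.+ sum e) → B k e ≈ 0#) → ∀ e → D < o ℕ.+ (r ℕ.+ sum e) → pSeq r B e ≈ 0#
  pSeq-vanish zero    h e lt = h 0 e lt
  pSeq-vanish (suc r) {B} {D} {o} h e lt = pSeq-vanish r {next B} {D} {suc o} (λ k e lt → trans (+-cong
      (h (suc k) e (≡.subst (D <_) (≡.sym (ℕ.+-suc o (k ℕ.+ sum e))) lt))
      (-‿cong (h 0 (suc k ∷ e) (≡.subst (D <_) (≡.sym (ℕ.+-suc o (k ℕ.+ sum e))) lt)))) (trans (+-identityˡ _) -0#≈0#))
    e (≡.subst (D <_) (ℕ.+-suc o (r ℕ.+ sum e)) lt)

  pSeq-ind : ∀ (Q : Fun → Set) → (∀ {f g} → Q f → Q g → Q (λ e → f e - g e)) → (∀ {f} k → Q f → Q (f ∘ (k ∷_))) →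
    ∀ r {B : ℕ → Fun} → (∀ k → Q (B k)) → Q (pSeq r B)
  pSeq-ind Q sub E zero    h = h 0
  pSeq-ind Q sub E (suc r) h = pSeq-ind Q sub E r (λ k → sub (h (suc k)) (E (suc k) (h 0)))

  derivs : Fun → ℕ → Fun
  derivs f k e = ⟦ k ⟧ * f (k ∷ e)

  derivs-nice : ∀ {f} → Nice f → ∀ k → Nice (derivs f k)
  derivs-nice nf k = record
    { sym-nice = λ p → *-congˡ (sym-nice nf (prep k p))
    ; pad-nice = λ e → *-congˡ (trans (sym-nice nf (_↭_.swap k 0 ↭-refl)) (pad-nice nf _)) }

  -- P r is r ∂/∂p_r.
  P : ℕ → SymFun → SymFun
  P r f = record
    { coeff     = pSeq r (derivs (coeff f))
    ; symmetric = sym-nice nP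
    ; padding   = λ e → trans (sym-nice nP (↭-sym (Perm.∷↭∷ʳ 0 e))) (pad-nice nP e)
    ; degree    = degree f ∸ r
    ; bounded   = λ e lt → pSeq-vanish r {D = degree f} {0} (λ k e lt → trans (*-congˡ (bounded f (k ∷ e) lt)) (zeroʳ _)) e
        (ℕ.≤-trans (s≤s (ℕ.m≤n+m∸n (degree f) r)) (ℕ.≤-trans (ℕ.≤-reflexive (≡.sym (ℕ.+-suc r _))) (ℕ.+-monoʳ-≤ r lt)))
    }
    where
    nP : Nice (pSeq r (derivs (coeff f)))
    nP = pSeq-nice r (derivs-nice (coeff-nice f))

  -- A further variable `x` changes the power sum `p_r` into `p_r + x^r`. By the chain rule `x d/dx`
  -- is therefore the sum of `x^r` times `r` times the derivative in `p_r`; the equation compares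
  -- coefficients at `x^n`.
  P-newton : ∀ f n e → antidiag n (λ r k → coeff (P r f) (k ∷ e)) ≈ ⟦ n ⟧ * coeff f (n ∷ e)
  P-newton f n e = pSeq-newton n (derivs-nice (coeff-nice f)) e

  P-cong : ∀ r {f g} → f ≈ₛ g → P r f ≈ₛ P r g
  P-cong r h = pSeq-cong r (λ k e → *-congˡ (h (k ∷ e)))

  P-vanish : ∀ {r} f → degree f < r → P r f ≈ₛ 0ₛ
  P-vanish {r} f lt e = pSeq-vanish r {D = degree f} {0} (λ k e lt → trans (*-congˡ (bounded f (k ∷ e) lt)) (zeroʳ _)) e
    (ℕ.≤-trans lt (ℕ.m≤m+n r (sum e)))

  P-0 : ∀ f → P 0 f ≈ₛ 0ₛ
  P-0 f e = zeroˡ _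

  P-unique : ∀ r f (Q : ℕ → SymFun) → (∀ n e → antidiag n (λ r k → coeff (Q r) (k ∷ e)) ≈ ⟦ n ⟧ * coeff f (n ∷ e)) → Q r ≈ₛ P r f
  P-unique r f Q h = pSeq-unique r (coeff-nice ∘ Q) h

  P-+ : ∀ r f g → P r (f +ₛ g) ≈ₛ P r f +ₛ P r g
  P-+ r f g e = sym (P-unique r (f +ₛ g) (λ r → P r f +ₛ P r g) (λ n e → trans (antidiag-+ n _ _)
    (trans (+-cong (P-newton f n e) (P-newton g n e)) (sym (distribˡ _ _ _)))) e)

  P-• : ∀ r a f → P r (a • f) ≈ₛ a • P r f
  P-• r a f e = sym (P-unique r (a • f) (λ r → a • P r f) (λ n e → trans (antidiag-*ˡ n a _)
    (trans (*-congˡ (P-newton f n e)) (solve 3 (λ a n f → a :* (n :* f) := n :* (a :* f)) refl a _ _))) e)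

  low-+ˡ : ∀ s n F G → low s n (λ k → F k + G k) ≈ low s n F + low s n G
  low-+ˡ zero    n       F G = refl
  low-+ˡ (suc s) zero    F G = sym (+-identityˡ 0#)
  low-+ˡ (suc s) (suc n) F G = low-+ˡ s n F G

  low-weight : ∀ s n F → low s n (λ k → ⟦ s ⟧ * F k + ⟦ k ⟧ * F k) ≈ ⟦ n ⟧ * low s n F
  low-weight zero    n       F = trans (+-congʳ (zeroˡ _)) (+-identityˡ _)
  low-weight (suc s) zero    F = sym (zeroˡ _)
  low-weight (suc s) (suc n) F = trans (low-cong s n (λ k → solve 3 (λ s k f → (con 1 :+ s) :* f :+ k :* f := f :+ (s :* f :+ k :* f)) refl ⟦ s ⟧ ⟦ k ⟧ (F k)))
    (trans (low-+ˡ s n F _) (trans (+-congˡ (low-weight s n F)) (solve 2 (λ n f → f :+ n :* f := (con 1 :+ n) :* f) refl ⟦ n ⟧ _)))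

  antidiag-low : ∀ s n (G : ℕ → ℕ → Carrier) → antidiag n (λ r k → low s k (G r)) ≈ low s n (λ n′ → antidiag n′ G)
  antidiag-low zero    n       G = refl
  antidiag-low (suc s) zero    G = refl
  antidiag-low (suc s) (suc n) G = trans (antidiag-last n (λ r k → low (suc s) k (G r))) (trans (+-identityʳ _) (antidiag-low s n G))

  kron : ℕ → ℕ → Carrier
  kron r s with r ℕ.≟ s
  ... | yes _ = 1#
  ... | no _  = 0#

  kron-same : ∀ r → kron r r ≈ 1#
  kron-same r with r ℕ.≟ r
  ... | yes _ = refl
  ... | no ne = ⊥-elim (ne ≡.refl)

  kron-other : ∀ {r s} → r ≢ s → kron r s ≈ 0#
  kron-other {r} {s} ne with r ℕ.≟ s
  ... | yes e = ⊥-elim (ne e)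
  ... | no _  = refl

  convolve-antidiagʳ : ∀ n (F : ℕ → ℕ → Fun) g e →
    convolve g (λ a → antidiag n (λ i j → F i j a)) e ≈ antidiag n (λ i j → convolve g (F i j) e)
  convolve-antidiagʳ n F g e = trans (convolve-comm g _ e) (trans (convolve-antidiagˡ n F g e)
    (antidiag-cong n (λ i j _ → convolve-comm (F i j) g e)))

  -- Checked on the equations that characterize `P`: the Kronecker term supplies the degree `suc s`
  -- that the adjoined variable has in the power sum, and `low-weight` adds it to the degree left in
  -- `f`.
  P-powerSum : ∀ r s f → P r (powerSum (suc s) · f) ≈ₛ (kron r (suc s) * ⟦ suc s ⟧) • f +ₛ powerSum (suc s) · P r f
  P-powerSum r s f e = sym (P-unique r (powerSum (suc s) · f) (λ r → (kron r (suc s) * ⟦ suc s ⟧) • f +ₛ powerSum (suc s) · P r f) identity e)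
    where
    p : Fun
    p = coeff (powerSum (suc s))
    identity : ∀ n e → antidiag n (λ r k → kron r (suc s) * ⟦ suc s ⟧ * coeff f (k ∷ e) + convolve p (coeff (P r f)) (k ∷ e)) ≈
      ⟦ n ⟧ * convolve p (coeff f) (n ∷ e)
    identity n e = trans (antidiag-+ n _ _) (trans (+-cong
        (antidiag-pick (suc s) n {F = λ k → ⟦ suc s ⟧ * coeff f (k ∷ e)} (λ j → *-congʳ (trans (*-congʳ (kron-same (suc s))) (*-identityˡ _)))
          (λ i j ne → trans (*-congʳ (trans (*-congʳ (kron-other ne)) (zeroˡ _))) (zeroˡ _)))
        (trans (antidiag-cong n (λ r k _ → powerSum-∷ s (coeff (P r f)) k e)) (trans (antidiag-+ n _ _) (+-cong
          (trans (antidiag-low (suc s) n (λ r j → coeff (P r f) (j ∷ e))) (low-cong (suc s) n (λ j → P-newton f j e)))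
          (trans (sym (convolve-antidiagʳ n (λ r k → coeff (P r f) ∘ (k ∷_)) p e))
            (trans (convolve-cong {p} {p} (λ _ → refl) (λ a → P-newton f n a) e) (trans (convolve-comm p _ e) (trans (convolve-*ˡ ⟦ n ⟧ _ p e) (*-congˡ (convolve-comm _ p e))))))))))
      (trans (sym (+-assoc _ _ _)) (trans (+-congʳ (trans (sym (low-+ˡ (suc s) n _ _)) (low-weight (suc s) n (λ k → coeff f (k ∷ e)))))
      (trans (sym (distribˡ _ _ _)) (*-congˡ (sym (powerSum-∷ s (coeff f) n e)))))))

  P-1 : ∀ r → P r 1ₛ ≈ₛ 0ₛ
  P-1 r e = sym (P-unique r 1ₛ (λ _ → 0ₛ) (λ n e → trans (antidiag-zero n (λ _ _ _ → refl)) (sym (go n e))) e)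
    where
    go : ∀ n e → ⟦ n ⟧ * one (n ∷ e) ≈ 0#
    go zero    e = zeroˡ _
    go (suc n) e = trans (*-congˡ (one-suc n e)) (zeroʳ _)

  powerSum-0 : powerSum 0 ≈ₛ 0ₛ
  powerSum-0 e = δ-≢ (shape e) (0 ∷ []) (λ eq → absurd (≡.subst (All.All (0 <_)) eq (proj₂ (shape-isPartition e))))
    where
    absurd : ¬ All.All (0 <_) (0 ∷ [])
    absurd (() All.∷ _)

  range : ℕ → List ℕ
  range zero    = 0 ∷ []
  range (suc d) = 0 ∷ map suc (range d)

  sum-range : ∀ d F → sumOf (range (suc d)) F ≈ F 0 + sumOf (range d) (F ∘ suc)
  sum-range d F = +-congˡ (reflexive (sumOf-map suc (range d) F))

  sum-range-last : ∀ d F → sumOf (range (suc d)) F ≈ sumOf (range d) F + F (suc d)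
  sum-range-last zero    F = trans (+-congˡ (+-identityʳ _)) (+-congʳ (sym (+-identityʳ _)))
  sum-range-last (suc d) F = trans (sum-range (suc d) F) (trans (+-congˡ (sum-range-last d (F ∘ suc)))
    (trans (sym (+-assoc _ _ _)) (+-congʳ (sym (sum-range d F)))))

  sum-range-low : ∀ n d (G : ℕ → ℕ → Carrier) → (∀ r j → d < r → G r j ≈ 0#) → sumOf (range d) (λ r → low r n (G r)) ≈ antidiag n G
  sum-range-low zero    zero    G h = +-identityʳ _
  sum-range-low zero    (suc d) G h = trans (+-congˡ (trans (reflexive (sumOf-map suc (range d) _)) (sumOf-zero (range d) (λ _ → refl)))) (+-identityʳ _)
  sum-range-low (suc n) zero    G h = +-congˡ (sym (antidiag-zero n (λ i j _ → h (suc i) j (s≤s z≤n))))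
  sum-range-low (suc n) (suc d) G h = trans (sum-range d _) (+-congˡ (sum-range-low n d (G ∘ suc) (λ r j lt → h (suc r) j (s≤s lt))))

  sum-range-square : ∀ d (G : ℕ → ℕ → Carrier) → (∀ r s → d < r ℕ.+ s → G r s ≈ 0#) →
    sumOf (range d) (λ r → sumOf (range d) (G r)) ≈ sumOf (range d) (λ t → antidiag t G)
  sum-range-square zero    G h = +-congʳ (+-identityʳ _)
  sum-range-square (suc d) G h = trans (sum-range d _) (trans (+-cong (sum-range d (G 0))
      (trans (sumOf-cong (range d) (λ r → trans (sum-range-last d (G (suc r))) (trans (+-congˡ (h (suc r) (suc d) (s≤s (ℕ.m≤n+m (suc d) r)))) (+-identityʳ _))))
        (sum-range-square d (G ∘ suc) (λ r s lt → h (suc r) s (s≤s lt)))))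
    (trans (+-assoc _ _ _) (trans (+-congˡ (sym (sumOf-+ (range d) _ _))) (sym (sum-range d (λ t → antidiag t G))))))

  Xpow : ℕ → ℕ → Fn → Fn
  Xpow r k g = record { app = λ η → low r (η k) (λ p → app g (upd η k p)) ; ext = λ {η} {ζ} h →
    trans (reflexive (≡.cong (λ n → low r n (λ p → app g (upd η k p))) (h k))) (low-cong r (ζ k) (λ p → ext g (upd-cong h k p))) }

  Xpow-cong : ∀ r k {f g} → f ≋ g → Xpow r k f ≋ Xpow r k g
  Xpow-cong r k h η = low-cong r (η k) (λ p → h _)

  Xpow-suc : ∀ r k g → X k (Xpow r k g) ≋ Xpow (suc r) k g
  Xpow-suc r k g η = go (η k)
    where
    go : ∀ n → low 1 n (λ p → low r (upd η k p k) (λ q → app g (upd (upd η k p) k q))) ≈ low (suc r) n (λ p → app g (upd η k p))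
    go zero    = refl
    go (suc n) = trans (reflexive (≡.cong (λ j → low r j (λ q → app g (upd (upd η k n) k q))) (upd-same η k n)))
      (low-cong r n (λ q → ext g (upd-upd η k n q)))

  Xpow-0 : ∀ k g → Xpow 0 k g ≋ g
  Xpow-0 k g η = ext g (upd-id η k)

  module Bridge {Y : List ℕ} (uY : Unique Y) where

    hat-pick : ∀ f {k Y′} → Y ↭ k ∷ Y′ → k ∉ Y′ → ∀ η p → app (hat f Y) (upd η k p) ≈ coeff f (p ∷ map η Y′)
    hat-pick f {k} {Y′} p k∉ η v = trans (symmetric f (Perm.map⁺ (upd η k v) p))
      (reflexive (≡.cong (coeff f) (≡.cong₂ _∷_ (upd-same η k v) (map-upd η v Y′ k∉))))

    sum-Xpow : ∀ r f η → sumOf Y (λ k → app (Xpow (suc r) k (hat f Y)) η) ≈ coeff (powerSum (suc r) · f) (map η Y)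
    sum-Xpow r f η = go (coeff f) (λ e≡ → reflexive (≡.cong (coeff f) e≡)) Y uY
      where
      go : ∀ (g : Fun) → (∀ {e e′} → e ≡ e′ → g e ≈ g e′) → ∀ Z → Unique Z →
        sumOf Z (λ k → low (suc r) (η k) (λ p → g (map (upd η k p) Z))) ≈ convolve (coeff (powerSum (suc r))) g (map η Z)
      go g gc []      u = sym (powerSum-[] r g)
      go g gc (z ∷ Z) u = trans (+-cong
          (low-cong (suc r) (η z) (λ p → gc (≡.cong₂ _∷_ (upd-same η z p) (map-upd η p Z (Unique-head u)))))
          (trans (sumOf-cong∈ Z (λ {k} k∈ → low-cong (suc r) (η k) (λ p → gc (≡.cong (_∷ map (upd η k p) Z)
              (upd-other η p (λ e → Unique-head u (≡.subst (_∈ Z) (≡.sym e) k∈)))))))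
            (go (g ∘ (η z ∷_)) (λ e≡ → gc (≡.cong (η z ∷_) e≡)) Z (Unique-tail u))))
        (sym (powerSum-∷ r g (η z) (map η Z)))

    sum-Xpow-0 : ∀ f η → sumOf Y (λ k → app (Xpow 0 k (hat f Y)) η) ≈ ⟦ length Y ⟧ * coeff f (map η Y)
    sum-Xpow-0 f η = trans (sumOf-cong Y (λ k → Xpow-0 k (hat f Y) η)) (sumOf-const Y _)

    -- This is `P-newton` with the variable `k` as the distinguished one. The sum stops at `d`
    -- because `P r f` vanishes beyond the degree.
    T-expand : ∀ d f → degree f ≤ d → ∀ {k} → k ∈ Y → T k (hat f Y) ≋ ⨁ (range d) (λ r → Xpow r k (hat (P r f) Y))
    T-expand d f deg {k} k∈ η with ∈⇒↭ k∈
    ... | Y′ , p = trans (*-congˡ (trans (ext (hat f Y) (λ x → ≡.sym (upd-id η k x))) (hat-pick f p k∉ η (η k)))) (trans (sym (P-newton f (η k) (map η Y′)))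
        (sym (trans (sumOf-cong (range d) (λ r → low-cong r (η k) (λ j → hat-pick (P r f) p k∉ η j)))
          (sum-range-low (η k) d (λ r j → coeff (P r f) (j ∷ map η Y′)) (λ r j lt → P-vanish f (ℕ.≤-<-trans deg lt) _)))))
      where
      k∉ : k ∉ Y′
      k∉ = Unique-head (Unique-↭ p uY)

    hat-sym : ∀ f {k l} → k ∈ Y → l ∈ Y → k ≢ l → s k l (hat f Y) ≋ hat f Y
    hat-sym f {k} {l} k∈ l∈ ne η = trans (reflexive (≡.cong (coeff f) (map-compose η (τ k l) Y))) (symmetric f (Perm.map⁺ η (map-τ-↭ uY k∈ l∈ ne)))

    hat-𝒴 : ∀ f {k} → k ∈ Y → 𝒴 Y k (hat f Y) ≋ α ⊙ T k (hat f Y)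
    hat-𝒴 f {k} k∈ η = trans (+-congˡ (sumOf-zero Y (λ {j} j∈ → trivial j∈ (k ℕ.≟ j)))) (+-identityʳ _)
      where
      trivial : ∀ {j} → j ∈ Y → Dec (k ≡ j) → app (N° k j (hat f Y)) η ≈ 0#
      trivial j∈ (yes ≡.refl) = N°-same k (hat f Y) η
      trivial j∈ (no ne)      = trans (N°-other ne (hat f Y) η) (N-sym ne η (hat f Y) (hat-sym f k∈ j∈ ne))

    s-Xpow : ∀ r f {k l} → k ∈ Y → l ∈ Y → k ≢ l → s k l (Xpow r k (hat f Y)) ≋ Xpow r l (hat f Y)
    s-Xpow r f {k} {l} k∈ l∈ ne η = trans (reflexive (≡.cong (λ j → low r (η j) (λ p → app (hat f Y) (upd (η ∘ τ k l) k p))) (τ-l k l)))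
      (low-cong r (η l) (λ p → trans (ext (hat f Y) (λ x → ≡.trans (upd-τ k l η k p x) (≡.cong (λ j → upd η j p (τ k l x)) (τ-l k l))))
        (hat-sym f k∈ l∈ ne (upd η l p))))

    𝒴-Xpow-suc : ∀ r f {k} → k ∈ Y → ∀ η →
      app (𝒴 Y k (Xpow (suc r) k (hat f Y))) η + app (Xpow (suc r) k (hat f Y)) η ≈
      app (X k (𝒴 Y k (Xpow r k (hat f Y)))) η + (α * app (Xpow (suc r) k (hat f Y)) η + coeff (powerSum (suc r) · f) (map η Y))
    𝒴-Xpow-suc r f {k} k∈ η with ∈⇒↭ k∈
    ... | Y′ , p = trans (+-congʳ (trans (𝒴-cong Y k {g} {X k (Xpow r k (hat f Y))} (λ ζ → sym (Xpow-suc r k (hat f Y) ζ)) η)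
        (trans (𝒴-↭ p k (X k (Xpow r k (hat f Y))) η) (trans (𝒴-Xˡ (Unique-head u′) (Xpow r k (hat f Y)) η)
        (+-cong (X-cong k {𝒴 (k ∷ Y′) k (Xpow r k (hat f Y))} {𝒴 Y k (Xpow r k (hat f Y))} (λ ζ → sym (𝒴-↭ p k (Xpow r k (hat f Y)) ζ)) η)
          (+-cong (*-congˡ (Xpow-suc r k (hat f Y) η))
            (sumOf-cong∈ Y′ (λ {l} l∈ → trans (Xpow-suc r k (hat f Y) (η ∘ τ k l)) (s-Xpow (suc r) f k∈ (Y′⊂Y l∈) (k≢l l∈) η)))))))))
      (trans (solve 4 (λ a b c d → (a :+ (b :+ c)) :+ d := a :+ (b :+ (d :+ c))) refl _ _ _ _)
      (+-congˡ (+-congˡ (trans (sym (sumOf-↭ (λ l → app (Xpow (suc r) l (hat f Y)) η) p)) (sum-Xpow r f η)))))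
      where
      g : Fn
      g = Xpow (suc r) k (hat f Y)
      u′ : Unique (k ∷ Y′)
      u′ = Unique-↭ p uY
      Y′⊂Y : ∀ {l} → l ∈ Y′ → l ∈ Y
      Y′⊂Y l∈ = Perm.∈-resp-↭ (↭-sym p) (there l∈)
      k≢l : ∀ {l} → l ∈ Y′ → k ≢ l
      k≢l l∈ e = Unique-head u′ (≡.subst (_∈ Y′) (≡.sym e) l∈)

    -- Summed over `l`, the quotient `x_l (x_k^r - x_l^r) / (x_k - x_l)` gives the products
    -- `x_k^c p_b` with `c + b = r` and `b` at least 1. The excluded `l = k` accounts for `r` copies
    -- of `x_k^r`, which `𝒴-Xpow` adds on its left.
    cross : ℕ → ℕ → SymFun → Exp → Carrier
    cross zero    k f η = 0#
    cross (suc r) k f η = antidiag r (λ c b → app (Xpow c k (hat (powerSum (suc b) · f) Y)) η)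

    𝒴-Xpow : ∀ r f {k} → k ∈ Y → ∀ η →
      app (𝒴 Y k (Xpow r k (hat f Y))) η + ⟦ r ⟧ * app (Xpow r k (hat f Y)) η ≈
      α * app (Xpow r k (T k (hat f Y))) η + (⟦ r ⟧ * (α * app (Xpow r k (hat f Y)) η) + cross r k f η)
    𝒴-Xpow zero    f {k} k∈ η = trans (+-cong (trans (𝒴-cong Y k {Xpow 0 k (hat f Y)} {hat f Y} (Xpow-0 k (hat f Y)) η) (trans (hat-𝒴 f k∈ η) (*-congˡ (sym (Xpow-0 k (T k (hat f Y)) η))))) (zeroˡ _))
      (+-congˡ (sym (trans (+-congʳ (zeroˡ _)) (+-identityʳ 0#))))
    𝒴-Xpow (suc r) f {k} k∈ η = trans (solve 3 (λ y n x → y :+ (con 1 :+ n) :* x := (y :+ x) :+ n :* x) refl _ ⟦ r ⟧ _)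
      (trans (+-congʳ (𝒴-Xpow-suc r f k∈ η))
      (trans (solve 5 (λ a b c n x → (a :+ (b :+ c)) :+ n :* x := (a :+ n :* x) :+ (b :+ c)) refl _ _ _ ⟦ r ⟧ _)
      (trans (+-congʳ below)
      (trans (solve 6 (λ t n x cr ax p → (t :+ (n :* ax :+ cr)) :+ (ax :+ p) := t :+ ((con 1 :+ n) :* ax :+ (p :+ cr))) refl _ ⟦ r ⟧ 0# _ _ _)
      (+-congˡ (+-congˡ (top r)))))))
      where
      Xk : Fn → Carrier
      Xk g = app (X k g) η
      crossFn : ℕ → Fn
      crossFn r = record { app = cross r k f ; ext = λ {ζ} {ξ} h → cross-ext r h }
        where
        cross-ext : ∀ r {ζ ξ} → ζ ≗ᵉ ξ → cross r k f ζ ≈ cross r k f ξ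
        cross-ext zero    h = refl
        cross-ext (suc r) h = antidiag-cong r (λ c b _ → ext (Xpow c k (hat (powerSum (suc b) · f) Y)) h)
      below : Xk (𝒴 Y k (Xpow r k (hat f Y))) + ⟦ r ⟧ * app (Xpow (suc r) k (hat f Y)) η ≈
        α * app (Xpow (suc r) k (T k (hat f Y))) η + (⟦ r ⟧ * (α * app (Xpow (suc r) k (hat f Y)) η) + Xk (crossFn r))
      below = trans (+-congˡ (trans (*-congˡ (sym (Xpow-suc r k (hat f Y) η))) (sym (X-* k ⟦ r ⟧ (Xpow r k (hat f Y)) η))))
        (trans (sym (X-+ k (𝒴 Y k (Xpow r k (hat f Y))) (⟦ r ⟧ ⊙ Xpow r k (hat f Y)) η))
        (trans (X-cong k {𝒴 Y k (Xpow r k (hat f Y)) ⊕ ⟦ r ⟧ ⊙ Xpow r k (hat f Y)}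
            {α ⊙ Xpow r k (T k (hat f Y)) ⊕ (⟦ r ⟧ ⊙ (α ⊙ Xpow r k (hat f Y)) ⊕ crossFn r)} (𝒴-Xpow r f k∈) η)
        (trans (X-+ k (α ⊙ Xpow r k (T k (hat f Y))) (⟦ r ⟧ ⊙ (α ⊙ Xpow r k (hat f Y)) ⊕ crossFn r) η)
        (+-cong (trans (X-* k α (Xpow r k (T k (hat f Y))) η) (*-congˡ (Xpow-suc r k (T k (hat f Y)) η)))
          (trans (X-+ k (⟦ r ⟧ ⊙ (α ⊙ Xpow r k (hat f Y))) (crossFn r) η)
            (+-congʳ (trans (X-* k ⟦ r ⟧ (α ⊙ Xpow r k (hat f Y)) η) (*-congˡ (trans (X-* k α (Xpow r k (hat f Y)) η) (*-congˡ (Xpow-suc r k (hat f Y) η)))))))))))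
      low-antidiag : ∀ r n (F : ℕ → ℕ → ℕ → Carrier) → low 1 n (λ p → antidiag r (λ c b → F c b p)) ≈ antidiag r (λ c b → low 1 n (F c b))
      low-antidiag r zero    F = sym (antidiag-zero r (λ _ _ _ → refl))
      low-antidiag r (suc n) F = refl
      X-cross : ∀ r → Xk (crossFn (suc r)) ≈ antidiag r (λ c b → app (Xpow (suc c) k (hat (powerSum (suc b) · f) Y)) η)
      X-cross r = trans (low-antidiag r (η k) _) (antidiag-cong r (λ c b _ → Xpow-suc c k (hat (powerSum (suc b) · f) Y) η))
      X-0 : ∀ n → low 1 n (λ _ → 0#) ≈ 0#
      X-0 zero    = refl
      X-0 (suc n) = refl
      top : ∀ r → coeff (powerSum (suc r) · f) (map η Y) + Xk (crossFn r) ≈ cross (suc r) k f η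
      top zero    = trans (+-congˡ (X-0 (η k))) (trans (+-identityʳ _) (sym (Xpow-0 k (hat (powerSum 1 · f) Y) η)))
      top (suc r) = +-cong (sym (Xpow-0 k (hat (powerSum (suc (suc r)) · f) Y) η)) (X-cross r)

    pairs : ℕ → SymFun → Fun
    pairs r f e = antidiag r (λ c b → coeff (powerSum c · (powerSum b · f)) e)

    -- The summand with `c = 0` is the same for all variables; it alone depends on how many there
    -- are.
    sum-cross : ∀ r f η → sumOf Y (λ k → cross (suc r) k f η) ≈ ⟦ length Y ⟧ * coeff (powerSum (suc r) · f) (map η Y) + pairs (suc r) f (map η Y)
    sum-cross r f η = trans (sumOf-antidiag Y r _) (trans (go r (λ b → powerSum (suc b) · f))
        (+-congˡ (sym (trans (+-cong (zero-left r) (antidiag-last-zero r)) (+-identityˡ _)))))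
      where
      sumOf-antidiag : ∀ {A : Set} (xs : List A) n (G : A → ℕ → ℕ → Carrier) → sumOf xs (λ x → antidiag n (G x)) ≈ antidiag n (λ i j → sumOf xs (λ x → G x i j))
      sumOf-antidiag []       n G = sym (antidiag-zero n (λ _ _ _ → refl))
      sumOf-antidiag (x ∷ xs) n G = trans (+-congˡ (sumOf-antidiag xs n G)) (sym (antidiag-+ n _ _))
      zero-left : ∀ r → coeff (powerSum 0 · (powerSum (suc r) · f)) (map η Y) ≈ 0#
      zero-left r = trans (convolve-cong {coeff (powerSum 0)} {λ _ → 0#} powerSum-0 (λ _ → refl) (map η Y)) (convolve-zeroˡ _ (map η Y) (λ _ _ → refl))
      core : ℕ → Carrier
      core zero    = 0#
      core (suc r) = antidiag r (λ c b → coeff (powerSum (suc c) · (powerSum (suc b) · f)) (map η Y))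
      zero-inner : ∀ c → coeff (powerSum c · (powerSum 0 · f)) (map η Y) ≈ 0#
      zero-inner c = trans (·-cong {powerSum c} {powerSum c} {powerSum 0 · f} {0ₛ} (λ _ → refl) (λ e → trans (·-cong {powerSum 0} {0ₛ} {f} {f} powerSum-0 (λ _ → refl) e) (convolve-zeroˡ (coeff f) e (λ _ _ → refl))) (map η Y))
        (trans (·-comm (powerSum c) 0ₛ (map η Y)) (convolve-zeroˡ (coeff (powerSum c)) (map η Y) (λ _ _ → refl)))
      antidiag-last-zero : ∀ r → antidiag r (λ c b → coeff (powerSum (suc c) · (powerSum b · f)) (map η Y)) ≈ core r
      antidiag-last-zero zero    = zero-inner 1
      antidiag-last-zero (suc r) = trans (antidiag-last r (λ c b → coeff (powerSum (suc c) · (powerSum b · f)) (map η Y))) (trans (+-congˡ (zero-inner (suc (suc r)))) (+-identityʳ _))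
      go : ∀ r (_ : ℕ → SymFun) → antidiag r (λ c b → sumOf Y (λ k → app (Xpow c k (hat (powerSum (suc b) · f) Y)) η)) ≈
        ⟦ length Y ⟧ * coeff (powerSum (suc r) · f) (map η Y) + core r
      go zero    _ = trans (sum-Xpow-0 (powerSum 1 · f) η) (sym (+-identityʳ _))
      go (suc r) _ = +-cong (sum-Xpow-0 (powerSum (suc (suc r)) · f) η) (antidiag-cong r (λ c b _ → sum-Xpow c (powerSum (suc b) · f) η))

    D-Xpow : ∀ d r f → degree f ≤ d → ∀ η → let e = map η Y in
      sumOf Y (λ k → app (𝒴 Y k (Xpow (suc r) k (hat f Y))) η) + ⟦ suc r ⟧ * coeff (powerSum (suc r) · f) e ≈
      α * sumOf (range d) (λ t → coeff (powerSum (suc r ℕ.+ t) · P t f) e) +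
        (⟦ suc r ⟧ * (α * coeff (powerSum (suc r) · f) e) + (⟦ length Y ⟧ * coeff (powerSum (suc r) · f) e + pairs (suc r) f e))
    D-Xpow d r f deg η = trans (+-congˡ (trans (*-congˡ (sym (sum-Xpow r f η))) (sym (sumOf-*ˡ Y _ _))))
      (trans (sym (sumOf-+ Y _ _)) (trans (sumOf-cong∈ Y (λ k∈ → 𝒴-Xpow (suc r) f k∈ η))
      (trans (sumOf-+ Y _ _) (+-cong
        (trans (sumOf-*ˡ Y α _) (*-congˡ (trans (sumOf-cong∈ Y (λ {k} k∈ → expand k∈)) (trans (sumOf-swap Y (range d) _)
          (sumOf-cong (range d) (λ t → sum-Xpow (r ℕ.+ t) (P t f) η))))))
        (trans (sumOf-+ Y _ _) (+-cong (trans (sumOf-*ˡ Y _ _) (*-congˡ (trans (sumOf-*ˡ Y α _) (*-congˡ (sum-Xpow r f η))))) (sum-cross r f η)))))))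
      where
      Xpow-Xpow : ∀ r t k g → Xpow r k (Xpow t k g) ≋ Xpow (r ℕ.+ t) k g
      Xpow-Xpow zero    t k g η = Xpow-0 k (Xpow t k g) η
      Xpow-Xpow (suc r) t k g η = trans (sym (Xpow-suc r k (Xpow t k g) η)) (trans (X-cong k {Xpow r k (Xpow t k g)} {Xpow (r ℕ.+ t) k g} (Xpow-Xpow r t k g) η) (Xpow-suc (r ℕ.+ t) k g η))
      low-sumOf : ∀ r n (xs : List ℕ) (F : ℕ → ℕ → Carrier) → low r n (λ p → sumOf xs (λ x → F x p)) ≈ sumOf xs (λ x → low r n (F x))
      low-sumOf zero    n       xs F = refl
      low-sumOf (suc r) zero    xs F = sym (sumOf-zero xs (λ _ → refl))
      low-sumOf (suc r) (suc n) xs F = low-sumOf r n xs F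
      expand : ∀ {k} → k ∈ Y → app (Xpow (suc r) k (T k (hat f Y))) η ≈ sumOf (range d) (λ t → app (Xpow (suc r ℕ.+ t) k (hat (P t f) Y)) η)
      expand {k} k∈ = trans (Xpow-cong (suc r) k {T k (hat f Y)} {⨁ (range d) (λ t → Xpow t k (hat (P t f) Y))} (T-expand d f deg k∈) η)
        (trans (low-sumOf (suc r) (η k) (range d) _) (sumOf-cong (range d) (λ t → Xpow-Xpow (suc r) t k (hat (P t f) Y) η)))

-- Power sums span the symmetric functions

module PowerSumBasis (K : CommutativeRing 0ℓ 0ℓ) (α : CommutativeRing.Carrier K) where

  open import Defs using (Partition; mkPartition; nonzero; z; u; partitionsInSquare)

  open CommutativeRing K
  open RingProperties ring using (-‿distribˡ-*; -1*x≈-x)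
  open SymmetricFunctions K
  open FiniteSums K
  open Convolution K
  open KnopSahiSupport K α using (count; count-same; count-other; count-↭; count-∈; remove; remove-↭; stab)
  open PowerSumDerivations K α using (Nice; coeff-nice; P; P-1; P-powerSum; kron-same; kron-other)
  open Nice

  coeff-zeros : ∀ f k e → coeff f (e ++ replicate k 0) ≈ coeff f e
  coeff-zeros f k e = trans (symmetric f (Perm.++-comm e (replicate k 0))) (go k)
    where
    go : ∀ k → coeff f (replicate k 0 ++ e) ≈ coeff f e
    go zero    = refl
    go (suc k) = trans (pad-nice (coeff-nice f) _) (go k)

  coeff-shape : ∀ f e → coeff f e ≈ coeff f (shape e)
  coeff-shape f e = let (k , p) = ↭-shape e in trans (symmetric f p) (coeff-zeros f k (shape e))

  coeff-≡shape : ∀ f {e e′} → shape e ≡ shape e′ → coeff f e ≈ coeff f e′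
  coeff-≡shape f {e} {e′} eq = trans (coeff-shape f e) (trans (reflexive (≡.cong (coeff f) eq)) (sym (coeff-shape f e′)))

  powerSum-picks : ∀ r {f : Fun} → (∀ {e e′} → e ↭ e′ → f e ≈ f e′) → ∀ e →
    convolve (coeff (powerSum (suc r))) f e ≈ sumPicks e (λ v e′ → low (suc r) v (λ k → f (k ∷ e′)))
  powerSum-picks r {f} h []      = powerSum-[] r f
  powerSum-picks r {f} h (n ∷ e) = trans (powerSum-∷ r f n e) (+-congˡ (trans (powerSum-picks r (h ∘ prep n) e)
    (sumPicks-cong e (λ v e′ _ → low-cong (suc r) v (λ k → h (_↭_.swap n k ↭-refl))))))

  low-ind : ∀ (Q : Carrier → Set) → Q 0# → ∀ r v {F : ℕ → Carrier} → (∀ j → v ≡ r ℕ.+ j → Q (F j)) → Q (low r v F)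
  low-ind Q q0 zero    v       h = h v ≡.refl
  low-ind Q q0 (suc r) zero    h = q0
  low-ind Q q0 (suc r) (suc v) h = low-ind Q q0 r v (λ j eq → h j (≡.cong suc eq))

  pow : List ℕ → SymFun
  pow = foldr (λ r f → powerSum r · f) 1ₛ

  pow-↭ : ∀ {ρ σ} → ρ ↭ σ → pow ρ ≈ₛ pow σ
  pow-↭ _↭_.refl         = λ _ → refl
  pow-↭ (prep {ρ} {σ} r p) = ·-cong {powerSum r} {powerSum r} {pow ρ} {pow σ} (λ _ → refl) (pow-↭ p)
  pow-↭ (_↭_.swap {ρ} {σ} r s p) e = trans (·-cong {a} {a} {b · pow ρ} {b · pow σ} (λ _ → refl) (·-cong {b} {b} {pow ρ} {pow σ} (λ _ → refl) (pow-↭ p)) e)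
    (trans (sym (·-assoc a b (pow σ) e)) (trans (·-cong {a · b} {b · a} {pow σ} {pow σ} (·-comm a b) (λ _ → refl) e) (·-assoc b a (pow σ) e)))
    where
    a b : SymFun
    a = powerSum r
    b = powerSum s
  pow-↭ (_↭_.trans p q) e = trans (pow-↭ p e) (pow-↭ q e)

  data PS : SymFun → Set where
    pows  : ∀ {ρ} → All (0 <_) ρ → PS (pow ρ)
    adds  : ∀ {f g} → PS f → PS g → PS (f +ₛ g)
    scale : ∀ a {f} → PS f → PS (a • f)
    same  : ∀ {f g} → f ≈ₛ g → PS f → PS g

  PS-powerSum : ∀ {r f} → 0 < r → PS f → PS (powerSum r · f)
  PS-powerSum r>0 (pows ps)     = pows (r>0 ∷ ps)
  PS-powerSum {r} r>0 (adds {f} {g} p q) = same (λ e → sym (·-distribˡ (powerSum r) f g e)) (adds (PS-powerSum r>0 p) (PS-powerSum r>0 q))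
  PS-powerSum {r} r>0 (scale a {f} p)  = same (λ e → sym (·-•ʳ a (powerSum r) f e)) (scale a (PS-powerSum r>0 p))
  PS-powerSum {r} r>0 (same {f} {g} eq p)    = same (·-cong {powerSum r} {powerSum r} {f} {g} (λ _ → refl) eq) (PS-powerSum r>0 p)

  ∑-ind : ∀ (Q : SymFun → Set) → Q 0ₛ → (∀ {f g} → Q f → Q g → Q (f +ₛ g)) →
    ∀ {A : Set} (F : A → SymFun) xs → (∀ x → Q (F x)) → Q (∑ (map F xs))
  ∑-ind Q q0 q+ F []       h = q0
  ∑-ind Q q0 q+ F (x ∷ xs) h = q+ (h x) (∑-ind Q q0 q+ F xs h)

  support : List ℕ → ℕ
  support e = length (nonzero e)

  support-pos : ∀ {ns} → All (0 <_) ns → support ns ≡ length ns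
  support-pos []                     = ≡.refl
  support-pos {suc n ∷ ns} (_ ∷ ps)  = ≡.cong suc (support-pos ps)

  support-zeros : ∀ k → support (replicate k 0) ≡ 0
  support-zeros zero    = ≡.refl
  support-zeros (suc k) = support-zeros k

  support-↭ : ∀ {e e′} → e ↭ e′ → support e ≡ support e′
  support-↭ p = Perm.↭-length (Perm.filter-↭ (0 ℕ.<?_) p)

  support-shape : ∀ e → support e ≡ length (shape e)
  support-shape e = let (k , p) = ↭-shape e in ≡.trans (support-↭ p) (≡.trans (≡.cong length (filter-++ (0 ℕ.<?_) (shape e) (replicate k 0)))
    (≡.trans (length-++ (nonzero (shape e))) (≡.trans (≡.cong₂ ℕ._+_ (support-pos (proj₂ (shape-isPartition e))) (support-zeros k)) (ℕ.+-identityʳ _))))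

  module Spanning (inverse : ∀ n → ∃[ y ] ⟦ suc n ⟧ * y ≈ 1#) where

    private
      zeroPS : PS 0ₛ
      zeroPS = same (λ e → zeroˡ _) (scale 0# (pows []))

      isNat : Carrier → Set
      isNat x = ∃[ n ] x ≈ ⟦ n ⟧

      δ-nat : ∀ ms ns → isNat (δ ms ns)
      δ-nat ms ns with ms Defs.≟ˡ ns
      ... | yes _ = 1 , sym ⟦1⟧
      ... | no _  = 0 , refl

      sumPicks-nat : ∀ e {G : ℕ → List ℕ → Carrier} → (∀ v e′ → isNat (G v e′)) → isNat (sumPicks e G)
      sumPicks-nat []      h = 0 , refl
      sumPicks-nat (x ∷ e) h = let (m , p) = h x e ; (n , q) = sumPicks-nat e (λ v e′ → h v (x ∷ e′)) in m ℕ.+ n , trans (+-cong p q) (sym (⟦⟧-+ m n))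

    bounded-span : ∀ k → (∀ ν → length (parts ν) ≤ k → PS (monomial ν)) → ∀ f → (∀ e → k < support e → coeff f e ≈ 0#) → PS f
    bounded-span k h f supp = same (λ e → sym (monomial-expansion f e)) (∑-ind PS zeroPS adds (λ ν → mcoeff f ν • monomial ν) (partitionsInSquare (degree f)) term)
      where
      term : ∀ ν → PS (mcoeff f ν • monomial ν)
      term ν with length (parts ν) ℕ.≤? k
      ... | yes le = scale _ (h ν le)
      ... | no gt  = same (λ e → sym (trans (*-congʳ (supp (parts ν) (ℕ.≤-trans (ℕ.≰⇒> gt) (ℕ.≤-reflexive (≡.sym (support-pos (proj₂ (isPartition ν)))))))) (zeroˡ _))) zeroPS

    -- p_r m_μ is a positive multiple of m_(r ∷ μ) up to monomials with
    -- fewer variables.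
    monomials-span : ∀ k ν → length (parts ν) ≤ k → PS (monomial ν)
    monomials-span k       (mkPartition [] isP)            le = pows []
    monomials-span (suc k) (mkPartition (zero ∷ μ) (_ , () ∷ _)) le
    monomials-span (suc k) (mkPartition (suc r ∷ μ) isP@(link , _ ∷ pos)) (s≤s le) =
      same (λ e → result e) (scale c⁻¹ (adds lead (scale (- 1#) (bounded-span k (monomials-span k) rest rest-support))))
      where
      ν : List ℕ
      ν = suc r ∷ μ
      tail-linked : ∀ {μ} → Linked _≥_ (suc r ∷ μ) → Linked _≥_ μ
      tail-linked [-]     = []
      tail-linked (_ ∷ l) = l
      isP-μ : IsPartition μ
      isP-μ = tail-linked link , pos
      m : SymFun
      m = orbitSum μ
      q : SymFun
      q = powerSum (suc r) · m
      c : Carrier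
      c = coeff q ν
      lead : PS q
      lead = PS-powerSum (s≤s z≤n) (monomials-span k (mkPartition μ isP-μ) le)
      rest : SymFun
      rest = q +ₛ (- c) • orbitSum ν
      -- The coefficient is a sum of zeros and ones in which the pick of the first part of `ν` gives
      -- 1, so it is positive without being computed.
      c-nat : ∃[ n ] c ≈ ⟦ suc n ⟧
      c-nat = let (n , eq) = sumPicks-nat μ (λ v e′ → low-ind isNat (0 , refl) (suc r) v (λ j _ → δ-nat (shape (j ∷ suc r ∷ e′)) μ)) in
        n , trans (powerSum-picks r (symmetric m) ν) (+-cong (trans (low-self (suc r) _) (δ-≡ (shape-partition isP-μ))) eq)
        where
        low-self : ∀ r F → low r r F ≈ F 0
        low-self zero    F = refl
        low-self (suc r) F = low-self r F
      c⁻¹ : Carrier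
      c⁻¹ = proj₁ (inverse (proj₁ c-nat))
      c-inv : c⁻¹ * c ≈ 1#
      c-inv = trans (*-comm _ _) (trans (*-congʳ (proj₂ c-nat)) (proj₂ (inverse (proj₁ c-nat))))
      result : ∀ e → c⁻¹ * (coeff q e + - 1# * (coeff q e + - c * coeff (orbitSum ν) e)) ≈ coeff (orbitSum ν) e
      result e = trans (*-congˡ (trans (+-congˡ (trans (distribˡ _ _ _) (+-cong (-1*x≈-x _) (trans (-1*x≈-x _) (trans (-‿distribˡ-* _ _) (*-congʳ (-‿involutive c)))))))
          (trans (sym (+-assoc _ _ _)) (trans (+-congʳ (-‿inverseʳ _)) (+-identityˡ _)))))
        (trans (sym (*-assoc _ _ _)) (trans (*-congʳ c-inv) (*-identityˡ _)))
        where open RingProperties ring using (-‿involutive)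
      -- As `μ` has at most `k` parts, an `e` with more than `k` nonzero exponents is reached only
      -- if the power sum brings in a new variable, and then its shape is `ν`.
      miss : ∀ e → k < support e → shape e ≢ ν → coeff q e ≈ 0#
      miss e lt ne = trans (powerSum-picks r (symmetric m) e) (sumPicks-zero e (λ v e′ p → low-ind (_≈ 0#) refl (suc r) v (λ j v≡ → term v e′ p j v≡)))
        where
        term : ∀ v e′ → v ∷ e′ ↭ e → ∀ j → v ≡ suc r ℕ.+ j → coeff m (j ∷ e′) ≈ 0#
        term v e′ p (suc j) ≡.refl = δ-≢ (shape (suc j ∷ e′)) μ (λ eq → ℕ.<⇒≱ (ℕ.≤-trans lt (ℕ.≤-reflexive (≡.sym (support-↭ p))))
          (ℕ.≤-trans (ℕ.≤-reflexive (≡.trans (support-shape (suc j ∷ e′)) (≡.cong length eq))) le))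
        term v e′ p zero ≡.refl = δ-≢ (shape (0 ∷ e′)) μ (λ eq → ne (≡.trans (shape-↭ (↭-sym p))
          (≡.trans (≡.cong (λ x → shape (x ∷ e′)) (ℕ.+-identityʳ (suc r)))
          (shape-pads isP {k = proj₁ (↭-shape e′)} (prep (suc r) (≡.subst (λ s → e′ ↭ s ++ replicate (proj₁ (↭-shape e′)) 0) eq (proj₂ (↭-shape e′))))))))
      rest-support : ∀ e → k < support e → coeff rest e ≈ 0#
      rest-support e lt = go (shape e Defs.≟ˡ ν)
        where
        go : Dec (shape e ≡ ν) → coeff rest e ≈ 0#
        go (yes eq) = trans (+-cong (coeff-≡shape q {e} {ν} (≡.trans eq (≡.sym (shape-partition isP)))) (trans (*-congˡ (δ-≡ eq)) (*-identityʳ _))) (-‿inverseʳ _)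
        go (no ne)  = trans (+-cong (miss e lt ne) (trans (*-congˡ (δ-≢ (shape e) ν ne)) (zeroʳ _))) (+-identityˡ _)

    spanning : ∀ f → PS f
    spanning f = bounded-span (degree f) (monomials-span (degree f)) f (λ e lt → bounded f e (ℕ.≤-trans lt (support≤sum e)))
      where
      support≤sum : ∀ e → support e ≤ sum e
      support≤sum []          = z≤n
      support≤sum (zero ∷ e)  = support≤sum e
      support≤sum (suc x ∷ e) = s≤s (ℕ.≤-trans (support≤sum e) (ℕ.m≤n+m _ x))

  positive-shape : ∀ {ρ} → All (0 <_) ρ → ρ ↭ shape ρ
  positive-shape {ρ} pos = let (k , p) = ↭-shape ρ in go k p
    where
    go : ∀ k → ρ ↭ shape ρ ++ replicate k 0 → ρ ↭ shape ρ
    go zero    p = ↭-trans p (↭-reflexive (++-identityʳ _))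
    go (suc k) p with All.lookup pos (Perm.∈-resp-↭ (↭-sym p) (∈-++⁺ʳ (shape ρ) (here ≡.refl)))
    ... | ()

  toPartition : List ℕ → Partition
  toPartition ρ = mkPartition (shape ρ) (shape-isPartition ρ)

  prodTo : ℕ → (ℕ → ℕ) → ℕ
  prodTo B F = product (map F (map suc (upTo B)))

  prodTo-suc : ∀ B F → prodTo (suc B) F ≡ prodTo B F ℕ.* F (suc B)
  prodTo-suc B F = ≡.trans (≡.cong (λ l → product (map F (map suc l))) (≡.sym (upTo-∷ʳ B)))
    (≡.trans (≡.cong (product ∘ map F) (map-++ suc (upTo B) (B ∷ []))) (≡.trans (≡.cong product (map-++ F (map suc (upTo B)) (suc B ∷ [])))
    (≡.trans (product-++ (map F (map suc (upTo B))) (F (suc B) ∷ [])) (≡.cong (prodTo B F ℕ.*_) (ℕ.*-identityʳ _)))))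

  prodTo-cong : ∀ B {F G} → (∀ i → F i ≡ G i) → prodTo B F ≡ prodTo B G
  prodTo-cong zero    h = ≡.refl
  prodTo-cong (suc B) {F} {G} h = ≡.trans (prodTo-suc B F) (≡.trans (≡.cong₂ ℕ._*_ (prodTo-cong B h) (h (suc B))) (≡.sym (prodTo-suc B G)))

  prodTo-extend : ∀ B k {F} → (∀ i → B < i → F i ≡ 1) → prodTo (k ℕ.+ B) F ≡ prodTo B F
  prodTo-extend B zero    h = ≡.refl
  prodTo-extend B (suc k) {F} h = ≡.trans (prodTo-suc (k ℕ.+ B) F) (≡.trans (≡.cong₂ ℕ._*_ (prodTo-extend B k h) (h (suc (k ℕ.+ B)) (s≤s (ℕ.m≤n+m B k)))) (ℕ.*-identityʳ _))

  prodTo-change : ∀ {x m F G} B → x ≢ 0 → x ≤ B → (∀ i → i ≢ x → F i ≡ G i) → F x ≡ m ℕ.* G x → prodTo B F ≡ m ℕ.* prodTo B G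
  prodTo-change {zero}  zero x≢0 le h eq = ⊥-elim (x≢0 ≡.refl)
  prodTo-change {x} {m} {F} {G} (suc B) x≢0 le h eq with x ℕ.≟ suc B
  ... | yes ≡.refl = ≡.trans (prodTo-suc B F) (≡.trans (≡.cong₂ ℕ._*_ (below B ℕ.≤-refl) eq)
      (≡.trans (≡.sym (ℕ.*-assoc (prodTo B G) m _)) (≡.trans (≡.cong (ℕ._* G (suc B)) (ℕ.*-comm (prodTo B G) m)) (≡.trans (ℕ.*-assoc m (prodTo B G) _) (≡.cong (m ℕ.*_) (≡.sym (prodTo-suc B G)))))))
    where
    below : ∀ C → C ≤ B → prodTo C F ≡ prodTo C G
    below zero    _  = ≡.refl
    below (suc C) le = ≡.trans (prodTo-suc C F) (≡.trans (≡.cong₂ ℕ._*_ (below C (ℕ.≤-trans (ℕ.n≤1+n C) le)) (h (suc C) (λ e → ℕ.<-irrefl (ℕ.suc-injective e) le))) (≡.sym (prodTo-suc C G)))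
  ... | no ne = ≡.trans (prodTo-suc B F) (≡.trans (≡.cong₂ ℕ._*_ (prodTo-change {m = m} B x≢0 (ℕ.≤-pred (ℕ.≤∧≢⇒< le ne)) h eq) (h (suc B) (ne ∘ ≡.sym)))
      (≡.trans (ℕ.*-assoc m (prodTo B G) _) (≡.cong (m ℕ.*_) (≡.sym (prodTo-suc B G)))))

  -- The common form of `z` and `u`: one factor for each `i`, depending on the multiplicity of `i`.
  -- As a missing `i` gives 1 by `w0`, cutting off at the size is harmless, and a new part changes
  -- one factor.
  module MultiplicityProduct (w : ℕ → ℕ → ℕ) (step : ℕ → ℕ → ℕ) (w0 : ∀ i → w i 0 ≡ 1) (ws : ∀ i c → w i (suc c) ≡ step i c ℕ.* w i c) where

    W : List ℕ → ℕ
    W ns = prodTo (sum ns) (λ i → w i (count i ns))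

    W-↭ : ∀ {ns ms} → ns ↭ ms → W ns ≡ W ms
    W-↭ {ns} {ms} p = ≡.trans (≡.cong (λ B → prodTo B (λ i → w i (count i ns))) (sum-↭ p)) (prodTo-cong (sum ms) (λ i → ≡.cong (w i) (count-↭ i p)))

    W-∷ : ∀ {r} ns → 0 < r → W (r ∷ ns) ≡ step r (count r ns) ℕ.* W ns
    W-∷ {suc r} ns r>0 = ≡.trans (prodTo-change {m = step (suc r) (count (suc r) ns)} (suc r ℕ.+ sum ns) (λ ()) (ℕ.m≤m+n (suc r) (sum ns)) (λ i ne → ≡.cong (w i) (count-other ns ne))
        (≡.trans (≡.cong (w (suc r)) (count-same (suc r) ns)) (ws (suc r) (count (suc r) ns))))
      (≡.cong (step (suc r) (count (suc r) ns) ℕ.*_) (prodTo-extend (sum ns) (suc r) (λ i lt → ≡.trans (≡.cong (w i) (count-∈ ns (λ i∈ → ℕ.<⇒≱ lt (mem ns i∈)))) (w0 i))))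
      where
      mem : ∀ {i} ns → i ∈ ns → i ≤ sum ns
      mem (n ∷ ns) (here ≡.refl) = ℕ.m≤m+n n _
      mem (n ∷ ns) (there q)     = ℕ.≤-trans (mem ns q) (ℕ.m≤n+m _ n)

  private
    *-middle : ∀ i p s f → (i ℕ.* p) ℕ.* (s ℕ.* f) ≡ (i ℕ.* s) ℕ.* (p ℕ.* f)
    *-middle = solve-∀
    module Z = MultiplicityProduct (λ i c → i ℕ.^ c ℕ.* c !) (λ i c → i ℕ.* suc c) (λ i → ≡.refl)
      (λ i c → *-middle i (i ℕ.^ c) (suc c) (c !))
    module U = MultiplicityProduct (λ i c → c !) (λ i c → suc c) (λ i → ≡.refl) (λ i c → ≡.refl)

  z-∷ : ∀ {r ρ} → 0 < r → All (0 <_) ρ → z (toPartition (r ∷ ρ)) ≡ (r ℕ.* suc (count r ρ)) ℕ.* z (toPartition ρ)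
  z-∷ {r} {ρ} r>0 pos = ≡.trans (Z.W-↭ (↭-sym (positive-shape (r>0 ∷ pos)))) (≡.trans (Z.W-∷ ρ r>0)
    (≡.cong ((r ℕ.* suc (count r ρ)) ℕ.*_) (Z.W-↭ (positive-shape pos))))

  u-stab : ∀ θ → u θ ≡ stab (parts θ)
  u-stab θ = go (proj₂ (isPartition θ))
    where
    go : ∀ {ns} → All (0 <_) ns → U.W ns ≡ stab ns
    go []                    = ≡.refl
    go {suc n ∷ ns} (p ∷ ps) = ≡.trans (U.W-∷ ns p) (≡.cong (suc (count (suc n) ns) ℕ.*_) (go ps))

  P-pow : ∀ r {τ} → All (0 <_) τ → P r (pow τ) ≈ₛ ⟦ r ℕ.* count r τ ⟧ • pow (remove r τ)
  P-pow r []                       e = trans (P-1 r e) (sym (trans (*-congʳ (reflexive (≡.cong ⟦_⟧ (ℕ.*-zeroʳ r)))) (zeroˡ _)))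
  P-pow r {suc s ∷ τ} (_ ∷ pos) e with r ℕ.≟ suc s
  ... | yes ≡.refl = trans (P-powerSum r s (pow τ) e) (trans (+-cong (*-congʳ (trans (*-congʳ (kron-same r)) (*-identityˡ _)))
        (trans (·-cong {powerSum r} {powerSum r} {P r (pow τ)} {⟦ r ℕ.* count r τ ⟧ • pow (remove r τ)} (λ _ → refl) (P-pow r pos) e) (trans (·-•ʳ _ (powerSum r) (pow (remove r τ)) e) (again (r ∈? τ)))))
      (trans (sym (distribʳ _ _ _)) (*-congʳ (trans (sym (⟦⟧-+ r (r ℕ.* count r τ))) (reflexive (≡.cong ⟦_⟧ (≡.trans (≡.sym (ℕ.*-suc r (count r τ))) (≡.cong (r ℕ.*_) (≡.sym (count-same r τ))))))))))
    where
    again : Dec (r ∈ τ) → ⟦ r ℕ.* count r τ ⟧ * coeff (pow (r ∷ remove r τ)) e ≈ ⟦ r ℕ.* count r τ ⟧ * coeff (pow τ) e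
    again (yes r∈) = *-congˡ (pow-↭ (↭-sym (remove-↭ r∈)) e)
    again (no r∉)  = trans (*-congʳ zero-count) (trans (zeroˡ _) (sym (trans (*-congʳ zero-count) (zeroˡ _))))
      where
      zero-count : ⟦ r ℕ.* count r τ ⟧ ≈ 0#
      zero-count = reflexive (≡.cong ⟦_⟧ (≡.trans (≡.cong (r ℕ.*_) (count-∈ τ r∉)) (ℕ.*-zeroʳ r)))
  ... | no ne = trans (P-powerSum r s (pow τ) e) (trans (+-cong (trans (*-congʳ (trans (*-congʳ (kron-other ne)) (zeroˡ _))) (zeroˡ _))
        (trans (·-cong {powerSum (suc s)} {powerSum (suc s)} {P r (pow τ)} {⟦ r ℕ.* count r τ ⟧ • pow (remove r τ)} (λ _ → refl) (P-pow r pos) e) (·-•ʳ _ (powerSum (suc s)) (pow (remove r τ)) e)))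
      (trans (+-identityˡ _) (*-congʳ (reflexive (≡.cong (λ c → ⟦ r ℕ.* c ⟧) (≡.sym (count-other τ ne)))))))

-- Adjoints, one-row functions and anisotropy

module JackForm (K : CommutativeRing 0ℓ 0ℓ) (α : CommutativeRing.Carrier K) where

  open import Defs using (mkPartition; z; ℓ)

  open CommutativeRing K
  open Solver commutativeSemiring using (solve; _:=_; _:+_; _:*_)
  open RingProperties ring using (-0#≈0#)
  open RawSemiringDefinitions (Semiring.rawSemiring semiring) using (_^_)
  open Antidiagonal K
  open SymmetricFunctions K
  open FiniteSums K
  open Convolution K
  open KnopSahiSupport K α using (count; count-same; count-↭; count-∈; remove; remove-↭)
  open KnopSahiSymmetry K α using (sumPicks-replicate)
  open PowerSumDerivations K α
  open PowerSumBasis K α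
  open Nice

  -- What the argument needs to know about ℚ(α)
  record JackField : Set₁ where
    field
      invertible : ∀ a b → a ℕ.+ b ≢ 0 → ∃[ y ] (⟦ a ⟧ * α + ⟦ b ⟧) * y ≈ 1#
      separated  : ∀ a b a′ b′ {x} → b ≢ b′ → (α * ⟦ a ⟧ + ⟦ b ⟧) * x ≈ (α * ⟦ a′ ⟧ + ⟦ b′ ⟧) * x → x ≈ 0#
      nontrivial : ¬ (1# ≈ 0#)
      reciprocal : ∀ x → ¬ (x ≈ 0#) → ∃[ y ] x * y ≈ 1#
      square-0   : ∀ x → x * x ≈ 0# → x ≈ 0#
      NonNeg     : Carrier → Set
      NonNeg-≈   : ∀ {x y} → x ≈ y → NonNeg x → NonNeg y
      NonNeg-0   : NonNeg 0#
      NonNeg-+   : ∀ {x y} → NonNeg x → NonNeg y → NonNeg (x + y)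
      NonNeg-sq  : ∀ n l x → NonNeg (⟦ n ⟧ * (α ^ l) * (x * x))
      NonNeg-sum : ∀ {x y} → NonNeg x → NonNeg y → x + y ≈ 0# → x ≈ 0#

    inverse-nat : ∀ n → ∃[ y ] ⟦ suc n ⟧ * y ≈ 1#
    inverse-nat n = let (y , eq) = invertible 0 (suc n) (λ ()) in y , trans (*-congʳ (sym (trans (+-congʳ (zeroˡ α)) (+-identityˡ _)))) eq

    inverse-α : ∃[ y ] α * y ≈ 1#
    inverse-α = let (y , eq) = invertible 1 0 (λ ()) in y , trans (*-congʳ (sym (trans (+-identityʳ _) (trans (*-congʳ ⟦1⟧) (*-identityˡ _))))) eq

    cancel-unit : ∀ {u x y} → ∃[ v ] u * v ≈ 1# → u * x ≈ u * y → x ≈ y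
    cancel-unit {u} {x} {y} (v , uv) eq = trans (sym (one-times x)) (trans (*-congˡ eq) (one-times y))
      where
      one-times : ∀ x → v * (u * x) ≈ x
      one-times x = trans (sym (*-assoc _ _ _)) (trans (*-congʳ (trans (*-comm _ _) uv)) (*-identityˡ _))

    unit-* : ∀ {u v} → ∃[ y ] u * y ≈ 1# → ∃[ y ] v * y ≈ 1# → ∃[ y ] (u * v) * y ≈ 1#
    unit-* {u} {v} (x , ux) (y , vy) = x * y , trans (solve 4 (λ u v x y → (u :* v) :* (x :* y) := (u :* x) :* (v :* y)) refl u v x y)
      (trans (*-cong ux vy) (*-identityˡ 1#))

    unit-^ : ∀ n → ∃[ y ] (α ^ n) * y ≈ 1#
    unit-^ zero    = 1# , *-identityˡ 1#
    unit-^ (suc n) = unit-* inverse-α (unit-^ n)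

  record ScalarProduct (⟨_,_⟩ : SymFun → SymFun → Carrier) : Set where
    field
      cong        : ∀ {f f′ g g′} → f ≈ₛ f′ → g ≈ₛ g′ → ⟨ f , g ⟩ ≈ ⟨ f′ , g′ ⟩
      commutative : ∀ f g → ⟨ f , g ⟩ ≈ ⟨ g , f ⟩
      additive    : ∀ f g h → ⟨ f +ₛ g , h ⟩ ≈ ⟨ f , h ⟩ + ⟨ g , h ⟩
      homogeneous : ∀ a f g → ⟨ a • f , g ⟩ ≈ a * ⟨ f , g ⟩
      orthogonal  : ∀ θ μ → parts θ ≢ parts μ → ⟨ powerSums θ , powerSums μ ⟩ ≈ 0#
      norm        : ∀ θ → ⟨ powerSums θ , powerSums θ ⟩ ≈ ⟦ z θ ⟧ * (α ^ ℓ θ)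

  module Form (F : JackField) (⟨_,_⟩ : SymFun → SymFun → Carrier) (S : ScalarProduct ⟨_,_⟩) where
    open JackField F
    open ScalarProduct S public

    congˡ : ∀ {f f′ h} → f ≈ₛ f′ → ⟨ f , h ⟩ ≈ ⟨ f′ , h ⟩
    congˡ {f} {f′} {h} p = cong {f} {f′} {h} {h} p (λ _ → refl)

    congʳ : ∀ {f h h′} → h ≈ₛ h′ → ⟨ f , h ⟩ ≈ ⟨ f , h′ ⟩
    congʳ {f} {h} {h′} p = cong {f} {f} {h} {h′} (λ _ → refl) p

    additiveʳ : ∀ f g h → ⟨ f , g +ₛ h ⟩ ≈ ⟨ f , g ⟩ + ⟨ f , h ⟩
    additiveʳ f g h = trans (commutative f (g +ₛ h)) (trans (additive g h f) (+-cong (commutative g f) (commutative h f)))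

    homogeneousʳ : ∀ a f g → ⟨ f , a • g ⟩ ≈ a * ⟨ f , g ⟩
    homogeneousʳ a f g = trans (commutative f (a • g)) (trans (homogeneous a g f) (*-congˡ (commutative g f)))

    zeroˡ′ : ∀ {f h} → f ≈ₛ 0ₛ → ⟨ f , h ⟩ ≈ 0#
    zeroˡ′ {f} {h} p = trans (congˡ {f} {0# • 0ₛ} {h} (λ e → trans (p e) (sym (zeroˡ _)))) (trans (homogeneous 0# 0ₛ h) (zeroˡ _))

    zeroʳ′ : ∀ {f h} → h ≈ₛ 0ₛ → ⟨ f , h ⟩ ≈ 0#
    zeroʳ′ {f} {h} p = trans (commutative f h) (zeroˡ′ p)

    open Spanning inverse-nat public

    orthogonal-pow : ∀ {ρ σ} → All (0 <_) ρ → All (0 <_) σ → ¬ (ρ ↭ σ) → ⟨ pow ρ , pow σ ⟩ ≈ 0#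
    orthogonal-pow {ρ} {σ} pρ pσ ne = trans (cong {pow ρ} {pow (shape ρ)} {pow σ} {pow (shape σ)} (pow-↭ (positive-shape pρ)) (pow-↭ (positive-shape pσ)))
      (orthogonal (toPartition ρ) (toPartition σ) (λ eq → ne (↭-trans (positive-shape pρ) (↭-trans (↭-reflexive eq) (↭-sym (positive-shape pσ))))))

    norm-pow : ∀ {ρ} → All (0 <_) ρ → ⟨ pow ρ , pow ρ ⟩ ≈ ⟦ z (toPartition ρ) ⟧ * (α ^ length ρ)
    norm-pow {ρ} pρ = trans (cong {pow ρ} {pow (shape ρ)} {pow ρ} {pow (shape ρ)} (pow-↭ (positive-shape pρ)) (pow-↭ (positive-shape pρ)))
      (trans (norm (toPartition ρ)) (*-congˡ (reflexive (≡.cong (α ^_) (≡.sym (Perm.↭-length (positive-shape pρ)))))))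

    private
      remove-pos : ∀ r {σ} → All (0 <_) σ → All (0 <_) (remove r σ)
      remove-pos r []                   = []
      remove-pos r {x ∷ σ} (p ∷ ps) with r ℕ.≟ x
      ... | yes _ = ps
      ... | no _  = p ∷ remove-pos r ps

      -- Unless `σ` is `ρ` with a part `r` inserted, both sides vanish. Otherwise `z` grows by the
      -- factor `r` times the multiplicity of `r` in `σ`, which is the coefficient in `P-pow`, and
      -- the power of `α` by one.
      adjoint-pow : ∀ r {ρ σ} → 0 < r → All (0 <_) ρ → All (0 <_) σ → ⟨ pow (r ∷ ρ) , pow σ ⟩ ≈ α * ⟨ pow ρ , P r (pow σ) ⟩
      adjoint-pow r {ρ} {σ} r>0 pρ pσ = trans (go (r ∈? σ)) (*-congˡ (sym (trans (congʳ {pow ρ} {P r (pow σ)} (P-pow r pσ)) (homogeneousʳ _ (pow ρ) (pow τ)))))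
        where
        τ : List ℕ
        τ = remove r σ
        pτ : All (0 <_) τ
        pτ = remove-pos r pσ
        rhs : Carrier
        rhs = α * (⟦ r ℕ.* count r σ ⟧ * ⟨ pow ρ , pow τ ⟩)
        go : Dec (r ∈ σ) → ⟨ pow (r ∷ ρ) , pow σ ⟩ ≈ rhs
        go (no r∉) = trans (orthogonal-pow (r>0 ∷ pρ) pσ (λ p → r∉ (Perm.∈-resp-↭ p (here ≡.refl))))
          (sym (trans (*-congˡ (trans (*-congʳ (reflexive (≡.cong ⟦_⟧ (≡.trans (≡.cong (r ℕ.*_) (count-∈ σ r∉)) (ℕ.*-zeroʳ r))))) (zeroˡ _))) (zeroʳ _)))
        go (yes r∈) = inner (shape ρ ≟ˡ shape τ)
          where
          inner : Dec (shape ρ ≡ shape τ) → ⟨ pow (r ∷ ρ) , pow σ ⟩ ≈ rhs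
          inner (yes eq) = trans (congʳ {pow (r ∷ ρ)} {pow σ} {pow (r ∷ ρ)} (pow-↭ (↭-trans (remove-↭ r∈) (prep r (↭-sym ρ↭τ)))))
            (trans (norm-pow (r>0 ∷ pρ)) (trans (*-congʳ (trans (reflexive (≡.cong ⟦_⟧ (z-∷ r>0 pρ))) (⟦⟧-* (r ℕ.* suc (count r ρ)) _)))
            (trans (solve 4 (λ k z a b → (k :* z) :* (a :* b) := a :* (k :* (z :* b))) refl _ _ α _)
            (*-congˡ (*-cong (reflexive (≡.cong (λ c → ⟦ r ℕ.* c ⟧) counts)) (sym (trans (congʳ {pow ρ} {pow τ} {pow ρ} (pow-↭ (↭-sym ρ↭τ))) (norm-pow pρ))))))))
            where
            ρ↭τ : ρ ↭ τ
            ρ↭τ = ↭-trans (positive-shape pρ) (↭-trans (↭-reflexive eq) (↭-sym (positive-shape pτ)))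
            counts : suc (count r ρ) ≡ count r σ
            counts = ≡.sym (≡.trans (count-↭ r (remove-↭ r∈)) (≡.trans (count-same r τ) (≡.cong suc (count-↭ r (↭-sym ρ↭τ)))))
          inner (no ne) = trans (orthogonal-pow (r>0 ∷ pρ) pσ (λ p → ne (shape-↭ (Perm.drop-∷ (↭-trans p (remove-↭ r∈))))))
            (sym (trans (*-congˡ (trans (*-congˡ (orthogonal-pow pρ pτ (λ p → ne (shape-↭ p)))) (zeroʳ _))) (zeroʳ _)))

    adjoint : ∀ {r} → 0 < r → ∀ f h → ⟨ powerSum r · f , h ⟩ ≈ α * ⟨ f , P r h ⟩
    adjoint {r} r>0 f h = outer (spanning f)
      where
      p : SymFun
      p = powerSum r
      inner : ∀ {ρ h} → All (0 <_) ρ → PS h → ⟨ pow (r ∷ ρ) , h ⟩ ≈ α * ⟨ pow ρ , P r h ⟩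
      inner pρ (pows pσ) = adjoint-pow r r>0 pρ pσ
      inner {ρ} pρ (adds {f} {g} x y) = trans (additiveʳ (pow (r ∷ ρ)) f g) (trans (+-cong (inner pρ x) (inner pρ y)) (trans (sym (distribˡ _ _ _))
        (*-congˡ (sym (trans (congʳ {pow ρ} {P r (f +ₛ g)} (P-+ r f g)) (additiveʳ (pow ρ) (P r f) (P r g)))))))
      inner {ρ} pρ (scale a {f} x) = trans (homogeneousʳ a (pow (r ∷ ρ)) f) (trans (*-congˡ (inner pρ x)) (trans (solve 3 (λ a b c → a :* (b :* c) := b :* (a :* c)) refl a α _)
        (*-congˡ (sym (trans (congʳ {pow ρ} {P r (a • f)} (P-• r a f)) (homogeneousʳ a (pow ρ) (P r f)))))))
      inner {ρ} pρ (same {f} {g} eq x) = trans (congʳ {pow (r ∷ ρ)} {g} {f} (λ e → sym (eq e))) (trans (inner pρ x) (*-congˡ (congʳ {pow ρ} {P r f} {P r g} (P-cong r {f} {g} eq))))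
      outer : ∀ {f} → PS f → ⟨ p · f , h ⟩ ≈ α * ⟨ f , P r h ⟩
      outer (pows pρ) = inner pρ (spanning h)
      outer (adds {f} {g} x y) = trans (congˡ {p · (f +ₛ g)} {p · f +ₛ p · g} {h} (·-distribˡ p f g)) (trans (additive (p · f) (p · g) h)
        (trans (+-cong (outer x) (outer y)) (trans (sym (distribˡ _ _ _)) (*-congˡ (sym (additive f g (P r h)))))))
      outer (scale a {f} x) = trans (congˡ {p · (a • f)} {a • (p · f)} {h} (·-•ʳ a p f)) (trans (homogeneous a (p · f) h) (trans (*-congˡ (outer x))
        (trans (solve 3 (λ a b c → a :* (b :* c) := b :* (a :* c)) refl a α _) (*-congˡ (sym (homogeneous a f (P r h)))))))
      outer (same {f} {g} eq x) = trans (congˡ {p · g} {p · f} {h} (·-cong {p} {p} {g} {f} (λ _ → refl) (λ e → sym (eq e)))) (trans (outer x) (*-congˡ (congˡ {f} {g} {P r h} eq)))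

    Below : ℕ → Fun → Set
    Below a f = ∀ e → Any (a <_) e → f e ≈ 0#

    -- `P r f` is assembled from coefficients of `f` at longer exponent lists, where an entry above
    -- `a` is still present.
    P-below : ∀ {a} r f → Below a (coeff f) → Below a (coeff (P r f))
    P-below {a} r f h = pSeq-ind (Below a) (λ hf hg e q → trans (+-cong (hf e q) (-‿cong (hg e q))) (trans (+-identityˡ _) -0#≈0#))
      (λ k hf e q → hf (k ∷ e) (there q)) r {derivs (coeff f)} (λ k e q → trans (*-congˡ (h (k ∷ e) (there q))) (zeroʳ _))

    -- For a product of power sums the adjoint is a composition of operators `α P r`, and linearity
    -- reaches every `q`. The field `below` is kept because first rows are bounded through the
    -- largest exponent.
    record Dual (q : SymFun) : Set where
      field
        op    : SymFun → SymFun
        dual  : ∀ f h → ⟨ q · f , h ⟩ ≈ ⟨ f , op h ⟩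
        below : ∀ {a} h → Below a (coeff h) → Below a (coeff (op h))
    open Dual

    private
      dual-pow : ∀ {ρ} → All (0 <_) ρ → Dual (pow ρ)
      dual-pow [] = record { op = λ h → h ; dual = λ f h → congˡ {1ₛ · f} {f} {h} (·-identityˡ f) ; below = λ h b → b }
      dual-pow {r ∷ ρ} (r>0 ∷ pρ) = record
        { op    = λ h → α • op D (P r h)
        ; dual  = λ f h → trans (congˡ {(powerSum r · pow ρ) · f} {powerSum r · (pow ρ · f)} {h} (·-assoc (powerSum r) (pow ρ) f))
            (trans (adjoint r>0 (pow ρ · f) h) (trans (*-congˡ (dual D f (P r h))) (sym (homogeneousʳ α f (op D (P r h))))))
        ; below = λ h b e q → trans (*-congˡ (below D (P r h) (P-below r h b) e q)) (zeroʳ _) }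
        where
        D : Dual (pow ρ)
        D = dual-pow pρ

      dual-PS : ∀ {q} → PS q → Dual q
      dual-PS (pows pρ) = dual-pow pρ
      dual-PS (adds {f} {g} x y) = record
        { op    = λ h → op (dual-PS x) h +ₛ op (dual-PS y) h
        ; dual  = λ k h → trans (congˡ {(f +ₛ g) · k} {f · k +ₛ g · k} {h} (·-distribʳ f g k)) (trans (additive (f · k) (g · k) h)
            (trans (+-cong (dual (dual-PS x) k h) (dual (dual-PS y) k h)) (sym (additiveʳ k (op (dual-PS x) h) (op (dual-PS y) h)))))
        ; below = λ h b e q → trans (+-cong (below (dual-PS x) h b e q) (below (dual-PS y) h b e q)) (+-identityˡ _) }
      dual-PS (scale a {f} x) = record
        { op    = λ h → a • op (dual-PS x) h
        ; dual  = λ k h → trans (congˡ {(a • f) · k} {a • (f · k)} {h} (·-•ˡ a f k)) (trans (homogeneous a (f · k) h)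
            (trans (*-congˡ (dual (dual-PS x) k h)) (sym (homogeneousʳ a k (op (dual-PS x) h)))))
        ; below = λ h b e q → trans (*-congˡ (below (dual-PS x) h b e q)) (zeroʳ _) }
      dual-PS (same {f} {g} eq x) = record
        { op    = op (dual-PS x)
        ; dual  = λ k h → trans (congˡ {g · k} {f · k} {h} (·-cong {g} {f} {k} {k} (λ e → sym (eq e)) (λ _ → refl))) (dual (dual-PS x) k h)
        ; below = below (dual-PS x) }

    dualOf : ∀ q → Dual q
    dualOf q = dual-PS (spanning q)

    -- The coefficient of x^k of an adjoined variable x
    E : ℕ → SymFun → SymFun
    E k f = record
      { coeff     = λ e → coeff f (k ∷ e)
      ; symmetric = λ p → symmetric f (prep k p)
      ; padding   = λ e → padding f (k ∷ e)
      ; degree    = degree f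
      ; bounded   = λ e lt → bounded f (k ∷ e) (ℕ.≤-trans lt (ℕ.m≤n+m _ k)) }

    antidiagₛ : ℕ → (ℕ → ℕ → SymFun) → SymFun
    antidiagₛ zero    G = G 0 0
    antidiagₛ (suc n) G = G 0 (suc n) +ₛ antidiagₛ n (λ i j → G (suc i) j)

    coeff-antidiagₛ : ∀ n G e → coeff (antidiagₛ n G) e ≈ antidiag n (λ i j → coeff (G i j) e)
    coeff-antidiagₛ zero    G e = refl
    coeff-antidiagₛ (suc n) G e = +-congˡ (coeff-antidiagₛ n _ e)

    form-antidiagₛ : ∀ n G h → ⟨ antidiagₛ n G , h ⟩ ≈ antidiag n (λ i j → ⟨ G i j , h ⟩)
    form-antidiagₛ zero    G h = refl
    form-antidiagₛ (suc n) G h = trans (additive (G 0 (suc n)) (antidiagₛ n (λ i j → G (suc i) j)) h) (+-congˡ (form-antidiagₛ n _ h))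

    ·-antidiagₛ : ∀ n G f → antidiagₛ n G · f ≈ₛ antidiagₛ n (λ i j → G i j · f)
    ·-antidiagₛ zero    G f e = refl
    ·-antidiagₛ (suc n) G f e = trans (·-distribʳ (G 0 (suc n)) (antidiagₛ n (λ i j → G (suc i) j)) f e) (+-congˡ (·-antidiagₛ n _ f e))

    -- g is the one-row function usually written g_k.
    record Row (k : ℕ) : Set where
      field
        g     : SymFun
        adj   : ∀ f h → ⟨ g · f , h ⟩ ≈ ⟨ f , E k h ⟩
        ones  : (α ^ k) * coeff g (replicate k 1) ≈ 1#
    open Row

    private
      powerSum-ones : ∀ r f n → coeff (powerSum (suc (suc r)) · f) (replicate n 1) ≈ 0#
      powerSum-ones r f n = trans (powerSum-picks (suc r) (symmetric f) (replicate n 1)) (go n)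
        where
        go : ∀ n → sumPicks (replicate n 1) (λ v e′ → low (suc (suc r)) v (λ k → coeff f (k ∷ e′))) ≈ 0#
        go n = sumPicks-zero (replicate n 1) (λ v e′ p → vanish v e′ (ones-entry n (Perm.∈-resp-↭ p (here ≡.refl))))
          where
          ones-entry : ∀ n {v} → v ∈ replicate n 1 → v ≡ 1
          ones-entry (suc n) (here eq) = eq
          ones-entry (suc n) (there p) = ones-entry n p
          vanish : ∀ v e′ → v ≡ 1 → low (suc (suc r)) v (λ k → coeff f (k ∷ e′)) ≈ 0#
          vanish v e′ ≡.refl = refl

      p1-ones : ∀ f n → coeff (powerSum 1 · f) (replicate (suc n) 1) ≈ ⟦ suc n ⟧ * coeff f (replicate n 1)
      p1-ones f n = trans (powerSum-picks 0 (symmetric f) (replicate (suc n) 1)) (trans (sumPicks-replicate n 1 (λ v e′ → low 1 v (λ k → coeff f (k ∷ e′))))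
        (*-congˡ (pad-nice (coeff-nice f) _)))

      -- Newton's recursion: `(k + 1) α g_(k+1)` is the sum of `p_(r+1) g_j` over `r + j = k`. The
      -- adjoint of the right-hand side is evaluated by `P-newton`, in which the term with `P 0`
      -- vanishes.
      rows-upto : ∀ n k → k ≤ n → Row k
      rows-upto n zero le = record { g = 1ₛ ; adj = λ f h → trans (congˡ {1ₛ · f} {f} {h} (·-identityˡ f)) (congʳ {f} {h} {E 0 h} (λ e → sym (pad-nice (coeff-nice h) e)))
        ; ones = *-identityˡ 1# }
      rows-upto (suc n) (suc k) (s≤s le) = record
        { g    = y • new
        ; adj  = λ f h → cancel-unit unit (trans (*-congˡ (trans (congˡ {(y • new) · f} {y • (new · f)} {h} (·-•ˡ y new f)) (homogeneous y (new · f) h)))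
            (trans (trans (sym (*-assoc _ _ _)) (trans (*-congʳ uy) (*-identityˡ _))) (adj-new f h)))
        ; ones = ones-new }
        where
        row : ∀ j → j ≤ k → Row j
        row j j≤k = rows-upto n j (ℕ.≤-trans j≤k le)
        -- A total function, as `antidiagₛ` takes one; the default `0ₛ` lies outside the indices
        -- that occur.
        grow : ℕ → SymFun
        grow j with j ℕ.≤? k
        ... | yes j≤k = g (row j j≤k)
        ... | no _    = 0ₛ
        grow-adj : ∀ {j} → j ≤ k → ∀ f h → ⟨ grow j · f , h ⟩ ≈ ⟨ f , E j h ⟩
        grow-adj {j} j≤k f h with j ℕ.≤? k
        ... | yes q = adj (row j q) f h
        ... | no nq = ⊥-elim (nq j≤k)
        grow-ones : (α ^ k) * coeff (grow k) (replicate k 1) ≈ 1#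
        grow-ones with k ℕ.≤? k
        ... | yes q = ones (row k q)
        ... | no nq = ⊥-elim (nq ℕ.≤-refl)
        u : Carrier
        u = ⟦ suc k ⟧ * α
        unit : ∃[ v ] u * v ≈ 1#
        unit = unit-* (inverse-nat k) inverse-α
        y : Carrier
        y = proj₁ unit
        uy : u * y ≈ 1#
        uy = proj₂ unit
        new : SymFun
        new = antidiagₛ k (λ r j → powerSum (suc r) · grow j)
        adj-new : ∀ f h → ⟨ new · f , h ⟩ ≈ u * ⟨ f , E (suc k) h ⟩
        adj-new f h = trans (congˡ {new · f} {antidiagₛ k (λ r j → (powerSum (suc r) · grow j) · f)} {h} (·-antidiagₛ k _ f))
          (trans (form-antidiagₛ k (λ r j → (powerSum (suc r) · grow j) · f) h)
          (trans (antidiag-cong k (λ r j eq → trans (congˡ {(powerSum (suc r) · grow j) · f} {powerSum (suc r) · (grow j · f)} {h} (·-assoc (powerSum (suc r)) (grow j) f))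
            (trans (adjoint (s≤s z≤n) (grow j · f) h) (*-congˡ (trans (grow-adj (ℕ.≤-trans (ℕ.m≤n+m j r) (ℕ.≤-reflexive eq)) f (P (suc r) h)) (commutative f (E j (P (suc r) h))))))))
          (trans (antidiag-*ˡ k α _) (trans (*-congˡ (trans (sym (form-antidiagₛ k (λ r j → E j (P (suc r) h)) f))
            (trans (congˡ {antidiagₛ k (λ r j → E j (P (suc r) h))} {⟦ suc k ⟧ • E (suc k) h} {f} newton) (trans (homogeneous _ (E (suc k) h) f) (*-congˡ (commutative (E (suc k) h) f))))))
          (solve 3 (λ a n x → a :* (n :* x) := (n :* a) :* x) refl α _ _)))))
          where
          newton : antidiagₛ k (λ r j → E j (P (suc r) h)) ≈ₛ ⟦ suc k ⟧ • E (suc k) h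
          newton e = trans (coeff-antidiagₛ k (λ r j → E j (P (suc r) h)) e) (trans (sym (trans (+-congʳ (P-0 h (suc k ∷ e))) (+-identityˡ _))) (P-newton h (suc k) e))
        ones-new : α * (α ^ k) * (y * coeff new (replicate (suc k) 1)) ≈ 1#
        ones-new = trans (*-congˡ (*-congˡ (trans (coeff-antidiagₛ k (λ r j → powerSum (suc r) · grow j) (replicate (suc k) 1)) (only-first k ≡.refl))))
          (trans (solve 5 (λ a A y n x → (a :* A) :* (y :* (n :* x)) := ((n :* a) :* y) :* (A :* x)) refl α (α ^ k) y ⟦ suc k ⟧ _)
          (trans (*-cong uy grow-ones) (*-identityˡ 1#)))
          where
          -- A squarefree monomial is reached through `p_1` only.
          only-first : ∀ j → j ≡ k → antidiag j (λ r i → coeff (powerSum (suc r) · grow i) (replicate (suc k) 1)) ≈ ⟦ suc k ⟧ * coeff (grow k) (replicate k 1)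
          only-first zero    ≡.refl = p1-ones (grow 0) 0
          only-first (suc j) ≡.refl = trans (+-cong (p1-ones (grow (suc j)) (suc j)) (antidiag-zero j (λ r i _ → powerSum-ones r (grow i) (suc (suc j))))) (+-identityʳ _)

    rowOf : ∀ k → Row k
    rowOf k = rows-upto k k ℕ.≤-refl

    -- Over ℚ(α) the form is anisotropic: it is a sum of squares with
    -- positive coefficients in the power sums.
    private
      Terms : Set
      Terms = List (Carrier × List ℕ)

      comb : Terms → SymFun
      comb []             = 0ₛ
      comb ((b , ρ) ∷ ts) = b • pow ρ +ₛ comb ts

      data Distinct : Terms → Set where
        []  : Distinct []
        add : ∀ {b ρ ts} → IsPartition ρ → All (λ t → ρ ≢ proj₂ t) ts → Distinct ts → Distinct ((b , ρ) ∷ ts)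

      insert : Carrier → List ℕ → Terms → Terms
      insert b ρ []             = (b , ρ) ∷ []
      insert b ρ ((c , σ) ∷ ts) with ρ ≟ˡ σ
      ... | yes _ = (b + c , σ) ∷ ts
      ... | no _  = (c , σ) ∷ insert b ρ ts

      insert-comb : ∀ b ρ ts → comb (insert b ρ ts) ≈ₛ b • pow ρ +ₛ comb ts
      insert-comb b ρ []             e = refl
      insert-comb b ρ ((c , σ) ∷ ts) e with ρ ≟ˡ σ
      ... | yes ≡.refl = solve 4 (λ b c x y → (b :+ c) :* x :+ y := b :* x :+ (c :* x :+ y)) refl b c _ _
      ... | no _       = trans (+-congˡ (insert-comb b ρ ts e)) (solve 3 (λ a b c → a :+ (b :+ c) := b :+ (a :+ c)) refl _ _ _)

      insert-fresh : ∀ {κ} b ρ ts → κ ≢ ρ → All (λ t → κ ≢ proj₂ t) ts → All (λ t → κ ≢ proj₂ t) (insert b ρ ts)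
      insert-fresh b ρ []             ne []       = ne ∷ []
      insert-fresh b ρ ((c , σ) ∷ ts) ne (p ∷ ps) with ρ ≟ˡ σ
      ... | yes _ = p ∷ ps
      ... | no _  = p ∷ insert-fresh b ρ ts ne ps

      insert-distinct : ∀ b {ρ ts} → IsPartition ρ → Distinct ts → Distinct (insert b ρ ts)
      insert-distinct b isP []                       = add isP [] []
      insert-distinct b {ρ} isP (add {c} {σ} isQ fr d) with ρ ≟ˡ σ
      ... | yes _ = add isQ fr d
      ... | no ne = add isQ (insert-fresh b ρ _ (ne ∘ ≡.sym) fr) (insert-distinct b isP d)

      record Normal (f : SymFun) : Set where
        field
          terms    : Terms
          distinct : Distinct terms
          equal    : f ≈ₛ comb terms
      open Normal

      merge : ∀ ts {us} → Distinct ts → Distinct us → ∃[ vs ] Distinct vs × comb vs ≈ₛ comb ts +ₛ comb us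
      merge []             {us} []             d′ = us , d′ , λ e → sym (+-identityˡ _)
      merge ((b , ρ) ∷ ts) {us} (add isP fr d) d′ = let (vs , dv , eq) = merge ts d d′ in insert b ρ vs , insert-distinct b isP dv ,
        λ e → trans (insert-comb b ρ vs e) (trans (+-congˡ (eq e)) (sym (+-assoc _ _ _)))

      scaled : ∀ a ts → Distinct ts → ∃[ vs ] Distinct vs × (∀ {κ} → All (λ t → κ ≢ proj₂ t) ts → All (λ t → κ ≢ proj₂ t) vs) × comb vs ≈ₛ a • comb ts
      scaled a []             []             = [] , [] , (λ p → p) , λ e → sym (zeroʳ a)
      scaled a ((b , ρ) ∷ ts) (add isP fr d) = let (vs , dv , keep , eq) = scaled a ts d in (a * b , ρ) ∷ vs , add isP (keep fr) dv ,
        (λ { (p ∷ ps) → p ∷ keep ps }) , λ e → trans (+-cong (*-assoc _ _ _) (eq e)) (sym (distribˡ _ _ _))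

      -- A representation in `PS` may repeat a product of power sums; only after collecting terms is
      -- the form a sum of squares.
      normalize : ∀ {f} → PS f → Normal f
      normalize (pows {ρ} pρ) = record { terms = (1# , shape ρ) ∷ [] ; distinct = add (shape-isPartition ρ) [] []
        ; equal = λ e → trans (pow-↭ (positive-shape pρ) e) (sym (trans (+-identityʳ _) (*-identityˡ _))) }
      normalize (adds x y) = let (vs , dv , eq) = merge (terms (normalize x)) (distinct (normalize x)) (distinct (normalize y)) in
        record { terms = vs ; distinct = dv ; equal = λ e → trans (+-cong (equal (normalize x) e) (equal (normalize y) e)) (sym (eq e)) }
      normalize (scale a x) = let (vs , dv , _ , eq) = scaled a (terms (normalize x)) (distinct (normalize x)) in
        record { terms = vs ; distinct = dv ; equal = λ e → trans (*-congˡ (equal (normalize x) e)) (sym (eq e)) }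
      normalize (same eq x) = record { terms = terms (normalize x) ; distinct = distinct (normalize x) ; equal = λ e → trans (sym (eq e)) (equal (normalize x) e) }

      fresh-orthogonal : ∀ {ρ ts} → IsPartition ρ → All (λ t → ρ ≢ proj₂ t) ts → Distinct ts → ⟨ pow ρ , comb ts ⟩ ≈ 0#
      fresh-orthogonal {ρ} isP []       []                        = zeroʳ′ {pow ρ} {0ₛ} (λ _ → refl)
      fresh-orthogonal {ρ} isP (ne ∷ fr) (add {b} {σ} {ts} isQ _ d) = trans (additiveʳ (pow ρ) (b • pow σ) (comb ts)) (trans (+-cong
        (trans (homogeneousʳ b (pow ρ) (pow σ)) (trans (*-congˡ (orthogonal (mkPartition ρ isP) (mkPartition σ isQ) ne)) (zeroʳ b)))
        (fresh-orthogonal isP fr d)) (+-identityˡ 0#))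

      square : Carrier → List ℕ → Carrier
      square b ρ = ⟦ z (toPartition ρ) ⟧ * (α ^ length ρ) * (b * b)

      form-comb : ∀ {b ρ ts} → Distinct ((b , ρ) ∷ ts) → ⟨ comb ((b , ρ) ∷ ts) , comb ((b , ρ) ∷ ts) ⟩ ≈ square b ρ + ⟨ comb ts , comb ts ⟩
      form-comb {b} {ρ} {ts} (add isP fr d) = trans (additive (b • pow ρ) (comb ts) (b • pow ρ +ₛ comb ts)) (+-cong
        (trans (homogeneous b (pow ρ) _) (trans (*-congˡ (trans (additiveʳ (pow ρ) (b • pow ρ) (comb ts)) (trans (+-cong (trans (homogeneousʳ b (pow ρ) (pow ρ)) (*-congˡ (norm-pow (proj₂ isP))))
          (fresh-orthogonal isP fr d)) (+-identityʳ _)))) (solve 3 (λ b z a → b :* (b :* (z :* a)) := (z :* a) :* (b :* b)) refl b _ _)))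
        (trans (additiveʳ (comb ts) (b • pow ρ) (comb ts)) (trans (+-congʳ (trans (homogeneousʳ b (comb ts) (pow ρ)) (trans (*-congˡ (trans (commutative (comb ts) (pow ρ)) (fresh-orthogonal isP fr d))) (zeroʳ b))))
          (+-identityˡ _))))

      form-nonneg : ∀ {ts} → Distinct ts → NonNeg ⟨ comb ts , comb ts ⟩
      form-nonneg []             = NonNeg-≈ (sym (zeroˡ′ {0ₛ} {0ₛ} (λ _ → refl))) NonNeg-0
      form-nonneg d@(add {b} {ρ} isP fr d′) = NonNeg-≈ (sym (form-comb d)) (NonNeg-+ (NonNeg-sq (z (toPartition ρ)) (length ρ) b) (form-nonneg d′))

      z≢0 : ∀ {ρ} → All (0 <_) ρ → ∃[ n ] z (toPartition ρ) ≡ suc n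
      z≢0 []                = 0 , ≡.refl
      z≢0 {suc r ∷ ρ} (p ∷ ps) = let (n , eq) = z≢0 ps in _ , ≡.trans (z-∷ p ps) (≡.cong ((suc r ℕ.* suc (count (suc r) ρ)) ℕ.*_) eq)

      comb-zero : ∀ {ts} → Distinct ts → ⟨ comb ts , comb ts ⟩ ≈ 0# → comb ts ≈ₛ 0ₛ
      comb-zero []             eq e = refl
      comb-zero d@(add {b} {ρ} {ts} isP fr d′) eq e = trans (+-cong (trans (*-congʳ b≈0) (zeroˡ _)) (comb-zero d′ rest e)) (+-identityˡ 0#)
        where
        total : square b ρ + ⟨ comb ts , comb ts ⟩ ≈ 0#
        total = trans (sym (form-comb d)) eq
        sq : square b ρ ≈ 0#
        sq = NonNeg-sum (NonNeg-sq (z (toPartition ρ)) (length ρ) b) (form-nonneg d′) total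
        rest : ⟨ comb ts , comb ts ⟩ ≈ 0#
        rest = NonNeg-sum (form-nonneg d′) (NonNeg-sq (z (toPartition ρ)) (length ρ) b) (trans (+-comm _ _) total)
        b≈0 : b ≈ 0#
        b≈0 = let (n , zn) = z≢0 (proj₂ isP) in square-0 b (cancel-unit (unit-* (inverse-nat n) (unit-^ (length ρ)))
          (trans (*-congʳ (*-congʳ (reflexive (≡.cong ⟦_⟧ (≡.sym zn))))) (trans sq (sym (zeroʳ _)))))

    anisotropic : ∀ f → ⟨ f , f ⟩ ≈ 0# → f ≈ₛ 0ₛ
    anisotropic f eq e = trans (equal n e) (comb-zero (distinct n) (trans (cong {comb (terms n)} {f} {comb (terms n)} {f} (λ e → sym (equal n e)) (λ e → sym (equal n e))) eq) e)
      where
      n : Normal f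
      n = normalize (spanning f)

-- Self-adjointness of the Laplace-Beltrami operator

module LaplaceBeltrami (K : CommutativeRing 0ℓ 0ℓ) (α : CommutativeRing.Carrier K) where

  open import Defs using ()

  open CommutativeRing K
  open Solver commutativeSemiring using (solve; _:=_; _:+_; _:*_)
  open RingProperties ring using (+-cancelʳ)
  open Antidiagonal K
  open SymmetricFunctions K
  open FiniteSums K
  open Convolution K
  open ExponentFunctions K α
  open Cherednik K α
  open KnopSahiSupport K α
  open JackFunctions K α
  open JackEigenvalues K α
  open PowerSumDerivations K α
  open PowerSumBasis K α
  open JackForm K α

  sumₛ : ∀ {A : Set} → List A → (A → SymFun) → SymFun
  sumₛ []       F = 0ₛ
  sumₛ (x ∷ xs) F = F x +ₛ sumₛ xs F

  coeff-sumₛ : ∀ {A : Set} (xs : List A) F e → coeff (sumₛ xs F) e ≈ sumOf xs (λ x → coeff (F x) e)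
  coeff-sumₛ []       F e = refl
  coeff-sumₛ (x ∷ xs) F e = +-congˡ (coeff-sumₛ xs F e)

  module Adjoint (F : JackField) (⟨_,_⟩ : SymFun → SymFun → Carrier) (S : ScalarProduct ⟨_,_⟩) where
    open JackField F
    open Form F ⟨_,_⟩ S

    form-sumₛ : ∀ {A : Set} (xs : List A) F h → ⟨ sumₛ xs F , h ⟩ ≈ sumOf xs (λ x → ⟨ F x , h ⟩)
    form-sumₛ []       F h = zeroˡ′ {0ₛ} {h} (λ _ → refl)
    form-sumₛ (x ∷ xs) F h = trans (additive (F x) (sumₛ xs F) h) (+-congˡ (form-sumₛ xs F h))

    adjoint₀ : ∀ r f h → ⟨ powerSum r · f , h ⟩ ≈ α * ⟨ f , P r h ⟩
    adjoint₀ zero    f h = trans (zeroˡ′ {powerSum 0 · f} {h} (λ e → trans (·-cong {powerSum 0} {0ₛ} {f} {f} powerSum-0 (λ _ → refl) e) (convolve-zeroˡ (coeff f) e (λ _ _ → refl))))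
      (sym (trans (*-congˡ (zeroʳ′ {f} {P 0 h} (P-0 h))) (zeroʳ α)))
    adjoint₀ (suc r) f h = adjoint (s≤s z≤n) f h

    module _ (d : ℕ) where

      opaque
        -- In `N` variables the operator `DFn` is `second - weighted + N euler`, by `D-sum`; the
        -- first two terms make no reference to `N`. The bound `d` truncates sums that end at the
        -- degree anyway.
        weighted euler second : SymFun → SymFun
        weighted f = sumₛ (range d) (λ r → ⟦ r ⟧ • (powerSum r · P r f))
        euler f    = sumₛ (range d) (λ r → powerSum r · P r f)
        second f   = sumₛ (range d) (λ r → α • sumₛ (range d) (λ t → powerSum (r ℕ.+ t) · P t (P r f)) +ₛ
          (⟦ r ⟧ • (α • (powerSum r · P r f)) +ₛ antidiagₛ r (λ c b → powerSum c · (powerSum b · P r f))))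

      opaque
        unfolding weighted second

        weighted-adjoint : ∀ f h → ⟨ weighted f , h ⟩ ≈ ⟨ weighted h , f ⟩
        weighted-adjoint f h = trans (half f h) (trans (sumOf-cong (range d) (λ r → *-congˡ (*-congˡ (commutative (P r f) (P r h))))) (sym (half h f)))
          where
          half : ∀ f h → ⟨ weighted f , h ⟩ ≈ sumOf (range d) (λ r → ⟦ r ⟧ * (α * ⟨ P r f , P r h ⟩))
          half f h = trans (form-sumₛ (range d) (λ r → ⟦ r ⟧ • (powerSum r · P r f)) h)
            (sumOf-cong (range d) (λ r → trans (homogeneous ⟦ r ⟧ (powerSum r · P r f) h) (*-congˡ (adjoint₀ r (P r f) h))))

        -- The terms of `f` with two derivations and the terms of `h` with two power sums are
        -- adjoint to each other, with the same power of `α`; the middle terms are symmetric. The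
        -- degree bound allows a sum over a square of indices to be rearranged by `r + t`.
        second-adjoint : ∀ f h → degree f ≤ d → degree h ≤ d → ⟨ second f , h ⟩ ≈ ⟨ second h , f ⟩
        second-adjoint f h df dh = trans (half f h dh) (trans (+-cong (+-comm _ _) (sumOf-cong (range d) (λ r → *-congˡ (*-congˡ (*-congˡ (commutative (P r f) (P r h)))))))
            (sym (half h f df)))
          where
          G : SymFun → SymFun → ℕ → ℕ → Carrier
          G f h r t = α * (α * ⟨ P t (P r f) , P (r ℕ.+ t) h ⟩)
          half : ∀ f h → degree h ≤ d → ⟨ second f , h ⟩ ≈
            (sumOf (range d) (λ s → antidiag s (G f h)) + sumOf (range d) (λ s → antidiag s (G h f))) +
            sumOf (range d) (λ r → ⟦ r ⟧ * (α * (α * ⟨ P r f , P r h ⟩)))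
          half f h dh = trans (form-sumₛ (range d) _ h) (trans (sumOf-cong (range d) (λ r → trans (additive (first-part r) (mid r +ₛ pair r) h)
              (+-cong (part₁ r) (trans (additive (mid r) (pair r) h) (+-cong (part₂ r) (part₃ r))))))
            (trans (sumOf-+ (range d) _ _) (trans (+-cong (sum-range-square d (G f h) (λ r s lt → trans (*-congˡ (trans (*-congˡ (zeroʳ′ {P s (P r f)} {P (r ℕ.+ s) h} (P-vanish h (ℕ.≤-<-trans dh lt)))) (zeroʳ α))) (zeroʳ α)))
              (sumOf-+ (range d) _ _)) (solve 3 (λ a b c → a :+ (b :+ c) := (a :+ c) :+ b) refl _ _ _))))
            where
            first-part mid pair : ℕ → SymFun
            first-part r = α • sumₛ (range d) (λ t → powerSum (r ℕ.+ t) · P t (P r f))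
            mid r = ⟦ r ⟧ • (α • (powerSum r · P r f))
            pair r = antidiagₛ r (λ c b → powerSum c · (powerSum b · P r f))
            part₁ : ∀ r → ⟨ first-part r , h ⟩ ≈ sumOf (range d) (G f h r)
            part₁ r = trans (homogeneous α _ h) (trans (*-congˡ (trans (form-sumₛ (range d) (λ t → powerSum (r ℕ.+ t) · P t (P r f)) h)
              (sumOf-cong (range d) (λ t → adjoint₀ (r ℕ.+ t) (P t (P r f)) h)))) (sym (sumOf-*ˡ (range d) α _)))
            part₂ : ∀ r → ⟨ mid r , h ⟩ ≈ ⟦ r ⟧ * (α * (α * ⟨ P r f , P r h ⟩))
            part₂ r = trans (homogeneous ⟦ r ⟧ (α • (powerSum r · P r f)) h) (*-congˡ (trans (homogeneous α (powerSum r · P r f) h) (*-congˡ (adjoint₀ r (P r f) h))))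
            part₃ : ∀ r → ⟨ pair r , h ⟩ ≈ antidiag r (G h f)
            part₃ r = trans (form-antidiagₛ r (λ c b → powerSum c · (powerSum b · P r f)) h) (antidiag-cong r (λ c b eq →
              trans (adjoint₀ c (powerSum b · P r f) h) (*-congˡ (trans (adjoint₀ b (P r f) (P c h)) (*-congˡ (trans (commutative (P r f) (P b (P c h)))
                (reflexive (≡.cong (λ s → ⟨ P b (P c h) , P s f ⟩) (≡.sym eq)))))))))

      module _ (f : SymFun) (df : degree f ≤ d) {Y : List ℕ} (uY : Unique Y) (η : Exp) where
        open Bridge uY
        private
          e : List ℕ
          e = map η Y
          dP : ∀ r → degree (P r f) ≤ d
          dP r = ℕ.≤-trans (ℕ.m∸n≤m (degree f) r) df

          zero-· : ∀ q {h} → h ≈ₛ 0ₛ → coeff (q · h) e ≈ 0#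
          zero-· q {h} h≈0 = trans (·-comm q h e) (convolve-zeroˡ (coeff q) e (λ a _ → h≈0 a))

          P-zero : ∀ t {h} → h ≈ₛ 0ₛ → P t h ≈ₛ 0ₛ
          P-zero t {h} h≈0 x = trans (P-cong t {h} {0# • 0ₛ} (λ y → trans (h≈0 y) (sym (zeroˡ _))) x) (trans (P-• t 0# 0ₛ x) (zeroˡ _))

          Xpow-zero : ∀ r k → P r f ≈ₛ 0ₛ → Xpow r k (hat (P r f) Y) ≋ 0ꟳ
          Xpow-zero r k h≈0 ζ = trans (Xpow-cong r k {hat (P r f) Y} {0ꟳ} (λ ξ → h≈0 _) ζ) (low-0 r (ζ k))
            where
            low-0 : ∀ r n → low r n (λ _ → 0#) ≈ 0#
            low-0 zero    n       = refl
            low-0 (suc r) zero    = refl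
            low-0 (suc r) (suc n) = low-0 r n

        opaque
          unfolding weighted euler second

          euler-sum : coeff (euler f) e ≈ ⟦ sum e ⟧ * coeff f e
          euler-sum = trans (coeff-sumₛ (range d) (λ r → powerSum r · P r f) e) (trans (sumOf-cong (range d) term)
            (trans (sumOf-swap (range d) Y (λ r k → app (Xpow r k (hat (P r f) Y)) η)) (trans (sumOf-cong∈ Y (λ {k} k∈ → sym (T-expand d f df k∈ η)))
            (trans (sumOf-*ʳ Y (coeff f e) (λ k → ⟦ η k ⟧)) (*-congʳ (sumOf-nat η Y))))))
            where
            term : ∀ r → coeff (powerSum r · P r f) e ≈ sumOf Y (λ k → app (Xpow r k (hat (P r f) Y)) η)
            term zero    = trans (zero-· (powerSum 0) {P 0 f} (P-0 f)) (sym (sumOf-zero Y (λ {k} _ → Xpow-zero 0 k (P-0 f) η)))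
            term (suc r) = sym (sum-Xpow r (P (suc r) f) η)

          D-sum : app (DFn Y (hat f Y)) η + coeff (weighted f) e ≈ coeff (second f) e + ⟦ length Y ⟧ * coeff (euler f) e
          D-sum = trans (+-cong (trans (sumOf-cong∈ Y (λ {k} k∈ → trans (𝒴-cong Y k {T k (hat f Y)} {⨁ (range d) (λ r → Xpow r k (hat (P r f) Y))} (T-expand d f df k∈) η) (𝒴-⨁ Y k (range d) _ η)))
              (sumOf-swap Y (range d) _)) (coeff-sumₛ (range d) _ e))
            (trans (sym (sumOf-+ (range d) _ _)) (trans (sumOf-cong (range d) term) (trans (sumOf-+ (range d) _ _)
            (+-cong (sym (coeff-sumₛ (range d) _ e)) (trans (sumOf-*ˡ (range d) ⟦ length Y ⟧ _) (*-congˡ (sym (coeff-sumₛ (range d) _ e))))))))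
            where
            summand : ℕ → SymFun
            summand r = α • sumₛ (range d) (λ t → powerSum (r ℕ.+ t) · P t (P r f)) +ₛ
              (⟦ r ⟧ • (α • (powerSum r · P r f)) +ₛ antidiagₛ r (λ c b → powerSum c · (powerSum b · P r f)))
            term : ∀ r → sumOf Y (λ k → app (𝒴 Y k (Xpow r k (hat (P r f) Y))) η) + ⟦ r ⟧ * coeff (powerSum r · P r f) e ≈
              coeff (summand r) e + ⟦ length Y ⟧ * coeff (powerSum r · P r f) e
            term zero    = trans (+-cong (sumOf-zero Y (λ {k} _ → trans (𝒴-cong Y k {Xpow 0 k (hat (P 0 f) Y)} {0ꟳ} (Xpow-zero 0 k (P-0 f)) η) (𝒴-0 Y k η))) (zeroˡ _))
              (trans (+-identityˡ 0#) (sym (trans (+-cong (trans (+-cong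
                (trans (*-congˡ (trans (coeff-sumₛ (range d) (λ t → powerSum t · P t (P 0 f)) e) (sumOf-zero (range d) (λ {t} _ → zero-· (powerSum t) {P t (P 0 f)} (P-zero t {P 0 f} (P-0 f)))))) (zeroʳ α))
                (+-cong (zeroˡ _) (zero-· (powerSum 0) {powerSum 0 · P 0 f} (λ x → trans (·-comm (powerSum 0) (P 0 f) x) (convolve-zeroˡ (coeff (powerSum 0)) x (λ a _ → P-0 f a))))))
                (trans (+-identityˡ _) (+-identityˡ 0#))) (trans (*-congˡ (zero-· (powerSum 0) {P 0 f} (P-0 f))) (zeroʳ _))) (+-identityˡ 0#))))
            term (suc r) = trans (D-Xpow d r (P (suc r) f) (dP (suc r)) η)
              (trans (+-cong (*-congˡ (sym (coeff-sumₛ (range d) _ e))) (+-congˡ (trans (+-congˡ (sym (coeff-antidiagₛ (suc r) (λ c b → powerSum c · (powerSum b · P (suc r) f)) e))) (+-comm _ _))))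
              (solve 4 (λ a b c n → a :+ (b :+ (c :+ n)) := (a :+ (b :+ c)) :+ n) refl _ _ _ _))

    -- Both sides of the equation in `N` variables contain `N` times the degree, since `euler` acts
    -- on the homogeneous `f` by its degree. What is left is an equation of symmetric functions
    -- without reference to `N`.
    jackF-second : ∀ {θ} (isP : IsPartition θ) → let f = jackF isP ; d = sum θ in
      second d f +ₛ ⟦ odds 0 θ ⟧ • f ≈ₛ (α * ⟦ squares θ ⟧) • f +ₛ weighted d f
    jackF-second {θ} isP e = from (jackF-eigen (cancel-unit inverse-α) isP e)
      where
      f : SymFun
      f = jackF isP
      d : ℕ
      d = sum θ
      balance : ∀ {D W S N E o q x y} → D + W ≈ S + N * E → E ≈ y * x → D + o * x ≈ (q + N * y) * x → S + o * x ≈ q * x + W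
      balance {D} {W} {S} {N} {E} {o} {q} {x} {y} p r t = +-cancelʳ (N * (y * x)) _ _ (trans (solve 3 (λ a b c → (a :+ b) :+ c := (a :+ c) :+ b) refl S (o * x) (N * (y * x)))
        (trans (+-congʳ (trans (+-congˡ (*-congˡ (sym r))) (sym p))) (trans (solve 3 (λ a b c → (a :+ b) :+ c := (a :+ c) :+ b) refl D W (o * x))
        (trans (+-congʳ t) (solve 5 (λ a n d x w → (a :+ n :* d) :* x :+ w := (a :* x :+ w) :+ n :* (d :* x)) refl q N y x W)))))
      homogeneous-e : ∀ e → ⟦ sum e ⟧ * coeff f e ≈ ⟦ d ⟧ * coeff f e
      homogeneous-e e = cases (sum e ℕ.≟ d)
        where
        cases : Dec (sum e ≡ d) → ⟦ sum e ⟧ * coeff f e ≈ ⟦ d ⟧ * coeff f e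
        cases (yes eq) = *-congʳ (reflexive (≡.cong ⟦_⟧ eq))
        cases (no ne)  = trans (*-congˡ fe≈0) (trans (zeroʳ _) (sym (trans (*-congˡ fe≈0) (zeroʳ _))))
          where
          fe≈0 : coeff f e ≈ 0#
          fe≈0 = knopSahi-supp isP e (λ D → ne (proj₁ D))
      at : ∀ Y η → Unique Y → ∀ e → map η Y ≡ e →
        app (DFn Y (hat f Y)) η + ⟦ odds 0 θ ⟧ * coeff f e ≈ (α * ⟦ squares θ ⟧ + ⟦ length e ⟧ * ⟦ d ⟧) * coeff f e →
        coeff (second d f) e + ⟦ odds 0 θ ⟧ * coeff f e ≈ α * ⟦ squares θ ⟧ * coeff f e + coeff (weighted d f) e
      at Y η uY .(map η Y) ≡.refl eq = balance {E = coeff (euler d f) (map η Y)} (D-sum d f ℕ.≤-refl uY η) (trans (euler-sum d f ℕ.≤-refl uY η) (homogeneous-e (map η Y)))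
        (trans eq (*-congʳ (+-congˡ (*-congʳ (reflexive (≡.cong ⟦_⟧ (length-map η Y)))))))
      from : (∃[ Y ] ∃[ η ] Unique Y × map η Y ≡ e ×
          app (DFn Y (hat f Y)) η + ⟦ odds 0 θ ⟧ * coeff f e ≈ (α * ⟦ squares θ ⟧ + ⟦ length e ⟧ * ⟦ d ⟧) * coeff f e) →
        coeff (second d f) e + ⟦ odds 0 θ ⟧ * coeff f e ≈ α * ⟦ squares θ ⟧ * coeff f e + coeff (weighted d f) e
      from (Y , η , uY , ηY , eq) = at Y η uY e ηY eq

    -- Pairing the two equations with each other gives two linear polynomials in `α` with equal
    -- products with the scalar product. Their constant terms are the two values of `odds`, so it
    -- suffices that these differ.
    jackF-orthogonal : ∀ {θ μ} (isP : IsPartition θ) (isQ : IsPartition μ) → sum θ ≡ sum μ → odds 0 θ ≢ odds 0 μ → ⟨ jackF isP , jackF isQ ⟩ ≈ 0#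
    jackF-orthogonal {θ} {μ} isP isQ size ne = separated (squares μ) (odds 0 θ) (squares θ) (odds 0 μ) ne
      (+-cancelʳ (⟨ second d f , h ⟩ + ⟨ weighted d h , f ⟩) _ _
        (trans (solve 5 (λ a b x A W → (a :+ b) :* x :+ (A :+ W) := (A :+ b :* x) :+ (a :* x :+ W)) refl (α * ⟦ squares μ ⟧) ⟦ odds 0 θ ⟧ x _ _)
        (trans (+-cong eqθ (sym eqμ))
        (trans (+-cong (+-congˡ (weighted-adjoint d f h)) (+-congʳ (second-adjoint d h f (ℕ.≤-reflexive (≡.sym size)) ℕ.≤-refl)))
        (solve 5 (λ a b x A W → (a :* x :+ W) :+ (A :+ b :* x) := (a :+ b) :* x :+ (A :+ W)) refl (α * ⟦ squares θ ⟧) ⟦ odds 0 μ ⟧ x _ _)))))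
      where
      f h : SymFun
      f = jackF isP
      h = jackF isQ
      d : ℕ
      d = sum θ
      x : Carrier
      x = ⟨ f , h ⟩
      pairing : ∀ {ν d} (isN : IsPartition ν) → sum ν ≡ d → ∀ k → ⟨ second d (jackF isN) , k ⟩ + ⟦ odds 0 ν ⟧ * ⟨ jackF isN , k ⟩ ≈
        α * ⟦ squares ν ⟧ * ⟨ jackF isN , k ⟩ + ⟨ weighted d (jackF isN) , k ⟩
      pairing {ν} {d} isN ≡.refl k = trans (sym (trans (additive (second d q) (⟦ odds 0 ν ⟧ • q) k) (+-congˡ (homogeneous _ q k))))
        (trans (congˡ {second d q +ₛ ⟦ odds 0 ν ⟧ • q} {(α * ⟦ squares ν ⟧) • q +ₛ weighted d q} {k} (jackF-second isN))
        (trans (additive ((α * ⟦ squares ν ⟧) • q) (weighted d q) k) (+-congʳ (homogeneous _ q k))))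
        where
        q : SymFun
        q = jackF isN
      eqθ : ⟨ second d f , h ⟩ + ⟦ odds 0 θ ⟧ * x ≈ α * ⟦ squares θ ⟧ * x + ⟨ weighted d f , h ⟩
      eqθ = pairing isP ≡.refl h
      eqμ : ⟨ second d h , f ⟩ + ⟦ odds 0 μ ⟧ * x ≈ α * ⟦ squares μ ⟧ * x + ⟨ weighted d h , f ⟩
      eqμ = trans (+-congˡ (*-congˡ (commutative f h))) (trans (pairing isQ (≡.sym size) f) (+-congʳ (*-congˡ (commutative h f))))

-- Dominance, triangularity and the identification with `J`

module JackBasis (K : CommutativeRing 0ℓ 0ℓ) (α : CommutativeRing.Carrier K) where

  open import Defs using (Partition; mkPartition; ∣_∣; 1^_; _⊴_; partitionsInSquare; length≤sum)

  open CommutativeRing K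
  open RingProperties ring using (+-cancelʳ; -‿distribˡ-*)
  open SymmetricFunctions K
  open FiniteSums K
  open Convolution K
  open KnopSahiSymmetry K α
  open KnopSahiSupport K α
  open JackFunctions K α
  open JackEigenvalues K α
  open PowerSumBasis K α
  open JackForm K α
  open LaplaceBeltrami K α

  infix 4 _≼_
  _≼_ : List ℕ → List ℕ → Set
  κ ≼ θ = sum κ ≡ sum θ × (∀ k → prefix k κ ≤ prefix k θ)

  ≼-refl : ∀ {θ} → θ ≼ θ
  ≼-refl = ≡.refl , λ _ → ℕ.≤-refl

  ≼-trans : ∀ {κ θ ν} → κ ≼ θ → θ ≼ ν → κ ≼ ν
  ≼-trans (p , h) (q , k) = ≡.trans p q , λ i → ℕ.≤-trans (h i) (k i)

  prefix-mono : ∀ {j k} xs → j ≤ k → prefix j xs ≤ prefix k xs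
  prefix-mono xs       z≤n      = z≤n
  prefix-mono []       (s≤s le) = z≤n
  prefix-mono (x ∷ xs) (s≤s le) = ℕ.+-monoʳ-≤ x (prefix-mono xs le)

  prefix-all : ∀ {k} xs → length xs ≤ k → prefix k xs ≡ sum xs
  prefix-all {zero}  []       le       = ≡.refl
  prefix-all {suc k} []       le       = ≡.refl
  prefix-all         (x ∷ xs) (s≤s le) = ≡.cong (x ℕ.+_) (prefix-all xs le)

  prefix-≤ : ∀ k xs → prefix k xs ≤ sum xs
  prefix-≤ zero    xs       = z≤n
  prefix-≤ (suc k) []       = z≤n
  prefix-≤ (suc k) (x ∷ xs) = ℕ.+-monoʳ-≤ x (prefix-≤ k xs)

  prefix-< : ∀ k {xs} → All (0 <_) xs → k < length xs → prefix k xs < sum xs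
  prefix-< zero    {x ∷ xs} (p ∷ ps) lt       = ℕ.≤-trans p (ℕ.m≤m+n x (sum xs))
  prefix-< (suc k) {x ∷ xs} (p ∷ ps) (s≤s lt) = ≡.subst (_≤ x ℕ.+ sum xs) (ℕ.+-suc x (prefix k xs)) (ℕ.+-monoʳ-≤ x (prefix-< k ps lt))

  Dom⇒≼ : ∀ {κ θ} → Dom κ θ → κ ≼ θ
  Dom⇒≼ {κ} {θ} (eq , h) = eq , λ k → ℕ.≤-trans (h (take k κ) (drop k κ) (↭-reflexive (take++drop≡id k κ)))
    (prefix-mono θ (ℕ.≤-trans (ℕ.≤-reflexive (length-take k κ)) (ℕ.m⊓n≤m k (length κ))))

  _≼?_ : ∀ κ θ → Dec (κ ≼ θ)
  κ ≼? θ = (sum κ ℕ.≟ sum θ) ×-dec′ All.all? (λ k → prefix k κ ℕ.≤? prefix k θ) (upTo (suc (length κ)))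
    where
    _×-dec′_ : Dec (sum κ ≡ sum θ) → Dec (All (λ k → prefix k κ ≤ prefix k θ) (upTo (suc (length κ)))) → Dec (κ ≼ θ)
    no ne  ×-dec′ _      = no (ne ∘ proj₁)
    yes eq ×-dec′ no na  = no (λ (_ , h) → na (All.tabulate (λ {k} _ → h k)))
    yes eq ×-dec′ yes al = yes (eq , bound)
      where
      bound : ∀ k → prefix k κ ≤ prefix k θ
      bound k with k ℕ.≤? length κ
      ... | yes le = All.lookup al (∈-upTo⁺ (s≤s le))
      ... | no gt  = ℕ.≤-trans (prefix-≤ k κ) (ℕ.≤-trans (ℕ.≤-reflexive (≡.sym (prefix-all κ ℕ.≤-refl)))
          (ℕ.≤-trans (All.lookup al (∈-upTo⁺ ℕ.≤-refl)) (prefix-mono θ (ℕ.<⇒≤ (ℕ.≰⇒> gt)))))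

  ≼-length : ∀ {κ θ} → All (0 <_) θ → κ ≼ θ → length θ ≤ length κ
  ≼-length {κ} {θ} pos (eq , h) = ℕ.≮⇒≥ (λ lt → ℕ.<-irrefl ≡.refl (ℕ.≤-trans (prefix-< (length κ) pos lt)
    (ℕ.≤-trans (ℕ.≤-reflexive (≡.trans (≡.sym eq) (≡.sym (prefix-all κ ℕ.≤-refl)))) (h (length κ)))))

  ≼-first : ∀ {κ θ} → κ ≼ θ → first κ ≤ first θ
  ≼-first {κ} {θ} (_ , h) = ≡.subst₂ _≤_ (prefix-1 κ) (prefix-1 θ) (h 1)
    where
    prefix-1 : ∀ xs → prefix 1 xs ≡ first xs
    prefix-1 []       = ≡.refl
    prefix-1 (x ∷ xs) = ℕ.+-identityʳ x

  -- Strictly monotone in the dominance order, hence a measure for inductions; `odds-area` makes it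
  -- the complement of `odds`, which is why comparable partitions have different eigenvalues.
  area : ℕ → List ℕ → ℕ
  area zero    xs = 0
  area (suc N) xs = prefix (suc N) xs ℕ.+ area N xs

  private
    area-[] : ∀ N → area N [] ≡ 0
    area-[] zero    = ≡.refl
    area-[] (suc N) = area-[] N

    area-∷ : ∀ N x xs → area (suc N) (x ∷ xs) ≡ suc N ℕ.* x ℕ.+ area N xs
    area-∷ zero    x xs = ≡.refl
    area-∷ (suc N) x xs = ≡.trans (≡.cong (x ℕ.+ prefix (suc N) xs ℕ.+_) (area-∷ N x xs)) (arith x (prefix (suc N) xs) N (area N xs))
      where
      arith : ∀ x p N a → x ℕ.+ p ℕ.+ (suc N ℕ.* x ℕ.+ a) ≡ suc (suc N) ℕ.* x ℕ.+ (p ℕ.+ a)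
      arith = solve-∀

    odds-shift : ∀ r xs → odds r xs ≡ (r ℕ.+ r) ℕ.* sum xs ℕ.+ odds 0 xs
    odds-shift r []       = ≡.sym (≡.trans (ℕ.+-identityʳ _) (ℕ.*-zeroʳ (r ℕ.+ r)))
    odds-shift r (x ∷ xs) = ≡.trans (≡.cong ((r ℕ.+ suc r) ℕ.* x ℕ.+_) (odds-shift (suc r) xs)) (≡.trans (arith r x (sum xs) (odds 0 xs))
      (≡.cong (λ t → (r ℕ.+ r) ℕ.* (x ℕ.+ sum xs) ℕ.+ (1 ℕ.* x ℕ.+ t)) (≡.sym (odds-shift 1 xs))))
      where
      arith : ∀ r x s o → (r ℕ.+ suc r) ℕ.* x ℕ.+ ((suc r ℕ.+ suc r) ℕ.* s ℕ.+ o) ≡ (r ℕ.+ r) ℕ.* (x ℕ.+ s) ℕ.+ (1 ℕ.* x ℕ.+ ((1 ℕ.+ 1) ℕ.* s ℕ.+ o))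
      arith = solve-∀

    odds-area : ∀ N xs → length xs ≤ N → odds 0 xs ℕ.+ 2 ℕ.* area N xs ≡ suc (N ℕ.+ N) ℕ.* sum xs
    odds-area N       []       le       = ≡.trans (≡.cong (2 ℕ.*_) (area-[] N)) (≡.sym (ℕ.*-zeroʳ (suc (N ℕ.+ N))))
    odds-area (suc N) (x ∷ xs) (s≤s le) = ≡.trans (≡.cong₂ (λ a b → (1 ℕ.* x ℕ.+ a) ℕ.+ 2 ℕ.* b) (odds-shift 1 xs) (area-∷ N x xs))
      (≡.trans (arith x (sum xs) (odds 0 xs) N (area N xs)) (≡.trans (≡.cong (λ t → (x ℕ.+ 2 ℕ.* sum xs ℕ.+ 2 ℕ.* (suc N ℕ.* x)) ℕ.+ t) (odds-area N xs le)) (arith₂ x (sum xs) N)))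
      where
      arith : ∀ x s o N a → (1 ℕ.* x ℕ.+ ((1 ℕ.+ 1) ℕ.* s ℕ.+ o)) ℕ.+ 2 ℕ.* (suc N ℕ.* x ℕ.+ a) ≡ (x ℕ.+ 2 ℕ.* s ℕ.+ 2 ℕ.* (suc N ℕ.* x)) ℕ.+ (o ℕ.+ 2 ℕ.* a)
      arith = solve-∀
      arith₂ : ∀ x s N → (x ℕ.+ 2 ℕ.* s ℕ.+ 2 ℕ.* (suc N ℕ.* x)) ℕ.+ suc (N ℕ.+ N) ℕ.* s ≡ suc (suc N ℕ.+ suc N) ℕ.* (x ℕ.+ s)
      arith₂ = solve-∀

    area-mono : ∀ N {κ θ} → κ ≼ θ → area N κ ≤ area N θ
    area-mono zero    le = z≤n
    area-mono (suc N) le = ℕ.+-mono-≤ (proj₂ le (suc N)) (area-mono N le)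

    area-equal : ∀ N {κ θ} → κ ≼ θ → area N κ ≡ area N θ → ∀ k → k ≤ N → prefix k κ ≡ prefix k θ
    area-equal N       le eq zero    _  = ≡.refl
    area-equal (suc N) {κ} {θ} le eq (suc k) (s≤s k≤N) with k ℕ.≟ N
    ... | yes ≡.refl = top
      where
      top : prefix (suc N) κ ≡ prefix (suc N) θ
      top = ℕ.≤-antisym (proj₂ le (suc N)) (ℕ.+-cancelʳ-≤ (area N θ) _ _ (ℕ.≤-trans (ℕ.≤-reflexive (≡.sym eq)) (ℕ.+-monoʳ-≤ (prefix (suc N) κ) (area-mono N le))))
    ... | no ne = area-equal N le (ℕ.≤-antisym (area-mono N le) (ℕ.+-cancelˡ-≤ (prefix (suc N) θ) _ _
        (ℕ.≤-trans (ℕ.≤-reflexive (≡.sym eq)) (ℕ.+-monoˡ-≤ (area N κ) (proj₂ le (suc N)))))) (suc k) (ℕ.≤∧≢⇒< k≤N ne)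

    prefix-injective : ∀ {κ θ} → All (0 <_) κ → All (0 <_) θ → (∀ k → prefix k κ ≡ prefix k θ) → κ ≡ θ
    prefix-injective []                    []       h = ≡.refl
    prefix-injective {θ = suc y ∷ θ} []    (q ∷ qs) h with h 1
    ... | ()
    prefix-injective {suc x ∷ κ} (p ∷ ps)  []       h with h 1
    ... | ()
    prefix-injective {x ∷ κ} {y ∷ θ} (p ∷ ps) (q ∷ qs) h with ≡.trans (≡.sym (ℕ.+-identityʳ x)) (≡.trans (h 1) (ℕ.+-identityʳ y))
    ... | ≡.refl = ≡.cong (x ∷_) (prefix-injective ps qs (λ k → ℕ.+-cancelˡ-≡ x _ _ (h (suc k))))

  module _ {κ θ : List ℕ} (pκ : All (0 <_) κ) (pθ : All (0 <_) θ) (le : κ ≼ θ) where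
    private
      n : ℕ
      n = sum θ
      lenθ : length θ ≤ n
      lenθ = length≤sum pθ
      lenκ : length κ ≤ n
      lenκ = ℕ.≤-trans (length≤sum pκ) (ℕ.≤-reflexive (proj₁ le))

    area-strict : κ ≢ θ → area n κ < area n θ
    area-strict ne = ℕ.≤∧≢⇒< (area-mono n le) (λ eq → ne (prefix-injective pκ pθ (all-k eq)))
      where
      all-k : area n κ ≡ area n θ → ∀ k → prefix k κ ≡ prefix k θ
      all-k eq k with k ℕ.≤? n
      ... | yes k≤n = area-equal n le eq k k≤n
      ... | no gt   = ≡.trans (prefix-all κ (ℕ.≤-trans lenκ (ℕ.<⇒≤ (ℕ.≰⇒> gt)))) (≡.trans (proj₁ le) (≡.sym (prefix-all θ (ℕ.≤-trans lenθ (ℕ.<⇒≤ (ℕ.≰⇒> gt))))))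

    odds-distinct : κ ≢ θ → odds 0 θ ≢ odds 0 κ
    odds-distinct ne eq = ℕ.<-irrefl (ℕ.*-cancelˡ-≡ (area n κ) (area n θ) 2 (ℕ.+-cancelˡ-≡ (odds 0 κ) _ _
      (≡.trans (odds-area n κ lenκ) (≡.trans (≡.cong (suc (n ℕ.+ n) ℕ.*_) (proj₁ le)) (≡.trans (≡.sym (odds-area n θ lenθ)) (≡.cong (ℕ._+ 2 ℕ.* area n θ) eq)))))) (area-strict ne)

  lead : ∀ {θ} → IsPartition θ → Carrier
  lead {θ} isP = coeff (jackF isP) θ

  lead-column : ∀ {θ} (isP : IsPartition θ) → lead isP ≈ colFactor θ * lead (removeColumn-isPartition isP)
  lead-column {θ} isP@(link , pos) = trans (reflexive (≡.cong (coeff (jackF isP)) (≡.sym (suc-pred pos))))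
    (trans (jackF-column isP (map pred θ) (length-map pred θ)) (*-congˡ (trans (reflexive (≡.cong (coeff (jackF (removeColumn-isPartition isP))) (pred-split link)))
      (coeff-zeros (jackF (removeColumn-isPartition isP)) _ (removeColumn θ)))))

  module Basis (F : JackField) where
    open JackField F

    colFactor-unit : ∀ θ → ∃[ y ] colFactor θ * y ≈ 1#
    colFactor-unit []       = 1# , *-identityˡ 1#
    colFactor-unit (x ∷ xs) = unit-* (invertible (pred x) (suc (length xs)) (λ eq → ℕ.1+n≢0 (≡.trans (≡.sym (ℕ.+-suc (pred x) (length xs))) eq))) (colFactor-unit xs)

    unit-≈ : ∀ {x y} → x ≈ y → ∃[ v ] y * v ≈ 1# → ∃[ v ] x * v ≈ 1#
    unit-≈ x≈y (v , eq) = v , trans (*-congʳ x≈y) eq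

    lead-unit : ∀ {θ} (isP : IsPartition θ) → ∃[ y ] lead isP * y ≈ 1#
    lead-unit {θ} isP = go (first θ) isP (≤-first (proj₁ isP))
      where
      go : ∀ n {θ} (isP : IsPartition θ) → All (_≤ n) θ → ∃[ y ] lead isP * y ≈ 1#
      go zero    isP bnd with isPartition-≤0 isP bnd
      ... | ≡.refl = 1# , *-identityˡ 1#
      go (suc n) {θ} isP bnd = unit-≈ (lead-column isP) (unit-* (colFactor-unit θ) (go n (removeColumn-isPartition isP) (removeColumn-≤ bnd)))

    data Span (Q : List ℕ → Set) : SymFun → Set where
      jack  : ∀ {θ} (isP : IsPartition θ) → Q θ → Span Q (jackF isP)
      none  : Span Q 0ₛ
      plus  : ∀ {f g} → Span Q f → Span Q g → Span Q (f +ₛ g)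
      times : ∀ a {f} → Span Q f → Span Q (a • f)
      equiv : ∀ {f g} → f ≈ₛ g → Span Q f → Span Q g

    Span-⊂ : ∀ {Q R f} → (∀ {κ} → Q κ → R κ) → Span Q f → Span R f
    Span-⊂ h (jack isP q) = jack isP (h q)
    Span-⊂ h none         = none
    Span-⊂ h (plus x y)   = plus (Span-⊂ h x) (Span-⊂ h y)
    Span-⊂ h (times a x)  = times a (Span-⊂ h x)
    Span-⊂ h (equiv eq x) = equiv eq (Span-⊂ h x)

    span-by : ∀ {Q} f → (∀ ν → coeff f (parts ν) ≈ 0# ⊎ Span Q (monomial ν)) → Span Q f
    span-by {Q} f h = equiv (λ e → sym (monomial-expansion f e)) (∑-ind (Span Q) none plus (λ ν → mcoeff f ν • monomial ν) (partitionsInSquare (degree f)) term)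
      where
      term : ∀ ν → Span Q (mcoeff f ν • monomial ν)
      term ν with h ν
      ... | inj₁ z = equiv (λ e → sym (trans (*-congʳ z) (zeroˡ _))) none
      ... | inj₂ s = times _ s

    -- The matrix of the jackF in the monomials is triangular with
    -- invertible diagonal.
    monomial-span : ∀ {θ} (isP : IsPartition θ) → Span (_≼ θ) (orbitSum θ)
    monomial-span {θ} isP = <-rec (λ a → ∀ {θ} (isP : IsPartition θ) → area (sum θ) θ ≡ a → Span (_≼ θ) (orbitSum θ)) step (area (sum θ) θ) isP ≡.refl
      where
      step : ∀ a → (∀ {b} → b < a → ∀ {θ} (isP : IsPartition θ) → area (sum θ) θ ≡ b → Span (_≼ θ) (orbitSum θ)) →
        ∀ {θ} (isP : IsPartition θ) → area (sum θ) θ ≡ a → Span (_≼ θ) (orbitSum θ)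
      step a ih {θ} isP ≡.refl = equiv result (times y (plus (jack isP ≼-refl) (times (- 1#) (span-by rest other))))
        where
        f rest : SymFun
        f = jackF isP
        c y : Carrier
        c = lead isP
        y = proj₁ (lead-unit isP)
        rest = f +ₛ (- c) • orbitSum θ
        result : ∀ e → y * (coeff f e + - 1# * (coeff f e + - c * coeff (orbitSum θ) e)) ≈ coeff (orbitSum θ) e
        result e = trans (*-congˡ (trans (+-congˡ (trans (distribˡ _ _ _) (+-cong (-1*x≈-x _) (trans (-1*x≈-x _) (trans (-‿distribˡ-* _ _) (*-congʳ (-‿involutive c)))))))
            (trans (sym (+-assoc _ _ _)) (trans (+-congʳ (-‿inverseʳ _)) (+-identityˡ _)))))
          (trans (sym (*-assoc _ _ _)) (trans (*-congʳ (trans (*-comm _ _) (proj₂ (lead-unit isP)))) (*-identityˡ _)))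
          where open RingProperties ring using (-‿involutive; -1*x≈-x)
        off : ∀ ν → parts ν ≢ θ → coeff (orbitSum θ) (parts ν) ≈ 0#
        off ν ne = δ-≢ _ θ (λ eq → ne (≡.trans (≡.sym (shape-partition (isPartition ν))) eq))
        other : ∀ ν → coeff rest (parts ν) ≈ 0# ⊎ Span (_≼ θ) (monomial ν)
        other ν with parts ν ≟ˡ θ
        ... | yes ≡.refl = inj₁ (trans (+-congˡ (trans (*-congˡ (δ-≡ (shape-partition (isPartition ν)))) (*-identityʳ _))) (-‿inverseʳ _))
        ... | no ne with parts ν ≼? θ
        ...   | yes le = inj₂ (Span-⊂ (λ le′ → ≼-trans le′ le) (ih (≡.subst (λ n → area n (parts ν) < area (sum θ) θ) (≡.sym (proj₁ le)) (area-strict (proj₂ (isPartition ν)) (proj₂ isP) le ne)) (isPartition ν) ≡.refl))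
        ...   | no nle = inj₁ (trans (+-cong (knopSahi-supp isP (parts ν) (nle ∘ Dom⇒≼)) (trans (*-congˡ (off ν ne)) (zeroʳ _))) (+-identityˡ 0#))

    unit-! : ∀ n → ∃[ y ] ⟦ n ! ⟧ * y ≈ 1#
    unit-! zero    = unit-≈ refl (inverse-nat 0)
    unit-! (suc n) = unit-≈ (⟦⟧-* (suc n) (n !)) (unit-* (inverse-nat n) (unit-! n))

    module SpanForm (⟨_,_⟩ : SymFun → SymFun → Carrier) (S : ScalarProduct ⟨_,_⟩) where
      open Form F ⟨_,_⟩ S

      span-orthogonal : ∀ {Q f h} → (∀ {κ} (isP : IsPartition κ) → Q κ → ⟨ f , jackF isP ⟩ ≈ 0#) → Span Q h → ⟨ f , h ⟩ ≈ 0#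
      span-orthogonal h (jack isP q) = h isP q
      span-orthogonal {f = f} h none = zeroʳ′ {f} {0ₛ} (λ _ → refl)
      span-orthogonal {f = f} h (plus {g} {k} x y) = trans (additiveʳ f g k) (trans (+-cong (span-orthogonal h x) (span-orthogonal h y)) (+-identityˡ 0#))
      span-orthogonal {f = f} h (times a {g} x) = trans (homogeneousʳ a f g) (trans (*-congˡ (span-orthogonal h x)) (zeroʳ a))
      span-orthogonal {f = f} h (equiv {g} {k} eq x) = trans (congʳ {f} {k} {g} (λ e → sym (eq e))) (span-orthogonal h x)

    module Identify (⟨_,_⟩ : SymFun → SymFun → Carrier) (S : ScalarProduct ⟨_,_⟩) (J : Partition → SymFun)
      (J-orthogonal : ∀ θ μ → parts θ ≢ parts μ → ⟨ J θ , J μ ⟩ ≈ 0#)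
      (J-triangular : ∀ θ μ → ¬ (μ ⊴ θ) → mcoeff (J θ) μ ≈ 0#)
      (J-normalized : ∀ θ → mcoeff (J θ) (1^ ∣ θ ∣) ≈ ⟦ ∣ θ ∣ ! ⟧) where
      open Form F ⟨_,_⟩ S
      open Adjoint F ⟨_,_⟩ S
      open SpanForm ⟨_,_⟩ S

      -- Multiplied by each other's leading coefficient, `J θ` and `F_θ` differ by a combination `h`
      -- of lower functions `F_κ`. Both are orthogonal to these: `J θ` because `F_κ` is `J κ` by
      -- induction, `F_θ` by its eigenvalue. So `h` is orthogonal to itself and vanishes by
      -- anisotropy; the normalization then identifies the leading coefficients.
      J≈jackF : ∀ θ → J θ ≈ₛ jackF (isPartition θ)
      J≈jackF θ = <-rec (λ a → ∀ θ → area ∣ θ ∣ (parts θ) ≡ a → J θ ≈ₛ jackF (isPartition θ)) step (area ∣ θ ∣ (parts θ)) θ ≡.refl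
        where
        step : ∀ a → (∀ {b} → b < a → ∀ θ → area ∣ θ ∣ (parts θ) ≡ b → J θ ≈ₛ jackF (isPartition θ)) →
          ∀ θ → area ∣ θ ∣ (parts θ) ≡ a → J θ ≈ₛ jackF (isPartition θ)
        step a ih θ ≡.refl e = cancel-unit (lead-unit isP) (trans (proportional e) (*-congʳ v≈c))
          where
          isP : IsPartition (parts θ)
          isP = isPartition θ
          f h : SymFun
          f = jackF isP
          c v : Carrier
          c = lead isP
          v = mcoeff (J θ) θ
          h = c • J θ +ₛ (- v) • f
          Lower : List ℕ → Set
          Lower κ = κ ≼ parts θ × κ ≢ parts θ
          lower-span : Span Lower h
          lower-span = span-by h term
            where
            term : ∀ ν → coeff h (parts ν) ≈ 0# ⊎ Span Lower (monomial ν)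
            term ν with parts ν ≟ˡ parts θ
            ... | yes eq = inj₁ (trans (reflexive (≡.cong (coeff h) eq)) (trans (+-congʳ (*-comm c v)) (trans (+-congˡ (sym (-‿distribˡ-* v c))) (-‿inverseʳ _))))
            ... | no ne with parts ν ≼? parts θ
            ...   | yes le = inj₂ (Span-⊂ (λ {κ} le′ → ≼-trans le′ le , λ { ≡.refl → ne (antisym le′ le) }) (monomial-span (isPartition ν)))
              where
              antisym : parts θ ≼ parts ν → parts ν ≼ parts θ → parts ν ≡ parts θ
              antisym le₁ le₂ with parts ν ≟ˡ parts θ
              ... | yes eq = eq
              ... | no ne  = ⊥-elim (ℕ.<-asym (area-strict (proj₂ (isPartition ν)) (proj₂ isP) le₂ ne)
                  (≡.subst (λ n → area n (parts θ) < area n (parts ν)) (proj₁ le₂) (area-strict (proj₂ isP) (proj₂ (isPartition ν)) le₁ (ne ∘ ≡.sym))))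
            ...   | no nle = inj₁ (trans (+-cong (trans (*-congˡ (J-triangular θ ν nle)) (zeroʳ _)) (trans (*-congˡ (knopSahi-supp isP (parts ν) (nle ∘ Dom⇒≼))) (zeroʳ _))) (+-identityˡ 0#))
          perp : ∀ {κ} (isK : IsPartition κ) → Lower κ → ⟨ h , jackF isK ⟩ ≈ 0#
          perp {κ} isK (le , ne) = trans (additive (c • J θ) ((- v) • f) (jackF isK)) (trans (+-cong
            (trans (homogeneous c (J θ) (jackF isK)) (trans (*-congˡ (trans (congʳ {J θ} {jackF isK} {J κᴾ} (λ e → sym (ih smaller κᴾ ≡.refl e))) (J-orthogonal θ κᴾ (ne ∘ ≡.sym)))) (zeroʳ c)))
            (trans (homogeneous (- v) f (jackF isK)) (trans (*-congˡ (jackF-orthogonal isP isK (≡.sym (proj₁ le)) (odds-distinct (proj₂ isK) (proj₂ isP) le ne))) (zeroʳ _)))) (+-identityˡ 0#))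
            where
            κᴾ : Partition
            κᴾ = mkPartition κ isK
            smaller : area (sum κ) κ < area ∣ θ ∣ (parts θ)
            smaller = ≡.subst (λ n → area n κ < area ∣ θ ∣ (parts θ)) (≡.sym (proj₁ le)) (area-strict (proj₂ isK) (proj₂ isP) le ne)
          h≈0 : h ≈ₛ 0ₛ
          h≈0 = anisotropic h (span-orthogonal perp lower-span)
          proportional : ∀ e → c * coeff (J θ) e ≈ v * coeff f e
          proportional e = +-cancelʳ (- (v * coeff f e)) _ _ (trans (trans (+-congˡ (-‿distribˡ-* v _)) (h≈0 e)) (sym (-‿inverseʳ _)))
          v≈c : v ≈ c
          v≈c = sym (cancel-unit (unit-! ∣ θ ∣) (trans (*-comm _ _) (trans (*-congˡ (sym (J-normalized θ))) (trans (proportional (replicate ∣ θ ∣ 1)) (trans (*-congˡ (jackF-ones isP)) (*-comm _ _))))))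

-- Removal of first columns and first rows

module RowsAndColumns (K : CommutativeRing 0ℓ 0ℓ) (α : CommutativeRing.Carrier K) where

  open import Defs using (1^_)

  open CommutativeRing K
  open Solver commutativeSemiring using (solve; _:=_; _:+_; _:*_)
  open RingProperties ring using (+-cancelʳ; -‿distribˡ-*)
  open Antidiagonal K
  open SymmetricFunctions K
  open FiniteSums K
  open Convolution K
  open KnopSahiSymmetry K α
  open KnopSahiSupport K α
  open KnopSahiValues K α using (zeros-sucs)
  open JackFunctions K α
  open PowerSumDerivations K α using (Nice; coeff-nice)
  open PowerSumBasis K α
  open JackForm K α
  open JackBasis K α
  open Nice

  elem : ℕ → SymFun
  elem m = orbitSum (replicate m 1)

  private
    ∈-replicate : ∀ {A : Set} n {x y : A} → y ∈ replicate n x → y ≡ x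
    ∈-replicate (suc n) (here eq) = eq
    ∈-replicate (suc n) (there p) = ∈-replicate n p

    support-≤ : ∀ e → support e ≤ length e
    support-≤ []          = z≤n
    support-≤ (zero ∷ e)  = ℕ.≤-trans (support-≤ e) (ℕ.n≤1+n _)
    support-≤ (suc x ∷ e) = s≤s (support-≤ e)

    support-zero : ∀ {e} → 0 ∈ e → support e < length e
    support-zero {zero ∷ e}  (here _)  = s≤s (support-≤ e)
    support-zero {zero ∷ e}  (there p) = s≤s (support-≤ e)
    support-zero {suc x ∷ e} (there p) = s≤s (support-zero p)

    no-zero : ∀ {e} → 0 ∉ e → All (0 <_) e
    no-zero {[]}        p = []
    no-zero {zero ∷ e}  p = ⊥-elim (p (here ≡.refl))
    no-zero {suc x ∷ e} p = s≤s z≤n ∷ no-zero (p ∘ there)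

    elem-0 : ∀ m a → length a ≡ m → coeff (elem (suc m)) (0 ∷ a) ≈ 0#
    elem-0 m a len = δ-≢ (shape (0 ∷ a)) (replicate (suc m) 1) (λ eq → ℕ.<-irrefl ≡.refl (ℕ.≤-trans
      (ℕ.≤-reflexive (≡.sym (≡.trans (support-shape (0 ∷ a)) (≡.trans (≡.cong length eq) (length-replicate (suc m)))))) (ℕ.≤-trans (support-≤ a) (ℕ.≤-reflexive len))))

    elem-1 : ∀ m a → coeff (elem (suc m)) (1 ∷ a) ≈ coeff (elem m) a
    elem-1 m a = go (shape a ≟ˡ replicate m 1)
      where
      go : Dec (shape a ≡ replicate m 1) → coeff (elem (suc m)) (1 ∷ a) ≈ coeff (elem m) a
      go (yes eq) = trans (δ-≡ (shape-pads (isPartition (1^ (suc m))) {k = proj₁ (↭-shape a)}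
        (prep 1 (≡.subst (λ s → a ↭ s ++ replicate (proj₁ (↭-shape a)) 0) eq (proj₂ (↭-shape a)))))) (sym (δ-≡ eq))
      go (no ne) = trans (δ-≢ (shape (1 ∷ a)) (replicate (suc m) 1) (λ eq → ne (shape-pads (isPartition (1^ m)) {k = proj₁ (↭-shape (1 ∷ a))}
        (Perm.drop-∷ (≡.subst (λ s → 1 ∷ a ↭ s ++ replicate (proj₁ (↭-shape (1 ∷ a))) 0) eq (proj₂ (↭-shape (1 ∷ a)))))))) (sym (δ-≢ (shape a) (replicate m 1) ne))

    elem-2 : ∀ m i a → coeff (elem m) (suc (suc i) ∷ a) ≈ 0#
    elem-2 m i a = δ-≢ (shape (suc (suc i) ∷ a)) (replicate m 1) (λ eq → contra (∈-++-cases m (Perm.∈-resp-↭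
      (≡.subst (λ s → suc (suc i) ∷ a ↭ s ++ replicate (proj₁ (↭-shape (suc (suc i) ∷ a))) 0) eq (proj₂ (↭-shape (suc (suc i) ∷ a)))) (here ≡.refl))))
      where
      ∈-++-cases : ∀ m {k} → suc (suc i) ∈ replicate m 1 ++ replicate k 0 → suc (suc i) ≡ 1 ⊎ suc (suc i) ≡ 0
      ∈-++-cases m {k} p with ∈-++⁻ (replicate m 1) p
      ... | inj₁ q = inj₁ (∈-replicate m q)
      ... | inj₂ q = inj₂ (∈-replicate k q)
      contra : ¬ (suc (suc i) ≡ 1 ⊎ suc (suc i) ≡ 0)
      contra (inj₁ ())
      contra (inj₂ ())

    elem-∷ : ∀ m (h : Fun) n e → length e ≡ m → convolve (coeff (elem (suc m))) h (n ∷ e) ≈ low 1 n (λ j → convolve (coeff (elem m)) (h ∘ (j ∷_)) e)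
    elem-∷ m h n e len = antidiag-pick 1 n (λ j → convolve-congˡ _ e (λ a _ → elem-1 m a)) other
      where
      other : ∀ i j → i ≢ 1 → convolve (coeff (elem (suc m)) ∘ (i ∷_)) (h ∘ (j ∷_)) e ≈ 0#
      other zero          j ne = convolve-zeroˡ _ e (λ a la → elem-0 m a (≡.trans la len))
      other (suc zero)    j ne = ⊥-elim (ne ≡.refl)
      other (suc (suc i)) j ne = convolve-zeroˡ _ e (λ a la → elem-2 (suc m) i a)

  -- In exactly `length w` variables the elementary function is the single monomial with all
  -- exponents 1.
  elem-sucs : ∀ w (h : Fun) → convolve (coeff (elem (length w))) h (map suc w) ≈ h w
  elem-sucs []      h = *-identityˡ _
  elem-sucs (x ∷ w) h = trans (elem-∷ (length w) h (suc x) (map suc w) (length-map suc w)) (elem-sucs w (h ∘ (x ∷_)))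

  elem-zero : ∀ e (h : Fun) → 0 ∈ e → convolve (coeff (elem (length e))) h e ≈ 0#
  elem-zero (n ∷ e) h p = trans (elem-∷ (length e) h n e ≡.refl) (go n p)
    where
    go : ∀ n → 0 ∈ n ∷ e → low 1 n (λ j → convolve (coeff (elem (length e))) (h ∘ (j ∷_)) e) ≈ 0#
    go zero    _         = refl
    go (suc n) (there p) = elem-zero e (h ∘ (n ∷_)) p

  jackF-support : ∀ {θ} (isP : IsPartition θ) e → support e < length θ → coeff (jackF isP) e ≈ 0#
  jackF-support isP e lt = let (c , w , p) = zeros-sucs e in trans (symmetric (jackF isP) p)
    (jackF-few isP c w (ℕ.≤-trans (s≤s (ℕ.≤-reflexive (≡.sym (≡.trans (support-↭ p) (count-sucs c w))))) lt))
    where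
    count-sucs : ∀ c w → support (replicate c 0 ++ map suc w) ≡ length w
    count-sucs zero    []      = ≡.refl
    count-sucs zero    (x ∷ w) = ≡.cong suc (count-sucs 0 w)
    count-sucs (suc c) w       = count-sucs c w

  addColumn : ℕ → List ℕ → List ℕ
  addColumn m κ = map suc (κ ++ replicate (m ∸ length κ) 0)

  length-addColumn : ∀ {m κ} → length κ ≤ m → length (addColumn m κ) ≡ m
  length-addColumn {m} {κ} le = ≡.trans (length-map suc (κ ++ replicate (m ∸ length κ) 0)) (≡.trans (length-++ κ {replicate (m ∸ length κ) 0}) (≡.trans (≡.cong (length κ ℕ.+_) (length-replicate (m ∸ length κ))) (ℕ.m+[n∸m]≡n le)))

  addColumn-isPartition : ∀ m {κ} → IsPartition κ → IsPartition (addColumn m κ)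
  addColumn-isPartition m {κ} (link , pos) = suc-linked (pad-linked (m ∸ length κ) link) , All.map⁺ (All.universal (λ _ → s≤s z≤n) _)
    where
    zeros-linked : ∀ k → Linked _≥_ (replicate k 0)
    zeros-linked 0             = []
    zeros-linked 1             = [-]
    zeros-linked (suc (suc k)) = z≤n ∷ zeros-linked (suc k)
    pad-linked : ∀ k {xs} → Linked _≥_ xs → Linked _≥_ (xs ++ replicate k 0)
    pad-linked k       []      = zeros-linked k
    pad-linked zero    [-]     = [-]
    pad-linked (suc k) [-]     = z≤n ∷ zeros-linked (suc k)
    pad-linked k       (p ∷ l) = p ∷ pad-linked k l
    suc-linked : ∀ {xs} → Linked _≥_ xs → Linked _≥_ (map suc xs)
    suc-linked []      = []
    suc-linked [-]     = [-]
    suc-linked (p ∷ l) = s≤s p ∷ suc-linked l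

  filter-zeros : ∀ k → filter (0 ℕ.<?_) (replicate k 0) ≡ []
  filter-zeros zero    = ≡.refl
  filter-zeros (suc k) = filter-zeros k

  removeColumn-addColumn : ∀ m {κ} → All (0 <_) κ → removeColumn (addColumn m κ) ≡ κ
  removeColumn-addColumn m {κ} pos = ≡.trans (≡.cong (filter (0 ℕ.<?_)) (pred-suc (κ ++ replicate (m ∸ length κ) 0)))
    (≡.trans (filter-++ (0 ℕ.<?_) κ _) (≡.trans (≡.cong₂ _++_ (filter-all (0 ℕ.<?_) pos) (filter-zeros (m ∸ length κ))) (++-identityʳ κ)))
    where
    pred-suc : ∀ xs → map pred (map suc xs) ≡ xs
    pred-suc []       = ≡.refl
    pred-suc (x ∷ xs) = ≡.cong (x ∷_) (pred-suc xs)

  addColumn-removeColumn : ∀ {θ} → IsPartition θ → addColumn (length θ) (removeColumn θ) ≡ θ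
  addColumn-removeColumn (link , pos) = ≡.trans (≡.cong (map suc) (≡.sym (pred-split link))) (suc-pred pos)

  removeRow-isPartition : ∀ {θ} → IsPartition θ → IsPartition (drop 1 θ)
  removeRow-isPartition {[]}        isP          = isP
  removeRow-isPartition {x ∷ []}    (l , _ ∷ ps) = [] , ps
  removeRow-isPartition {x ∷ y ∷ θ} (_ ∷ l , _ ∷ ps) = l , ps

  removeRow-removeColumn : ∀ {θ} → IsPartition θ → drop 1 (removeColumn θ) ≡ removeColumn (drop 1 θ)
  removeRow-removeColumn {[]}            isP = ≡.refl
  removeRow-removeColumn {suc zero ∷ θ}  isP@(l , _) = ≡.trans (≡.cong (drop 1) empty) (≡.sym empty)
    where
    empty : removeColumn θ ≡ []
    empty = isPartition-≤0 (removeColumn-isPartition (removeRow-isPartition isP)) (removeColumn-≤ (below (≤-first l)))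
      where
      below : ∀ {θ} → All (_≤ 1) (1 ∷ θ) → All (_≤ 1) θ
      below (_ ∷ ps) = ps
  removeRow-removeColumn {suc (suc x) ∷ θ} isP = ≡.refl
  removeRow-removeColumn {zero ∷ θ} (_ , () ∷ _)

  Homogeneous : ℕ → Fun → Set
  Homogeneous n f = ∀ e → sum e ≢ n → f e ≈ 0#

  -- A squarefree monomial splits by distributing its variables between the factors, and homogeneity
  -- admits only splittings into `a` and `b` variables. Their number is a binomial coefficient, here
  -- cleared of denominators.
  ones-product : ∀ a b {f g : Fun} → Nice f → Nice g → Homogeneous a f → Homogeneous b g →
    (⟦ a ! ⟧ * ⟦ b ! ⟧) * convolve f g (replicate (a ℕ.+ b) 1) ≈ ⟦ (a ℕ.+ b) ! ⟧ * (f (replicate a 1) * g (replicate b 1))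
  ones-product a b nf ng hf hg = go (a ℕ.+ b) a b ≡.refl nf ng hf hg
    where
    E₁-nice : ∀ {f : Fun} → Nice f → Nice (f ∘ (1 ∷_))
    E₁-nice nf = record { sym-nice = λ p → sym-nice nf (prep 1 p) ; pad-nice = λ e → trans (sym-nice nf (_↭_.swap 1 0 ↭-refl)) (pad-nice nf (1 ∷ e)) }
    E₁-hom : ∀ {n} {f : Fun} → Homogeneous (suc n) f → Homogeneous n (f ∘ (1 ∷_))
    E₁-hom h e ne = h (1 ∷ e) (ne ∘ ℕ.suc-injective)
    split : ∀ {f g : Fun} → Nice f → Nice g → ∀ n → convolve f g (replicate (suc n) 1) ≈ convolve f (g ∘ (1 ∷_)) (replicate n 1) + convolve (f ∘ (1 ∷_)) g (replicate n 1)
    split nf ng n = +-cong (convolve-cong (pad-nice nf) (λ _ → refl) (replicate n 1)) (convolve-cong (λ _ → refl) (pad-nice ng) (replicate n 1))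
    kill : ∀ {f : Fun} g e → Homogeneous 0 f → convolve (f ∘ (1 ∷_)) g e ≈ 0#
    kill g e h = convolve-zeroˡ g e (λ a _ → h (1 ∷ a) (λ ()))
    go : ∀ n a b {f g : Fun} → a ℕ.+ b ≡ n → Nice f → Nice g → Homogeneous a f → Homogeneous b g →
      (⟦ a ! ⟧ * ⟦ b ! ⟧) * convolve f g (replicate n 1) ≈ ⟦ n ! ⟧ * (f (replicate a 1) * g (replicate b 1))
    go zero zero zero eq nf ng hf hg = *-congʳ (trans (*-congˡ ⟦1⟧) (*-identityʳ _))
    go (suc n) zero (suc b) {f} {g} ≡.refl nf ng hf hg = trans (*-cong (*-congˡ (⟦⟧-* (suc b) (b !))) (trans (split nf ng n) (trans (+-congˡ (kill g (replicate n 1) hf)) (+-identityʳ _))))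
      (trans (solve 4 (λ x s b c → (x :* (s :* b)) :* c := s :* ((x :* b) :* c)) refl ⟦ 0 ! ⟧ ⟦ suc b ⟧ ⟦ b ! ⟧ _)
      (trans (*-congˡ (go n 0 b ≡.refl nf (E₁-nice ng) hf (E₁-hom hg))) (trans (sym (*-assoc _ _ _)) (*-congʳ (sym (⟦⟧-* (suc b) (b !)))))))
    go (suc n) (suc a) zero {f} {g} eq nf ng hf hg = trans (*-cong (*-congʳ (⟦⟧-* (suc a) (a !))) (trans (split nf ng n)
        (trans (+-congʳ (trans (convolve-comm f _ (replicate n 1)) (kill f (replicate n 1) hg))) (+-identityˡ _))))
      (trans (solve 4 (λ s a x c → ((s :* a) :* x) :* c := s :* ((a :* x) :* c)) refl ⟦ suc a ⟧ ⟦ a ! ⟧ ⟦ 0 ! ⟧ _)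
      (trans (*-congˡ (go n a 0 (ℕ.suc-injective eq) (E₁-nice nf) ng (E₁-hom hf) hg)) (trans (sym (*-assoc _ _ _)) (*-congʳ (trans (*-congʳ (reflexive (≡.cong ⟦_⟧ (≡.trans (≡.sym (ℕ.+-identityʳ (suc a))) eq)))) (sym (⟦⟧-* (suc n) (n !))))))))
    go (suc n) (suc a) (suc b) {f} {g} eq nf ng hf hg = trans (*-cong (*-cong (⟦⟧-* (suc a) (a !)) (⟦⟧-* (suc b) (b !))) (split nf ng n))
      (trans (solve 6 (λ s A t B x y → ((s :* A) :* (t :* B)) :* (x :+ y) := t :* (((s :* A) :* B) :* x) :+ s :* ((A :* (t :* B)) :* y)) refl ⟦ suc a ⟧ ⟦ a ! ⟧ ⟦ suc b ⟧ ⟦ b ! ⟧ _ _)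
      (trans (+-cong
          (*-congˡ (trans (*-congʳ (*-congʳ (sym (⟦⟧-* (suc a) (a !))))) (go n (suc a) b (ℕ.suc-injective (≡.trans (≡.cong suc (≡.sym (ℕ.+-suc a b))) eq)) nf (E₁-nice ng) hf (E₁-hom hg))))
          (*-congˡ (trans (*-congʳ (*-congˡ (sym (⟦⟧-* (suc b) (b !))))) (go n a (suc b) (ℕ.suc-injective eq) (E₁-nice nf) ng (E₁-hom hf) hg))))
      (trans (solve 4 (λ s t N x → t :* (N :* x) :+ s :* (N :* x) := ((s :+ t) :* N) :* x) refl ⟦ suc a ⟧ ⟦ suc b ⟧ ⟦ n ! ⟧ _)
      (*-congʳ (trans (*-congʳ (trans (sym (⟦⟧-+ (suc a) (suc b))) (reflexive (≡.cong ⟦_⟧ eq)))) (sym (⟦⟧-* (suc n) (n !))))))))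

  jackF-homogeneous : ∀ {θ} (isP : IsPartition θ) → Homogeneous (sum θ) (coeff (jackF isP))
  jackF-homogeneous isP e ne = knopSahi-supp isP e (ne ∘ proj₁)

  jackF-≡ : ∀ {θ μ} (isP : IsPartition θ) (isQ : IsPartition μ) → θ ≡ μ → jackF isP ≈ₛ jackF isQ
  jackF-≡ isP isQ ≡.refl e = refl

  lead-≡ : ∀ {θ μ} (isP : IsPartition θ) (isQ : IsPartition μ) → θ ≡ μ → lead isP ≈ lead isQ
  lead-≡ isP isQ ≡.refl = refl

  colFactor-ones : ∀ b → colFactor (replicate b 1) ≈ ⟦ b ! ⟧
  colFactor-ones zero    = sym ⟦1⟧
  colFactor-ones (suc b) = trans (*-cong (trans (+-congʳ (zeroˡ α)) (trans (+-identityˡ _) (reflexive (≡.cong (λ n → ⟦ suc n ⟧) (length-replicate b))))) (colFactor-ones b)) (sym (⟦⟧-* (suc b) (b !)))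

  module Theory (F : JackField) (⟨_,_⟩ : SymFun → SymFun → Carrier) (S : ScalarProduct ⟨_,_⟩)
    (orth : ∀ {θ μ} (isP : IsPartition θ) (isQ : IsPartition μ) → θ ≢ μ → ⟨ jackF isP , jackF isQ ⟩ ≈ 0#) where
    open JackField F
    open Form F ⟨_,_⟩ S
    open Basis F
    open SpanForm ⟨_,_⟩ S
    open Dual
    open Row

    nondegenerate : ∀ f → (∀ {κ} (isP : IsPartition κ) → ⟨ f , jackF isP ⟩ ≈ 0#) → f ≈ₛ 0ₛ
    nondegenerate f h = anisotropic f (span-orthogonal {Q = λ _ → ⊤} (λ isP _ → h isP) (span-by f (λ ν → inj₂ (Span-⊂ (λ _ → tt) (monomial-span (isPartition ν))))))

    minus : Carrier → SymFun → Carrier → SymFun → SymFun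
    minus a f b g = a • f +ₛ (- b) • g

    minus-≈ : ∀ {a f b g} → minus a f b g ≈ₛ 0ₛ → ∀ e → a * coeff f e ≈ b * coeff g e
    minus-≈ {a} {f} {b} {g} h e = +-cancelʳ (- (b * coeff g e)) _ _ (trans (trans (+-congˡ (-‿distribˡ-* b _)) (h e)) (sym (-‿inverseʳ _)))

    minus-zero : ∀ {a b x y} → a * x ≈ b * y → a * x + - b * y ≈ 0#
    minus-zero {a} {b} {x} {y} eq = trans (+-cong eq (sym (-‿distribˡ-* b y))) (-‿inverseʳ _)

    form-minus : ∀ a f b g h → ⟨ minus a f b g , h ⟩ ≈ a * ⟨ f , h ⟩ + - b * ⟨ g , h ⟩
    form-minus a f b g h = trans (additive (a • f) ((- b) • g) h) (+-cong (homogeneous a f h) (homogeneous (- b) g h))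

    form-minus-≈ : ∀ {a f b g h} → ⟨ minus a f b g , h ⟩ ≈ 0# → a * ⟨ f , h ⟩ ≈ b * ⟨ g , h ⟩
    form-minus-≈ {a} {f} {b} {g} {h} eq = +-cancelʳ (- (b * ⟨ g , h ⟩)) _ _ (trans (trans (+-congˡ (-‿distribˡ-* b _)) (trans (sym (form-minus a f b g h)) eq)) (sym (-‿inverseʳ _)))

    ⟪_⟫ : ∀ {θ} → IsPartition θ → Carrier
    ⟪ isP ⟫ = ⟨ jackF isP , jackF isP ⟩

    norm-unit : ∀ {θ} (isP : IsPartition θ) → ∃[ y ] ⟪ isP ⟫ * y ≈ 1#
    norm-unit {θ} isP = reciprocal ⟪ isP ⟫ (λ eq → nontrivial (trans (sym (proj₂ (unit-! (sum θ)))) (trans (*-congʳ (trans (sym (jackF-ones isP)) (anisotropic (jackF isP) eq _))) (zeroˡ _))))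

    norm-≡ : ∀ {θ μ} (isP : IsPartition θ) (isQ : IsPartition μ) → θ ≡ μ → ⟪ isP ⟫ ≈ ⟪ isQ ⟫
    norm-≡ isP isQ eq = cong {jackF isP} {jackF isQ} {jackF isP} {jackF isQ} (jackF-≡ isP isQ eq) (jackF-≡ isP isQ eq)

    -- The kernel of the restriction to `m` variables. It is an ideal, and by `Ker-orthogonal` it is
    -- invisible to Jack functions with at most `m` rows.
    Ker : ℕ → SymFun → Set
    Ker m f = ∀ e → length e ≡ m → coeff f e ≈ 0#

    Ker-· : ∀ {m f} q → Ker m f → Ker m (f · q)
    Ker-· q h e len = convolve-zeroˡ (coeff q) e (λ a la → h a (≡.trans la len))

    Ker-·ʳ : ∀ {m f} q → Ker m f → Ker m (q · f)
    Ker-·ʳ {m} {f} q h e len = trans (·-comm q f e) (Ker-· {m} {f} q h e len)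

    -- f is a combination of monomials, hence of Jack functions, with more
    -- than m rows.
    Ker-orthogonal : ∀ {m f θ} → Ker m f → (isP : IsPartition θ) → length θ ≤ m → ⟨ f , jackF isP ⟩ ≈ 0#
    Ker-orthogonal {m} {f} {θ} h isP le = trans (commutative f (jackF isP)) (span-orthogonal {Q = λ κ → m < length κ}
        (λ isK lt → orth isP isK (λ { ≡.refl → ℕ.<⇒≱ lt le })) (span-by f term))
      where
      term : ∀ ν → coeff f (parts ν) ≈ 0# ⊎ Span (λ κ → m < length κ) (monomial ν)
      term ν with length (parts ν) ℕ.≤? m
      ... | yes short = inj₁ (trans (sym (coeff-zeros f (m ∸ length (parts ν)) (parts ν)))
          (h _ (≡.trans (length-++ (parts ν)) (≡.trans (≡.cong (length (parts ν) ℕ.+_) (length-replicate _)) (ℕ.m+[n∸m]≡n short)))))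
      ... | no long = inj₂ (Span-⊂ (λ κ≼ν → ℕ.≤-trans (ℕ.≰⇒> long) (≼-length (proj₂ (isPartition ν)) κ≼ν)) (monomial-span (isPartition ν)))

    Ker-short : ∀ {θ m} (isP : IsPartition θ) → m < length θ → Ker m (jackF isP)
    Ker-short isP lt e ≡.refl = jackF-support isP e (ℕ.≤-trans (s≤s (support-≤ e)) lt)

    -- Both functions vanish where an exponent is 0; elsewhere all exponents can be lowered by one,
    -- and the equation is `jackF-column`.
    column-Ker : ∀ {θ} (isP : IsPartition θ) → Ker (length θ) (minus 1# (jackF isP) (colFactor θ) (elem (length θ) · jackF (removeColumn-isPartition isP)))
    column-Ker {θ} isP e len = minus-zero (trans (*-identityˡ _) (go (0 ∈? e)))
      where
      h : SymFun
      h = jackF (removeColumn-isPartition isP)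
      go : Dec (0 ∈ e) → coeff (jackF isP) e ≈ colFactor θ * coeff (elem (length θ) · h) e
      go (yes 0∈) = trans (jackF-support isP e (ℕ.≤-trans (support-zero 0∈) (ℕ.≤-reflexive len)))
        (sym (trans (*-congˡ (trans (reflexive (≡.cong (λ m → coeff (elem m · h) e) (≡.sym len))) (elem-zero e (coeff h) 0∈))) (zeroʳ _)))
      go (no 0∉) = ≡.subst (λ e → coeff (jackF isP) e ≈ colFactor θ * coeff (elem (length θ) · h) e) (suc-pred (no-zero 0∉))
        (trans (jackF-column isP w lenw) (*-congˡ (sym (trans (reflexive (≡.cong (λ m → coeff (elem m · h) (map suc w)) (≡.sym lenw))) (elem-sucs w (coeff h))))))
        where
        w : List ℕ
        w = map pred e
        lenw : length w ≡ length θ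
        lenw = ≡.trans (length-map pred e) len

    -- Replacing `F_μ` by its factorization in `length θ` variables changes the product by an
    -- element of the ideal `Ker`, which `F_θ` does not see.
    column-form : ∀ {θ μ} (isP : IsPartition θ) (isQ : IsPartition μ) → length θ ≡ length μ → ∀ q →
      ⟨ jackF isP , jackF isQ · q ⟩ ≈ colFactor μ * ⟨ jackF isP , elem (length θ) · (jackF (removeColumn-isPartition isQ) · q) ⟩
    column-form {θ} {μ} isP isQ len q = trans (commutative (jackF isP) (jackF isQ · q)) (trans (sym (*-identityˡ _)) (trans (form-minus-≈ {1#} {jackF isQ · q} {colFactor μ} {elem m · (h · q)} {jackF isP}
        (trans (congˡ {minus 1# (jackF isQ · q) (colFactor μ) (elem m · (h · q))} {minus 1# (jackF isQ) (colFactor μ) (elem m · h) · q} {jackF isP} dist)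
          (Ker-orthogonal {m} {minus 1# (jackF isQ) (colFactor μ) (elem m · h) · q} (Ker-· {m} {minus 1# (jackF isQ) (colFactor μ) (elem m · h)} q ker) isP ℕ.≤-refl))) (*-congˡ (commutative (elem m · (h · q)) (jackF isP)))))
      where
      m : ℕ
      m = length θ
      h : SymFun
      h = jackF (removeColumn-isPartition isQ)
      ker : Ker m (minus 1# (jackF isQ) (colFactor μ) (elem m · h))
      ker = ≡.subst (λ j → Ker j (minus 1# (jackF isQ) (colFactor μ) (elem j · h))) (≡.sym len) (column-Ker isQ)
      dist : minus 1# (jackF isQ · q) (colFactor μ) (elem m · (h · q)) ≈ₛ minus 1# (jackF isQ) (colFactor μ) (elem m · h) · q
      dist e = sym (trans (·-distribʳ (1# • jackF isQ) ((- colFactor μ) • (elem m · h)) q e) (+-cong (·-•ˡ 1# (jackF isQ) q e)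
        (trans (·-•ˡ (- colFactor μ) (elem m · h) q e) (*-congˡ (·-assoc (elem m) h q e)))))

    -- The adjoint of `elem m` at `F_θ` is identified by testing against all `F_κ`. For `κ` with at
    -- most `m` rows, `elem m · F_κ` is, up to a factor and up to `Ker`, the Jack function of `κ`
    -- with a column of length `m` added, hence orthogonal to `F_θ` unless that partition is `θ`.
    column-adjoint : ∀ {θ} (isP : IsPartition θ) q → (colFactor θ * ⟪ removeColumn-isPartition isP ⟫) * ⟨ jackF isP , elem (length θ) · q ⟩ ≈
      ⟪ isP ⟫ * ⟨ jackF (removeColumn-isPartition isP) , q ⟩
    column-adjoint {θ} isP q = trans (*-congˡ (trans (commutative f (elem m · q)) (trans (dual D q f) (commutative q (op D f)))))
      (form-minus-≈ {c} {op D f} {⟪ isP ⟫} {h} {q} (zeroˡ′ {minus c (op D f) ⟪ isP ⟫ h} {q} (nondegenerate (minus c (op D f) ⟪ isP ⟫ h) perp)))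
      where
      m : ℕ
      m = length θ
      isP̄ : IsPartition (removeColumn θ)
      isP̄ = removeColumn-isPartition isP
      f h : SymFun
      f = jackF isP
      h = jackF isP̄
      c : Carrier
      c = colFactor θ * ⟪ isP̄ ⟫
      D : Dual (elem m)
      D = dualOf (elem m)
      perp : ∀ {κ} (isK : IsPartition κ) → ⟨ minus c (op D f) ⟪ isP ⟫ h , jackF isK ⟩ ≈ 0#
      perp {κ} isK = trans (form-minus c (op D f) ⟪ isP ⟫ h (jackF isK)) (minus-zero (trans (*-congˡ (trans (commutative (op D f) (jackF isK)) (sym (dual D (jackF isK) f)))) (go (length κ ℕ.≤? m))))
        where
        k : SymFun
        k = jackF isK
        vanish : ⟨ elem m · k , f ⟩ ≈ 0# → removeColumn θ ≢ κ → c * ⟨ elem m · k , f ⟩ ≈ ⟪ isP ⟫ * ⟨ h , k ⟩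
        vanish z ne = trans (*-congˡ z) (trans (zeroʳ c) (sym (trans (*-congˡ (orth isP̄ isK ne)) (zeroʳ _))))
        go : Dec (length κ ≤ m) → c * ⟨ elem m · k , f ⟩ ≈ ⟪ isP ⟫ * ⟨ h , k ⟩
        go (no long) = vanish (Ker-orthogonal {m} {elem m · k} (Ker-·ʳ {m} {k} (elem m) (Ker-short isK (ℕ.≰⇒> long))) isP ℕ.≤-refl)
          (λ { ≡.refl → long (length-removeColumn θ) })
        go (yes short) = inner (κ⁺ ≟ˡ θ)
          where
          κ⁺ : List ℕ
          κ⁺ = addColumn m κ
          isK⁺ : IsPartition κ⁺
          isK⁺ = addColumn-isPartition m isK
          len⁺ : length κ⁺ ≡ m
          len⁺ = length-addColumn {m} {κ} short
          raised : colFactor κ⁺ * ⟨ elem m · k , f ⟩ ≈ ⟨ jackF isK⁺ , f ⟩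
          raised = sym (trans (sym (*-identityˡ _)) (trans (form-minus-≈ {1#} {jackF isK⁺} {colFactor κ⁺} {elem (length κ⁺) · k′} {f}
              (Ker-orthogonal {length κ⁺} {minus 1# (jackF isK⁺) (colFactor κ⁺) (elem (length κ⁺) · k′)} (column-Ker isK⁺) isP (ℕ.≤-reflexive (≡.sym len⁺))))
            (*-congˡ (congˡ {elem (length κ⁺) · k′} {elem m · k} {f} (·-cong {elem (length κ⁺)} {elem m} {k′} {k} (λ e → reflexive (≡.cong (λ j → coeff (elem j) e) len⁺))
              (jackF-≡ (removeColumn-isPartition isK⁺) isK (removeColumn-addColumn m (proj₂ isK))))))))
            where
            k′ : SymFun
            k′ = jackF (removeColumn-isPartition isK⁺)
          inner : Dec (κ⁺ ≡ θ) → c * ⟨ elem m · k , f ⟩ ≈ ⟪ isP ⟫ * ⟨ h , k ⟩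
          inner (yes eq) = trans (solve 3 (λ a j x → (a :* j) :* x := (a :* x) :* j) refl (colFactor θ) _ _)
            (*-cong (trans (*-congʳ (reflexive (≡.cong colFactor (≡.sym eq)))) (trans raised (congˡ {jackF isK⁺} {f} {f} (jackF-≡ isK⁺ isP eq))))
              (congʳ {h} {h} {k} (jackF-≡ isP̄ isK (≡.trans (≡.cong removeColumn (≡.sym eq)) (removeColumn-addColumn m (proj₂ isK))))))
          inner (no ne) = vanish (cancel-unit (colFactor-unit κ⁺) (trans raised (trans (orth isK⁺ isP ne) (sym (zeroʳ _)))))
            (λ { ≡.refl → ne (addColumn-removeColumn isP) })

    E-vanish : ∀ {a θ} (isP : IsPartition θ) → first θ < a → E a (jackF isP) ≈ₛ 0ₛ
    E-vanish {a} {θ} isP lt e = knopSahi-supp isP (a ∷ e) (λ (_ , h) → ℕ.<⇒≱ lt (ℕ.≤-trans (ℕ.≤-reflexive (≡.sym (ℕ.+-identityʳ a))) (ℕ.≤-trans (h (a ∷ []) e ↭-refl) (ℕ.≤-reflexive (prefix-1 θ)))))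
      where
      prefix-1 : ∀ xs → prefix 1 xs ≡ first xs
      prefix-1 []       = ≡.refl
      prefix-1 (x ∷ xs) = ℕ.+-identityʳ x

    -- By induction on the columns: the two sides agree in ℓ(θ) - 1
    -- variables by jackF-column, and both are orthogonal to the Jack
    -- functions with more rows by column-adjoint.
    row-removal : ∀ {θ} (isP : IsPartition θ) → lead (removeRow-isPartition isP) • E (first θ) (jackF isP) ≈ₛ lead isP • jackF (removeRow-isPartition isP)
    row-removal {θ} isP = go (first θ) isP ≡.refl
      where
      go : ∀ n {θ} (isP : IsPartition θ) → first θ ≡ n → lead (removeRow-isPartition isP) • E n (jackF isP) ≈ₛ lead isP • jackF (removeRow-isPartition isP)
      go n       {[]}        isP ≡.refl e = *-congˡ (pad-nice (coeff-nice (jackF isP)) e)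
      go zero    {suc _ ∷ θ} isP ()
      go n       {zero ∷ θ}  (_ , () ∷ _)
      go (suc n) {suc .n ∷ θ} isP ≡.refl = minus-≈ {lead isR} {E x f} {lead isP} {r} (nondegenerate w perp)
        where
        x m : ℕ
        x = suc n
        m = length θ
        isR : IsPartition θ
        isR = removeRow-isPartition isP
        isP̄ : IsPartition (removeColumn (x ∷ θ))
        isP̄ = removeColumn-isPartition isP
        isR̄ : IsPartition (removeColumn θ)
        isR̄ = removeColumn-isPartition isR
        f r w : SymFun
        f = jackF isP
        r = jackF isR
        w = minus (lead isR) (E x f) (lead isP) r
        g′ : Row x
        g′ = rowOf x
        E-form : ∀ k → ⟨ E x f , k ⟩ ≈ ⟨ f , k · g g′ ⟩
        E-form k = trans (commutative (E x f) k) (trans (sym (adj g′ k f)) (trans (commutative (g g′ · k) f) (congʳ {f} {g g′ · k} {k · g g′} (·-comm (g g′) k))))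
        bar : first (removeColumn (x ∷ θ)) ≡ n
        bar = first-removeColumn isP
        ih : ∀ e → lead (removeRow-isPartition isP̄) * coeff (jackF isP̄) (n ∷ e) ≈ lead isP̄ * coeff (jackF (removeRow-isPartition isP̄)) e
        ih = go n isP̄ bar
        both : drop 1 (removeColumn (x ∷ θ)) ≡ removeColumn θ
        both = removeRow-removeColumn isP
        ker : Ker m w
        ker e len = minus-zero {lead isR} {lead isP} (cases (0 ∈? e))
          where
          cases : Dec (0 ∈ e) → lead isR * coeff f (x ∷ e) ≈ lead isP * coeff r e
          cases (yes 0∈) = trans (trans (*-congˡ (jackF-support isP (x ∷ e) (s≤s lt))) (zeroʳ _)) (sym (trans (*-congˡ (jackF-support isR e lt)) (zeroʳ _)))
            where
            lt : support e < m
            lt = ℕ.≤-trans (support-zero 0∈) (ℕ.≤-reflexive len)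
          cases (no 0∉) = ≡.subst (λ e → lead isR * coeff f (x ∷ e) ≈ lead isP * coeff r e) (suc-pred (no-zero 0∉))
            (trans (*-cong (lead-column isR) (jackF-column isP (n ∷ v) (≡.cong suc lenv)))
            (trans (solve 4 (λ a l b y → (a :* l) :* (b :* y) := (a :* b) :* (l :* y)) refl (colFactor θ) (lead isR̄) (colFactor (x ∷ θ)) _)
            (trans (*-congˡ (trans (*-congʳ (lead-≡ isR̄ (removeRow-isPartition isP̄) (≡.sym both))) (trans (ih v) (*-congˡ (jackF-≡ (removeRow-isPartition isP̄) isR̄ both v)))))
            (trans (solve 4 (λ a b l y → (a :* b) :* (l :* y) := (b :* l) :* (a :* y)) refl (colFactor θ) (colFactor (x ∷ θ)) (lead isP̄) _)
            (*-cong (sym (lead-column isP)) (sym (jackF-column isR v lenv)))))))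
            where
            v : List ℕ
            v = map pred e
            lenv : length v ≡ m
            lenv = ≡.trans (length-map pred e) len
        perp : ∀ {κ} (isK : IsPartition κ) → ⟨ w , jackF isK ⟩ ≈ 0#
        perp {κ} isK with length κ ℕ.≤? m
        ... | yes short = Ker-orthogonal {m} {w} ker isK short
        ... | no long = trans (form-minus (lead isR) (E x f) (lead isP) r (jackF isK)) (trans (+-cong
            (trans (*-congˡ (trans (E-form (jackF isK)) (kill (length κ ℕ.≟ suc m)))) (zeroʳ _))
            (trans (*-congˡ (orth isR isK (λ { ≡.refl → long ℕ.≤-refl }))) (zeroʳ _))) (+-identityˡ 0#))
          where
          kill : Dec (length κ ≡ suc m) → ⟨ f , jackF isK · g g′ ⟩ ≈ 0#
          kill (no ne) = trans (commutative f (jackF isK · g g′)) (Ker-orthogonal {suc m} {jackF isK · g g′} (Ker-· {suc m} {jackF isK} (g g′) (Ker-short isK (ℕ.≤∧≢⇒< (ℕ.≰⇒> long) (ne ∘ ≡.sym)))) isP ℕ.≤-refl)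
          -- Here `κ` has as many rows as `x ∷ θ`, so a column comes off on both sides. Then `g_x`
          -- is paired with a function whose first row is only `n`, and its adjoint `E x` kills
          -- that.
          kill (yes eq) = trans (column-form isP isK (≡.sym eq) (g g′)) (trans (*-congˡ (cancel-unit (unit-* (colFactor-unit (x ∷ θ)) (norm-unit isP̄))
              (trans (column-adjoint isP (k̄ · g g′)) (trans (*-congˡ lower) (trans (zeroʳ _) (sym (zeroʳ _))))))) (zeroʳ _))
            where
            k̄ : SymFun
            k̄ = jackF (removeColumn-isPartition isK)
            lower : ⟨ jackF isP̄ , k̄ · g g′ ⟩ ≈ 0#
            lower = trans (commutative (jackF isP̄) (k̄ · g g′)) (trans (congˡ {k̄ · g g′} {g g′ · k̄} {jackF isP̄} (·-comm k̄ (g g′))) (trans (adj g′ k̄ (jackF isP̄))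
              (zeroʳ′ {k̄} {E x (jackF isP̄)} (E-vanish isP̄ (s≤s (ℕ.≤-reflexive bar))))))

    below-span : ∀ {a} h → Below a (coeff h) → Span (λ κ → first κ ≤ a) h
    below-span {a} h b = span-by h term
      where
      entry : ∀ xs → ¬ (first xs ≤ a) → Any (a <_) xs
      entry []       gt = ⊥-elim (gt z≤n)
      entry (x ∷ xs) gt = here (ℕ.≰⇒> gt)
      term : ∀ ν → coeff h (parts ν) ≈ 0# ⊎ Span (λ κ → first κ ≤ a) (monomial ν)
      term ν with first (parts ν) ℕ.≤? a
      ... | yes le = inj₂ (Span-⊂ (λ κ≼ν → ℕ.≤-trans (≼-first κ≼ν) le) (monomial-span (isPartition ν)))
      ... | no gt  = inj₁ (b (parts ν) (entry (parts ν) gt))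

    jackF-below : ∀ {θ} (isP : IsPartition θ) → Below (first θ) (coeff (jackF isP))
    jackF-below {θ} isP e any = let (k , k∈ , lt) = find any ; (e′ , p) = ∈⇒↭ k∈ in
      trans (symmetric (jackF isP) p) (E-vanish isP lt e′)
      where
      open Cherednik K α using (∈⇒↭)

    -- After the adjoint of `q` is moved onto `F_θ`, no exponent exceeds `a`, so the result is a
    -- combination of Jack functions with first row at most `a`, to all of which `w` is orthogonal.
    row-orthogonal : ∀ {θ a} (isP : IsPartition θ) → first θ ≤ a → ∀ w → (∀ {κ} (isK : IsPartition κ) → first κ ≤ a → ⟨ w , jackF isK ⟩ ≈ 0#) →
      ∀ q → ⟨ jackF isP , w · q ⟩ ≈ 0#
    row-orthogonal {θ} {a} isP le w h q = trans (commutative (jackF isP) (w · q)) (trans (congˡ {w · q} {q · w} {jackF isP} (·-comm w q)) (trans (dual (dualOf q) w (jackF isP))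
      (span-orthogonal {Q = λ κ → first κ ≤ a} h (below-span (op (dualOf q) (jackF isP)) (below (dualOf q) (jackF isP) (λ e any → jackF-below isP e (Any.map (λ lt → ℕ.≤-<-trans le lt) any)))))))

    row-form : ∀ {θ} (isP : IsPartition θ) q → lead (removeRow-isPartition isP) * ⟨ jackF isP , g (rowOf (first θ)) · q ⟩ ≈ lead isP * ⟨ jackF (removeRow-isPartition isP) , q ⟩
    row-form {θ} isP q = trans (*-congˡ (trans (commutative (jackF isP) (g (rowOf (first θ)) · q)) (trans (adj (rowOf (first θ)) q (jackF isP)) (commutative q (E (first θ) (jackF isP))))))
      (trans (sym (homogeneous (lead isR) (E (first θ) (jackF isP)) q)) (trans (congˡ {lead isR • E (first θ) (jackF isP)} {lead isP • jackF isR} {q} (row-removal isP)) (homogeneous (lead isP) (jackF isR) q)))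
      where
      isR : IsPartition (drop 1 θ)
      isR = removeRow-isPartition isP

    -- Up to constants, `g_a F_μ̂` has the same pairings as `F_μ` with all Jack functions of first
    -- row at most `a`. By `row-orthogonal` the difference `w` disappears against `F_θ` even after
    -- multiplication by `q`.
    row-step : ∀ {θ μ} (isP : IsPartition θ) (isQ : IsPartition μ) → first θ ≡ first μ → ∀ q →
      (lead isP * lead (removeRow-isPartition isQ) * ⟪ isQ ⟫) * ⟨ jackF (removeRow-isPartition isP) , jackF (removeRow-isPartition isQ) · q ⟩ ≈
      (lead isQ * lead (removeRow-isPartition isP) * ⟪ removeRow-isPartition isQ ⟫) * ⟨ jackF isP , jackF isQ · q ⟩
    row-step {θ} {μ} isP isQ same-row q = trans (solve 4 (λ a b c x → (a :* b :* c) :* x := (b :* c) :* (a :* x)) refl (lead isP) (lead isQ̂) ⟪ isQ ⟫ _)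
      (trans (*-congˡ (trans (sym (row-form isP (q̂ · q))) (*-congˡ (congʳ {jackF isP} {G · (q̂ · q)} {(G · q̂) · q} (λ e → sym (·-assoc G q̂ q e))))))
      (trans (solve 4 (λ b c l y → (b :* c) :* (l :* y) := l :* ((b :* c) :* y)) refl (lead isQ̂) ⟪ isQ ⟫ (lead isP̂) _)
      (trans (*-congˡ middle) (solve 4 (λ l a j y → l :* ((a :* j) :* y) := (a :* l :* j) :* y) refl (lead isP̂) (lead isQ) ⟪ isQ̂ ⟫ _))))
      where
      a : ℕ
      a = first θ
      isP̂ : IsPartition (drop 1 θ)
      isP̂ = removeRow-isPartition isP
      isQ̂ : IsPartition (drop 1 μ)
      isQ̂ = removeRow-isPartition isQ
      G q̂ w : SymFun
      G = g (rowOf a)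
      q̂ = jackF isQ̂
      A B : Carrier
      A = lead isQ̂ * ⟪ isQ ⟫
      B = lead isQ * ⟪ isQ̂ ⟫
      w = minus A (G · q̂) B (jackF isQ)
      E-form : ∀ k → ⟨ G · q̂ , k ⟩ ≈ ⟨ q̂ , E a k ⟩
      E-form k = adj (rowOf a) q̂ k
      perp : ∀ {κ} (isK : IsPartition κ) → first κ ≤ a → ⟨ w , jackF isK ⟩ ≈ 0#
      perp {κ} isK le = trans (form-minus A (G · q̂) B (jackF isQ) (jackF isK)) (minus-zero (trans (*-congˡ (E-form (jackF isK))) (cases (κ ≟ˡ μ))))
        where
        isK̂ : IsPartition (drop 1 κ)
        isK̂ = removeRow-isPartition isK
        removed : first κ ≡ a → lead isK̂ * ⟨ q̂ , E a (jackF isK) ⟩ ≈ lead isK * ⟨ q̂ , jackF isK̂ ⟩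
        removed eq = trans (sym (homogeneousʳ (lead isK̂) q̂ (E a (jackF isK)))) (trans (congʳ {q̂} {lead isK̂ • E a (jackF isK)} {lead isK • jackF isK̂}
          (≡.subst (λ n → lead isK̂ • E n (jackF isK) ≈ₛ lead isK • jackF isK̂) eq (row-removal isK))) (homogeneousʳ (lead isK) q̂ (jackF isK̂)))
        tails : ∀ {κ μ} → IsPartition κ → IsPartition μ → first κ ≡ first μ → drop 1 μ ≡ drop 1 κ → κ ≡ μ
        tails {[]}        {[]}        _ _ p q = ≡.refl
        tails {[]}        {zero ∷ μ}  _ (_ , () ∷ _) p q
        tails {zero ∷ κ}  {[]}        (_ , () ∷ _) _ p q
        tails {x ∷ κ}     {y ∷ μ}     _ _ p q = ≡.cong₂ _∷_ p (≡.sym q)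
        cases : Dec (κ ≡ μ) → A * ⟨ q̂ , E a (jackF isK) ⟩ ≈ B * ⟨ jackF isQ , jackF isK ⟩
        cases (yes ≡.refl) = trans (solve 3 (λ l j x → (l :* j) :* x := j :* (l :* x)) refl (lead isQ̂) ⟪ isQ ⟫ _)
          (trans (*-congˡ (trans (removed (≡.sym same-row)) (*-congˡ (congʳ {q̂} {jackF isK̂} {q̂} (jackF-≡ isK̂ isQ̂ ≡.refl)))))
          (trans (solve 3 (λ j l i → j :* (l :* i) := (l :* i) :* j) refl ⟪ isQ ⟫ (lead isQ) ⟪ isQ̂ ⟫) (*-congˡ (congʳ {jackF isQ} {jackF isQ} {jackF isK} (jackF-≡ isQ isK ≡.refl)))))
        cases (no ne) = trans (*-congˡ zero-form) (trans (zeroʳ _) (sym (trans (*-congˡ (orth isQ isK (ne ∘ ≡.sym))) (zeroʳ _))))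
          where
          zero-form : ⟨ q̂ , E a (jackF isK) ⟩ ≈ 0#
          zero-form with first κ ℕ.≟ a
          ... | no lt  = zeroʳ′ {q̂} {E a (jackF isK)} (E-vanish isK (ℕ.≤∧≢⇒< le lt))
          ... | yes eq = cancel-unit (lead-unit isK̂) (trans (removed eq) (trans (*-congˡ (orth isQ̂ isK̂ (λ t → ne (tails isK isQ (≡.trans eq same-row) t)))) (trans (zeroʳ _) (sym (zeroʳ _)))))
      middle : A * ⟨ jackF isP , (G · q̂) · q ⟩ ≈ B * ⟨ jackF isP , jackF isQ · q ⟩
      middle = trans (*-congˡ (commutative (jackF isP) ((G · q̂) · q))) (trans (form-minus-≈ {A} {(G · q̂) · q} {B} {jackF isQ · q} {jackF isP}
        (trans (congˡ {minus A ((G · q̂) · q) B (jackF isQ · q)} {w · q} {jackF isP} dist) (trans (commutative (w · q) (jackF isP)) (row-orthogonal isP ℕ.≤-refl w perp q)))) (*-congˡ (commutative (jackF isQ · q) (jackF isP))))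
        where
        dist : minus A ((G · q̂) · q) B (jackF isQ · q) ≈ₛ w · q
        dist e = sym (trans (·-distribʳ (A • (G · q̂)) ((- B) • jackF isQ) q e) (+-cong (·-•ˡ A (G · q̂) q e) (·-•ˡ (- B) (jackF isQ) q e)))

    column-step : ∀ {θ μ} (isP : IsPartition θ) (isQ : IsPartition μ) → length θ ≡ length μ → ∀ q →
      (colFactor θ * ⟪ removeColumn-isPartition isP ⟫) * ⟨ jackF isP , jackF isQ · q ⟩ ≈
      (colFactor μ * ⟪ isP ⟫) * ⟨ jackF (removeColumn-isPartition isP) , jackF (removeColumn-isPartition isQ) · q ⟩
    column-step {θ} {μ} isP isQ len q = trans (*-congˡ (column-form isP isQ len q)) (trans (solve 3 (λ c a x → c :* (a :* x) := a :* (c :* x)) refl (colFactor θ * _) (colFactor μ) _)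
      (trans (*-congˡ (column-adjoint isP (jackF (removeColumn-isPartition isQ) · q))) (sym (*-assoc _ _ _))))

-- The norms of the explicit functions

module JackNorm (K : CommutativeRing 0ℓ 0ℓ) (α : CommutativeRing.Carrier K) where

  open import Defs using (length≤sum; 1^_)

  open CommutativeRing K
  open Solver commutativeSemiring using (solve; _:=_; _:+_; _:*_)
  open RingProperties ring using (+-cancelʳ; -‿distribˡ-*)
  open RawSemiringDefinitions (Semiring.rawSemiring semiring) using (_^_)
  open Antidiagonal K
  open SymmetricFunctions K
  open FiniteSums K
  open Convolution K
  open KnopSahiSymmetry K α
  open KnopSahiSupport K α
  open JackFunctions K α
  open PowerSumDerivations K α using (Nice; coeff-nice)
  open PowerSumBasis K α
  open JackForm K α
  open JackBasis K α
  open Nice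

  open RowsAndColumns K α

  oneRow : ℕ → List ℕ
  oneRow zero    = []
  oneRow (suc k) = suc k ∷ []

  oneRow-isPartition : ∀ k → IsPartition (oneRow k)
  oneRow-isPartition zero    = [] , []
  oneRow-isPartition (suc k) = [-] , s≤s z≤n ∷ []

  sum-oneRow : ∀ k → sum (oneRow k) ≡ k
  sum-oneRow zero    = ≡.refl
  sum-oneRow (suc k) = ℕ.+-identityʳ (suc k)

  hook : ℕ → ℕ → List ℕ
  hook n b = suc n ∷ replicate b 1

  hook-isPartition : ∀ n b → IsPartition (hook n b)
  hook-isPartition n b = link b , s≤s z≤n ∷ proj₂ (isPartition (1^ b))
    where
    link : ∀ b → Linked _≥_ (hook n b)
    link zero    = [-]
    link (suc b) = s≤s z≤n ∷ proj₁ (isPartition (1^ suc b))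

  sum-ones : ∀ b → sum (replicate b 1) ≡ b
  sum-ones zero    = ≡.refl
  sum-ones (suc b) = ≡.cong suc (sum-ones b)

  ones-unique : ∀ {κ} → All (0 <_) κ → sum κ ≤ length κ → κ ≡ replicate (length κ) 1
  ones-unique []                           le = ≡.refl
  ones-unique {suc zero ∷ κ}    (_ ∷ ps) (s≤s le) = ≡.cong (1 ∷_) (ones-unique ps le)
  ones-unique {suc (suc x) ∷ κ} (_ ∷ ps) (s≤s le) = ⊥-elim (ℕ.<-irrefl ≡.refl (ℕ.≤-trans (s≤s (ℕ.≤-trans (length≤sum ps) (ℕ.m≤n+m (sum κ) x))) le))

  elem-homogeneous : ∀ b → Homogeneous b (coeff (elem b))
  elem-homogeneous b e ne = δ-≢ (shape e) (replicate b 1) (λ eq → ne (≡.trans (≡.sym (sum-shape e)) (≡.trans (≡.cong sum eq) (sum-ones b))))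

  ·-homogeneous : ∀ a b {f g} → Homogeneous a (coeff f) → Homogeneous b (coeff g) → Homogeneous (a ℕ.+ b) (coeff (f · g))
  ·-homogeneous a b {f} {g} hf hg e ne = convolve-zero e cases
    where
    cases : ∀ x y → sum x ℕ.+ sum y ≡ sum e → coeff f x * coeff g y ≈ 0#
    cases x y eq with sum x ℕ.≟ a | sum y ℕ.≟ b
    ... | no nx | _     = trans (*-congʳ (hf x nx)) (zeroˡ _)
    ... | yes _ | no ny = trans (*-congˡ (hg y ny)) (zeroʳ _)
    ... | yes ≡.refl | yes ≡.refl = ⊥-elim (ne (≡.sym eq))

  module Norm (F : JackField) (⟨_,_⟩ : SymFun → SymFun → Carrier) (S : ScalarProduct ⟨_,_⟩)
    (orth : ∀ {θ μ} (isP : IsPartition θ) (isQ : IsPartition μ) → θ ≢ μ → ⟨ jackF isP , jackF isQ ⟩ ≈ 0#) where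
    open JackField F
    open Form F ⟨_,_⟩ S
    open Basis F
    open SpanForm ⟨_,_⟩ S
    open Theory F ⟨_,_⟩ S orth
    open Row

    isEmpty : IsPartition []
    isEmpty = [] , []

    empty-one : jackF isEmpty ≈ₛ 1ₛ
    empty-one e = go (sum e ℕ.≟ 0)
      where
      go : Dec (sum e ≡ 0) → coeff (jackF isEmpty) e ≈ coeff 1ₛ e
      go (no ne)  = trans (jackF-homogeneous isEmpty e ne) (sym (elem-homogeneous 0 e ne))
      go (yes eq) = trans (coeff-shape (jackF isEmpty) e) (trans (reflexive (≡.cong (coeff (jackF isEmpty)) empty)) (trans (trans (jackF-ones isEmpty) ⟦1⟧) (sym (δ-≡ empty))))
        where
        empty : shape e ≡ []
        empty = isPartition-≤0 (shape-isPartition e) (All.tabulate (λ {x} x∈ → ℕ.≤-trans (All.lookup (parts≤sum (shape e)) x∈) (ℕ.≤-reflexive (≡.trans (sum-shape e) eq))))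

    norm-empty : ⟪ isEmpty ⟫ ≈ 1#
    norm-empty = trans (cong {jackF isEmpty} {pow []} {jackF isEmpty} {pow []} empty-one empty-one) (trans (norm-pow []) (trans (*-identityʳ _) ⟦1⟧))

    -- Without its constant term `h` vanishes in zero variables, so `Ker-orthogonal` applies with
    -- `m = 0`.
    form-one : ∀ h → ⟨ h , 1ₛ ⟩ ≈ coeff h []
    form-one h = trans (congʳ {h} {1ₛ} {jackF isEmpty} (λ e → sym (empty-one e))) (trans (sym (*-identityˡ _))
      (trans (form-minus-≈ {1#} {h} {coeff h []} {jackF isEmpty} {jackF isEmpty} (Ker-orthogonal {0} {minus 1# h (coeff h []) (jackF isEmpty)} ker isEmpty z≤n))
      (trans (*-congˡ norm-empty) (*-identityʳ _))))
      where
      ker : Ker 0 (minus 1# h (coeff h []) (jackF isEmpty))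
      ker [] _ = minus-zero (trans (*-identityˡ _) (sym (trans (*-congˡ (trans (jackF-ones isEmpty) ⟦1⟧)) (*-identityʳ _))))

    proportional : ∀ {κ} (isK : IsPartition κ) f → (∀ {ρ} (isR : IsPartition ρ) → ρ ≢ κ → ⟨ f , jackF isR ⟩ ≈ 0#) →
      ⟪ isK ⟫ • f ≈ₛ ⟨ f , jackF isK ⟩ • jackF isK
    proportional {κ} isK f h = minus-≈ {⟪ isK ⟫} {f} {⟨ f , jackF isK ⟩} {jackF isK} (nondegenerate (minus ⟪ isK ⟫ f ⟨ f , jackF isK ⟩ (jackF isK))
      (λ {ρ} isR → trans (form-minus ⟪ isK ⟫ f ⟨ f , jackF isK ⟩ (jackF isK) (jackF isR)) (minus-zero (go isR (ρ ≟ˡ κ)))))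
      where
      go : ∀ {ρ} (isR : IsPartition ρ) → Dec (ρ ≡ κ) → ⟪ isK ⟫ * ⟨ f , jackF isR ⟩ ≈ ⟨ f , jackF isK ⟩ * ⟨ jackF isK , jackF isR ⟩
      go isR (yes eq) = trans (*-comm _ _) (*-cong (congʳ {f} {jackF isR} {jackF isK} (jackF-≡ isR isK eq)) (congʳ {jackF isK} {jackF isK} {jackF isR} (jackF-≡ isK isR (≡.sym eq))))
      go isR (no ne)  = trans (trans (*-congˡ (h isR ne)) (zeroʳ _)) (sym (trans (*-congˡ (orth isK isR (ne ∘ ≡.sym))) (zeroʳ _)))

    degree-orthogonal : ∀ {n ρ} f → Homogeneous n (coeff f) → (isR : IsPartition ρ) → sum ρ ≢ n → ⟨ f , jackF isR ⟩ ≈ 0#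
    degree-orthogonal {n} {ρ} f hom isR ne = trans (commutative f (jackF isR)) (span-orthogonal {Q = λ κ → sum κ ≡ n}
      (λ isK eq → orth isR isK (λ { ≡.refl → ne eq })) (span-by f term))
      where
      term : ∀ ν → coeff f (parts ν) ≈ 0# ⊎ Span (λ κ → sum κ ≡ n) (monomial ν)
      term ν with sum (parts ν) ℕ.≟ n
      ... | yes eq = inj₂ (Span-⊂ (λ κ≼ν → ≡.trans (proj₁ κ≼ν) eq) (monomial-span (isPartition ν)))
      ... | no ne′ = inj₁ (hom (parts ν) ne′)

    g[_] : ℕ → SymFun
    g[ k ] = g (rowOf k)

    rowScale : ℕ → Carrier
    rowScale k = ⟦ k ! ⟧ * (α ^ k)

    rowScale-unit : ∀ k → ∃[ y ] rowScale k * y ≈ 1#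
    rowScale-unit k = unit-* (unit-! k) (unit-^ k)

    -- Pairing `g_k` with `F_ρ` takes the coefficient of `x^k` in a single variable, which vanishes
    -- when `ρ` has more than one row or another size. So `g_k` is proportional to the one-row
    -- function, and the squarefree coefficient fixes the factor.
    jackF-row : ∀ k → jackF (oneRow-isPartition k) ≈ₛ rowScale k • g[ k ]
    jackF-row k e = cancel-unit (norm-unit isK) (trans (*-congʳ at-ones) (trans (solve 4 (λ x f A y → (x :* (f :* A)) :* y := (f :* A) :* (x :* y)) refl x ⟦ k ! ⟧ (α ^ k) _)
        (trans (*-congˡ (sym (prop e))) (solve 3 (λ r j y → r :* (j :* y) := j :* (r :* y)) refl (rowScale k) ⟪ isK ⟫ _))))
      where
      isK : IsPartition (oneRow k)
      isK = oneRow-isPartition k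
      x : Carrier
      x = ⟨ g[ k ] , jackF isK ⟩
      ortho : ∀ {ρ} (isR : IsPartition ρ) → ρ ≢ oneRow k → ⟨ g[ k ] , jackF isR ⟩ ≈ 0#
      ortho {ρ} isR ne = trans (congˡ {g[ k ]} {g[ k ] · 1ₛ} {jackF isR} (λ e → sym (trans (·-comm g[ k ] 1ₛ e) (·-identityˡ g[ k ] e))))
        (trans (adj (rowOf k) 1ₛ (jackF isR)) (trans (commutative 1ₛ (E k (jackF isR))) (trans (form-one (E k (jackF isR))) (go isR ne))))
        where
        go : ∀ {ρ} (isR : IsPartition ρ) → ρ ≢ oneRow k → coeff (jackF isR) (k ∷ []) ≈ 0#
        go {[]}         isR ne = jackF-homogeneous isR (k ∷ []) (differ k ne)
          where
          differ : ∀ k → [] ≢ oneRow k → k ℕ.+ 0 ≢ 0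
          differ zero    ne _ = ne ≡.refl
        go {suc r ∷ []} isR ne = jackF-homogeneous isR (k ∷ []) (λ eq → ne (differ k (≡.trans (≡.sym (ℕ.+-identityʳ k)) (≡.trans eq (ℕ.+-identityʳ (suc r))))))
          where
          differ : ∀ k → k ≡ suc r → suc r ∷ [] ≡ oneRow k
          differ k ≡.refl = ≡.refl
        go {zero ∷ []} (_ , () ∷ _) ne
        go {r ∷ s ∷ ρ}  isR ne = jackF-support isR (k ∷ []) (s≤s (ℕ.≤-trans (small k) (s≤s z≤n)))
          where
          small : ∀ k → support (k ∷ []) ≤ 1
          small zero    = z≤n
          small (suc k) = s≤s z≤n
      prop : ⟪ isK ⟫ • g[ k ] ≈ₛ x • jackF isK
      prop = proportional isK g[ k ] ortho
      at-ones : ⟪ isK ⟫ ≈ x * rowScale k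
      at-ones = trans (sym (*-identityʳ _)) (trans (*-congˡ (sym (ones (rowOf k)))) (trans (solve 3 (λ j A y → j :* (A :* y) := A :* (j :* y)) refl ⟪ isK ⟫ (α ^ k) _)
        (trans (*-congˡ (trans (prop (replicate k 1)) (*-congˡ (trans (reflexive (≡.cong (λ n → coeff (jackF isK) (replicate n 1)) (≡.sym (sum-oneRow k))))
          (trans (jackF-ones isK) (reflexive (≡.cong (λ n → ⟦ n ! ⟧) (sum-oneRow k))))))))
        (solve 3 (λ A x f → A :* (x :* f) := x :* (f :* A)) refl (α ^ k) x ⟦ k ! ⟧))))

    g-homogeneous : ∀ k → Homogeneous k (coeff g[ k ])
    g-homogeneous k e ne = cancel-unit (rowScale-unit k) (trans (sym (jackF-row k e)) (trans (jackF-homogeneous (oneRow-isPartition k) e (λ eq → ne (≡.trans eq (sum-oneRow k)))) (sym (zeroʳ _))))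

    -- A single column is minimal in dominance order, so `elem b` is a multiple of its Jack
    -- function.
    elem-orthogonal : ∀ b {ν} (isN : IsPartition ν) → ν ≢ replicate b 1 → ⟨ elem b , jackF isN ⟩ ≈ 0#
    elem-orthogonal b isN ne = trans (commutative (elem b) (jackF isN)) (span-orthogonal {Q = _≼ replicate b 1}
      (λ {κ} isK le → orth isN isK (λ { ≡.refl → ne (lowest isK le) })) (monomial-span (isPartition (1^ b))))
      where
      lowest : ∀ {κ} → IsPartition κ → κ ≼ replicate b 1 → κ ≡ replicate b 1
      lowest {κ} isK le = ≡.trans (ones-unique (proj₂ isK) (ℕ.≤-trans (ℕ.≤-reflexive total) long))
          (≡.cong (λ n → replicate n 1) (ℕ.≤-antisym (ℕ.≤-trans (length≤sum (proj₂ isK)) (ℕ.≤-reflexive total)) long))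
        where
        total : sum κ ≡ b
        total = ≡.trans (proj₁ le) (sum-ones b)
        long : b ≤ length κ
        long = ℕ.≤-trans (ℕ.≤-reflexive (≡.sym (length-replicate b))) (≼-length (proj₂ (isPartition (1^ b))) le)

    -- The adjoint of `g[ suc n ]` turns `F_ρ` into a multiple of the function with the first row
    -- removed, or into 0; and `elem b` is orthogonal to that function unless it belongs to a column
    -- of length `b`.
    hook-orthogonal : ∀ n b {ρ} (isR : IsPartition ρ) → first ρ ≤ suc n → ρ ≢ hook n b → ⟨ g[ suc n ] · elem b , jackF isR ⟩ ≈ 0#
    hook-orthogonal n b {ρ} isR le ne = trans (adj (rowOf (suc n)) (elem b) (jackF isR)) (go (first ρ ℕ.≟ suc n))
      where
      isR̂ : IsPartition (drop 1 ρ)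
      isR̂ = removeRow-isPartition isR
      go : Dec (first ρ ≡ suc n) → ⟨ elem b , E (suc n) (jackF isR) ⟩ ≈ 0#
      go (no lt)  = zeroʳ′ {elem b} {E (suc n) (jackF isR)} (E-vanish isR (ℕ.≤∧≢⇒< le lt))
      go (yes eq) = cancel-unit (lead-unit isR̂) (trans (sym (homogeneousʳ (lead isR̂) (elem b) (E (suc n) (jackF isR))))
        (trans (congʳ {elem b} {lead isR̂ • E (suc n) (jackF isR)} {lead isR • jackF isR̂} (≡.subst (λ a → lead isR̂ • E a (jackF isR) ≈ₛ lead isR • jackF isR̂) eq (row-removal isR)))
        (trans (homogeneousʳ (lead isR) (elem b) (jackF isR̂)) (trans (*-congˡ (elem-orthogonal b isR̂ (λ t → ne (build ρ eq t)))) (trans (zeroʳ _) (sym (zeroʳ _)))))))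
        where
        build : ∀ ρ → first ρ ≡ suc n → drop 1 ρ ≡ replicate b 1 → ρ ≡ hook n b
        build (x ∷ ρ) p q = ≡.cong₂ _∷_ p q

    -- The product `g_a e_b` may also have a component on the hook with first row `a + 1`; it is
    -- invisible to Jack functions of first row at most `a`, the only ones in `perp`. `value` gives
    -- the scalar freed of denominators.
    record Hook (n b : ℕ) : Set where
      field
        scalar : Carrier
        value  : (⟦ suc n ⟧ * α + ⟦ b ⟧) * (scalar * (rowScale (suc n) * ⟦ b ! ⟧)) ≈ ⟦ suc n ⟧ * α
        perp   : ∀ {ρ} (isR : IsPartition ρ) → first ρ ≤ suc n → ⟨ minus 1# (g[ suc n ] · elem b) scalar (jackF (hook-isPartition n b)) , jackF isR ⟩ ≈ 0#
    open Hook

    -- g_a e_b = s F_(a,1^b) + t F_(a+1,1^(b-1)); t is read off in b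
    -- variables and s + t from the coefficient of x₁ x₂ ⋯.
    hookOf : ∀ n b → Hook n b
    hookOf n zero = record
      { scalar = y
      ; value  = trans (*-congˡ (trans (solve 3 (λ y r o → y :* (r :* o) := (r :* y) :* o) refl y (rowScale (suc n)) ⟦ 1 ⟧) (trans (*-cong ry ⟦1⟧) (*-identityʳ 1#)))) (trans (*-identityʳ _) (+-identityʳ _))
      ; perp   = λ isR _ → zeroˡ′ {minus 1# (g[ suc n ] · elem 0) y f} {jackF isR} (λ e → minus-zero (trans (*-identityˡ _)
          (trans (trans (·-comm g[ suc n ] (elem 0) e) (·-identityˡ g[ suc n ] e)) (sym (trans (*-congˡ (jackF-row (suc n) e)) (trans (sym (*-assoc _ _ _)) (trans (*-congʳ (trans (*-comm _ _) ry)) (*-identityˡ _)))))))) }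
      where
      f : SymFun
      f = jackF (hook-isPartition n 0)
      y : Carrier
      y = proj₁ (rowScale-unit (suc n))
      ry : rowScale (suc n) * y ≈ 1#
      ry = proj₂ (rowScale-unit (suc n))
    hookOf n (suc b) = record
      { scalar = s
      ; value  = value′
      ; perp   = λ {ρ} isR le → trans (form-minus 1# ge s f (jackF isR)) (minus-zero (trans (*-identityˡ _) (below-a isR le))) }
      where
      a N : ℕ
      a = suc n
      N = a ℕ.+ suc b
      isS : IsPartition (hook n (suc b))
      isS = hook-isPartition n (suc b)
      isT : IsPartition (hook a b)
      isT = hook-isPartition a b
      ge f h w : SymFun
      ge = g[ a ] · elem (suc b)
      f = jackF isS
      h = jackF isT
      s t C : Carrier
      s = ⟨ ge , f ⟩ * proj₁ (norm-unit isS)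
      C = colFactor (hook a b)
      t-unit : ∃[ y ] (C * rowScale a) * y ≈ 1#
      t-unit = unit-* (colFactor-unit (hook a b)) (rowScale-unit a)
      t = proj₁ t-unit
      w = minus 1# ge s f +ₛ (- t) • h
      form-w : ∀ k → ⟨ ge , k ⟩ ≈ s * ⟨ f , k ⟩ → ⟨ h , k ⟩ ≈ 0# → ⟨ w , k ⟩ ≈ 0#
      form-w k p q = trans (additive (minus 1# ge s f) ((- t) • h) k) (trans (+-cong (trans (form-minus 1# ge s f k) (minus-zero (trans (*-identityˡ _) p)))
        (trans (homogeneous (- t) h k) (trans (*-congˡ q) (zeroʳ _)))) (+-identityˡ 0#))
      below-a : ∀ {ρ} (isR : IsPartition ρ) → first ρ ≤ a → ⟨ ge , jackF isR ⟩ ≈ s * ⟨ f , jackF isR ⟩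
      below-a {ρ} isR le = go (ρ ≟ˡ hook n (suc b))
        where
        go : Dec (ρ ≡ hook n (suc b)) → ⟨ ge , jackF isR ⟩ ≈ s * ⟨ f , jackF isR ⟩
        go (yes eq) = trans (congʳ {ge} {jackF isR} {f} (jackF-≡ isR isS eq)) (sym (trans (*-congˡ (congʳ {f} {jackF isR} {f} (jackF-≡ isR isS eq)))
          (trans (*-assoc _ _ _) (trans (*-congˡ (trans (*-comm _ _) (proj₂ (norm-unit isS)))) (*-identityʳ _)))))
        go (no ne)  = trans (hook-orthogonal n (suc b) isR le ne) (sym (trans (*-congˡ (orth isS isR (ne ∘ ≡.sym))) (zeroʳ _)))
      -- In `suc b` variables `f` vanishes, having more rows, and a column splits off `h`, leaving a
      -- multiple of `g[ a ]`; `t` is chosen as the inverse of the factors that appear.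
      ker : Ker (suc b) w
      ker e len = trans (+-cong (trans (+-congˡ (trans (*-congˡ (Ker-short isS (s≤s (s≤s (ℕ.≤-reflexive (≡.sym (length-replicate b))))) e len)) (zeroʳ _))) (+-identityʳ _)) (*-congˡ lower))
          (minus-zero (trans (*-identityˡ _) (trans (·-comm g[ a ] (elem (suc b)) e) (sym (trans (solve 4 (λ t C r x → t :* (C :* (r :* x)) := ((C :* r) :* t) :* x) refl t C (rowScale a) _)
            (trans (*-congʳ (proj₂ t-unit)) (*-identityˡ _)))))))
        where
        isA : IsPartition (removeColumn (hook a b))
        isA = removeColumn-isPartition isT
        short : removeColumn (hook a b) ≡ oneRow a
        short = ≡.cong (a ∷_) (isPartition-≤0 (removeColumn-isPartition (isPartition (1^ b))) (removeColumn-≤ (All.replicate⁺ b ℕ.≤-refl)))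
        lower : coeff h e ≈ C * (rowScale a * coeff (elem (suc b) · g[ a ]) e)
        lower = trans (sym (*-identityˡ _)) (trans (minus-≈′ (column-Ker isT e (≡.trans len (≡.cong suc (≡.sym (length-replicate b))))))
          (*-congˡ (trans (·-cong {elem (length (hook a b))} {elem (suc b)} {jackF isA} {rowScale a • g[ a ]} (λ e → reflexive (≡.cong (λ m → coeff (elem (suc m)) e) (length-replicate b)))
            (λ e → trans (jackF-≡ isA (oneRow-isPartition a) short e) (jackF-row a e)) e) (·-•ʳ (rowScale a) (elem (suc b)) g[ a ] e))))
          where
          minus-≈′ : ∀ {x y} → 1# * x + - C * y ≈ 0# → 1# * x ≈ C * y
          minus-≈′ {x} {y} eq = +-cancelʳ (- (C * y)) _ _ (trans (trans (+-congˡ (-‿distribˡ-* C y)) eq) (sym (-‿inverseʳ _)))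
      w≈0 : w ≈ₛ 0ₛ
      w≈0 = nondegenerate w cases
        where
        cases : ∀ {ρ} (isR : IsPartition ρ) → ⟨ w , jackF isR ⟩ ≈ 0#
        cases {ρ} isR = go (first ρ ℕ.≤? a) (length ρ ℕ.≤? suc b)
          where
          -- A partition exceeding both bounds has more than `N` boxes, so its degree alone excludes
          -- it.
          large : ¬ (first ρ ≤ a) → ¬ (length ρ ≤ suc b) → sum ρ ≢ N
          large gt long eq = ℕ.<-irrefl (≡.sym eq) (size isR gt long)
            where
            size : ∀ {ρ} → IsPartition ρ → ¬ (first ρ ≤ a) → ¬ (length ρ ≤ suc b) → a ℕ.+ suc b < sum ρ
            size {[]}    isR     gt long = ⊥-elim (gt z≤n)
            size {x ∷ ρ} (_ , _ ∷ ps) gt long = ℕ.+-mono-≤ (ℕ.≰⇒> gt) (ℕ.≤-trans (ℕ.≤-pred (ℕ.≰⇒> long)) (length≤sum ps))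
          go : Dec (first ρ ≤ a) → Dec (length ρ ≤ suc b) → ⟨ w , jackF isR ⟩ ≈ 0#
          go (yes le) _        = form-w (jackF isR) (below-a isR le) (orth isT isR (λ { ≡.refl → ℕ.<-irrefl ≡.refl le }))
          go (no gt) (yes len) = Ker-orthogonal {suc b} {w} ker isR len
          go (no gt) (no long) = form-w (jackF isR) (trans (degree-orthogonal ge (·-homogeneous a (suc b) {g[ a ]} {elem (suc b)} (g-homogeneous a) (elem-homogeneous (suc b))) isR (large gt long))
              (sym (trans (*-congˡ (orth isS isR (λ { ≡.refl → gt ℕ.≤-refl }))) (zeroʳ _))))
              (orth isT isR (λ { ≡.refl → long (s≤s (ℕ.≤-reflexive (length-replicate b))) }))
      at-ones : ∀ {κ} (isK : IsPartition κ) → sum κ ≡ N → coeff (jackF isK) (replicate N 1) ≈ ⟦ N ! ⟧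
      at-ones isK eq = ≡.subst (λ k → coeff (jackF isK) (replicate k 1) ≈ ⟦ k ! ⟧) eq (jackF-ones isK)
      A B : Carrier
      A = ⟦ suc b ! ⟧
      B = coeff ge (replicate N 1)
      ge-sum : B ≈ (s + t) * ⟦ N ! ⟧
      ge-sum = +-cancelʳ (- ((s + t) * ⟦ N ! ⟧)) _ _ (trans (trans (+-cong (sym (*-identityˡ B)) (trans (-‿cong (distribʳ _ s t)) (trans (sym (-‿+-comm _ _))
          (+-cong (-‿distribˡ-* s _) (-‿distribˡ-* t _))))) (trans (sym (+-assoc _ _ _)) (trans (+-cong (+-congˡ (*-congˡ (sym (at-ones isS (≡.cong (a ℕ.+_) (≡.cong suc (sum-ones b)))))))
          (*-congˡ (sym (at-ones isT (≡.trans (≡.cong (suc a ℕ.+_) (sum-ones b)) (≡.sym (ℕ.+-suc a b))))))) (w≈0 (replicate N 1))))) (sym (-‿inverseʳ _)))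
        where open RingProperties ring using (-‿+-comm)
      total : rowScale a * A * (s + t) ≈ 1#
      total = cancel-unit (unit-! N) (trans (solve 5 (λ N f p A x → N :* (((f :* p) :* A) :* x) := p :* ((f :* A) :* (x :* N))) refl ⟦ N ! ⟧ ⟦ a ! ⟧ (α ^ a) A (s + t))
        (trans (*-congˡ (trans (*-congˡ (sym ge-sum)) (ones-product a (suc b) (coeff-nice g[ a ]) (coeff-nice (elem (suc b))) (g-homogeneous a) (elem-homogeneous (suc b)))))
        (trans (solve 4 (λ p N x y → p :* (N :* (x :* y)) := N :* ((p :* x) :* y)) refl (α ^ a) ⟦ N ! ⟧ _ _)
        (*-congˡ (trans (*-cong (ones (rowOf a)) (δ-≡ (shape-partition (isPartition (1^ suc b))))) (*-identityˡ 1#))))))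
      D : Carrier
      D = ⟦ a ⟧ * α + ⟦ suc b ⟧
      t-value : D * (t * (rowScale a * A)) ≈ ⟦ suc b ⟧
      t-value = trans (*-congˡ (*-congˡ (*-congˡ (⟦⟧-* (suc b) (b !))))) (trans (solve 5 (λ D t r m f → D :* (t :* (r :* (m :* f))) := m :* (((D :* f) :* r) :* t)) refl D t (rowScale a) ⟦ suc b ⟧ ⟦ b ! ⟧)
        (trans (*-congˡ (trans (*-congʳ (*-congʳ (sym (*-cong (+-congˡ (reflexive (≡.cong (λ m → ⟦ suc m ⟧) (length-replicate b)))) (colFactor-ones b))))) (proj₂ t-unit))) (*-identityʳ _)))
      value′ : D * (s * (rowScale a * A)) ≈ ⟦ a ⟧ * α
      value′ = +-cancelʳ ⟦ suc b ⟧ _ _ (trans (+-congˡ (sym t-value)) (trans (solve 4 (λ D s t x → D :* (s :* x) :+ D :* (t :* x) := D :* (x :* (s :+ t))) refl D s t (rowScale a * A))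
        (trans (*-congˡ total) (*-identityʳ D))))

    hook-form : ∀ {θ} (isP : IsPartition θ) n b → first θ ≤ suc n → ∀ q →
      ⟨ jackF isP , g[ suc n ] · (elem b · q) ⟩ ≈ scalar (hookOf n b) * ⟨ jackF isP , jackF (hook-isPartition n b) · q ⟩
    hook-form isP n b le q = trans (commutative (jackF isP) _) (trans (sym (*-identityˡ _)) (trans (form-minus-≈ {1#} {g[ suc n ] · (elem b · q)} {s} {f · q} {jackF isP}
        (trans (congˡ {minus 1# (g[ suc n ] · (elem b · q)) s (f · q)} {w · q} {jackF isP} dist) (trans (commutative (w · q) (jackF isP)) (row-orthogonal isP le w (perp (hookOf n b)) q))))
        (*-congˡ (commutative (f · q) (jackF isP)))))
      where
      s : Carrier
      s = scalar (hookOf n b)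
      f w : SymFun
      f = jackF (hook-isPartition n b)
      w = minus 1# (g[ suc n ] · elem b) s f
      dist : minus 1# (g[ suc n ] · (elem b · q)) s (f · q) ≈ₛ w · q
      dist e = sym (trans (·-distribʳ (1# • (g[ suc n ] · elem b)) ((- s) • f) q e) (+-cong (trans (·-•ˡ 1# (g[ suc n ] · elem b) q e) (*-congˡ (·-assoc g[ suc n ] (elem b) q e))) (·-•ˡ (- s) f q e)))

    -- The factors of the upper left box in `c` and `c′`.
    corner corner′ : List ℕ → Carrier
    corner  []       = 1#
    corner  (x ∷ xs) = ⟦ pred x ⟧ * α + ⟦ suc (length xs) ⟧
    corner′ []       = 1#
    corner′ (x ∷ xs) = ⟦ x ⟧ * α + ⟦ length xs ⟧

    -- Evaluates ⟨F_θ, g_a e_(m-1) F_κ⟩ by removing the first row and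
    -- then the first column, and in the other order.
    norm-corner : ∀ {x xs} (isP : IsPartition (x ∷ xs)) →
      ⟪ isP ⟫ * ⟪ removeColumn-isPartition (removeRow-isPartition isP) ⟫ ≈
      corner (x ∷ xs) * corner′ (x ∷ xs) * (⟪ removeColumn-isPartition isP ⟫ * ⟪ removeRow-isPartition isP ⟫)
    norm-corner {zero} (_ , () ∷ _)
    norm-corner {suc n} {xs} isP = cancel-unit (lead-unit isB) (trans (solve 3 (λ l p k → l :* (p :* k) := p :* (l :* k)) refl (lead isB) ⟪ isP ⟫ ⟪ isK ⟫)
        (trans (*-congˡ (sym row-then)) (trans (solve 3 (λ p l y → p :* (l :* y) := l :* (p :* y)) refl ⟪ isP ⟫ (lead isK) Y)
        (trans (*-congˡ (sym (column-adjoint isP (g[ n ] · k)))) (trans (solve 5 (λ l C c j x → l :* (((C :* c) :* j) :* x) := ((c :* l) :* j) :* (C :* x)) refl (lead isK) C (colFactor xs) ⟪ isB ⟫ X₁)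
        (trans (*-congˡ (sym exchange)) (trans (*-congʳ (*-congʳ (sym (lead-column isR)))) (trans (solve 4 (λ l j C x → (l :* j) :* (C :* x) := (C :* j) :* (l :* x)) refl (lead isR) ⟪ isB ⟫ C′ X₂)
        (trans (*-congˡ (trans (row-form isP (elem b · k)) (trans (*-congʳ (lead-column isP)) (trans (solve 4 (λ C c l z → ((C :* c) :* l) :* z := (C :* l) :* (c :* z)) refl C (colFactor xs) (lead isB) Z) (*-congˡ column-then)))))
        (solve 5 (λ D j C l h → (D :* j) :* ((C :* l) :* h) := l :* ((C :* D) :* (j :* h))) refl C′ ⟪ isB ⟫ C (lead isB) ⟪ isR ⟫))))))))))
      where
      b : ℕ
      b = length xs
      isB : IsPartition (removeColumn (suc n ∷ xs))
      isB = removeColumn-isPartition isP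
      isR : IsPartition xs
      isR = removeRow-isPartition isP
      isK : IsPartition (removeColumn xs)
      isK = removeColumn-isPartition isR
      isS : IsPartition (hook n b)
      isS = hook-isPartition n b
      k : SymFun
      k = jackF isK
      C C′ X₁ X₂ Y Z s v : Carrier
      C = corner (suc n ∷ xs)
      C′ = corner′ (suc n ∷ xs)
      X₁ = ⟨ jackF isP , elem (suc b) · (g[ n ] · k) ⟩
      X₂ = ⟨ jackF isP , g[ suc n ] · (elem b · k) ⟩
      Y = ⟨ jackF isB , g[ n ] · k ⟩
      Z = ⟨ jackF isR , elem b · k ⟩
      s = scalar (hookOf n b)
      v = ⟦ suc n ⟧ * α
      row-then : lead isK * Y ≈ lead isB * ⟪ isK ⟫
      row-then = trans (*-cong (lead-≡ isK (removeRow-isPartition isB) (≡.sym both)) (reflexive (≡.cong (λ a → ⟨ jackF isB , g[ a ] · k ⟩) (≡.sym (first-removeColumn isP)))))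
        (trans (row-form isB k) (*-congˡ (congˡ {jackF (removeRow-isPartition isB)} {k} {k} (jackF-≡ (removeRow-isPartition isB) isK both))))
        where
        both : drop 1 (removeColumn (suc n ∷ xs)) ≡ removeColumn xs
        both = removeRow-removeColumn isP
      column-then : colFactor xs * Z ≈ ⟪ isR ⟫
      column-then = cancel-unit (norm-unit isK) (trans (solve 3 (λ j c z → j :* (c :* z) := (c :* j) :* z) refl ⟪ isK ⟫ (colFactor xs) Z) (trans (column-adjoint isR k) (*-comm _ _)))
      -- Against `F_θ` the product `g_a e_b` may be replaced by its component on the hook with first
      -- row `a`. This hook has as many rows as `θ`, so a column splits off it and leaves the
      -- one-row function of length `n`.
      through-hook : X₂ ≈ s * ((C * ⟦ b ! ⟧) * (rowScale n * X₁))
      through-hook = trans (hook-form isP n b ℕ.≤-refl k) (*-congˡ (trans (column-form isP isS (≡.cong suc (≡.sym (length-replicate b))) k) (*-cong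
        (*-cong (+-congˡ (reflexive (≡.cong (λ m → ⟦ suc m ⟧) (length-replicate b)))) (colFactor-ones b))
        (trans (congʳ {jackF isP} {elem (suc b) · (jackF isS̄ · k)} {rowScale n • (elem (suc b) · (g[ n ] · k))} inner) (homogeneousʳ (rowScale n) (jackF isP) (elem (suc b) · (g[ n ] · k)))))))
        where
        isS̄ : IsPartition (removeColumn (hook n b))
        isS̄ = removeColumn-isPartition isS
        short : ∀ n → removeColumn (hook n b) ≡ oneRow n
        short n = go n (isPartition-≤0 (removeColumn-isPartition (isPartition (1^ b))) (removeColumn-≤ (All.replicate⁺ b ℕ.≤-refl)))
          where
          go : ∀ n → removeColumn (replicate b 1) ≡ [] → removeColumn (hook n b) ≡ oneRow n
          go zero    eq = eq
          go (suc n) eq = ≡.cong (suc n ∷_) eq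
        inner : elem (suc b) · (jackF isS̄ · k) ≈ₛ rowScale n • (elem (suc b) · (g[ n ] · k))
        inner e = trans (·-cong {elem (suc b)} {elem (suc b)} {jackF isS̄ · k} {rowScale n • (g[ n ] · k)} (λ _ → refl)
          (λ e → trans (·-cong {jackF isS̄} {rowScale n • g[ n ]} {k} {k} (λ e → trans (jackF-≡ isS̄ (oneRow-isPartition n) (short n) e) (jackF-row n e)) (λ _ → refl) e) (·-•ˡ (rowScale n) g[ n ] k e)) e)
          (·-•ʳ (rowScale n) (elem (suc b)) (g[ n ] · k) e)
      -- The quotient of `rowScale (suc n)` by `rowScale n` is `(n + 1) α`, the right-hand side of
      -- `value`; hence no factor remains.
      unit-scalar : C′ * (s * (rowScale n * ⟦ b ! ⟧)) ≈ 1#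
      unit-scalar = cancel-unit (unit-* (inverse-nat n) inverse-α) (trans (solve 7 (λ m a C s f p q → (m :* a) :* (C :* (s :* ((f :* p) :* q))) := C :* (s :* (((m :* f) :* (a :* p)) :* q))) refl ⟦ suc n ⟧ α C′ s ⟦ n ! ⟧ (α ^ n) ⟦ b ! ⟧)
        (trans (*-congˡ (*-congˡ (*-congʳ (*-congʳ (sym (⟦⟧-* (suc n) (n !))))))) (trans (value (hookOf n b)) (sym (*-identityʳ _)))))
      exchange : C′ * X₂ ≈ C * X₁
      exchange = trans (*-congˡ through-hook) (trans (solve 6 (λ D s C q r x → D :* (s :* ((C :* q) :* (r :* x))) := (D :* (s :* (r :* q))) :* (C :* x)) refl C′ s C ⟦ b ! ⟧ (rowScale n) X₁)
        (trans (*-congʳ unit-scalar) (*-identityˡ _)))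

-- Products over boxes and translation of skew diagrams

module BoxProducts (K : CommutativeRing 0ℓ 0ℓ) (α : CommutativeRing.Carrier K) where

  open import Defs using (row; boxes; SkewPartition; outer; inner; Removal; topRow; leftColumn; CoincideUpToTranslation; _/∅; mkPartition)

  open CommutativeRing K
  open Solver commutativeSemiring using (solve; _:=_; _:*_)
  open Antidiagonal K
  open SymmetricFunctions K
  open FiniteSums K
  open Convolution K
  open KnopSahiSymmetry K α
  open KnopSahiSupport K α
  open JackFunctions K α
  open PowerSumDerivations K α using (Nice)
  open PowerSumBasis K α
  open JackForm K α
  open JackBasis K α
  open Nice

  open RowsAndColumns K α
  open JackNorm K α

  rowL colL : List ℕ → ℕ → ℕ
  rowL []       _       = 0
  rowL (x ∷ _)  zero    = x
  rowL (_ ∷ xs) (suc i) = rowL xs i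
  colL xs j = length (filter (j ℕ.<?_) xs)

  row-rowL : ∀ θ i → row θ i ≡ rowL (parts θ) i
  row-rowL (mkPartition []       _)   i       = ≡.refl
  row-rowL (mkPartition (x ∷ xs) _)   zero    = ≡.refl
  row-rowL (mkPartition (x ∷ xs) isP) (suc i) = row-rowL (mkPartition xs (removeRow-isPartition isP)) i

  line : (ℕ → Carrier) → ℕ → Carrier
  line f zero    = 1#
  line f (suc n) = f 0 * line (f ∘ suc) n

  rows : (ℕ → ℕ → Carrier) → List ℕ → Carrier
  rows F []       = 1#
  rows F (x ∷ xs) = line (F 0) x * rows (F ∘ suc) xs

  line-cong : ∀ n {f g} → (∀ j → j < n → f j ≈ g j) → line f n ≈ line g n
  line-cong zero    h = refl
  line-cong (suc n) h = *-cong (h 0 (s≤s z≤n)) (line-cong n (λ j lt → h (suc j) (s≤s lt)))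

  rows-cong : ∀ xs {F G} → (∀ i j → j < rowL xs i → F i j ≈ G i j) → rows F xs ≈ rows G xs
  rows-cong []       h = refl
  rows-cong (x ∷ xs) h = *-cong (line-cong x (h 0)) (rows-cong xs (h ∘ suc))

  rows-zeros : ∀ F xs k → rows F (xs ++ replicate k 0) ≈ rows F xs
  rows-zeros F []       zero    = refl
  rows-zeros F []       (suc k) = trans (*-identityˡ _) (rows-zeros (F ∘ suc) [] k)
  rows-zeros F (x ∷ xs) k       = *-congˡ (rows-zeros (F ∘ suc) xs k)

  rows-column : ∀ {θ} → IsPartition θ → ∀ F → rows F θ ≈ line (λ i → F i 0) (length θ) * rows (λ i j → F i (suc j)) (removeColumn θ)
  rows-column {θ} (link , pos) F = trans (split pos F) (*-congˡ (trans (reflexive (≡.cong (rows (λ i j → F i (suc j))) (pred-split link))) (rows-zeros _ (removeColumn θ) _)))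
    where
    split : ∀ {xs} → All (0 <_) xs → ∀ F → rows F xs ≈ line (λ i → F i 0) (length xs) * rows (λ i j → F i (suc j)) (map pred xs)
    split []                   F = sym (*-identityˡ 1#)
    split {suc x ∷ xs} (_ ∷ p) F = trans (*-congˡ (split p (F ∘ suc))) (solve 4 (λ a b c d → (a :* b) :* (c :* d) := (a :* c) :* (b :* d)) refl _ _ _ _)

  boxes-rows : ∀ θ (G : ℕ × ℕ → Carrier) → foldr (λ s x → G s * x) 1# (boxes θ) ≈ rows (λ i j → G (i , j)) (parts θ)
  boxes-rows θ G = go (parts θ) (λ i → i) (row-rowL θ)
    where
    prod : List (ℕ × ℕ) → Carrier
    prod = foldr (λ s x → G s * x) 1#
    prod-++ : ∀ xs ys → prod (xs ++ ys) ≈ prod xs * prod ys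
    prod-++ []       ys = sym (*-identityˡ _)
    prod-++ (x ∷ xs) ys = trans (*-congˡ (prod-++ xs ys)) (sym (*-assoc _ _ _))
    prod-line : ∀ k n h → prod (map (k ,_) (applyUpTo h n)) ≈ line (λ j → G (k , h j)) n
    prod-line k zero    h = refl
    prod-line k (suc n) h = *-congˡ (prod-line k n (h ∘ suc))
    go : ∀ xs h → (∀ i → row θ (h i) ≡ rowL xs i) → prod (concatMap (λ i → map (i ,_) (upTo (row θ i))) (applyUpTo h (length xs))) ≈ rows (λ i j → G (h i , j)) xs
    go []       h eq = refl
    go (x ∷ xs) h eq = trans (prod-++ (map (h 0 ,_) (upTo (row θ (h 0)))) _)
      (*-cong (trans (reflexive (≡.cong (λ n → prod (map (h 0 ,_) (upTo n))) (eq 0))) (prod-line (h 0) x (λ j → j))) (go xs (h ∘ suc) (eq ∘ suc)))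

  rows-pol : ∀ xs {F} → (∀ i j → Pol (F i j)) → Pol (rows F xs)
  rows-pol []       h = resp ⟦1⟧ (nat 1)
  rows-pol (x ∷ xs) h = times (go x (h 0)) (rows-pol xs (h ∘ suc))
    where
    go : ∀ n {f} → (∀ j → Pol (f j)) → Pol (line f n)
    go zero    h = resp ⟦1⟧ (nat 1)
    go (suc n) h = times (h 0) (go n (h ∘ suc))

  -- The boxes are indexed from 0, so the arm in row i and column j is
  -- rowL _ i ∸ suc j and the leg colL _ j ∸ suc i.
  C₂ C₂′ : List ℕ → List ℕ → Carrier
  C₂  μ θ = rows (λ i j → ⟦ rowL μ i ∸ suc j ⟧ * α + ⟦ colL θ j ∸ suc i ℕ.+ 1 ⟧) μ
  C₂′ θ μ = rows (λ i j → ⟦ rowL θ i ∸ suc j ℕ.+ 1 ⟧ * α + ⟦ colL μ j ∸ suc i ⟧) μ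

  C₂-pol : ∀ μ θ → Pol (C₂ μ θ)
  C₂-pol μ θ = rows-pol μ (λ i j → plus (times (nat (rowL μ i ∸ suc j)) alpha) (nat (colL θ j ∸ suc i ℕ.+ 1)))

  C₂′-pol : ∀ θ μ → Pol (C₂′ θ μ)
  C₂′-pol θ μ = rows-pol μ (λ i j → plus (times (nat (rowL θ i ∸ suc j ℕ.+ 1)) alpha) (nat (colL μ j ∸ suc i)))

  colL-∷ : ∀ {x} xs {j} → j < x → colL (x ∷ xs) j ≡ suc (colL xs j)
  colL-∷ xs {j} lt = ≡.cong length (filter-accept (j ℕ.<?_) lt)

  colL-0 : ∀ {θ} → All (0 <_) θ → colL θ 0 ≡ length θ
  colL-0 pos = ≡.cong length (filter-all (0 ℕ.<?_) pos)

  colL-removeColumn : ∀ θ j → colL (removeColumn θ) j ≡ colL θ (suc j)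
  colL-removeColumn []                j = ≡.refl
  colL-removeColumn (zero ∷ θ)        j = colL-removeColumn θ j
  colL-removeColumn (suc zero ∷ θ)    j = colL-removeColumn θ j
  colL-removeColumn (suc (suc x) ∷ θ) j with j ℕ.<? suc x
  ... | yes lt = ≡.trans (colL-∷ (removeColumn θ) lt) (≡.trans (≡.cong suc (colL-removeColumn θ j)) (≡.sym (colL-∷ θ (s≤s lt))))
  ... | no ge  = ≡.trans (≡.cong length (filter-reject (j ℕ.<?_) ge)) (≡.trans (colL-removeColumn θ j) (≡.sym (≡.cong length (filter-reject (suc j ℕ.<?_) (ge ∘ ℕ.≤-pred)))))

  rowL-removeColumn : ∀ {θ} → IsPartition θ → ∀ i → rowL (removeColumn θ) i ≡ pred (rowL θ i)
  rowL-removeColumn {θ} (link , _) i = ≡.trans (≡.sym (pads (removeColumn θ) _ i)) (≡.trans (≡.cong (λ xs → rowL xs i) (≡.sym (pred-split link))) (preds θ i))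
    where
    zeros : ∀ k i → rowL (replicate k 0) i ≡ 0
    zeros zero    i       = ≡.refl
    zeros (suc k) zero    = ≡.refl
    zeros (suc k) (suc i) = zeros k i
    pads : ∀ xs k i → rowL (xs ++ replicate k 0) i ≡ rowL xs i
    pads []       k i       = zeros k i
    pads (x ∷ xs) k zero    = ≡.refl
    pads (x ∷ xs) k (suc i) = pads xs k i
    preds : ∀ xs i → rowL (map pred xs) i ≡ pred (rowL xs i)
    preds []       i       = ≡.refl
    preds (x ∷ xs) zero    = ≡.refl
    preds (x ∷ xs) (suc i) = preds xs i

  pred-∸ : ∀ r j → pred r ∸ suc j ≡ r ∸ suc (suc j)
  pred-∸ zero    j = ≡.refl
  pred-∸ (suc r) j = ≡.refl

  rowL-≤ : ∀ {x xs} → IsPartition (x ∷ xs) → ∀ i → rowL xs i ≤ x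
  rowL-≤ {xs = []}     isP                i       = z≤n
  rowL-≤ {xs = y ∷ xs} (y≤x ∷ _ , _)      zero    = y≤x
  rowL-≤ {xs = y ∷ xs} isP@(y≤x ∷ _ , _)  (suc i) = ℕ.≤-trans (rowL-≤ (removeRow-isPartition isP) i) y≤x

  colFactor′ : List ℕ → Carrier
  colFactor′ []       = 1#
  colFactor′ (x ∷ xs) = (⟦ x ⟧ * α + ⟦ length xs ⟧) * colFactor′ xs

  -- The contributions of the first row to `c` and `c′`; the leg of a box in that row is the height
  -- of the column below it.
  rowFactor rowFactor′ : List ℕ → Carrier
  rowFactor  []       = 1#
  rowFactor  (x ∷ xs) = line (λ j → ⟦ x ∸ suc j ⟧ * α + ⟦ colL xs j ℕ.+ 1 ⟧) x
  rowFactor′ []       = 1#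
  rowFactor′ (x ∷ xs) = line (λ j → ⟦ x ∸ suc j ℕ.+ 1 ⟧ * α + ⟦ colL xs j ⟧) x

  -- The arms are those of `μ` and the legs those of `θ`. When the first columns agree, so do the
  -- legs in them, and the contribution is that of `μ` alone; in `C₂′-column` it is that of `θ`, and
  -- for first rows these roles are exchanged.
  C₂-column : ∀ {μ θ} → IsPartition μ → All (0 <_) θ → length θ ≡ length μ → C₂ μ θ ≈ colFactor μ * C₂ (removeColumn μ) (removeColumn θ)
  C₂-column {μ} {θ} isQ pos len = trans (rows-column isQ _) (*-cong (trans (line-cong (length μ) (λ i _ → reflexive (≡.cong (λ m → ⟦ rowL μ i ∸ 1 ⟧ * α + ⟦ m ∸ suc i ℕ.+ 1 ⟧) (≡.trans (colL-0 pos) len)))) (first-column μ))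
      (rows-cong (removeColumn μ) (λ i j _ → reflexive (≡.cong₂ (λ a l → ⟦ a ⟧ * α + ⟦ l ∸ suc i ℕ.+ 1 ⟧)
        (≡.sym (≡.trans (≡.cong (_∸ suc j) (rowL-removeColumn isQ i)) (pred-∸ (rowL μ i) j))) (≡.sym (colL-removeColumn θ j))))))
    where
    first-column : ∀ xs → line (λ i → ⟦ rowL xs i ∸ 1 ⟧ * α + ⟦ length xs ∸ suc i ℕ.+ 1 ⟧) (length xs) ≈ colFactor xs
    first-column []       = refl
    first-column (x ∷ xs) = *-cong (reflexive (≡.cong (λ l → ⟦ pred x ⟧ * α + ⟦ l ⟧) (ℕ.+-comm (length xs) 1))) (first-column xs)

  C₂′-column : ∀ {θ μ} → IsPartition θ → IsPartition μ → length θ ≡ length μ → C₂′ θ μ ≈ colFactor′ θ * C₂′ (removeColumn θ) (removeColumn μ)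
  C₂′-column {θ} {μ} isP@(_ , posθ) isQ len = trans (rows-column isQ _) (*-cong (trans (line-cong (length μ) (λ i _ → reflexive (≡.cong (λ m → ⟦ rowL θ i ∸ 1 ℕ.+ 1 ⟧ * α + ⟦ m ∸ suc i ⟧) (≡.trans (colL-0 (proj₂ isQ)) (≡.sym len)))))
      (trans (reflexive (≡.cong (line (λ i → ⟦ rowL θ i ∸ 1 ℕ.+ 1 ⟧ * α + ⟦ length θ ∸ suc i ⟧)) (≡.sym len))) (first-column posθ)))
      (rows-cong (removeColumn μ) (λ i j _ → reflexive (≡.cong₂ (λ a l → ⟦ a ℕ.+ 1 ⟧ * α + ⟦ l ∸ suc i ⟧)
        (≡.sym (≡.trans (≡.cong (_∸ suc j) (rowL-removeColumn isP i)) (pred-∸ (rowL θ i) j))) (≡.sym (colL-removeColumn μ j))))))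
    where
    first-column : ∀ {xs} → All (0 <_) xs → line (λ i → ⟦ rowL xs i ∸ 1 ℕ.+ 1 ⟧ * α + ⟦ length xs ∸ suc i ⟧) (length xs) ≈ colFactor′ xs
    first-column []                     = refl
    first-column {suc x ∷ xs} (_ ∷ pos) = *-cong (reflexive (≡.cong (λ a → ⟦ a ⟧ * α + ⟦ length xs ⟧) (ℕ.+-comm x 1))) (first-column pos)

  C₂-row : ∀ {μ θ} → IsPartition μ → All (0 <_) θ → first θ ≡ first μ → C₂ μ θ ≈ rowFactor θ * C₂ (drop 1 μ) (drop 1 θ)
  C₂-row {[]}    {[]}         isQ pos            eq = sym (*-identityˡ 1#)
  C₂-row {[]}    {suc _ ∷ _}  isQ pos            ()
  C₂-row {[]}    {zero ∷ _}   isQ (() ∷ _)       eq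
  C₂-row {zero ∷ _} {[]} (_ , () ∷ _) pos eq
  C₂-row {x ∷ μ} {.x ∷ θ}     isQ pos            ≡.refl = *-cong
    (line-cong x (λ j lt → reflexive (≡.cong (λ l → ⟦ x ∸ suc j ⟧ * α + ⟦ l ∸ 1 ℕ.+ 1 ⟧) (colL-∷ θ lt))))
    (rows-cong μ (λ i j lt → reflexive (≡.cong (λ l → ⟦ rowL μ i ∸ suc j ⟧ * α + ⟦ l ∸ suc (suc i) ℕ.+ 1 ⟧) (colL-∷ θ (ℕ.≤-trans lt (rowL-≤ isQ i))))))

  C₂′-row : ∀ {θ μ} → IsPartition μ → All (0 <_) θ → first θ ≡ first μ → C₂′ θ μ ≈ rowFactor′ μ * C₂′ (drop 1 θ) (drop 1 μ)
  C₂′-row {[]}         {[]} isQ pos eq = sym (*-identityˡ 1#)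
  C₂′-row {suc _ ∷ _}  {[]} isQ pos ()
  C₂′-row {zero ∷ _}   {[]} isQ (() ∷ _) eq
  C₂′-row {[]} {zero ∷ _} (_ , () ∷ _) pos eq
  C₂′-row {.x ∷ θ} {x ∷ μ}  isQ pos ≡.refl = *-cong
    (line-cong x (λ j lt → reflexive (≡.cong (λ l → ⟦ x ∸ suc j ℕ.+ 1 ⟧ * α + ⟦ l ∸ 1 ⟧) (colL-∷ μ lt))))
    (rows-cong μ (λ i j lt → reflexive (≡.cong (λ l → ⟦ rowL θ i ∸ suc j ℕ.+ 1 ⟧ * α + ⟦ l ∸ suc (suc i) ⟧) (colL-∷ μ (ℕ.≤-trans lt (rowL-≤ isQ i))))))

  lead-C : ∀ {θ} (isP : IsPartition θ) → lead isP ≈ C₂ θ θ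
  lead-C {θ} isP = go (first θ) isP (≤-first (proj₁ isP))
    where
    go : ∀ n {θ} (isP : IsPartition θ) → All (_≤ n) θ → lead isP ≈ C₂ θ θ
    go zero    isP bnd = empty (isPartition-≤0 isP bnd) isP
      where
      empty : ∀ {θ} → θ ≡ [] → (isP : IsPartition θ) → lead isP ≈ C₂ θ θ
      empty ≡.refl isP = trans (jackF-ones isP) ⟦1⟧
    go (suc n) isP bnd = trans (lead-column isP) (trans (*-congˡ (go n (removeColumn-isPartition isP) (removeColumn-≤ bnd))) (sym (C₂-column isP (proj₂ isP) ≡.refl)))

  module Skew (F : JackField) (⟨_,_⟩ : SymFun → SymFun → Carrier) (S : ScalarProduct ⟨_,_⟩)
    (orth : ∀ {θ μ} (isP : IsPartition θ) (isQ : IsPartition μ) → θ ≢ μ → ⟨ jackF isP , jackF isQ ⟩ ≈ 0#) where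
    open JackField F
    open Form F ⟨_,_⟩ S
    open Basis F
    open Theory F ⟨_,_⟩ S orth
    open Norm F ⟨_,_⟩ S orth

    rows-unit : ∀ xs {G} → (∀ i j → ∃[ y ] G i j * y ≈ 1#) → ∃[ y ] rows G xs * y ≈ 1#
    rows-unit []       h = 1# , *-identityˡ 1#
    rows-unit (x ∷ xs) h = unit-* (go x (h 0)) (rows-unit xs (h ∘ suc))
      where
      go : ∀ n {f} → (∀ j → ∃[ y ] f j * y ≈ 1#) → ∃[ y ] line f n * y ≈ 1#
      go zero    h = 1# , *-identityˡ 1#
      go (suc n) h = unit-* (h 0) (go n (h ∘ suc))

    C₂-unit : ∀ μ θ → ∃[ y ] C₂ μ θ * y ≈ 1#
    C₂-unit μ θ = rows-unit μ (λ i j → invertible (rowL μ i ∸ suc j) _ (λ eq → ℕ.m+1+n≢0 (colL θ j ∸ suc i) (ℕ.m+n≡0⇒n≡0 (rowL μ i ∸ suc j) eq)))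

    C₂′-unit : ∀ θ μ → ∃[ y ] C₂′ θ μ * y ≈ 1#
    C₂′-unit θ μ = rows-unit μ (λ i j → invertible _ (colL μ j ∸ suc i) (λ eq → ℕ.m+1+n≢0 (rowL θ i ∸ suc j) (ℕ.m+n≡0⇒m≡0 _ eq)))

    -- Passing from `xs` to `x ∷ xs` enlarges the first column only by the corner box, so the
    -- products over boxes satisfy the recursion `norm-corner` as well.
    norm-C : ∀ {θ} (isP : IsPartition θ) → ⟪ isP ⟫ ≈ C₂ θ θ * C₂′ θ θ
    norm-C {θ} isP = <-rec (λ n → ∀ {θ} (isP : IsPartition θ) → sum θ ≡ n → ⟪ isP ⟫ ≈ C₂ θ θ * C₂′ θ θ) step (sum θ) isP ≡.refl
      where
      step : ∀ n → (∀ {k} → k < n → ∀ {θ} (isP : IsPartition θ) → sum θ ≡ k → ⟪ isP ⟫ ≈ C₂ θ θ * C₂′ θ θ) → ∀ {θ} (isP : IsPartition θ) → sum θ ≡ n → ⟪ isP ⟫ ≈ C₂ θ θ * C₂′ θ θ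
      step n ih {[]}     isP eq = trans (norm-≡ isP isEmpty ≡.refl) (trans norm-empty (sym (*-identityˡ 1#)))
      step n ih {x ∷ xs} isP ≡.refl = cancel-unit (unit-* (C₂-unit κ κ) (C₂′-unit κ κ)) (trans (*-comm _ _) (trans (*-congˡ (sym (ih κ< isK ≡.refl)))
          (trans (norm-corner isP) (trans (*-congˡ (*-cong (ih θ̄< isB ≡.refl) (ih xs< isR ≡.refl)))
          (trans (*-congˡ (*-congˡ (*-cong (C₂-column isR (proj₂ isR) ≡.refl) (C₂′-column isR isR ≡.refl))))
          (trans (solve 8 (λ c c′ b b′ f f′ k k′ → (c :* c′) :* ((b :* b′) :* ((f :* k) :* (f′ :* k′))) := (k :* k′) :* (((c :* f) :* b) :* ((c′ :* f′) :* b′))) refl (corner (x ∷ xs)) (corner′ (x ∷ xs)) (C₂ θ̄ θ̄) (C₂′ θ̄ θ̄) (colFactor xs) (colFactor′ xs) (C₂ κ κ) (C₂′ κ κ))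
          (*-congˡ (sym (*-cong (C₂-column isP (proj₂ isP) ≡.refl) (C₂′-column isP isP ≡.refl))))))))))
        where
        θ̄ κ : List ℕ
        θ̄ = removeColumn (x ∷ xs)
        κ = removeColumn xs
        isB : IsPartition θ̄
        isB = removeColumn-isPartition isP
        isR : IsPartition xs
        isR = removeRow-isPartition isP
        isK : IsPartition κ
        isK = removeColumn-isPartition isR
        positive : ∀ {x xs} → IsPartition (x ∷ xs) → 0 < x
        positive (_ , p ∷ _) = p
        xs< : sum xs < x ℕ.+ sum xs
        xs< = ℕ.+-monoˡ-≤ (sum xs) (positive isP)
        κ< : sum κ < x ℕ.+ sum xs
        κ< = ℕ.≤-<-trans (ℕ.≤-trans (ℕ.m≤n+m (sum κ) (length xs)) (ℕ.≤-reflexive (sum-removeColumn isR))) xs<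
        θ̄< : sum θ̄ < x ℕ.+ sum xs
        θ̄< = ℕ.≤-trans (s≤s (ℕ.m≤n+m (sum θ̄) (length xs))) (ℕ.≤-reflexive (sum-removeColumn isP))

    pairing : SkewPartition → SymFun → Carrier
    pairing s q = ⟨ jackF (isPartition (outer s)) , jackF (isPartition (inner s)) · q ⟩

    weight : SkewPartition → Carrier
    weight s = C₂ (parts (inner s)) (parts (outer s)) * C₂′ (parts (outer s)) (parts (inner s))

    weight-unit : ∀ s → ∃[ y ] weight s * y ≈ 1#
    weight-unit s = unit-* (C₂-unit (parts (inner s)) (parts (outer s))) (C₂′-unit (parts (outer s)) (parts (inner s)))

    pairing-≡ : ∀ {θ θ′ μ μ′} (isP : IsPartition θ) (isP′ : IsPartition θ′) (isQ : IsPartition μ) (isQ′ : IsPartition μ′) → θ ≡ θ′ → μ ≡ μ′ → ∀ q →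
      ⟨ jackF isP , jackF isQ · q ⟩ ≈ ⟨ jackF isP′ , jackF isQ′ · q ⟩
    pairing-≡ isP isP′ isQ isQ′ p r q = cong {jackF isP} {jackF isP′} {jackF isQ · q} {jackF isQ′ · q} (jackF-≡ isP isP′ p) (·-cong {jackF isQ} {jackF isQ′} {q} {q} (jackF-≡ isQ isQ′ r) (λ _ → refl))

    -- Cross-multiplied by the weights, the relation is symmetric in `s` and `t`, so that it serves
    -- for inserting a row or column as well as for removing one.
    removal-step : ∀ {s t} → Removal s t → ∀ q → pairing s q * weight t ≈ pairing t q * weight s
    removal-step {s} {t} (topRow eq outer≡ inner≡) q = trans (*-cong Γ≈ weight≈′) (trans (solve 3 (λ r g n → (r :* g) :* n := g :* (r :* n)) refl ρ (⟨ jackF isP̂ , jackF isQ̂ · q ⟩) (C₂ (drop 1 μ) (drop 1 θ) * C₂′ (drop 1 θ) (drop 1 μ)))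
        (*-cong (sym (pairing-≡ (isPartition (outer t)) isP̂ (isPartition (inner t)) isQ̂ outer≡ inner≡ q)) weight≈))
      where
      θ μ : List ℕ
      θ = parts (outer s)
      μ = parts (inner s)
      isP : IsPartition θ
      isP = isPartition (outer s)
      isQ : IsPartition μ
      isQ = isPartition (inner s)
      isP̂ : IsPartition (drop 1 θ)
      isP̂ = removeRow-isPartition isP
      isQ̂ : IsPartition (drop 1 μ)
      isQ̂ = removeRow-isPartition isQ
      ρ : Carrier
      ρ = rowFactor θ * rowFactor′ μ
      first-row : ∀ ν → row ν 0 ≡ first (parts ν)
      first-row (mkPartition []       _) = ≡.refl
      first-row (mkPartition (x ∷ xs) _) = ≡.refl
      agree : first θ ≡ first μ
      agree = ≡.trans (≡.sym (first-row (outer s))) (≡.trans eq (first-row (inner s)))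
      weight≈′ : weight t ≈ C₂ (drop 1 μ) (drop 1 θ) * C₂′ (drop 1 θ) (drop 1 μ)
      weight≈′ = reflexive (≡.cong₂ (λ a b → C₂ b a * C₂′ a b) outer≡ inner≡)
      weight≈ : ρ * (C₂ (drop 1 μ) (drop 1 θ) * C₂′ (drop 1 θ) (drop 1 μ)) ≈ weight s
      weight≈ = trans (solve 4 (λ a b c d → (a :* b) :* (c :* d) := (a :* c) :* (b :* d)) refl (rowFactor θ) (rowFactor′ μ) _ _) (sym (*-cong (C₂-row isQ (proj₂ isP) agree) (C₂′-row isQ (proj₂ isP) agree)))
      Γ≈ : pairing s q ≈ ρ * ⟨ jackF isP̂ , jackF isQ̂ · q ⟩
      Γ≈ = cancel-unit (unit-* (unit-* (lead-unit isQ) (lead-unit isP̂)) (norm-unit isQ̂)) (trans (sym (row-step isP isQ agree q)) (trans (*-congʳ scalars) (*-assoc _ _ _)))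
        where
        -- As `lead` is `C₂` and the norm is `C₂` times `C₂′`, only the first-row parts of `c_θ` and
        -- `c′_μ` survive; by `C₂-row` and `C₂′-row` these are what that row contributes to the
        -- weight.
        scalars : lead isP * lead isQ̂ * ⟪ isQ ⟫ ≈ (lead isQ * lead isP̂ * ⟪ isQ̂ ⟫) * ρ
        scalars = trans (*-cong (*-congʳ (trans (lead-C isP) (trans (C₂-row isP (proj₂ isP) ≡.refl) (*-congˡ (sym (lead-C isP̂))))))
            (trans (norm-C isQ) (*-cong (sym (lead-C isQ)) (C₂′-row isQ (proj₂ isQ) ≡.refl))))
          (trans (solve 6 (λ r p q̂ q r′ c → ((r :* p) :* q̂) :* (q :* (r′ :* c)) := ((q :* p) :* (q̂ :* c)) :* (r :* r′)) refl (rowFactor θ) (lead isP̂) (lead isQ̂) (lead isQ) (rowFactor′ μ) (C₂′ (drop 1 μ) (drop 1 μ)))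
          (*-congʳ (*-congˡ (sym (trans (norm-C isQ̂) (*-congʳ (sym (lead-C isQ̂))))))))
    removal-step {s} {t} (leftColumn eq outer≡ inner≡) q = trans (*-cong Γ≈ weight≈′) (trans (solve 3 (λ r g n → (r :* g) :* n := g :* (r :* n)) refl ρ (⟨ jackF isP̄ , jackF isQ̄ · q ⟩) (C₂ (removeColumn μ) (removeColumn θ) * C₂′ (removeColumn θ) (removeColumn μ)))
        (*-cong (sym (pairing-≡ (isPartition (outer t)) isP̄ (isPartition (inner t)) isQ̄ outer≡ inner≡ q)) weight≈))
      where
      θ μ : List ℕ
      θ = parts (outer s)
      μ = parts (inner s)
      isP : IsPartition θ
      isP = isPartition (outer s)
      isQ : IsPartition μ
      isQ = isPartition (inner s)
      isP̄ : IsPartition (removeColumn θ)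
      isP̄ = removeColumn-isPartition isP
      isQ̄ : IsPartition (removeColumn μ)
      isQ̄ = removeColumn-isPartition isQ
      ρ : Carrier
      ρ = colFactor μ * colFactor′ θ
      agree : length θ ≡ length μ
      agree = ≡.trans (≡.sym (colL-0 (proj₂ isP))) (≡.trans eq (colL-0 (proj₂ isQ)))
      weight≈′ : weight t ≈ C₂ (removeColumn μ) (removeColumn θ) * C₂′ (removeColumn θ) (removeColumn μ)
      weight≈′ = reflexive (≡.cong₂ (λ a b → C₂ b a * C₂′ a b) outer≡ inner≡)
      weight≈ : ρ * (C₂ (removeColumn μ) (removeColumn θ) * C₂′ (removeColumn θ) (removeColumn μ)) ≈ weight s
      weight≈ = trans (solve 4 (λ a b c d → (a :* b) :* (c :* d) := (a :* c) :* (b :* d)) refl (colFactor μ) (colFactor′ θ) _ _) (sym (*-cong (C₂-column isQ (proj₂ isP) agree) (C₂′-column isP isQ agree)))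
      Γ≈ : pairing s q ≈ ρ * ⟨ jackF isP̄ , jackF isQ̄ · q ⟩
      Γ≈ = cancel-unit (unit-* (colFactor-unit θ) (norm-unit isP̄)) (trans (column-step isP isQ agree q) (trans (*-congʳ scalars) (*-assoc _ _ _)))
        where
        -- The factor `colFactor θ` of the norm reappears on the right, and what survives are the
        -- first-column parts of `c_μ` and `c′_θ`.
        scalars : colFactor μ * ⟪ isP ⟫ ≈ (colFactor θ * ⟪ isP̄ ⟫) * ρ
        scalars = trans (*-congˡ (trans (norm-C isP) (*-cong (C₂-column isP (proj₂ isP) ≡.refl) (C₂′-column isP isP ≡.refl))))
          (trans (solve 5 (λ m f c f′ c′ → m :* ((f :* c) :* (f′ :* c′)) := (f :* (c :* c′)) :* (m :* f′)) refl (colFactor μ) (colFactor θ) _ (colFactor′ θ) _)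
          (*-congʳ (*-congˡ (sym (norm-C isP̄)))))

    translation : ∀ {s t} → CoincideUpToTranslation s t → ∀ q → pairing s q * weight t ≈ pairing t q * weight s
    translation ε q = refl
    translation {s} {t} (_◅_ {j = r} x xs) q = cancel-unit (weight-unit r) (trans (solve 3 (λ r p t → r :* (p :* t) := (p :* r) :* t) refl (weight r) (pairing s q) (weight t))
        (trans (*-congʳ (either x)) (trans (solve 3 (λ p s t → (p :* s) :* t := (p :* t) :* s) refl (pairing r q) (weight s) (weight t))
        (trans (*-congʳ (translation xs q)) (solve 3 (λ p r s → (p :* r) :* s := r :* (p :* s)) refl (pairing t q) (weight r) (weight s))))))
      where
      either : SymClosure Removal s r → pairing s q * weight r ≈ pairing r q * weight s
      either (fwd y) = removal-step y q
      either (bwd y) = sym (removal-step y q)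

    pairing-straight : ∀ {s θ} → CoincideUpToTranslation s (θ /∅) → ∀ q → pairing s q ≈ weight s * ⟨ jackF (isPartition θ) , q ⟩
    pairing-straight {s} {θ} co q = trans (sym (trans (*-congˡ (*-identityˡ 1#)) (*-identityʳ _))) (trans (translation co q) (trans (*-comm _ _) (*-congˡ
      (congʳ {jackF (isPartition θ)} {jackF (isPartition (inner (θ /∅))) · q} {q} (λ e → trans (·-cong {jackF (isPartition (inner (θ /∅)))} {1ₛ} {q} {q} empty-one (λ _ → refl) e) (·-identityˡ q e))))))

-- Skew Jack functions over an abstract coefficient field

module SkewJack (K : CommutativeRing 0ℓ 0ℓ) (α : CommutativeRing.Carrier K) where

  open import Defs using (arm; leg; u; ∣_∣; _⊴_; boxes; SkewPartition; outer; inner; CoincideUpToTranslation; _/∅; Partition; mkPartition; 1^_)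

  open CommutativeRing K
  open Solver commutativeSemiring using (solve; _:=_; _:*_)
  open Antidiagonal K
  open SymmetricFunctions K
  open FiniteSums K
  open Convolution K
  open KnopSahiSymmetry K α
  open KnopSahiSupport K α
  open JackFunctions K α
  open PowerSumDerivations K α using (Nice)
  open PowerSumBasis K α
  open JackForm K α
  open JackBasis K α
  open Nice

  open RowsAndColumns K α
  open JackNorm K α
  open BoxProducts K α

  module _ (nat : ℕ → Carrier) (nat-⟦⟧ : ∀ n → nat n ≈ ⟦ n ⟧) where

    boxes-C₂ : ∀ μ θ → foldr (λ s x → (nat (arm μ s) * α + nat (leg θ s ℕ.+ 1)) * x) 1# (boxes μ) ≈ C₂ (parts μ) (parts θ)
    boxes-C₂ μ θ = trans (boxes-rows μ (λ s → nat (arm μ s) * α + nat (leg θ s ℕ.+ 1))) (rows-cong (parts μ) (λ i j _ → +-cong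
      (*-congʳ (trans (nat-⟦⟧ _) (reflexive (≡.cong (λ r → ⟦ r ∸ suc j ⟧) (row-rowL μ i))))) (nat-⟦⟧ _)))

    boxes-C₂′ : ∀ θ μ → foldr (λ s x → (nat (arm θ s ℕ.+ 1) * α + nat (leg μ s)) * x) 1# (boxes μ) ≈ C₂′ (parts θ) (parts μ)
    boxes-C₂′ θ μ = trans (boxes-rows μ (λ s → nat (arm θ s ℕ.+ 1) * α + nat (leg μ s))) (rows-cong (parts μ) (λ i j _ → +-cong
      (*-congʳ (trans (nat-⟦⟧ _) (reflexive (≡.cong (λ r → ⟦ r ∸ suc j ℕ.+ 1 ⟧) (row-rowL θ i))))) (nat-⟦⟧ _)))

  module Translation (F : JackField) (⟨_,_⟩ : SymFun → SymFun → Carrier) (S : ScalarProduct ⟨_,_⟩) (J : Partition → SymFun)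
    (J-orthogonal : ∀ θ μ → parts θ ≢ parts μ → ⟨ J θ , J μ ⟩ ≈ 0#)
    (J-triangular : ∀ θ μ → ¬ (μ ⊴ θ) → mcoeff (J θ) μ ≈ 0#)
    (J-normalized : ∀ θ → mcoeff (J θ) (1^ ∣ θ ∣) ≈ ⟦ ∣ θ ∣ ! ⟧) where
    open JackField F
    open Form F ⟨_,_⟩ S
    open Basis F
    open Identify ⟨_,_⟩ S J J-orthogonal J-triangular J-normalized using (J≈jackF)

    -- Incomparable partitions may have equal eigenvalues, so this does not follow from
    -- `jackF-orthogonal`; it is carried over from `J`.
    orth : ∀ {θ μ} (isP : IsPartition θ) (isQ : IsPartition μ) → θ ≢ μ → ⟨ jackF isP , jackF isQ ⟩ ≈ 0#
    orth {θ} {μ} isP isQ ne = trans (cong {jackF isP} {J (mkPartition θ isP)} {jackF isQ} {J (mkPartition μ isQ)} (λ e → sym (J≈jackF (mkPartition θ isP) e)) (λ e → sym (J≈jackF (mkPartition μ isQ) e)))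
      (J-orthogonal (mkPartition θ isP) (mkPartition μ isQ) ne)

    open Theory F ⟨_,_⟩ S orth
    open Skew F ⟨_,_⟩ S orth

    module _ {s : SkewPartition} {θ : Partition} (co : CoincideUpToTranslation s (θ /∅)) where

      pairing-J : ∀ q → ⟨ J (outer s) , J (inner s) · q ⟩ ≈ weight s * ⟨ J θ , q ⟩
      pairing-J q = trans (cong {J (outer s)} {jackF (isPartition (outer s))} {J (inner s) · q} {jackF (isPartition (inner s)) · q} (J≈jackF (outer s)) (·-cong {J (inner s)} {jackF (isPartition (inner s))} {q} {q} (J≈jackF (inner s)) (λ _ → refl)))
        (trans (pairing-straight co q) (*-congˡ (congˡ {jackF (isPartition θ)} {J θ} {q} (λ e → sym (J≈jackF θ e)))))

      -- The defining property tests `f` against Jack functions only; as these span and the form is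
      -- anisotropic, it determines `f`.
      skew-jack : ∀ f → (∀ ν → ⟨ f , J ν ⟩ ≈ ⟨ J (outer s) , J (inner s) · J ν ⟩) → f ≈ₛ weight s • J θ
      skew-jack f isSkew e = trans (sym (*-identityˡ _)) (minus-≈ {1#} {f} {weight s} {J θ} (nondegenerate (minus 1# f (weight s) (J θ)) perp) e)
        where
        perp : ∀ {κ} (isK : IsPartition κ) → ⟨ minus 1# f (weight s) (J θ) , jackF isK ⟩ ≈ 0#
        perp {κ} isK = trans (congʳ {minus 1# f (weight s) (J θ)} {jackF isK} {J ν} (λ e → sym (J≈jackF ν e))) (trans (form-minus 1# f (weight s) (J θ) (J ν))
          (minus-zero (trans (*-identityˡ _) (trans (isSkew ν) (pairing-J (J ν))))))
          where
          ν : Partition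
          ν = mkPartition κ isK

      structure-constant : ⟨ J (outer s) , J (inner s) · J θ ⟩ ≈ weight s * (C₂ (parts θ) (parts θ) * C₂′ (parts θ) (parts θ))
      structure-constant = trans (pairing-J (J θ)) (*-congˡ (trans (cong {J θ} {jackF (isPartition θ)} {J θ} {jackF (isPartition θ)} (J≈jackF θ) (J≈jackF θ)) (norm-C (isPartition θ))))

      integrality : ∀ f → f ≈ₛ weight s • J θ → ∀ ν → ∃[ q ] Pol q × mcoeff f ν ≈ ⟦ u ν ⟧ * q
      integrality f f≈ ν = weight s * quotient m , times (times (C₂-pol (parts (inner s)) (parts (outer s))) (C₂′-pol (parts (outer s)) (parts (inner s)))) (isPol m) ,
        trans (f≈ (parts ν)) (trans (*-congˡ (trans (J≈jackF θ (parts ν)) (equation m))) (trans (solve 3 (λ w n q → w :* (n :* q) := n :* (w :* q)) refl (weight s) _ _)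
          (*-congʳ (reflexive (≡.cong ⟦_⟧ (≡.sym (u-stab ν)))))))
        where
        open PolMult
        m : PolMult (stab (parts ν)) (coeff (jackF (isPartition θ)) (parts ν))
        m = jackF-pol (isPartition θ) (parts ν)

-- The order on ℚ(α)

open import Defs using (module Fractions)

module _ (R : CommutativeRing 0ℓ 0ℓ) where
  open CommutativeRing R
  open RingProperties ring using (-‿distribˡ-*; x∙y⁻¹≈ε⇒x≈y)

  cancel-distinct : (∀ x → ¬ (x ≈ 0#) → ∃[ y ] x * y ≈ 1#) → ∀ {y y′ x} → ¬ (y ≈ y′) → y * x ≈ y′ * x → x ≈ 0#
  cancel-distinct inverse {y} {y′} {x} y≉y′ eq with inverse (y - y′) (λ z → y≉y′ (x∙y⁻¹≈ε⇒x≈y y y′ z))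
  ... | v , dv = trans (sym (*-identityʳ x)) (trans (*-congˡ (sym dv)) (trans (sym (*-assoc _ _ _)) (trans (*-congʳ (trans (*-comm _ _) (trans (distribʳ _ _ _)
    (trans (+-cong eq (sym (-‿distribˡ-* y′ x))) (-‿inverseʳ _))))) (zeroˡ v))))

record PositiveCone (D : CommutativeRing 0ℓ 0ℓ) : Set₁ where
  open CommutativeRing D
  field
    Positive   : Carrier → Set
    Positive-≈ : ∀ {x y} → x ≈ y → Positive x → Positive y
    Positive-+ : ∀ {x y} → Positive x → Positive y → Positive (x + y)
    Positive-* : ∀ {x y} → Positive x → Positive y → Positive (x * y)
    asymmetric : ∀ {x} → Positive x → Positive (- x) → ⊥
    trichotomy : ∀ x → x ≈ 0# ⊎ Positive x ⊎ Positive (- x)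

module FractionOrder (D : CommutativeRing 0ℓ 0ℓ) (cone : PositiveCone D)
  (1≉0 : ¬ (CommutativeRing._≈_ D (CommutativeRing.1# D) (CommutativeRing.0# D)))
  (integral : ∀ a b → CommutativeRing._≈_ D (CommutativeRing._*_ D a b) (CommutativeRing.0# D) →
     CommutativeRing._≈_ D a (CommutativeRing.0# D) ⊎ CommutativeRing._≈_ D b (CommutativeRing.0# D)) where
  open CommutativeRing D
  open PositiveCone cone
  open RingProperties ring using (-‿distribˡ-*; -‿distribʳ-*; -‿involutive; -0#≈0#; +-cancelʳ)
  open Solver commutativeSemiring using (solve; _:=_; _:+_; _:*_)
  open Fractions D 1≉0 integral
  open Fraction
  private module K = CommutativeRing fractionField

  NonNegative : Carrier → Set
  NonNegative x = x ≈ 0# ⊎ Positive x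

  private
    NonNegative-≈ : ∀ {x y} → x ≈ y → NonNegative x → NonNegative y
    NonNegative-≈ eq (inj₁ z) = inj₁ (trans (sym eq) z)
    NonNegative-≈ eq (inj₂ p) = inj₂ (Positive-≈ eq p)

    NonNegative-+ : ∀ {x y} → NonNegative x → NonNegative y → NonNegative (x + y)
    NonNegative-+ (inj₁ z) q        = NonNegative-≈ (sym (trans (+-congʳ z) (+-identityˡ _))) q
    NonNegative-+ (inj₂ p) (inj₁ z) = inj₂ (Positive-≈ (sym (trans (+-congˡ z) (+-identityʳ _))) p)
    NonNegative-+ (inj₂ p) (inj₂ q) = inj₂ (Positive-+ p q)

    NonNegative-* : ∀ {x y} → NonNegative x → NonNegative y → NonNegative (x * y)
    NonNegative-* (inj₁ z) _        = inj₁ (trans (*-congʳ z) (zeroˡ _))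
    NonNegative-* (inj₂ p) (inj₁ z) = inj₁ (trans (*-congˡ z) (zeroʳ _))
    NonNegative-* (inj₂ p) (inj₂ q) = inj₂ (Positive-* p q)

    square : ∀ x → NonNegative (x * x)
    square x with trichotomy x
    ... | inj₁ z        = inj₁ (trans (*-congʳ z) (zeroˡ _))
    ... | inj₂ (inj₁ p) = inj₂ (Positive-* p p)
    ... | inj₂ (inj₂ p) = inj₂ (Positive-≈ (trans (sym (-‿distribˡ-* _ _)) (trans (-‿cong (sym (-‿distribʳ-* _ _))) (-‿involutive _))) (Positive-* p p))

    square-positive : ∀ {x} → ¬ (x ≈ 0#) → Positive (x * x)
    square-positive {x} x≉0 with square x
    ... | inj₂ p = p
    ... | inj₁ z = ⊥-elim (*≉0 x≉0 x≉0 z)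

    antisymmetric : ∀ {x} → NonNegative x → NonNegative (- x) → x ≈ 0#
    antisymmetric (inj₁ z) _        = z
    antisymmetric (inj₂ _) (inj₁ z) = trans (sym (-‿involutive _)) (trans (-‿cong z) -0#≈0#)
    antisymmetric (inj₂ p) (inj₂ q) = ⊥-elim (asymmetric p q)

    cancel-positive : ∀ {x t} → Positive t → NonNegative (x * t) → NonNegative x
    cancel-positive {x} {t} pt nn with trichotomy x
    ... | inj₁ z        = inj₁ z
    ... | inj₂ (inj₁ p) = inj₂ p
    ... | inj₂ (inj₂ p) with integral x t (antisymmetric nn (inj₂ (Positive-≈ (sym (-‿distribˡ-* x t)) (Positive-* p pt))))
    ...   | inj₁ z = inj₁ z
    ...   | inj₂ z = ⊥-elim (asymmetric pt (Positive-≈ (trans z (trans (sym -0#≈0#) (-‿cong (sym z)))) pt))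

  -- A fraction has the sign of numerator times denominator, which spares a normal form with
  -- positive denominators.
  NonNeg : Fraction → Set
  NonNeg x = NonNegative (num x * den x)

  NonNeg-≈ : ∀ {x y} → x ≈ᶠ y → NonNeg x → NonNeg y
  NonNeg-≈ {fraction a b b≉0} {fraction c d d≉0} eq nn = cancel-positive (square-positive b≉0) (NonNegative-≈
    (trans (solve 3 (λ a b d → (a :* b) :* (d :* d) := (a :* d) :* (b :* d)) refl a b d) (trans (*-congʳ eq) (solve 3 (λ b c d → (c :* b) :* (b :* d) := (c :* d) :* (b :* b)) refl b c d)))
    (NonNegative-* nn (square d)))

  NonNeg-0 : NonNeg K.0#
  NonNeg-0 = inj₁ (zeroˡ _)

  NonNeg-+ : ∀ {x y} → NonNeg x → NonNeg y → NonNeg (x +ᶠ y)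
  NonNeg-+ {fraction a b _} {fraction c d _} p q = NonNegative-≈ (solve 4 (λ a b c d → (a :* b) :* (d :* d) :+ (c :* d) :* (b :* b) := (a :* d :+ c :* b) :* (b :* d)) refl a b c d)
    (NonNegative-+ (NonNegative-* p (square d)) (NonNegative-* q (square b)))

  NonNeg-* : ∀ {x y} → NonNeg x → NonNeg y → NonNeg (x *ᶠ y)
  NonNeg-* {fraction a b _} {fraction c d _} p q = NonNegative-≈ (solve 4 (λ a b c d → (a :* b) :* (c :* d) := (a :* c) :* (b :* d)) refl a b c d) (NonNegative-* p q)

  NonNeg-square : ∀ x → NonNeg (x *ᶠ x)
  NonNeg-square (fraction a b _) = NonNegative-≈ (solve 2 (λ a b → (a :* b) :* (a :* b) := (a :* a) :* (b :* b)) refl a b) (square (a * b))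

  NonNeg-1 : NonNeg K.1#
  NonNeg-1 = square 1#

  NonNeg-positive : ∀ {a} → Positive a → NonNeg (fromDomain a)
  NonNeg-positive p = inj₂ (Positive-≈ (sym (*-identityʳ _)) p)

  num≈0⇒≈0 : ∀ {x} → num x ≈ 0# → x ≈ᶠ K.0#
  num≈0⇒≈0 z = trans (*-congʳ z) (trans (zeroˡ _) (sym (zeroˡ _)))

  ≈0⇒num≈0 : ∀ {x} → x ≈ᶠ K.0# → num x ≈ 0#
  ≈0⇒num≈0 eq = trans (sym (*-identityʳ _)) (trans eq (zeroˡ _))

  NonNeg-sum : ∀ {x y} → NonNeg x → NonNeg y → (x +ᶠ y) ≈ᶠ K.0# → x ≈ᶠ K.0#
  NonNeg-sum {x} {y} p q eq with integral (num x) (den x) (antisymmetric p (NonNegative-≈ (sym (-‿distribˡ-* _ _)) (NonNeg-≈ {y} {(-ᶠ x)} y≈-x q)))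
    where
    y≈-x : y ≈ᶠ (-ᶠ x)
    y≈-x = +-cancelʳ (num x * den y) _ _ (trans (trans (+-comm _ _) (≈0⇒num≈0 {x +ᶠ y} eq)) (sym (trans (sym (distribʳ _ _ _)) (trans (*-congʳ (-‿inverseˡ _)) (zeroˡ _)))))
  ... | inj₁ z = num≈0⇒≈0 {x} z
  ... | inj₂ z = ⊥-elim (den≉0 x z)

  square-0 : ∀ x → (x *ᶠ x) ≈ᶠ K.0# → x ≈ᶠ K.0#
  square-0 x eq with integral (num x) (num x) (≈0⇒num≈0 {x *ᶠ x} eq)
  ... | inj₁ z = num≈0⇒≈0 {x} z
  ... | inj₂ z = num≈0⇒≈0 {x} z

  inverse : ∀ x → ¬ (x ≈ᶠ K.0#) → ∃[ y ] (x *ᶠ y) ≈ᶠ K.1#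
  inverse x x≉0 = fraction (den x) (num x) (λ z → x≉0 (num≈0⇒≈0 {x} z)) , trans (*-identityʳ _) (trans (*-comm _ _) (sym (*-identityˡ _)))

  nontrivial : ¬ (K.1# ≈ᶠ K.0#)
  nontrivial eq = 1≉0 (≈0⇒num≈0 {K.1#} eq)

  fromDomain-cong : ∀ {a b} → a ≈ b → fromDomain a ≈ᶠ fromDomain b
  fromDomain-cong = *-congʳ

  fromDomain-injective : ∀ {a b} → fromDomain a ≈ᶠ fromDomain b → a ≈ b
  fromDomain-injective eq = trans (sym (*-identityʳ _)) (trans eq (*-identityʳ _))

  fromDomain-+ : ∀ a b → (fromDomain a +ᶠ fromDomain b) ≈ᶠ fromDomain (a + b)
  fromDomain-+ a b = trans (*-identityʳ _) (trans (+-cong (*-identityʳ a) (*-identityʳ b)) (sym (trans (*-congˡ (*-identityʳ 1#)) (*-identityʳ _))))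

  fromDomain-* : ∀ a b → (fromDomain a *ᶠ fromDomain b) ≈ᶠ fromDomain (a * b)
  fromDomain-* a b = *-congˡ (sym (*-identityʳ 1#))

open import Defs
private
  module K = CommutativeRing ℚ⟨α⟩
  module P = Polynomials ℚ.+-*-commutativeRing

open P using (_+ₚ_; _*ₚ_; scale)
open RingProperties (CommutativeRing.ring ℚ.+-*-commutativeRing) using () renaming (-‿involutive to neg-involutive)

-- The sign of a polynomial is that of its lowest nonzero coefficient, which makes `α` a positive
-- infinitesimal; natural numbers times powers of `α` are then nonnegative.
data LowestPositive : (ℕ → ℚ) → Set where
  here  : ∀ {f} → 0ℚ ℚ.< f 0 → LowestPositive f
  there : ∀ {f} → f 0 ≡ 0ℚ → LowestPositive (f ∘ suc) → LowestPositive f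

LowestPositive-≗ : ∀ {f g} → (∀ n → f n ≡ g n) → LowestPositive f → LowestPositive g
LowestPositive-≗ eq (here p)    = here (≡.subst (0ℚ ℚ.<_) (eq 0) p)
LowestPositive-≗ eq (there z p) = there (≡.trans (≡.sym (eq 0)) z) (LowestPositive-≗ (eq ∘ suc) p)

LowestPositive-+ : ∀ {f g} → LowestPositive f → LowestPositive g → LowestPositive (λ n → f n ℚ.+ g n)
LowestPositive-+ (here p)    (here q)    = here (ℚ.+-mono-< p q)
LowestPositive-+ {f} (here p) (there z q) = here (≡.subst (0ℚ ℚ.<_) (≡.sym (≡.trans (≡.cong (f 0 ℚ.+_) z) (ℚ.+-identityʳ _))) p)
LowestPositive-+ {f} {g} (there z p) (here q) = here (≡.subst (0ℚ ℚ.<_) (≡.sym (≡.trans (≡.cong (ℚ._+ g 0) z) (ℚ.+-identityˡ _))) q)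
LowestPositive-+ (there z p) (there w q) = there (≡.cong₂ ℚ._+_ z w) (LowestPositive-+ p q)

LowestPositive-* : ∀ {f g} → LowestPositive f → LowestPositive g → LowestPositive (f P.⊠ g)
LowestPositive-* {f} {g} (here p) (here q) = here (ℚ.positive⁻¹ (f 0 ℚ.* g 0) {{ℚ.pos*pos⇒pos (f 0) {{ℚ.positive p}} (g 0) {{ℚ.positive q}}}})
LowestPositive-* {f} {g} (here p) (there z q) = there (≡.trans (≡.cong (f 0 ℚ.*_) z) (ℚ.*-zeroʳ (f 0)))
  (LowestPositive-≗ (λ n → ≡.sym (≡.trans (antidiag-last n (λ i j → f i ℚ.* g j)) (≡.trans (≡.cong ((f P.⊠ (g ∘ suc)) n ℚ.+_) (≡.trans (≡.cong (f (suc n) ℚ.*_) z) (ℚ.*-zeroʳ (f (suc n))))) (ℚ.+-identityʳ _))))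
    (LowestPositive-* {f} {g ∘ suc} (here p) q))
  where open Antidiagonal ℚ.+-*-commutativeRing using (antidiag-last)
LowestPositive-* {f} {g} (there z p) q = there (≡.trans (≡.cong (ℚ._* g 0) z) (ℚ.*-zeroˡ (g 0)))
  (LowestPositive-≗ (λ n → ≡.sym (≡.trans (≡.cong (ℚ._+ ((f ∘ suc) P.⊠ g) n) (≡.trans (≡.cong (ℚ._* g (suc n)) z) (ℚ.*-zeroˡ (g (suc n))))) (ℚ.+-identityˡ _))) (LowestPositive-* p q))

negated : ∀ {a} → a ℚ.< 0ℚ → 0ℚ ℚ.< ℚ.- a
negated = ℚ.neg-antimono-<

LowestPositive-asymmetric : ∀ {f g} → (∀ n → g n ≡ ℚ.- f n) → LowestPositive f → LowestPositive g → ⊥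
LowestPositive-asymmetric eq (here p)    (here q)    = ℚ.<-asym p (≡.subst (ℚ._< 0ℚ) (neg-involutive _) (ℚ.neg-antimono-< (≡.subst (0ℚ ℚ.<_) (eq 0) q)))
LowestPositive-asymmetric {f} eq (here p) (there z q) = ℚ.<-irrefl (≡.sym (≡.trans (≡.sym (neg-involutive (f 0))) (≡.cong ℚ.-_ (≡.trans (≡.sym (eq 0)) z)))) p
LowestPositive-asymmetric eq (there z p) (here q)    = ℚ.<-irrefl (≡.sym (≡.trans (eq 0) (≡.cong ℚ.-_ z))) q
LowestPositive-asymmetric eq (there z p) (there w q) = LowestPositive-asymmetric (eq ∘ suc) p q

polyCone : PositiveCone polyRing
polyCone = record
  { Positive   = λ p → LowestPositive (P.coeff p)
  ; Positive-≈ = LowestPositive-≗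
  ; Positive-+ = λ {p} {q} x y → LowestPositive-≗ (λ n → ≡.sym (P.coeff-+ p q n)) (LowestPositive-+ x y)
  ; Positive-* = λ {p} {q} x y → LowestPositive-≗ (λ n → ≡.sym (P.coeff-* p q n)) (LowestPositive-* x y)
  ; asymmetric = λ {p} → LowestPositive-asymmetric (P.coeff-neg p)
  ; trichotomy = trichotomy
  }
  where
  trichotomy : ∀ p → p ≈ₚ [] ⊎ LowestPositive (P.coeff p) ⊎ LowestPositive (P.coeff (P.-ₚ p))
  trichotomy []      = inj₁ (λ _ → ≡.refl)
  trichotomy (a ∷ p) with ℚ.<-cmp 0ℚ a
  ... | tri< 0<a _ _ = inj₂ (inj₁ (here 0<a))
  ... | tri> _ _ a<0 = inj₂ (inj₂ (here (negated a<0)))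
  ... | tri≈ _ 0≡a _ with trichotomy p
  ...   | inj₁ z        = inj₁ (λ { zero → ≡.sym 0≡a ; (suc n) → z n })
  ...   | inj₂ (inj₁ x) = inj₂ (inj₁ (there (≡.sym 0≡a) x))
  ...   | inj₂ (inj₂ x) = inj₂ (inj₂ (there (≡.cong ℚ.-_ (≡.sym 0≡a)) x))

-- Natural numbers and linear polynomials in ℚ(α)

private
  module O = FractionOrder polyRing polyCone 1≉0 (polyIntegral (ℚ._≟ 0ℚ) ℚ-integral)

  ℕ⇒ℚ-≃ : ∀ n → toℚᵘ (ℕ⇒ℚ n) ≃ mkℚᵘ (ℤ.+ n) 0
  ℕ⇒ℚ-≃ n = ℚ.toℚᵘ-fromℚᵘ (mkℚᵘ (ℤ.+ n) 0)

ℕ⇒ℚ-+ : ∀ m n → ℕ⇒ℚ (m ℕ.+ n) ≡ ℕ⇒ℚ m ℚ.+ ℕ⇒ℚ n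
ℕ⇒ℚ-+ m n = ℚ.toℚᵘ-injective (ℚᵘ.≃-trans (ℕ⇒ℚ-≃ (m ℕ.+ n)) (ℚᵘ.≃-trans (*≡* (≡.cong (ℤ._* ℤ.+ 1) (≡.cong₂ ℤ._+_ (≡.sym (ℤ.*-identityʳ (ℤ.+ m))) (≡.sym (ℤ.*-identityʳ (ℤ.+ n))))))
  (ℚᵘ.≃-trans (ℚᵘ.+-cong (ℚᵘ.≃-sym (ℕ⇒ℚ-≃ m)) (ℚᵘ.≃-sym (ℕ⇒ℚ-≃ n))) (ℚᵘ.≃-sym (ℚ.toℚᵘ-homo-+ (ℕ⇒ℚ m) (ℕ⇒ℚ n))))))

ℕ⇒ℚ-* : ∀ m n → ℕ⇒ℚ (m ℕ.* n) ≡ ℕ⇒ℚ m ℚ.* ℕ⇒ℚ n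
ℕ⇒ℚ-* m n = ℚ.toℚᵘ-injective (ℚᵘ.≃-trans (ℕ⇒ℚ-≃ (m ℕ.* n)) (ℚᵘ.≃-trans (*≡* (≡.cong (ℤ._* ℤ.+ 1) (ℤ.pos-* m n)))
  (ℚᵘ.≃-trans (ℚᵘ.*-cong (ℚᵘ.≃-sym (ℕ⇒ℚ-≃ m)) (ℚᵘ.≃-sym (ℕ⇒ℚ-≃ n))) (ℚᵘ.≃-sym (ℚ.toℚᵘ-homo-* (ℕ⇒ℚ m) (ℕ⇒ℚ n))))))

ℕ⇒ℚ-injective : ∀ {m n} → ℕ⇒ℚ m ≡ ℕ⇒ℚ n → m ≡ n
ℕ⇒ℚ-injective {m} {n} eq with ℚᵘ.≃-trans (ℚᵘ.≃-sym (ℕ⇒ℚ-≃ m)) (ℚᵘ.≃-trans (ℚᵘ.≃-reflexive (≡.cong toℚᵘ eq)) (ℕ⇒ℚ-≃ n))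
... | *≡* e = ℤ.+-injective (≡.trans (≡.sym (ℤ.*-identityʳ (ℤ.+ m))) (≡.trans e (ℤ.*-identityʳ (ℤ.+ n))))

ℕ⇒ℚ-inverse : ∀ d .{{_ : NonZero d}} → (ℤ.+ 1 ℚ./ d) ℚ.* ℕ⇒ℚ d ≡ 1ℚ
ℕ⇒ℚ-inverse (suc k) = ℚ.toℚᵘ-injective (ℚᵘ.≃-trans (ℚ.toℚᵘ-homo-* (ℤ.+ 1 ℚ./ suc k) (ℕ⇒ℚ (suc k))) (ℚᵘ.≃-trans (ℚᵘ.*-cong (ℚ.toℚᵘ-fromℚᵘ (mkℚᵘ (ℤ.+ 1) k)) (ℕ⇒ℚ-≃ (suc k)))
  (*≡* (≡.trans (ℤ.*-identityʳ _) (≡.trans (ℤ.*-comm (ℤ.+ 1) (ℤ.+ suc k)) (≡.trans (ℤ.*-identityʳ _) (≡.sym (≡.trans (ℤ.*-identityˡ _) (≡.cong ℤ.+_ (ℕ.*-identityʳ (suc k)))))))))))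

open FiniteSums ℚ⟨α⟩ using (⟦_⟧)
open KnopSahiSupport ℚ⟨α⟩ α using (Pol; nat; alpha; plus; times; resp)
open BoxProducts ℚ⟨α⟩ α using (C₂; C₂′)
open JackForm ℚ⟨α⟩ α using (JackField; ScalarProduct)
open SetoidReasoning K.setoid

fromPoly-≡ : ∀ {p q} → p ≡ q → fromPoly p ≈ᴷ fromPoly q
fromPoly-≡ {p} ≡.refl = K.refl {fromPoly p}

fromℕ≈ : ∀ n → fromℕ n ≈ᴷ ⟦ n ⟧
fromℕ≈ zero    = O.fromDomain-cong {ℕ⇒ℚ 0 ∷ []} {[]} (λ { zero → ≡.refl ; (suc _) → ≡.refl })
fromℕ≈ (suc n) = begin
  fromℕ (suc n)                             ≈⟨ fromPoly-≡ (≡.cong (_∷ []) (ℕ⇒ℚ-+ 1 n)) ⟩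
  fromPoly ((1ℚ ∷ []) +ₚ (ℕ⇒ℚ n ∷ []))       ≈⟨ O.fromDomain-+ (1ℚ ∷ []) (ℕ⇒ℚ n ∷ []) ⟨
  1# +ᴷ fromℕ n                             ≈⟨ K.+-congˡ {1#} {fromℕ n} {⟦ n ⟧} (fromℕ≈ n) ⟩
  1# +ᴷ ⟦ n ⟧                               ∎

linear : ∀ a b → (⟦ a ⟧ *ᴷ α +ᴷ ⟦ b ⟧) ≈ᴷ fromPoly (ℕ⇒ℚ b ∷ ℕ⇒ℚ a ∷ [])
linear a b = begin
  (⟦ a ⟧ *ᴷ α) +ᴷ ⟦ b ⟧                      ≈⟨ K.+-cong {⟦ a ⟧ *ᴷ α} {fromℕ a *ᴷ α} {⟦ b ⟧} {fromℕ b} (K.*-congʳ {α} {⟦ a ⟧} {fromℕ a} (K.sym {fromℕ a} {⟦ a ⟧} (fromℕ≈ a))) (K.sym {fromℕ b} {⟦ b ⟧} (fromℕ≈ b)) ⟩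
  (fromℕ a *ᴷ α) +ᴷ fromℕ b                  ≈⟨ K.+-congʳ {fromℕ b} {fromℕ a *ᴷ α} {fromPoly pa} (O.fromDomain-* (ℕ⇒ℚ a ∷ []) (0ℚ ∷ 1ℚ ∷ [])) ⟩
  fromPoly pa +ᴷ fromℕ b                     ≈⟨ O.fromDomain-+ pa (ℕ⇒ℚ b ∷ []) ⟩
  fromPoly (pa +ₚ (ℕ⇒ℚ b ∷ []))              ≈⟨ fromPoly-≡ (≡.cong₂ (λ x y → x ∷ y ∷ []) (≡.trans (≡.cong (λ t → t ℚ.+ 0ℚ ℚ.+ ℕ⇒ℚ b) (ℚ.*-zeroʳ (ℕ⇒ℚ a))) (ℚ.+-identityˡ (ℕ⇒ℚ b))) (ℚ.*-identityʳ (ℕ⇒ℚ a))) ⟩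
  fromPoly (ℕ⇒ℚ b ∷ ℕ⇒ℚ a ∷ [])              ∎
  where
  pa : Poly
  pa = (ℕ⇒ℚ a ∷ []) *ₚ (0ℚ ∷ 1ℚ ∷ [])

linear-injective : ∀ {a b a′ b′} → (⟦ a ⟧ *ᴷ α +ᴷ ⟦ b ⟧) ≈ᴷ (⟦ a′ ⟧ *ᴷ α +ᴷ ⟦ b′ ⟧) → a ≡ a′ × b ≡ b′
linear-injective {a} {b} {a′} {b′} eq = ℕ⇒ℚ-injective (same 1) , ℕ⇒ℚ-injective (same 0)
  where
  same : (ℕ⇒ℚ b ∷ ℕ⇒ℚ a ∷ []) ≈ₚ (ℕ⇒ℚ b′ ∷ ℕ⇒ℚ a′ ∷ [])
  same = O.fromDomain-injective {ℕ⇒ℚ b ∷ ℕ⇒ℚ a ∷ []} {ℕ⇒ℚ b′ ∷ ℕ⇒ℚ a′ ∷ []} (begin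
    fromPoly (ℕ⇒ℚ b ∷ ℕ⇒ℚ a ∷ [])    ≈⟨ linear a b ⟨
    (⟦ a ⟧ *ᴷ α) +ᴷ ⟦ b ⟧            ≈⟨ eq ⟩
    (⟦ a′ ⟧ *ᴷ α) +ᴷ ⟦ b′ ⟧          ≈⟨ linear a′ b′ ⟩
    fromPoly (ℕ⇒ℚ b′ ∷ ℕ⇒ℚ a′ ∷ [])  ∎)

NonNeg-nat : ∀ n → O.NonNeg ⟦ n ⟧
NonNeg-nat zero    = O.NonNeg-0
NonNeg-nat (suc n) = O.NonNeg-+ {1#} {⟦ n ⟧} O.NonNeg-1 (NonNeg-nat n)

NonNeg-α^ : ∀ l → O.NonNeg (α ^ᴷ l)
NonNeg-α^ zero    = O.NonNeg-1
NonNeg-α^ (suc l) = O.NonNeg-* {α} {α ^ᴷ l} (O.NonNeg-positive {0ℚ ∷ 1ℚ ∷ []} (there ≡.refl (here (ℚ.positive⁻¹ 1ℚ)))) (NonNeg-α^ l)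

-- `invertible` and `separated` only compare linear polynomials, whose coefficients
-- `linear-injective` recovers; the remaining fields are properties of an ordered field in which `α`
-- is positive.
jackField : JackField
jackField = record
  { invertible = λ a b ne → O.inverse (⟦ a ⟧ *ᴷ α +ᴷ ⟦ b ⟧) (λ z → let (p , q) = linear-injective {a} {b} {0} {0} (K.trans {⟦ a ⟧ *ᴷ α +ᴷ ⟦ b ⟧} {0#} {⟦ 0 ⟧ *ᴷ α +ᴷ ⟦ 0 ⟧} z (zero-linear)) in ne (≡.cong₂ ℕ._+_ p q))
  ; separated  = λ a b a′ b′ {x} ne eq → cancel-distinct ℚ⟨α⟩ O.inverse {α *ᴷ ⟦ a ⟧ +ᴷ ⟦ b ⟧} {α *ᴷ ⟦ a′ ⟧ +ᴷ ⟦ b′ ⟧} {x} (λ z → ne (proj₂ (linear-injective {a} {b} {a′} {b′} (swapped a b a′ b′ z)))) eq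
  ; nontrivial = O.nontrivial
  ; reciprocal = O.inverse
  ; square-0   = O.square-0
  ; NonNeg     = O.NonNeg
  ; NonNeg-≈   = λ {x} {y} → O.NonNeg-≈ {x} {y}
  ; NonNeg-0   = O.NonNeg-0
  ; NonNeg-+   = λ {x} {y} → O.NonNeg-+ {x} {y}
  ; NonNeg-sq  = λ n l x → O.NonNeg-* {⟦ n ⟧ *ᴷ (α ^ᴷ l)} {x *ᴷ x} (O.NonNeg-* {⟦ n ⟧} {α ^ᴷ l} (NonNeg-nat n) (NonNeg-α^ l)) (O.NonNeg-square x)
  ; NonNeg-sum = λ {x} {y} → O.NonNeg-sum {x} {y}
  }
  where
  zero-linear : 0# ≈ᴷ (⟦ 0 ⟧ *ᴷ α +ᴷ ⟦ 0 ⟧)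
  zero-linear = begin
    0#                      ≈⟨ K.zeroˡ α ⟨
    0# *ᴷ α                 ≈⟨ K.+-identityʳ (0# *ᴷ α) ⟨
    (0# *ᴷ α) +ᴷ 0#         ∎
  swapped : ∀ a b a′ b′ → (α *ᴷ ⟦ a ⟧ +ᴷ ⟦ b ⟧) ≈ᴷ (α *ᴷ ⟦ a′ ⟧ +ᴷ ⟦ b′ ⟧) → (⟦ a ⟧ *ᴷ α +ᴷ ⟦ b ⟧) ≈ᴷ (⟦ a′ ⟧ *ᴷ α +ᴷ ⟦ b′ ⟧)
  swapped a b a′ b′ eq = begin
    (⟦ a ⟧ *ᴷ α) +ᴷ ⟦ b ⟧      ≈⟨ K.+-congʳ {⟦ b ⟧} {⟦ a ⟧ *ᴷ α} {α *ᴷ ⟦ a ⟧} (K.*-comm ⟦ a ⟧ α) ⟩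
    (α *ᴷ ⟦ a ⟧) +ᴷ ⟦ b ⟧      ≈⟨ eq ⟩
    (α *ᴷ ⟦ a′ ⟧) +ᴷ ⟦ b′ ⟧    ≈⟨ K.+-congʳ {⟦ b′ ⟧} {⟦ a′ ⟧ *ᴷ α} {α *ᴷ ⟦ a′ ⟧} (K.*-comm ⟦ a′ ⟧ α) ⟨
    (⟦ a′ ⟧ *ᴷ α) +ᴷ ⟦ b′ ⟧    ∎

-- Coefficient lists of natural numbers

-- `addℕ` and `mulℕ` copy the recursions of `_+ₚ_` and `_*ₚ_`, so that `map ℕ⇒ℚ` commutes with them
-- as an equality of lists.
addℕ : List ℕ → List ℕ → List ℕ
addℕ []       ds       = ds
addℕ (c ∷ cs) []       = c ∷ cs
addℕ (c ∷ cs) (d ∷ ds) = (c ℕ.+ d) ∷ addℕ cs ds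

mulℕ : List ℕ → List ℕ → List ℕ
mulℕ []       ds = []
mulℕ (c ∷ cs) ds = addℕ (map (c ℕ.*_) ds) (0 ∷ mulℕ cs ds)

map-addℕ : ∀ cs ds → map ℕ⇒ℚ (addℕ cs ds) ≡ map ℕ⇒ℚ cs +ₚ map ℕ⇒ℚ ds
map-addℕ []       ds       = ≡.refl
map-addℕ (c ∷ cs) []       = ≡.refl
map-addℕ (c ∷ cs) (d ∷ ds) = ≡.cong₂ _∷_ (ℕ⇒ℚ-+ c d) (map-addℕ cs ds)

map-scaleℕ : ∀ c ds → map ℕ⇒ℚ (map (c ℕ.*_) ds) ≡ scale (ℕ⇒ℚ c) (map ℕ⇒ℚ ds)
map-scaleℕ c []       = ≡.refl
map-scaleℕ c (d ∷ ds) = ≡.cong₂ _∷_ (ℕ⇒ℚ-* c d) (map-scaleℕ c ds)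

map-mulℕ : ∀ cs ds → map ℕ⇒ℚ (mulℕ cs ds) ≡ map ℕ⇒ℚ cs *ₚ map ℕ⇒ℚ ds
map-mulℕ []       ds = ≡.refl
map-mulℕ (c ∷ cs) ds = ≡.trans (map-addℕ (map (c ℕ.*_) ds) (0 ∷ mulℕ cs ds)) (≡.cong₂ (λ p q → p +ₚ (0ℚ ∷ q)) (map-scaleℕ c ds) (map-mulℕ cs ds))

Pol⇒nonnegative : ∀ {x} → Pol x → HasNonnegativeIntegerCoefficients x
Pol⇒nonnegative (nat n) = n ∷ [] , K.sym {fromℕ n} {⟦ n ⟧} (fromℕ≈ n)
Pol⇒nonnegative alpha   = 0 ∷ 1 ∷ [] , K.refl {α}
Pol⇒nonnegative (plus {x} {y} p q) = let (cs , ex) = Pol⇒nonnegative p ; (ds , ey) = Pol⇒nonnegative q in addℕ cs ds , (begin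
  x +ᴷ y                                                   ≈⟨ K.+-cong {x} {fromPoly (map ℕ⇒ℚ cs)} {y} {fromPoly (map ℕ⇒ℚ ds)} ex ey ⟩
  fromPoly (map ℕ⇒ℚ cs) +ᴷ fromPoly (map ℕ⇒ℚ ds)           ≈⟨ O.fromDomain-+ (map ℕ⇒ℚ cs) (map ℕ⇒ℚ ds) ⟩
  fromPoly (map ℕ⇒ℚ cs +ₚ map ℕ⇒ℚ ds)                      ≈⟨ fromPoly-≡ (map-addℕ cs ds) ⟨
  fromPoly (map ℕ⇒ℚ (addℕ cs ds))                          ∎)
Pol⇒nonnegative (times {x} {y} p q) = let (cs , ex) = Pol⇒nonnegative p ; (ds , ey) = Pol⇒nonnegative q in mulℕ cs ds , (begin
  x *ᴷ y                                                   ≈⟨ K.*-cong {x} {fromPoly (map ℕ⇒ℚ cs)} {y} {fromPoly (map ℕ⇒ℚ ds)} ex ey ⟩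
  fromPoly (map ℕ⇒ℚ cs) *ᴷ fromPoly (map ℕ⇒ℚ ds)           ≈⟨ O.fromDomain-* (map ℕ⇒ℚ cs) (map ℕ⇒ℚ ds) ⟩
  fromPoly (map ℕ⇒ℚ cs *ₚ map ℕ⇒ℚ ds)                      ≈⟨ fromPoly-≡ (map-mulℕ cs ds) ⟨
  fromPoly (map ℕ⇒ℚ (mulℕ cs ds))                          ∎)
Pol⇒nonnegative (resp {x} {y} x≈y p) = let (cs , ex) = Pol⇒nonnegative p in cs , K.trans {y} {x} {fromPoly (map ℕ⇒ℚ cs)} (K.sym {x} {y} x≈y) ex

divide : ∀ d .{{_ : NonZero d}} {x q} → x ≈ᴷ (⟦ d ⟧ *ᴷ q) → (fromℚ (ℤ.+ 1 ℚ./ d) *ᴷ x) ≈ᴷ q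
divide d {x} {q} eq = begin
  r *ᴷ x                                   ≈⟨ K.*-congˡ {r} {x} {⟦ d ⟧ *ᴷ q} eq ⟩
  r *ᴷ (⟦ d ⟧ *ᴷ q)                        ≈⟨ K.*-assoc r ⟦ d ⟧ q ⟨
  (r *ᴷ ⟦ d ⟧) *ᴷ q                        ≈⟨ K.*-congʳ {q} {r *ᴷ ⟦ d ⟧} {1#} one ⟩
  1# *ᴷ q                                  ≈⟨ K.*-identityˡ q ⟩
  q                                        ∎
  where
  r : Fraction
  r = fromℚ (ℤ.+ 1 ℚ./ d)
  one : (r *ᴷ ⟦ d ⟧) ≈ᴷ 1#
  one = begin
    r *ᴷ ⟦ d ⟧                                          ≈⟨ K.*-congˡ {r} {⟦ d ⟧} {fromℕ d} (K.sym {fromℕ d} {⟦ d ⟧} (fromℕ≈ d)) ⟩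
    r *ᴷ fromℕ d                                        ≈⟨ O.fromDomain-* ((ℤ.+ 1 ℚ./ d) ∷ []) (ℕ⇒ℚ d ∷ []) ⟩
    fromPoly (((ℤ.+ 1 ℚ./ d) ∷ []) *ₚ (ℕ⇒ℚ d ∷ []))     ≈⟨ fromPoly-≡ (≡.cong (_∷ []) (≡.trans (ℚ.+-identityʳ ((ℤ.+ 1 ℚ./ d) ℚ.* ℕ⇒ℚ d)) (ℕ⇒ℚ-inverse d))) ⟩
    1#                                                  ∎

-- Conclusion over ℚ(α)

scalarProduct : ∀ {⟨_,_⟩} → IsJackScalarProduct ⟨_,_⟩ → ScalarProduct ⟨_,_⟩
scalarProduct {⟨_,_⟩} isJackScalarProduct = record
  { cong        = λ {f} {f′} {g} {g′} → S.cong {f} {f′} {g} {g′}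
  ; commutative = S.commutative
  ; additive    = S.additive
  ; homogeneous = S.homogeneous
  ; orthogonal  = S.orthogonal
  ; norm        = λ θ → K.trans {⟨ powerSums θ , powerSums θ ⟩} {fromℕ (z θ) *ᴷ (α ^ᴷ ℓ θ)} {⟦ z θ ⟧ *ᴷ (α ^ᴷ ℓ θ)} (S.norm θ)
      (K.*-congʳ {α ^ᴷ ℓ θ} {fromℕ (z θ)} {⟦ z θ ⟧} (fromℕ≈ (z θ)))
  }
  where module S = IsJackScalarProduct isJackScalarProduct

module Products = SkewJack ℚ⟨α⟩ α

corollary7 : (⟨_,_⟩ : SymFun → SymFun → Fraction) → IsJackScalarProduct ⟨_,_⟩ →
    (J : Partition → SymFun) → IsJack ⟨_,_⟩ J →
    (λ/μ : SkewPartition) (λ̃ : Partition) → CoincideUpToTranslation λ/μ (λ̃ /∅) →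
    ((Jλ/μ : SymFun) → IsSkewJack ⟨_,_⟩ J λ/μ Jλ/μ →
      (Jλ/μ ≈ₛ ((c₂ (inner λ/μ) (outer λ/μ) *ᴷ c₂′ (outer λ/μ) (inner λ/μ)) • J λ̃))
      × ((ν : Partition) → HasNonnegativeIntegerCoefficients (ṽ Jλ/μ ν)))
    × (g ⟨_,_⟩ J (outer λ/μ) (inner λ/μ) λ̃ ≈ᴷ
        (c₂ (inner λ/μ) (outer λ/μ) *ᴷ c₂′ (outer λ/μ) (inner λ/μ) *ᴷ c λ̃ *ᴷ c′ λ̃))
corollary7 ⟨_,_⟩ isJackScalarProduct J isJack s θ co =
  (λ f isSkew → let f≈ = T.skew-jack co f isSkew in
    (λ e → begin
      coeff f e                                                    ≈⟨ f≈ e ⟩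
      weight *ᴷ coeff (J θ) e                                      ≈⟨ K.*-congʳ {coeff (J θ) e} {c₂ (inner s) (outer s) *ᴷ c₂′ (outer s) (inner s)} {weight} weight≈ ⟨
      (c₂ (inner s) (outer s) *ᴷ c₂′ (outer s) (inner s)) *ᴷ coeff (J θ) e   ∎) ,
    λ ν → let (q , pol , eq) = T.integrality co f f≈ ν ; (cs , ex) = Pol⇒nonnegative pol in
      cs , K.trans {ṽ f ν} {q} {fromPoly (map ℕ⇒ℚ cs)} (divide (u ν) {{u-nonZero ν}} {mcoeff f ν} {q} eq) ex) ,
  (begin
    g ⟨_,_⟩ J (outer s) (inner s) θ                       ≈⟨ T.structure-constant co ⟩
    weight *ᴷ (C *ᴷ C′)                                   ≈⟨ K.*-assoc weight C C′ ⟨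
    (weight *ᴷ C) *ᴷ C′                                   ≈⟨ K.*-cong {(c₂ (inner s) (outer s) *ᴷ c₂′ (outer s) (inner s)) *ᴷ c θ} {weight *ᴷ C} {c′ θ} {C′}
                                                              (K.*-cong {c₂ (inner s) (outer s) *ᴷ c₂′ (outer s) (inner s)} {weight} {c θ} {C} weight≈ (Products.boxes-C₂ fromℕ fromℕ≈ θ θ)) (Products.boxes-C₂′ fromℕ fromℕ≈ θ θ) ⟨
    ((c₂ (inner s) (outer s) *ᴷ c₂′ (outer s) (inner s)) *ᴷ c θ) *ᴷ c′ θ   ∎)
  where
  module Jk = IsJack isJack
  module T = Products.Translation jackField ⟨_,_⟩ (scalarProduct isJackScalarProduct) J Jk.orthogonal Jk.triangular
    (λ θ → K.trans {mcoeff (J θ) (1^ ∣ θ ∣)} {fromℕ (∣ θ ∣ !)} {⟦ ∣ θ ∣ ! ⟧} (Jk.normalized θ) (fromℕ≈ (∣ θ ∣ !)))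
  weight C C′ : Fraction
  weight = C₂ (parts (inner s)) (parts (outer s)) *ᴷ C₂′ (parts (outer s)) (parts (inner s))
  C = C₂ (parts θ) (parts θ)
  C′ = C₂′ (parts θ) (parts θ)
  weight≈ : (c₂ (inner s) (outer s) *ᴷ c₂′ (outer s) (inner s)) ≈ᴷ weight
  weight≈ = K.*-cong {c₂ (inner s) (outer s)} {C₂ (parts (inner s)) (parts (outer s))} {c₂′ (outer s) (inner s)} {C₂′ (parts (outer s)) (parts (inner s))}
    (Products.boxes-C₂ fromℕ fromℕ≈ (inner s) (outer s)) (Products.boxes-C₂′ fromℕ fromℕ≈ (outer s) (inner s))
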